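{- As power series in $q$ (with $|q|<1$), \begin{align*} \sum_{n=0}^{\infty}\left(N^{0}(0,8;8n+1)-N^{0}(4,8;8n+1) \right)q^n&=\frac{J_{2}^4}{J_{1}^2J_{4}},\\ \sum_{n=0}^{\infty}\left(N^{0}(0,8;8n+3)-N^{0}(4,8;8n+3) \right)q^n&=\frac{J_{4}^3}{J_{2}^2}+qg(q^2;q^4),\\ \sum_{n=0}^{\infty}\left(N^{0}(1,8;8n)-N^{0}(3,8;8n) \right)q^n&=qg(q;q^4),\\ \sum_{n=0}^{\infty}\left(N^{0}(1,8;8n+2)-N^{0}(3,8;8n+2) \right)q^n&=\frac{J_{2}J_{4}}{J_{1}}. \end{align*}
   Context: For $|q|<1$: $(a;q)_n=\prod_{k=0}^{n-1}(1-aq^k)$, $(a;q)_\infty=\prod_{k\ge0}(1-aq^k)$, $J_m=(q^m;q^m)_\infty$, and for $x$ not an integer power of $q$, \[g(x;q)=x^{ -1}\Big(-1+\sum_{n=0}^{\infty}\frac{q^{n^2}}{(x;q)_{n+1}(q/x;q)_{n}}\Big).\] An odd Durfee symbol of a positive integer $n$ consists of a nonnegative integer $D$ together with two (possibly empty) non-increasing sequences of odd positive integers $a_1\ge\cdots\ge a_s$ (top row) and $b_1\ge\cdots\ge b_t$ (bottom row), all entries at most $2D+1$, with $n=\sum a_i+\sum b_j+2D^2+2D+1$; its odd rank is $s-t$. $N^{0}(a,M;n)$ is the number of odd Durfee symbols of $n$ with odd rank congruent to $a$ modulo $M$, and $N^0(a,M;0)=0$. -}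

module Defs where

open import Data.Nat as ℕ using (ℕ; zero; suc; _≤ᵇ_; _≡ᵇ_; NonZero)
open import Data.Nat.DivMod using (_%_)
open import Data.Integer as ℤ using (ℤ; +_; 0ℤ; 1ℤ)
open import Data.Integer.DivMod using (_%ℕ_)
open import Data.List using (List; []; _∷_; map; foldr; length; filterᵇ; concatMap; upTo; zipWith)
open import Data.Nat.ListAction using (sum)
open import Data.Vec as Vec using (Vec; []; _∷_)
open import Data.Bool using (Bool; true; false; _∧_)
open import Data.Product using (_×_; _,_)

allLists : ℕ → ℕ → List (List ℕ)
allLists zero    b = [] ∷ []
allLists (suc L) b = [] ∷ concatMap (λ x → map (x ∷_) (allLists L b)) (upTo (suc b))

isOdd : ℕ → Bool
isOdd x = (x % 2) ≡ᵇ 1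

allᵇ : (ℕ → Bool) → List ℕ → Bool
allᵇ p []      = true
allᵇ p (x ∷ r) = p x ∧ allᵇ p r

nonIncreasing : List ℕ → Bool
nonIncreasing []            = true
nonIncreasing (x ∷ [])      = true
nonIncreasing (x ∷ y ∷ r)   = (y ≤ᵇ x) ∧ nonIncreasing (y ∷ r)

validRow : ℕ → List ℕ → Bool
validRow D r = nonIncreasing r ∧ allᵇ (λ x → isOdd x ∧ (x ≤ᵇ 2 ℕ.* D ℕ.+ 1)) r

-- (D , top row , bottom row)
DurfeeSymbol : Set
DurfeeSymbol = ℕ × List ℕ × List ℕ

isOddDurfeeSymbolOf : ℕ → DurfeeSymbol → Bool
isOddDurfeeSymbolOf n (D , a , b) =
  validRow D a ∧ validRow D b ∧
  ((sum a ℕ.+ sum b ℕ.+ 2 ℕ.* D ℕ.* D ℕ.+ 2 ℕ.* D ℕ.+ 1) ≡ᵇ n)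

-- all odd Durfee symbols of n (each listed exactly once).  Every entry and
-- every row length and D is ≤ n, so the candidate range is exhaustive.
oddDurfeeSymbols : ℕ → List DurfeeSymbol
oddDurfeeSymbols n =
  filterᵇ (isOddDurfeeSymbolOf n)
    (concatMap (λ D → concatMap (λ a → map (λ b → (D , a , b)) (allLists n n))
                                 (allLists n n))
               (upTo (suc n)))

oddRank : DurfeeSymbol → ℤ
oddRank (D , a , b) = + length a ℤ.- + length b

N⁰ : ℤ → (M : ℕ) → .{{NonZero M}} → ℕ → ℕ
N⁰ a M zero    = 0
N⁰ a M (suc n) =
  length (filterᵇ (λ s → ((oddRank s ℤ.- a) %ℕ M) ≡ᵇ 0) (oddDurfeeSymbols (suc n)))

-- Formal power series in q over ℤ (coefficient functions)

PS : Set
PS = ℕ → ℤ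

sumℤ : List ℤ → ℤ
sumℤ = foldr ℤ._+_ 0ℤ

X^ : ℕ → PS
X^ k n = if' (n ≡ᵇ k)
  where
  if' : Bool → ℤ
  if' true  = 1ℤ
  if' false = 0ℤ

𝟙 : PS
𝟙 = X^ 0

_⊕_ : PS → PS → PS
(f ⊕ g) n = f n ℤ.+ g n

_⊖_ : PS → PS → PS
(f ⊖ g) n = f n ℤ.- g n

_⊗_ : PS → PS → PS
(f ⊗ g) n = sumℤ (map (λ k → f k ℤ.* g (n ℕ.∸ k)) (upTo (suc n)))

infixl 7 _⊗_
infixl 6 _⊕_ _⊖_

prodUpTo : ℕ → (ℕ → PS) → PS
prodUpTo zero    F = 𝟙
prodUpTo (suc n) F = prodUpTo n F ⊗ F n

sumUpTo : ℕ → (ℕ → PS) → PS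
sumUpTo zero    F n = 0ℤ
sumUpTo (suc m) F n = sumUpTo m F n ℤ.+ F m n

-- ∏_{k≥0} F k, for families with F k ≡ 1 mod q^(k+1)
-- (so only k ≤ n contribute to the coefficient of q^n)
infProd : (ℕ → PS) → PS
infProd F n = prodUpTo (suc n) F n

-- ∑_{k≥0} F k, for families with F k ≡ 0 mod q^(k+1) for k ≥ 1
infSum : (ℕ → PS) → PS
infSum F n = sumUpTo (suc n) F n

-- multiplicative inverse of a series whose constant term is a unit (±1):
-- c₀ = f₀ , c_{m} = - f₀ ∑_{k=1}^{m} f_k c_{m-k}
invVec : PS → (n : ℕ) → Vec ℤ (suc n)   -- c_n ∷ … ∷ c_0
invVec f zero    = f 0 ∷ []
invVec f (suc n) = new ∷ prev
  where
  prev = invVec f n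
  new  = ℤ.- (f 0 ℤ.* sumℤ (zipWith ℤ._*_ (map (λ i → f (suc i)) (upTo (suc n)))
                                            (Vec.toList prev)))

inv : PS → PS
inv f n = Vec.head (invVec f n)

-- division by q^k (used only when the series is divisible by q^k)
divX^ : ℕ → PS → PS
divX^ k f n = f (n ℕ.+ k)

J : ℕ → PS
J m = infProd (λ k → 𝟙 ⊖ X^ (m ℕ.* suc k))

poch : ℕ → ℕ → ℕ → PS
poch e s n = prodUpTo n (λ k → 𝟙 ⊖ X^ (e ℕ.+ s ℕ.* k))

-- g(q^a ; q^s) = q^{-a} ( -1 + ∑_{n≥0} q^{s n²} / ((q^a;q^s)_{n+1} (q^{s-a};q^s)_n) )
-- (for 0 < a < s, the bracket is divisible by q^a)
gq : ℕ → ℕ → PS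
gq a s = divX^ a ((ℤ.-_ ∘′ 𝟙) ⊕ infSum term)
  where
  _∘′_ : (ℤ → ℤ) → PS → PS
  (h ∘′ f) n = h (f n)
  term : ℕ → PS
  term n = X^ (s ℕ.* n ℕ.* n) ⊗ inv (poch a s (suc n) ⊗ poch (s ℕ.∸ a) s n)

{-# OPTIONS --safe #-}
module Submission where

-- Put z = ζ₈ in Σ_D q^(2D²+2D+1) / ((zq;q²)_{D+1} (q/z;q²)_{D+1}). The coefficients of 1 and ζ₈ are the generating
-- functions of N⁰(0,8;n) − N⁰(4,8;n) and N⁰(1,8;n) − N⁰(5,8;n), and N⁰(5,8;n) = N⁰(3,8;n) by exchanging the rows.
-- Expanding every summand into partial fractions in z + 1/z and summing over D by the Durfee rectangle identity
-- turns this series, and in the same way g(q^a;q⁴), into Lambert series with numerators (−1)^n q^(3n(n+1)/2).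
-- Lambert series in the bases q and q⁴ are related by the partial fraction expansions, in w + 1/w, of
-- 1 / ((wq, q/w; q²)_∞ (−wq², −q²/w; q⁴)_∞) and 1 / ((wq, q/w; q²)_∞ (−w, −q⁴/w; q⁴)_∞). They are used at w = i in
-- the base q², and the first one once more at w = −1 and w = −1/q in the base q⁸; the theta quotients that remain
-- are identified by φ(q) = φ(q⁴) + 2 q ψ(q⁸).
-- Everything is computed in rings in which q^M = 0 for some M, where all sums and products are finite.

open import Level using (0ℓ)
open import Algebra.Bundles using (CommutativeRing; RawRing; Semiring)
import Algebra.Definitions.RawSemiring as RawSemiringPower
import Algebra.Solver.Ring
import Algebra.Solver.Ring.AlmostCommutativeRing as ACR
open import Data.Bool using (Bool; true; false; _∧_; if_then_else_)
open import Data.Bool.Properties using (∧-assoc; ∧-comm; ∧-zeroʳ; T-≡)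
open import Data.Empty using (⊥-elim)
open import Data.Integer as ℤ using (ℤ; +_; -[1+_])
open import Data.Integer.DivMod using (_%ℕ_; _/ℕ_; n%ℕd<d; a≡a%ℕn+[a/ℕn]*n)
import Data.Integer.Properties as ℤₚ
import Data.Integer.Solver as ℤSolver
open import Data.List using (List; []; _∷_; _++_; map; concatMap; upTo; applyUpTo; length; filterᵇ; zipWith)
open import Data.List.Properties using (map-applyUpTo; ++-identityʳ)
open import Data.List.Relation.Unary.All as All using (All; []; _∷_)
import Data.List.Relation.Unary.All.Properties as Allₚ
open import Data.List.Relation.Unary.AllPairs using (AllPairs; []; _∷_)
import Data.List.Relation.Unary.AllPairs.Properties as AllPairsₚ
open import Data.Maybe using (Maybe; just; nothing)
import Data.Nat
open import Data.Nat as ℕ using (ℕ; zero; suc; z≤n; s≤s; _≤ᵇ_; _≡ᵇ_)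
open import Data.Nat.DivMod using (_%_; _/_; m≡m%n+[m/n]*n; m%n<n; [m+kn]%n≡m%n)
open import Data.Nat.ListAction using (sum)
import Data.Nat.Properties as ℕₚ
open import Data.Nat.Solver using (module +-*-Solver)
open import Data.Product using (_×_; _,_; proj₁; proj₂; ∃)
open import Data.Sign as Sign using (Sign)
import Data.Vec as Vec
open import Function.Bundles using (Equivalence)
open import Relation.Binary.Definitions using (Tri; tri<; tri≈; tri>)
open import Relation.Binary.PropositionalEquality as ≡ using (_≡_; _≢_)
open import Relation.Nullary using (yes; no; ¬_)
open import Defs

-- The four claims are two identities read off modulo 8: with F₁, ..., F₄ the right-hand sides, the
-- coefficient of 1 is q F₁(q⁸) + q³ F₂(q⁸) and that of ζ₈ is F₃(q⁸) + q² F₄(q⁸). The base q⁸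
-- appears because the rank series lives in base q² and each Lambert identity passes from a base to
-- its fourth power. At w = i it leads to auxiliary series in base p = q⁸; the second round, at w =
-- -1 and w = -1/p, leads from these to base p⁴, where g(p²;p⁴) and g(p;p⁴) live. Writing τ = w +
-- 1/w, the number w need not lie in the ring, and every pair of factors is a form 1 + y² - yτ,
-- linear in τ, so that a residue is a product of values of the other forms. If y has positive
-- degree and τ is constant, the form is a unit with a finite geometric inverse. The obstacle is a
-- form without inverse: w = i meets (1 + w)(1 + 1/w) = 2, and w = -1/q meets 2 (1 + q²). The
-- expansions are therefore multiplied through by this one form, whose own pole contributes a term
-- without denominator. The identity for ζ₈ thus comes out doubled, and the 2 is cancelled only at
-- the end, between integers.

module IntegerSolver (R : CommutativeRing 0ℓ 0ℓ) where
  open CommutativeRing R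
  open import Algebra.Properties.Ring ring
  open import Algebra.Properties.AbelianGroup +-abelianGroup using (⁻¹-∙-comm)
  open import Algebra.Properties.Group +-group using (ε⁻¹≈ε; ⁻¹-involutive)
  open import Algebra.Properties.Semiring.Mult.TCOptimised semiring
    renaming (_×_ to _·_) using (×1-homo-*)
  open import Algebra.Properties.Monoid.Mult.TCOptimised +-monoid
    using (×-homo-+; 1+×)
  open import Relation.Binary.Reasoning.Setoid setoid

  -- The solver must decide equality of coefficients, which is possible in ℤ but not in the carrier.
  -- With the optimised multiple `1 · 1#` reduces to `1#`, so that 0 and 1 are preserved by `refl`.
  ⟦_⟧ : ℤ → Carrier
  ⟦ + n ⟧      = n · 1#
  ⟦ -[1+ n ] ⟧ = - (suc n · 1#)

  private
    ⊖-homo : ∀ m n → ⟦ m ℤ.⊖ n ⟧ ≈ m · 1# - n · 1#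
    ⊖-homo zero    zero    = sym (-‿inverseʳ _)
    ⊖-homo zero    (suc n) = sym (+-identityˡ _)
    ⊖-homo (suc m) zero    = sym (trans (+-congˡ ε⁻¹≈ε) (+-identityʳ _))
    ⊖-homo (suc m) (suc n) = begin
      ⟦ suc m ℤ.⊖ suc n ⟧ ≡⟨ ≡.cong ⟦_⟧ (ℤₚ.[1+m]⊖[1+n]≡m⊖n m n) ⟩
      ⟦ m ℤ.⊖ n ⟧ ≈⟨ ⊖-homo m n ⟩
      m · 1# - n · 1# ≈⟨ +-congʳ (sym (trans (+-congʳ (-‿inverseʳ 1#)) (+-identityˡ _))) ⟩
      (1# - 1#) + m · 1# - n · 1# ≈⟨ +-congʳ (trans (+-assoc _ _ _) (trans (+-congˡ (+-comm _ _)) (sym (+-assoc _ _ _)))) ⟩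
      (1# + m · 1#) - 1# - n · 1# ≈⟨ +-assoc _ _ _ ⟩
      (1# + m · 1#) + (- 1# - n · 1#) ≈⟨ +-cong (sym (1+× m 1#)) (trans (⁻¹-∙-comm _ _) (-‿cong (sym (1+× n 1#)))) ⟩
      suc m · 1# - suc n · 1# ∎

    +-homo : ∀ i j → ⟦ i ℤ.+ j ⟧ ≈ ⟦ i ⟧ + ⟦ j ⟧
    +-homo (+ m)    (+ n)    = ×-homo-+ 1# m n
    +-homo (+ m)    -[1+ n ] = ⊖-homo m (suc n)
    +-homo -[1+ m ] (+ n)    = trans (⊖-homo n (suc m)) (+-comm _ _)
    +-homo -[1+ m ] -[1+ n ] = begin
      - (suc (suc (m ℕ.+ n)) · 1#) ≡⟨ ≡.cong (λ k → - (k · 1#)) (≡.sym (ℕₚ.+-suc (suc m) n)) ⟩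
      - ((suc m ℕ.+ suc n) · 1#) ≈⟨ -‿cong (×-homo-+ 1# (suc m) (suc n)) ⟩
      - (suc m · 1# + suc n · 1#) ≈⟨ sym (⁻¹-∙-comm _ _) ⟩
      - (suc m · 1#) - (suc n · 1#) ∎

    *-homo : ∀ i j → ⟦ i ℤ.* j ⟧ ≈ ⟦ i ⟧ * ⟦ j ⟧
    *-homo (+ m) (+ n) = trans (reflexive (≡.cong ⟦_⟧ (ℤₚ.+◃n≡+n (m ℕ.* n)))) (×1-homo-* m n)
    *-homo (+ zero) -[1+ n ] = sym (zeroˡ _)
    *-homo (+ suc m) -[1+ n ] = trans (-‿cong (×1-homo-* (suc m) (suc n))) (-‿distribʳ-* _ _)
    *-homo -[1+ m ] (+ zero) = trans (reflexive (≡.cong (λ k → ⟦ Data.Sign.- ℤ.◃ k ⟧) (ℕₚ.*-zeroʳ m))) (sym (zeroʳ _))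
      where import Data.Sign
    *-homo -[1+ m ] (+ suc n) = trans (-‿cong (×1-homo-* (suc m) (suc n))) (-‿distribˡ-* _ _)
    *-homo -[1+ m ] -[1+ n ] = begin
      (suc m ℕ.* suc n) · 1# ≈⟨ ×1-homo-* (suc m) (suc n) ⟩
      suc m · 1# * suc n · 1# ≈⟨ sym (⁻¹-involutive _) ⟩
      - - (suc m · 1# * suc n · 1#) ≈⟨ -‿cong (-‿distribˡ-* _ _) ⟩
      - (- (suc m · 1#) * suc n · 1#) ≈⟨ -‿distribʳ-* _ _ ⟩
      - (suc m · 1#) * - (suc n · 1#) ∎

    -‿homo : ∀ i → ⟦ ℤ.- i ⟧ ≈ - ⟦ i ⟧
    -‿homo (+ zero)  = sym ε⁻¹≈ε
    -‿homo (+ suc n) = refl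
    -‿homo -[1+ n ]  = sym (⁻¹-involutive _)

    ℤ-rawRing : RawRing 0ℓ 0ℓ
    ℤ-rawRing = record { Carrier = ℤ ; _≈_ = _≡_ ; _+_ = ℤ._+_ ; _*_ = ℤ._*_ ; -_ = ℤ.-_ ; 0# = ℤ.0ℤ ; 1# = ℤ.1ℤ }

    morphism : ℤ-rawRing ACR.-Raw-AlmostCommutative⟶ ACR.fromCommutativeRing R
    morphism = record
      { ⟦_⟧ = ⟦_⟧ ; +-homo = +-homo ; *-homo = *-homo ; -‿homo = -‿homo ; 0-homo = refl ; 1-homo = refl }

    ≟-coeff : ∀ i j → Maybe (⟦ i ⟧ ≈ ⟦ j ⟧)
    ≟-coeff i j with i ℤ.≟ j
    ... | yes i≡j = just (reflexive (≡.cong ⟦_⟧ i≡j))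
    ... | no _    = nothing

  open Algebra.Solver.Ring ℤ-rawRing (ACR.fromCommutativeRing R) morphism ≟-coeff public
    using (solve; _:=_; _:+_; _:*_; _:-_; :-_; _:^_; con; Polynomial)

  :1 : ∀ {n} → Polynomial n
  :1 = con (+ 1)
  :0 : ∀ {n} → Polynomial n
  :0 = con (+ 0)

-- Finite sums and products in a commutative ring.

module FiniteSums (R : CommutativeRing 0ℓ 0ℓ) where
  open CommutativeRing R
  open IntegerSolver R
  open import Relation.Binary.Reasoning.Setoid setoid

  ∑ ∏ : ℕ → (ℕ → Carrier) → Carrier
  ∑ zero    F = 0#
  ∑ (suc n) F = ∑ n F + F n
  ∏ zero    F = 1#
  ∏ (suc n) F = ∏ n F * F n

  sg : ℕ → Carrier
  sg zero    = 1#
  sg (suc n) = - sg n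

  private
    variable
      F G : ℕ → Carrier

  ∑-cong : ∀ n → (∀ i → i ℕ.< n → F i ≈ G i) → ∑ n F ≈ ∑ n G
  ∑-cong zero    e = refl
  ∑-cong (suc n) e = +-cong (∑-cong n λ i i<n → e i (ℕₚ.m≤n⇒m≤1+n i<n)) (e n ℕₚ.≤-refl)

  ∏-cong : ∀ n → (∀ i → i ℕ.< n → F i ≈ G i) → ∏ n F ≈ ∏ n G
  ∏-cong zero    e = refl
  ∏-cong (suc n) e = *-cong (∏-cong n λ i i<n → e i (ℕₚ.m≤n⇒m≤1+n i<n)) (e n ℕₚ.≤-refl)

  ∑-zero : ∀ n → (∀ i → i ℕ.< n → F i ≈ 0#) → ∑ n F ≈ 0#
  ∑-zero zero    e = refl
  ∑-zero (suc n) e = trans (+-cong (∑-zero n λ i i<n → e i (ℕₚ.m≤n⇒m≤1+n i<n)) (e n ℕₚ.≤-refl)) (+-identityˡ _)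

  ∏-one : ∀ n → (∀ i → i ℕ.< n → F i ≈ 1#) → ∏ n F ≈ 1#
  ∏-one zero    e = refl
  ∏-one (suc n) e = trans (*-cong (∏-one n λ i i<n → e i (ℕₚ.m≤n⇒m≤1+n i<n)) (e n ℕₚ.≤-refl)) (*-identityˡ _)

  ∑-+ : ∀ n → ∑ n (λ i → F i + G i) ≈ ∑ n F + ∑ n G
  ∑-+ zero    = sym (+-identityˡ _)
  ∑-+ {F} {G} (suc n) = trans (+-congʳ (∑-+ n))
    (solve 4 (λ a b c d → a :+ b :+ (c :+ d) := a :+ c :+ (b :+ d)) refl _ _ _ _)

  ∏-* : ∀ n → ∏ n (λ i → F i * G i) ≈ ∏ n F * ∏ n G
  ∏-* zero    = sym (*-identityˡ _)
  ∏-* {F} {G} (suc n) = trans (*-congʳ (∏-* n))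
    (solve 4 (λ a b c d → a :* b :* (c :* d) := a :* c :* (b :* d)) refl _ _ _ _)

  *-∑ : ∀ n c → c * ∑ n F ≈ ∑ n (λ i → c * F i)
  *-∑ zero    c = zeroʳ c
  *-∑ (suc n) c = trans (distribˡ _ _ _) (+-congʳ (*-∑ n c))

  ∑-* : ∀ n c → ∑ n F * c ≈ ∑ n (λ i → F i * c)
  ∑-* zero    c = zeroˡ c
  ∑-* (suc n) c = trans (distribʳ _ _ _) (+-congʳ (∑-* n c))

  ∑-head : ∀ n → ∑ (suc n) F ≈ F 0 + ∑ n (λ i → F (suc i))
  ∑-head zero    = +-comm _ _
  ∑-head (suc n) = trans (+-congʳ (∑-head n)) (+-assoc _ _ _)

  ∏-head : ∀ n → ∏ (suc n) F ≈ F 0 * ∏ n (λ i → F (suc i))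
  ∏-head zero    = *-comm _ _
  ∏-head (suc n) = trans (*-congʳ (∏-head n)) (*-assoc _ _ _)

  ∑-split : ∀ m n → ∑ (m ℕ.+ n) F ≈ ∑ m F + ∑ n (λ i → F (m ℕ.+ i))
  ∑-split {F} m zero    = trans (reflexive (≡.cong (λ k → ∑ k F) (ℕₚ.+-identityʳ m))) (sym (+-identityʳ _))
  ∑-split {F} m (suc n) = trans (reflexive (≡.cong (λ k → ∑ k F) (ℕₚ.+-suc m n)))
    (trans (+-congʳ (∑-split m n)) (+-assoc _ _ _))

  ∏-split : ∀ m n → ∏ (m ℕ.+ n) F ≈ ∏ m F * ∏ n (λ i → F (m ℕ.+ i))
  ∏-split {F} m zero    = trans (reflexive (≡.cong (λ k → ∏ k F) (ℕₚ.+-identityʳ m))) (sym (*-identityʳ _))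
  ∏-split {F} m (suc n) = trans (reflexive (≡.cong (λ k → ∏ k F) (ℕₚ.+-suc m n)))
    (trans (*-congʳ (∏-split m n)) (*-assoc _ _ _))

  ∑-truncate< : ∀ {m n} → m ℕ.≤ n → (∀ i → m ℕ.≤ i → i ℕ.< n → F i ≈ 0#) → ∑ n F ≈ ∑ m F
  ∑-truncate< {F} {m} {n} m≤n e = begin
    ∑ n F ≡⟨ ≡.cong (λ k → ∑ k F) (≡.sym (ℕₚ.m+[n∸m]≡n m≤n)) ⟩
    ∑ (m ℕ.+ (n ℕ.∸ m)) F ≈⟨ ∑-split m (n ℕ.∸ m) ⟩
    ∑ m F + ∑ (n ℕ.∸ m) (λ i → F (m ℕ.+ i)) ≈⟨ +-congˡ (∑-zero (n ℕ.∸ m) λ i i<n∸m → e _ (ℕₚ.m≤m+n m i)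
      (ℕₚ.<-≤-trans (ℕₚ.+-monoʳ-< m i<n∸m) (ℕₚ.≤-reflexive (ℕₚ.m+[n∸m]≡n m≤n)))) ⟩
    ∑ m F + 0# ≈⟨ +-identityʳ _ ⟩
    ∑ m F ∎

  ∑-truncate : ∀ {m n} → m ℕ.≤ n → (∀ i → m ℕ.≤ i → F i ≈ 0#) → ∑ n F ≈ ∑ m F
  ∑-truncate m≤n e = ∑-truncate< m≤n λ i m≤i _ → e i m≤i

  ∏-truncate : ∀ {m n} → m ℕ.≤ n → (∀ i → m ℕ.≤ i → F i ≈ 1#) → ∏ n F ≈ ∏ m F
  ∏-truncate {F} {m} {n} m≤n e = begin
    ∏ n F ≡⟨ ≡.cong (λ k → ∏ k F) (≡.sym (ℕₚ.m+[n∸m]≡n m≤n)) ⟩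
    ∏ (m ℕ.+ (n ℕ.∸ m)) F ≈⟨ ∏-split m (n ℕ.∸ m) ⟩
    ∏ m F * ∏ (n ℕ.∸ m) (λ i → F (m ℕ.+ i)) ≈⟨ *-congˡ (∏-one (n ℕ.∸ m) λ i _ → e _ (ℕₚ.m≤m+n m i)) ⟩
    ∏ m F * 1# ≈⟨ *-identityʳ _ ⟩
    ∏ m F ∎

  -- both sides sum H over { (i + k , i) | i + k < n }
  ∑-triangle : ∀ n (H : ℕ → ℕ → Carrier) →
    ∑ n (λ D → ∑ (suc D) (H D)) ≈ ∑ n (λ i → ∑ (n ℕ.∸ i) (λ k → H (i ℕ.+ k) i))
  ∑-triangle zero    H = refl
  ∑-triangle (suc n) H = begin
    ∑ n (λ D → ∑ (suc D) (H D)) + (∑ n (H n) + H n n)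
      ≈⟨ +-congʳ (∑-triangle n H) ⟩
    ∑ n (λ i → ∑ (n ℕ.∸ i) (λ k → H (i ℕ.+ k) i)) + (∑ n (H n) + H n n)
      ≈⟨ trans (sym (+-assoc _ _ _)) (+-cong (sym (∑-+ n)) lem) ⟩
    ∑ n (λ i → ∑ (n ℕ.∸ i) (λ k → H (i ℕ.+ k) i) + H n i) + ∑ (suc n ℕ.∸ n) (λ k → H (n ℕ.+ k) n)
      ≈⟨ +-congʳ (∑-cong n step) ⟩
    ∑ (suc n) (λ i → ∑ (suc n ℕ.∸ i) (λ k → H (i ℕ.+ k) i)) ∎
    where
    lem : H n n ≈ ∑ (suc n ℕ.∸ n) (λ k → H (n ℕ.+ k) n)
    lem = sym (begin
      ∑ (suc n ℕ.∸ n) (λ k → H (n ℕ.+ k) n) ≡⟨ ≡.cong (λ j → ∑ j (λ k → H (n ℕ.+ k) n)) (ℕₚ.m+n∸n≡m 1 n) ⟩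
      0# + H (n ℕ.+ 0) n ≈⟨ +-identityˡ _ ⟩
      H (n ℕ.+ 0) n ≡⟨ ≡.cong (λ k → H k n) (ℕₚ.+-identityʳ n) ⟩
      H n n ∎)
    step : ∀ i → i ℕ.< n → ∑ (n ℕ.∸ i) (λ k → H (i ℕ.+ k) i) + H n i ≈ ∑ (suc n ℕ.∸ i) (λ k → H (i ℕ.+ k) i)
    step i i<n = begin
      ∑ (n ℕ.∸ i) (λ k → H (i ℕ.+ k) i) + H n i
        ≡⟨ ≡.cong (λ j → ∑ (n ℕ.∸ i) (λ k → H (i ℕ.+ k) i) + H j i) (≡.sym (ℕₚ.m+[n∸m]≡n (ℕₚ.<⇒≤ i<n))) ⟩
      ∑ (suc (n ℕ.∸ i)) (λ k → H (i ℕ.+ k) i)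
        ≡⟨ ≡.cong (λ j → ∑ j (λ k → H (i ℕ.+ k) i)) (≡.sym (ℕₚ.+-∸-assoc 1 (ℕₚ.<⇒≤ i<n))) ⟩
      ∑ (suc n ℕ.∸ i) (λ k → H (i ℕ.+ k) i) ∎

  ∏-parity : ∀ n {F : ℕ → Carrier} → ∏ (n ℕ.+ n) F ≈ ∏ n (λ i → F (i ℕ.+ i)) * ∏ n (λ i → F (suc (i ℕ.+ i)))
  ∏-parity zero = sym (*-identityˡ _)
  ∏-parity (suc n) {F} = begin
    ∏ (n ℕ.+ suc n) F * F (n ℕ.+ suc n) ≡⟨ ≡.cong (λ k → ∏ k F * F k) (ℕₚ.+-suc n n) ⟩
    ∏ (n ℕ.+ n) F * F (n ℕ.+ n) * F (suc (n ℕ.+ n)) ≈⟨ *-congʳ (*-congʳ (∏-parity n)) ⟩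
    ∏ n (λ i → F (i ℕ.+ i)) * ∏ n (λ i → F (suc (i ℕ.+ i))) * F (n ℕ.+ n) * F (suc (n ℕ.+ n))
      ≈⟨ solve 4 (λ a b c d → a :* b :* c :* d := a :* c :* (b :* d)) refl _ _ _ _ ⟩
    ∏ (suc n) (λ i → F (i ℕ.+ i)) * ∏ (suc n) (λ i → F (suc (i ℕ.+ i))) ∎

  ∑-parity : ∀ n {F : ℕ → Carrier} → ∑ (n ℕ.+ n) F ≈ ∑ n (λ i → F (i ℕ.+ i)) + ∑ n (λ i → F (suc (i ℕ.+ i)))
  ∑-parity zero = sym (+-identityˡ _)
  ∑-parity (suc n) {F} = begin
    ∑ (n ℕ.+ suc n) F + F (n ℕ.+ suc n) ≡⟨ ≡.cong (λ k → ∑ k F + F k) (ℕₚ.+-suc n n) ⟩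
    ∑ (n ℕ.+ n) F + F (n ℕ.+ n) + F (suc (n ℕ.+ n)) ≈⟨ +-congʳ (+-congʳ (∑-parity n)) ⟩
    ∑ n (λ i → F (i ℕ.+ i)) + ∑ n (λ i → F (suc (i ℕ.+ i))) + F (n ℕ.+ n) + F (suc (n ℕ.+ n))
      ≈⟨ solve 4 (λ a b c d → a :+ b :+ c :+ d := a :+ c :+ (b :+ d)) refl _ _ _ _ ⟩
    ∑ (suc n) (λ i → F (i ℕ.+ i)) + ∑ (suc n) (λ i → F (suc (i ℕ.+ i))) ∎

  inverse-unique : ∀ {a b c} → a * b ≈ 1# → a * c ≈ 1# → b ≈ c
  inverse-unique {a} {b} {c} ab ac = begin
    b             ≈⟨ sym (*-identityˡ b) ⟩
    1# * b        ≈⟨ *-congʳ (sym ac) ⟩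
    a * c * b     ≈⟨ solve 3 (λ a b c → a :* c :* b := a :* b :* c) refl a b c ⟩
    a * b * c     ≈⟨ *-congʳ ab ⟩
    1# * c        ≈⟨ *-identityˡ c ⟩
    c             ∎

  -- The rings in use have nilpotent elements, so cancelling a factor requires an explicit inverse.
  *-cancel : ∀ {a a⁻¹ b c} → a * a⁻¹ ≈ 1# → a * b ≈ a * c → b ≈ c
  *-cancel {a} {a⁻¹} {b} {c} u e = begin
    b               ≈⟨ sym (*-identityˡ b) ⟩
    1# * b          ≈⟨ *-congʳ (sym u) ⟩
    a * a⁻¹ * b     ≈⟨ solve 3 (λ a i b → a :* i :* b := i :* (a :* b)) refl a a⁻¹ b ⟩
    a⁻¹ * (a * b)   ≈⟨ *-congˡ e ⟩
    a⁻¹ * (a * c)   ≈⟨ solve 3 (λ a i b → i :* (a :* b) := a :* i :* b) refl a a⁻¹ c ⟩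
    a * a⁻¹ * c     ≈⟨ *-congʳ u ⟩
    1# * c          ≈⟨ *-identityˡ c ⟩
    c ∎

  inverse-* : ∀ {a a⁻¹ b b⁻¹} → a * a⁻¹ ≈ 1# → b * b⁻¹ ≈ 1# → (a * b) * (a⁻¹ * b⁻¹) ≈ 1#
  inverse-* {a} {a⁻¹} {b} {b⁻¹} p q = trans
    (solve 4 (λ a i b j → a :* b :* (i :* j) := a :* i :* (b :* j)) refl a a⁻¹ b b⁻¹)
    (trans (*-cong p q) (*-identityˡ _))

  ∏-inverse : ∀ n → (∀ i → i ℕ.< n → F i * G i ≈ 1#) → ∏ n F * ∏ n G ≈ 1#
  ∏-inverse n e = trans (sym (∏-* n)) (∏-one n e)

-- Partial fractions for abstract linear forms.

module PartialFractions (R : CommutativeRing 0ℓ 0ℓ) where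
  open CommutativeRing R
  open IntegerSolver R
  open import Relation.Binary.Reasoning.Setoid setoid

  ∑L ∏L : {I : Set} → (I → Carrier) → List I → Carrier
  ∑L F []       = 0#
  ∑L F (i ∷ is) = F i + ∑L F is
  ∏L F []       = 1#
  ∏L F (i ∷ is) = F i * ∏L F is

  module _ {I : Set} where
    ∑L-cong : {F G : I → Carrier} {is : List I} → All (λ i → F i ≈ G i) is → ∑L F is ≈ ∑L G is
    ∑L-cong []       = refl
    ∑L-cong (e ∷ es) = +-cong e (∑L-cong es)

    ∑L-linear : (F G : I → Carrier) (a b : Carrier) (is : List I) →
                ∑L (λ i → a * F i + b * G i) is ≈ a * ∑L F is + b * ∑L G is
    ∑L-linear F G a b []       = solve 2 (λ a b → :0 := a :* :0 :+ b :* :0) refl a b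
    ∑L-linear F G a b (i ∷ is) = trans (+-congˡ (∑L-linear F G a b is))
      (solve 6 (λ a b f g s t → a :* f :+ b :* g :+ (a :* s :+ b :* t) := a :* (f :+ s) :+ b :* (g :+ t))
        refl a b (F i) (G i) _ _)

  -- If f i = 1 / L i for linear forms L i in one variable, d i j is the value of f j at the zero of L i.
  -- These values are 1 / L for the same forms, which is why d v satisfies the hypothesis on f.
  module Residues {I : Set} (d : I → I → Carrier) (Distinct : I → I → Set)
    (d-refl : ∀ i → d i i ≈ 1#)
    (d-split : ∀ v i j → Distinct v i → Distinct v j → Distinct i j →
               d v i * d v j ≈ d i j * d v i + d j i * d v j) where

    Splits : (I → Carrier) → I → I → Set
    Splits f i j = f i * f j ≈ d i j * f i + d j i * f j

    splits-d : ∀ v {is} → All (Distinct v) is → AllPairs Distinct is → AllPairs (Splits (d v)) is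
    splits-d v []       []       = []
    splits-d v (p ∷ ps) (q ∷ qs) = go p ps q ∷ splits-d v ps qs
      where
      go : ∀ {i is} → Distinct v i → All (Distinct v) is → All (Distinct i) is → All (Splits (d v) i) is
      go p []        []       = []
      go p (p′ ∷ ps) (q ∷ qs) = d-split v _ _ p p′ q ∷ go p ps qs

    -- Induction on the list. When the expansion of the tail is multiplied by `f v` and each
    -- `f v * f i` is split, the terms with `f i` receive their missing factor `d i v`. The terms
    -- with `f v` collect the coefficient `∑L (λ i → d v i * c i) zs`, which is `∏L (d v) zs` by the
    -- same theorem for `d v`; this is why `f` is universally quantified. The value `d i i ≈ 1#`
    -- lets every product run over the whole list.
    partial-fractions : ∀ (f : I → Carrier) w is → AllPairs Distinct (w ∷ is) → AllPairs (Splits f) (w ∷ is) →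
      ∏L f (w ∷ is) ≈ ∑L (λ i → f i * ∏L (d i) (w ∷ is)) (w ∷ is)
    partial-fractions f w [] _ _ = begin
      f w * 1# ≈⟨ solve 1 (λ a → a :* :1 := a :* (:1 :* :1) :+ :0) refl (f w) ⟩
      f w * (1# * 1#) + 0# ≈⟨ +-congʳ (*-congˡ (*-congʳ (sym (d-refl w)))) ⟩
      f w * (d w w * 1#) + 0# ∎
    partial-fractions f v (w ∷ is) (p ∷ ps) (q ∷ qs) = begin
      f v * ∏L f zs
        ≈⟨ *-congˡ (partial-fractions f w is ps qs) ⟩
      f v * ∑L (λ i → f i * c i) zs
        -- The summand with coefficient 0 only brings the sum into the shape of `∑L-linear`.
        ≈⟨ trans (solve 2 (λ a b → a :* b := a :* b :+ :0 :* b) refl _ _)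
             (sym (∑L-linear (λ i → f i * c i) (λ i → f i * c i) (f v) 0# zs)) ⟩
      ∑L (λ i → f v * (f i * c i) + 0# * (f i * c i)) zs
        ≈⟨ ∑L-cong (All.map (λ {i} s → step s) q) ⟩
      ∑L (λ i → f v * (d v i * c i) + 1# * (f i * (d i v * c i))) zs
        ≈⟨ ∑L-linear (λ i → d v i * c i) (λ i → f i * (d i v * c i)) (f v) 1# zs ⟩
      f v * ∑L (λ i → d v i * c i) zs + 1# * ∑L (λ i → f i * (d i v * c i)) zs
        ≈⟨ +-cong (*-congˡ (sym (partial-fractions (d v) w is ps (splits-d v p ps)))) (*-identityˡ _) ⟩
      f v * ∏L (d v) zs + ∑L (λ i → f i * (d i v * c i)) zs
        ≈⟨ +-congʳ (*-congˡ (sym (trans (*-congʳ (d-refl v)) (*-identityˡ _)))) ⟩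
      f v * (d v v * ∏L (d v) zs) + ∑L (λ i → f i * (d i v * c i)) zs ∎
      where
      zs = w ∷ is
      c : I → Carrier
      c i = ∏L (d i) zs
      step : ∀ {i} → Splits f v i →
             f v * (f i * c i) + 0# * (f i * c i) ≈ f v * (d v i * c i) + 1# * (f i * (d i v * c i))
      step {i} s = begin
        f v * (f i * c i) + 0# * (f i * c i)
          ≈⟨ solve 3 (λ a b c → a :* (b :* c) :+ :0 :* (b :* c) := a :* b :* c) refl (f v) (f i) (c i) ⟩
        f v * f i * c i ≈⟨ *-congʳ s ⟩
        (d v i * f v + d i v * f i) * c i
          ≈⟨ solve 5 (λ a b c d e → (d :* a :+ e :* b) :* c := a :* (d :* c) :+ :1 :* (b :* (e :* c)))
               refl (f v) (f i) (c i) (d v i) (d i v) ⟩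
        f v * (d v i * c i) + 1# * (f i * (d i v * c i)) ∎

    -- V stands for 1 / f v, which is allowed to be a non-unit.
    partial-fractions′ : ∀ (f : I → Carrier) V v w is →
      AllPairs Distinct (v ∷ w ∷ is) → AllPairs (Splits f) (w ∷ is) →
      All (λ i → f i ≈ d v i + d i v * (V * f i)) (w ∷ is) →
      ∏L f (w ∷ is) ≈ ∏L (d v) (v ∷ w ∷ is) + ∑L (λ i → V * f i * ∏L (d i) (v ∷ w ∷ is)) (w ∷ is)
    partial-fractions′ f V v w is (p ∷ ps) qs hs = begin
      ∏L f zs ≈⟨ partial-fractions f w is ps qs ⟩
      -- The hypothesis `hs` is the splitting of `f v * f i` multiplied by `V`, a form that still
      -- makes sense when `V` has no inverse.
      ∑L (λ i → f i * c i) zs ≈⟨ ∑L-cong (All.map (λ {i} → step) hs) ⟩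
      ∑L (λ i → 1# * (d v i * c i) + 1# * (V * f i * (d i v * c i))) zs
        ≈⟨ ∑L-linear _ _ 1# 1# zs ⟩
      1# * ∑L (λ i → d v i * c i) zs + 1# * ∑L (λ i → V * f i * (d i v * c i)) zs
        ≈⟨ +-cong (trans (*-identityˡ _) (sym (partial-fractions (d v) w is ps (splits-d v p ps)))) (*-identityˡ _) ⟩
      ∏L (d v) zs + ∑L (λ i → V * f i * (d i v * c i)) zs
        ≈⟨ +-congʳ (sym (trans (*-congʳ (d-refl v)) (*-identityˡ _))) ⟩
      d v v * ∏L (d v) zs + ∑L (λ i → V * f i * (d i v * c i)) zs ∎
      where
      zs = w ∷ is
      c : I → Carrier
      c i = ∏L (d i) zs
      step : ∀ {i} → f i ≈ d v i + d i v * (V * f i) →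
             f i * c i ≈ 1# * (d v i * c i) + 1# * (V * f i * (d i v * c i))
      step {i} h = trans (*-congʳ h)
        (solve 4 (λ a b c e → (a :+ b :* e) :* c := :1 :* (a :* c) :+ :1 :* (e :* (b :* c)))
          refl (d v i) (d i v) (c i) (V * f i))

-- Inverses and residues at monomials in a nilpotent x.

module Geometric (R : CommutativeRing 0ℓ 0ℓ) (M : ℕ) where
  open CommutativeRing R
  open IntegerSolver R
  open FiniteSums R
  open import Algebra.Properties.Semiring.Exp semiring
  open import Relation.Binary.Reasoning.Setoid setoid

  -- The inverse of `1# - u` as soon as `u ^ M` vanishes. As a total function it can be written in
  -- Lambert series before any nilpotency is assumed.
  geo : Carrier → Carrier
  geo u = ∑ M (u ^_)

  geo-cong : ∀ {u v} → u ≈ v → geo u ≈ geo v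
  geo-cong e = ∑-cong M λ i _ → ^-congˡ i e

  private
    geo-telescope : ∀ n u → (1# - u) * ∑ n (u ^_) ≈ 1# - u ^ n
    geo-telescope zero    u = solve 1 (λ u → (:1 :- u) :* :0 := :1 :- :1) refl u
    geo-telescope (suc n) u = begin
      (1# - u) * (∑ n (u ^_) + u ^ n) ≈⟨ distribˡ _ _ _ ⟩
      (1# - u) * ∑ n (u ^_) + (1# - u) * u ^ n ≈⟨ +-congʳ (geo-telescope n u) ⟩
      1# - u ^ n + (1# - u) * u ^ n ≈⟨ solve 2 (λ u v → :1 :- v :+ (:1 :- u) :* v := :1 :- u :* v) refl u (u ^ n) ⟩
      1# - u ^ suc n ∎

  geo-inverse : ∀ {u} → u ^ M ≈ 0# → (1# - u) * geo u ≈ 1#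
  geo-inverse {u} e = trans (geo-telescope M u) (trans (+-congˡ (-‿cong e)) (solve 0 (:1 :- :0 := :1) refl))


Vanishes : (R : CommutativeRing 0ℓ 0ℓ) → ℕ → CommutativeRing.Carrier R → Set
Vanishes R k x = let open CommutativeRing R ; open RawSemiringPower (Semiring.rawSemiring semiring) in x ^ k ≈ 0#

module Nilpotent (R : CommutativeRing 0ℓ 0ℓ) (M : ℕ) (x : CommutativeRing.Carrier R) (x^M≈0 : Vanishes R M x) where
  open CommutativeRing R
  open IntegerSolver R
  open FiniteSums R
  open PartialFractions R
  open import Algebra.Properties.Semiring.Exp semiring
  open import Algebra.Properties.CommutativeSemiring.Exp commutativeSemiring using (^-distrib-*)
  open import Relation.Binary.Reasoning.Setoid setoid

  open Geometric R M public

  x^≥M : ∀ {k} → M ℕ.≤ k → x ^ k ≈ 0#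
  x^≥M {k} M≤k = begin
    x ^ k ≡⟨ ≡.cong (x ^_) (≡.sym (ℕₚ.m+[n∸m]≡n M≤k)) ⟩
    x ^ (M ℕ.+ (k ℕ.∸ M)) ≈⟨ ^-homo-* x M _ ⟩
    x ^ M * x ^ (k ℕ.∸ M) ≈⟨ *-congʳ x^M≈0 ⟩
    0# * x ^ (k ℕ.∸ M) ≈⟨ zeroˡ _ ⟩
    0# ∎

  c*x^-nil : ∀ c {k} → 1 ℕ.≤ k → (c * x ^ k) ^ M ≈ 0#
  c*x^-nil c {suc k} _ = begin
    (c * x ^ suc k) ^ M ≈⟨ ^-distrib-* c (x ^ suc k) M ⟩
    c ^ M * (x ^ suc k) ^ M ≈⟨ *-congˡ (^-assocʳ x (suc k) M) ⟩
    c ^ M * x ^ (M ℕ.+ k ℕ.* M) ≈⟨ *-congˡ (x^≥M (ℕₚ.m≤m+n M _)) ⟩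
    c ^ M * 0# ≈⟨ zeroʳ _ ⟩
    0# ∎

  σ : Sign → Carrier
  σ Sign.+ = 1#
  σ Sign.- = - 1#

  σ-sq : ∀ s → σ s * σ s ≈ 1#
  σ-sq Sign.+ = *-identityˡ 1#
  σ-sq Sign.- = solve 0 ((:- :1) :* (:- :1) := :1) refl

  -- (s , e) labels the monomial s x^e
  Label : Set
  Label = Sign × ℕ

  y : Label → Carrier
  y (s , e) = σ s * x ^ e

  ratio : Label → Label → Carrier
  ratio (s , e) (t , e′) = σ s * σ t * x ^ (e′ ℕ.∸ e)

  -- Write y and y′ for `y l` and `y l′`. At τ = y + 1/y, the zero of the form of `l`, the form 1 +
  -- y′² - y′τ of `l′` takes the value (1 - y′/y)(1 - y y′). For `l ≺ l′` this is `u l l′`, and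
  -- `U l l′` is its inverse.
  u U : Label → Label → Carrier
  u l l′ = (1# - ratio l l′) * (1# - y l * y l′)
  U l l′ = geo (ratio l l′) * geo (y l * y l′)

  _≺_ : Label → Label → Set
  (_ , e) ≺ (_ , e′) = e ℕ.< e′

  y*y : ∀ l l′ → y l * y l′ ≈ σ (proj₁ l) * σ (proj₁ l′) * x ^ (proj₂ l ℕ.+ proj₂ l′)
  y*y (s , e) (t , e′) = trans
    (solve 4 (λ a b c d → a :* b :* (c :* d) := a :* c :* (b :* d)) refl _ _ _ _)
    (*-congˡ (sym (^-homo-* x e e′)))

  u*U : ∀ {l l′} → l ≺ l′ → u l l′ * U l l′ ≈ 1#
  u*U {l@(s , e)} {l′@(t , e′)} e<e′ = inverse-*
    (geo-inverse (c*x^-nil _ (ℕₚ.m<n⇒0<n∸m e<e′)))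
    (geo-inverse (trans (^-congˡ M (y*y l l′))
      (c*x^-nil _ (ℕₚ.≤-trans (ℕₚ.≤-trans (s≤s z≤n) e<e′) (ℕₚ.m≤n+m e′ e)))))

  -- For `l′ ≺ l` the quotient y′/y has negative degree; with r = `ratio l′ l` the rewriting 1/(1 -
  -- 1/r) = -r/(1 - r) removes it. The value 1 at equal degrees stands for the factor that a residue
  -- omits.
  d : Label → Label → Carrier
  d l l′ with ℕₚ.<-cmp (proj₂ l) (proj₂ l′)
  ... | tri< _ _ _ = U l l′
  ... | tri≈ _ _ _ = 1#
  ... | tri> _ _ _ = - ratio l′ l * U l′ l

  d-< : ∀ {l l′} → l ≺ l′ → d l l′ ≈ U l l′
  d-< {l} {l′} p with ℕₚ.<-cmp (proj₂ l) (proj₂ l′)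
  ... | tri< _ _ _ = refl
  ... | tri≈ q _ _ = ⊥-elim (q p)
  ... | tri> q _ _ = ⊥-elim (q p)

  d-> : ∀ {l l′} → l ≺ l′ → d l′ l ≈ - ratio l l′ * U l l′
  d-> {l} {l′} p with ℕₚ.<-cmp (proj₂ l′) (proj₂ l)
  ... | tri< _ _ q = ⊥-elim (q p)
  ... | tri≈ _ _ q = ⊥-elim (q p)
  ... | tri> _ _ _ = refl

  d-refl : ∀ l → d l l ≈ 1#
  d-refl l with ℕₚ.<-cmp (proj₂ l) (proj₂ l)
  ... | tri< _ q _ = ⊥-elim (q ≡.refl)
  ... | tri≈ _ _ _ = refl
  ... | tri> _ q _ = ⊥-elim (q ≡.refl)

  ratio-* : ∀ {l m n} → l ≺ m → m ≺ n → ratio l n ≈ ratio l m * ratio m n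
  ratio-* {s , e} {t , e′} {r , e″} p q = begin
    σ s * σ r * x ^ (e″ ℕ.∸ e)
      ≡⟨ ≡.cong (λ k → σ s * σ r * x ^ k) (≡.sym eq) ⟩
    σ s * σ r * x ^ ((e′ ℕ.∸ e) ℕ.+ (e″ ℕ.∸ e′))
      ≈⟨ *-cong (trans (*-congʳ (sym (*-identityʳ _))) (*-congʳ (*-congˡ (sym (σ-sq t))))) (^-homo-* x (e′ ℕ.∸ e) (e″ ℕ.∸ e′)) ⟩
    σ s * (σ t * σ t) * σ r * (x ^ (e′ ℕ.∸ e) * x ^ (e″ ℕ.∸ e′))
      ≈⟨ solve 5 (λ s t r a b → s :* (t :* t) :* r :* (a :* b) := s :* t :* a :* (t :* r :* b)) refl _ _ _ _ _ ⟩
    σ s * σ t * x ^ (e′ ℕ.∸ e) * (σ t * σ r * x ^ (e″ ℕ.∸ e′)) ∎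
    where
    eq : (e′ ℕ.∸ e) ℕ.+ (e″ ℕ.∸ e′) ≡ e″ ℕ.∸ e
    eq = ≡.trans (ℕₚ.+-comm (e′ ℕ.∸ e) _) (≡.trans (≡.sym (ℕₚ.+-∸-assoc (e″ ℕ.∸ e′) (ℕₚ.<⇒≤ p)))
           (≡.cong (ℕ._∸ e) (ℕₚ.m∸n+n≡m (ℕₚ.<⇒≤ q))))

  y-ratio : ∀ {l m} → l ≺ m → y m ≈ ratio l m * y l
  y-ratio {s , e} {t , e′} p = begin
    σ t * x ^ e′ ≡⟨ ≡.cong (λ k → σ t * x ^ k) (≡.sym (ℕₚ.m∸n+n≡m (ℕₚ.<⇒≤ p))) ⟩
    σ t * x ^ ((e′ ℕ.∸ e) ℕ.+ e) ≈⟨ *-cong (trans (sym (*-identityˡ _)) (*-congʳ (sym (σ-sq s)))) (^-homo-* x (e′ ℕ.∸ e) e) ⟩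
    σ s * σ s * σ t * (x ^ (e′ ℕ.∸ e) * x ^ e)
      ≈⟨ solve 4 (λ s t a b → s :* s :* t :* (a :* b) := s :* t :* a :* (s :* b)) refl _ _ _ _ ⟩
    σ s * σ t * x ^ (e′ ℕ.∸ e) * (σ s * x ^ e) ∎

  -- For forms L, the difference of L n / y n and L m / y m does not contain τ. Comparing its values
  -- at the zeros of L m and of L l gives the relation.
  u-relation : ∀ {l m n} → l ≺ m → m ≺ n → u l n ≈ ratio m n * u l m + u m n
  u-relation {l} {m} {n} p q = begin
    (1# - ratio l n) * (1# - y l * y n)
      ≈⟨ *-cong (+-congˡ (-‿cong (ratio-* {l} {m} {n} p q))) (+-congˡ (-‿cong (*-congˡ yn))) ⟩
    (1# - a * b) * (1# - v * (b * (a * v)))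
      ≈⟨ solve 3 (λ a b v → (:1 :- a :* b) :* (:1 :- v :* (b :* (a :* v)))
           := b :* ((:1 :- a) :* (:1 :- v :* (a :* v))) :+ (:1 :- b) :* (:1 :- a :* v :* (b :* (a :* v)))) refl a b v ⟩
    b * ((1# - a) * (1# - v * (a * v))) + (1# - b) * (1# - a * v * (b * (a * v)))
      ≈⟨ sym (+-cong (*-congˡ (*-congˡ (+-congˡ (-‿cong (*-congˡ ym))))) (*-congˡ (+-congˡ (-‿cong (*-cong ym yn))))) ⟩
    b * ((1# - a) * (1# - v * y m)) + (1# - b) * (1# - y m * y n) ∎
    where
    a = ratio l m
    b = ratio m n
    v = y l
    ym : y m ≈ a * v
    ym = y-ratio {l} {m} p
    yn : y n ≈ b * (a * v)
    yn = trans (y-ratio {m} {n} q) (*-congˡ ym)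

  U-relation : ∀ {l m n} → l ≺ m → m ≺ n → U l m * U m n ≈ U l m * U l n + ratio m n * (U m n * U l n)
  U-relation {l} {m} {n} p q = begin
    U l m * U m n ≈⟨ sym (*-identityʳ _) ⟩
    U l m * U m n * 1# ≈⟨ *-congˡ (sym (u*U {l} {n} (ℕₚ.<-trans p q))) ⟩
    U l m * U m n * (u l n * U l n) ≈⟨ *-congˡ (*-congʳ (u-relation {l} {m} {n} p q)) ⟩
    U l m * U m n * ((ratio m n * u l m + u m n) * U l n)
      ≈⟨ solve 6 (λ A B C a b r → A :* B :* ((r :* a :+ b) :* C) := A :* C :* (b :* B) :+ r :* (B :* C) :* (a :* A))
           refl (U l m) (U m n) (U l n) (u l m) (u m n) (ratio m n) ⟩
    U l m * U l n * (u m n * U m n) + ratio m n * (U m n * U l n) * (u l m * U l m)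
      ≈⟨ +-cong (trans (*-congˡ (u*U {m} {n} q)) (*-identityʳ _)) (trans (*-congˡ (u*U {l} {m} p)) (*-identityʳ _)) ⟩
    U l m * U l n + ratio m n * (U m n * U l n) ∎

  -- The degrees must differ, not just the monomials: for equal degrees and opposite signs
  -- `1# - ratio l l′` is 2, which need not be a unit.
  Distinct : Label → Label → Set
  Distinct l l′ = proj₂ l ≢ proj₂ l′

  private
    Ordering : Label → Label → Set
    Ordering l l′ = Tri (l ≺ l′) (proj₂ l ≡ proj₂ l′) (l′ ≺ l)

    Split : Label → Label → Label → Set
    Split v i j = d v i * d v j ≈ d i j * d v i + d j i * d v j

    swap : ∀ {v i j} → Split v i j → Split v j i
    swap e = trans (*-comm _ _) (trans e (+-comm _ _))

    least : ∀ {l m n} → l ≺ m → m ≺ n → Split l m n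
    least {l} {m} {n} p q = begin
      d l m * d l n ≈⟨ *-cong (d-< {l} {m} p) (d-< {l} {n} pq) ⟩
      U l m * U l n ≈⟨ solve 4 (λ A B C r → A :* C := (A :* C :+ r :* (B :* C)) :- r :* (B :* C)) refl (U l m) (U m n) (U l n) (ratio m n) ⟩
      (U l m * U l n + ratio m n * (U m n * U l n)) - ratio m n * (U m n * U l n) ≈⟨ +-congʳ (sym (U-relation {l} {m} {n} p q)) ⟩
      U l m * U m n - ratio m n * (U m n * U l n)
        ≈⟨ solve 4 (λ A B C r → A :* B :- r :* (B :* C) := B :* A :+ (:- r) :* B :* C) refl (U l m) (U m n) (U l n) (ratio m n) ⟩
      U m n * U l m + - ratio m n * U m n * U l n
        ≈⟨ sym (+-cong (*-cong (d-< {m} {n} q) (d-< {l} {m} p)) (*-cong (d-> {m} {n} q) (d-< {l} {n} pq))) ⟩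
      d m n * d l m + d n m * d l n ∎
      where
      pq : l ≺ n
      pq = ℕₚ.<-trans p q

    middle : ∀ {l m n} → l ≺ m → m ≺ n → Split m l n
    middle {l} {m} {n} p q = begin
      d m l * d m n ≈⟨ *-cong (d-> {l} {m} p) (d-< {m} {n} q) ⟩
      - ratio l m * U l m * U m n ≈⟨ *-assoc _ _ _ ⟩
      - ratio l m * (U l m * U m n) ≈⟨ *-congˡ (U-relation {l} {m} {n} p q) ⟩
      - ratio l m * (U l m * U l n + ratio m n * (U m n * U l n))
        ≈⟨ solve 5 (λ A B C r s → (:- s) :* (A :* C :+ r :* (B :* C)) := C :* ((:- s) :* A) :+ (:- (s :* r)) :* C :* B)
             refl (U l m) (U m n) (U l n) (ratio m n) (ratio l m) ⟩
      U l n * (- ratio l m * U l m) + - (ratio l m * ratio m n) * U l n * U m n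
        ≈⟨ sym (+-cong (*-cong (d-< {l} {n} pq) (d-> {l} {m} p))
             (*-cong (trans (d-> {l} {n} pq) (*-congʳ (-‿cong (ratio-* {l} {m} {n} p q)))) (d-< {m} {n} q))) ⟩
      d l n * d m l + d n l * d m n ∎
      where
      pq : l ≺ n
      pq = ℕₚ.<-trans p q

    greatest : ∀ {l m n} → l ≺ m → m ≺ n → Split n l m
    greatest {l} {m} {n} p q = begin
      d n l * d n m ≈⟨ *-cong (trans (d-> {l} {n} pq) (*-congʳ (-‿cong (ratio-* {l} {m} {n} p q)))) (d-> {m} {n} q) ⟩
      - (ratio l m * ratio m n) * U l n * (- ratio m n * U m n)
        ≈⟨ solve 5 (λ A B C r s → (:- (s :* r)) :* C :* ((:- r) :* B)
               := (s :* r) :* ((A :* C :+ r :* (B :* C)) :- A :* C)) refl (U l m) (U m n) (U l n) (ratio m n) (ratio l m) ⟩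
      ratio l m * ratio m n * ((U l m * U l n + ratio m n * (U m n * U l n)) - U l m * U l n)
        ≈⟨ *-congˡ (+-congʳ (sym (U-relation {l} {m} {n} p q))) ⟩
      ratio l m * ratio m n * (U l m * U m n - U l m * U l n)
        ≈⟨ solve 5 (λ A B C r s → s :* r :* (A :* B :- A :* C)
               := A :* ((:- (s :* r)) :* C) :+ (:- s) :* A :* ((:- r) :* B)) refl (U l m) (U m n) (U l n) (ratio m n) (ratio l m) ⟩
      U l m * (- (ratio l m * ratio m n) * U l n) + - ratio l m * U l m * (- ratio m n * U m n)
        ≈⟨ sym (+-cong (*-cong (d-< {l} {m} p) (trans (d-> {l} {n} pq) (*-congʳ (-‿cong (ratio-* {l} {m} {n} p q)))))
             (*-cong (d-> {l} {m} p) (d-> {m} {n} q))) ⟩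
      d l m * d n l + d m l * d n m ∎
      where
      pq : l ≺ n
      pq = ℕₚ.<-trans p q

  -- Exchanging `i` and `j` reduces the six orders of the degrees to three positions of `v`. Each of
  -- these is `U-relation` rearranged, with the signs and ratios that `d->` brings in.
  d-split : ∀ v i j → Distinct v i → Distinct v j → Distinct i j → Split v i j
  d-split v i j vi vj ij
    = go (ℕₚ.<-cmp (proj₂ v) (proj₂ i)) (ℕₚ.<-cmp (proj₂ v) (proj₂ j)) (ℕₚ.<-cmp (proj₂ i) (proj₂ j))
    where
    go : Ordering v i → Ordering v j → Ordering i j → Split v i j
    go (tri≈ _ e _) _ _ = ⊥-elim (vi e)
    go (tri< _ _ _) (tri≈ _ e _) _ = ⊥-elim (vj e)
    go (tri> _ _ _) (tri≈ _ e _) _ = ⊥-elim (vj e)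
    go (tri< _ _ _) (tri< _ _ _) (tri≈ _ e _) = ⊥-elim (ij e)
    go (tri> _ _ _) (tri> _ _ _) (tri≈ _ e _) = ⊥-elim (ij e)
    go (tri> _ _ _) (tri< _ _ _) (tri≈ _ e _) = ⊥-elim (ij e)
    go (tri< _ _ _) (tri> _ _ _) (tri≈ _ e _) = ⊥-elim (ij e)
    go (tri< a _ _) (tri< _ _ _) (tri< b _ _) = least {v} {i} {j} a b
    go (tri< _ _ _) (tri< a _ _) (tri> _ _ b) = swap {v} {j} {i} (least {v} {j} {i} a b)
    go (tri> _ _ a) (tri< b _ _) (tri< _ _ _) = middle {i} {v} {j} a b
    go (tri> _ _ a) (tri< b _ _) (tri> _ _ c) = middle {i} {v} {j} a b
    go (tri< a _ _) (tri> _ _ b) (tri< _ _ _) = swap {v} {j} {i} (middle {j} {v} {i} b a)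
    go (tri< a _ _) (tri> _ _ b) (tri> _ _ _) = swap {v} {j} {i} (middle {j} {v} {i} b a)
    go (tri> _ _ _) (tri> _ _ a) (tri< b _ _) = greatest {i} {j} {v} b a
    go (tri> _ _ a) (tri> _ _ _) (tri> _ _ b) = swap {v} {j} {i} (greatest {j} {i} {v} b a)

  open Residues d Distinct d-refl d-split public

-- Pochhammer symbols, the Durfee rectangle, residues within one family.

tri : ℕ → ℕ
tri zero    = 0
tri (suc n) = tri n ℕ.+ suc n

n≤n*[n+m] : ∀ n m → n ℕ.≤ n ℕ.* (n ℕ.+ m)
n≤n*[n+m] zero    m = z≤n
n≤n*[n+m] (suc n) m = ℕₚ.m≤m*n (suc n) (suc n ℕ.+ m)

T-exponent : ∀ k m j → suc k ℕ.* (suc k ℕ.+ m) ℕ.+ j ≡ m ℕ.+ suc (j ℕ.+ k) ℕ.+ k ℕ.* (k ℕ.+ suc m)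
T-exponent = solve 3 (λ k m j → (con 1 :+ k) :* (con 1 :+ k :+ m) :+ j := m :+ (con 1 :+ (j :+ k)) :+ k :* (k :+ (con 1 :+ m))) ≡.refl
  where open +-*-Solver

self-exponent : ∀ j l h → suc (j ℕ.+ j ℕ.+ h ℕ.+ l) ≡ j ℕ.+ suc l ℕ.+ j ℕ.+ h
self-exponent = solve 3 (λ j l h → con 1 :+ (j :+ j :+ h :+ l) := j :+ (con 1 :+ l) :+ j :+ h) ≡.refl
  where open +-*-Solver

shift-exponent : ∀ n j h → n ℕ.+ j ℕ.+ h ≡ n ℕ.+ h ℕ.+ j
shift-exponent = solve 3 (λ n j h → n :+ j :+ h := n :+ h :+ j) ≡.refl
  where open +-*-Solver

module Pochhammer (R : CommutativeRing 0ℓ 0ℓ) (M : ℕ) (x : CommutativeRing.Carrier R) (x^M≈0 : Vanishes R M x) where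
  open CommutativeRing R
  open IntegerSolver R
  open FiniteSums R
  open Nilpotent R M x x^M≈0
  open import Algebra.Properties.Semiring.Exp semiring
  open import Relation.Binary.Reasoning.Setoid setoid

  g : ℕ → Carrier
  g k = geo (x ^ k)

  g-inverse : ∀ k → (1# - x ^ suc k) * g (suc k) ≈ 1#
  g-inverse k = geo-inverse (trans (^-congˡ M (sym (*-identityˡ _))) (c*x^-nil 1# {suc k} (s≤s z≤n)))

  g-large : ∀ {k} → M ℕ.≤ k → 1 ℕ.≤ k → g k ≈ 1#
  g-large {suc k} M≤k _ = inverse-unique {1# - x ^ suc k} (g-inverse k)
    (trans (*-identityʳ _) (trans (+-congˡ (-‿cong (x^≥M M≤k))) (solve 0 (:1 :- :0 := :1) refl)))

  -- (x;x)_n and its inverse. All factors of index at least M are 1, so `P M` is (x;x)_∞.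
  P P⁻¹ : ℕ → Carrier
  P   n = ∏ n (λ j → 1# - x ^ suc j)
  P⁻¹ n = ∏ n (λ j → g (suc j))

  P-inverse : ∀ n → P n * P⁻¹ n ≈ 1#
  P-inverse n = ∏-inverse n (λ i _ → g-inverse i)

  P-stable : ∀ {n} → M ℕ.≤ n → P n ≈ P M
  P-stable M≤n = ∏-truncate M≤n λ i M≤i →
    trans (+-congˡ (-‿cong (x^≥M (ℕₚ.m≤n⇒m≤1+n M≤i)))) (solve 0 (:1 :- :0 := :1) refl)

  P⁻¹-stable : ∀ {n} → M ℕ.≤ n → P⁻¹ n ≈ P⁻¹ M
  P⁻¹-stable M≤n = ∏-truncate M≤n λ i M≤i → g-large (ℕₚ.m≤n⇒m≤1+n M≤i) (s≤s z≤n)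

  P⁻¹-suc : ∀ n → (1# - x ^ suc n) * P⁻¹ (suc n) ≈ P⁻¹ n
  P⁻¹-suc n = begin
    (1# - x ^ suc n) * (P⁻¹ n * g (suc n)) ≈⟨ solve 3 (λ a b c → a :* (b :* c) := b :* (a :* c)) refl _ _ _ ⟩
    P⁻¹ n * ((1# - x ^ suc n) * g (suc n)) ≈⟨ *-congˡ (g-inverse n) ⟩
    P⁻¹ n * 1# ≈⟨ *-identityʳ _ ⟩
    P⁻¹ n ∎

  private
    T : ℕ → ℕ → ℕ → Carrier
    T K m k = x ^ (k ℕ.* (k ℕ.+ m)) * (P⁻¹ k * P⁻¹ (k ℕ.+ m)) * P⁻¹ (K ℕ.∸ k)

    -- 1 − x^(K+1) = (1 − x^(K+1−k)) + x^(K+1−k) (1 − x^k)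
    T-recurrence : ∀ K m →
      (1# - x ^ suc K) * ∑ (suc (suc K)) (T (suc K) m)
        ≈ ∑ (suc K) (T K m) + x ^ (m ℕ.+ suc K) * ∑ (suc K) (T K (suc m))
    T-recurrence K m = begin
      (1# - x ^ suc K) * ∑ (suc (suc K)) (T (suc K) m)
        ≈⟨ *-∑ (suc (suc K)) _ ⟩
      ∑ (suc (suc K)) (λ k → (1# - x ^ suc K) * T (suc K) m k)
        ≈⟨ ∑-cong (suc (suc K)) (λ k k<2+K → splitting k (ℕₚ.≤-pred k<2+K)) ⟩
      ∑ (suc (suc K)) (λ k → α k + β k)
        ≈⟨ ∑-+ (suc (suc K)) ⟩
      ∑ (suc K) α + α (suc K) + ∑ (suc (suc K)) β
        ≈⟨ +-cong (+-cong (∑-cong (suc K) λ k k<1+K → α-low k (ℕₚ.≤-pred k<1+K)) α-top) (∑-head (suc K)) ⟩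
      ∑ (suc K) (T K m) + 0# + (β 0 + ∑ (suc K) (λ k → β (suc k)))
        ≈⟨ +-cong (+-identityʳ _) (+-cong β-zero (∑-cong (suc K) λ k k<1+K → β-suc k (ℕₚ.≤-pred k<1+K))) ⟩
      ∑ (suc K) (T K m) + (0# + ∑ (suc K) (λ k → x ^ (m ℕ.+ suc K) * T K (suc m) k))
        ≈⟨ +-congˡ (trans (+-identityˡ _) (sym (*-∑ (suc K) _))) ⟩
      ∑ (suc K) (T K m) + x ^ (m ℕ.+ suc K) * ∑ (suc K) (T K (suc m)) ∎
      where
      α β : ℕ → Carrier
      α k = x ^ (k ℕ.* (k ℕ.+ m)) * (P⁻¹ k * P⁻¹ (k ℕ.+ m)) * ((1# - x ^ (suc K ℕ.∸ k)) * P⁻¹ (suc K ℕ.∸ k))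
      β k = x ^ (k ℕ.* (k ℕ.+ m)) * x ^ (suc K ℕ.∸ k) * ((1# - x ^ k) * P⁻¹ k * P⁻¹ (k ℕ.+ m)) * P⁻¹ (suc K ℕ.∸ k)
      splitting : ∀ k → k ℕ.≤ suc K → (1# - x ^ suc K) * T (suc K) m k ≈ α k + β k
      splitting k k≤1+K = begin
        (1# - x ^ suc K) * T (suc K) m k
          ≈⟨ *-congʳ (+-congˡ (-‿cong (trans (^-congʳ x (≡.sym (ℕₚ.m∸n+n≡m k≤1+K))) (^-homo-* x (suc K ℕ.∸ k) k)))) ⟩
        (1# - x ^ (suc K ℕ.∸ k) * x ^ k) * T (suc K) m k
          ≈⟨ solve 6 (λ a b c p q r → (:1 :- a :* b) :* (c :* (p :* q) :* r)
               := c :* (p :* q) :* ((:1 :- a) :* r) :+ c :* a :* ((:1 :- b) :* p :* q) :* r) refl _ _ _ _ _ _ ⟩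
        α k + β k ∎
      α-low : ∀ k → k ℕ.≤ K → α k ≈ T K m k
      α-low k k≤K rewrite ℕₚ.+-∸-assoc 1 k≤K = *-congˡ (P⁻¹-suc (K ℕ.∸ k))
      α-top : α (suc K) ≈ 0#
      α-top rewrite ℕₚ.n∸n≡0 K = solve 2 (λ a b → a :* ((:1 :- :1) :* b) := :0) refl _ _
      β-zero : β 0 ≈ 0#
      β-zero = solve 5 (λ a b p q r → a :* b :* ((:1 :- :1) :* p :* q) :* r := :0) refl _ _ _ _ _
      β-suc : ∀ k → k ℕ.≤ K → β (suc k) ≈ x ^ (m ℕ.+ suc K) * T K (suc m) k
      β-suc k k≤K = begin
        x ^ (suc k ℕ.* (suc k ℕ.+ m)) * x ^ (K ℕ.∸ k) * ((1# - x ^ suc k) * P⁻¹ (suc k) * P⁻¹ (suc k ℕ.+ m)) * P⁻¹ (K ℕ.∸ k)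
          ≈⟨ *-congʳ (*-cong (trans (sym (^-homo-* x (suc k ℕ.* (suc k ℕ.+ m)) (K ℕ.∸ k))) (trans (^-congʳ x eq) (^-homo-* x (m ℕ.+ suc K) _)))
               (*-cong (P⁻¹-suc k) (reflexive (≡.cong P⁻¹ (≡.sym (ℕₚ.+-suc k m)))))) ⟩
        x ^ (m ℕ.+ suc K) * x ^ (k ℕ.* (k ℕ.+ suc m)) * (P⁻¹ k * P⁻¹ (k ℕ.+ suc m)) * P⁻¹ (K ℕ.∸ k)
          ≈⟨ solve 4 (λ a b c d → a :* b :* c :* d := a :* (b :* c :* d)) refl _ _ _ _ ⟩
        x ^ (m ℕ.+ suc K) * T K (suc m) k ∎
        where
        eq : suc k ℕ.* (suc k ℕ.+ m) ℕ.+ (K ℕ.∸ k) ≡ m ℕ.+ suc K ℕ.+ k ℕ.* (k ℕ.+ suc m)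
        eq = ≡.trans (T-exponent k m (K ℕ.∸ k)) (≡.cong (λ z → m ℕ.+ suc z ℕ.+ k ℕ.* (k ℕ.+ suc m)) (ℕₚ.m∸n+n≡m k≤K))

  -- A finite form of the Durfee rectangle identity. `T-recurrence` lowers K at the price of raising
  -- m, so the induction on K treats all m at once.
  q-Vandermonde : ∀ K m → ∑ (suc K) (T K m) ≈ P⁻¹ K * P⁻¹ (K ℕ.+ m)
  q-Vandermonde zero    m = solve 1 (λ a → :0 :+ :1 :* (:1 :* a) :* :1 := :1 :* a) refl _
  q-Vandermonde (suc K) m = *-cancel (g-inverse K) (begin
    (1# - x ^ suc K) * ∑ (suc (suc K)) (T (suc K) m)
      ≈⟨ T-recurrence K m ⟩
    ∑ (suc K) (T K m) + x ^ (m ℕ.+ suc K) * ∑ (suc K) (T K (suc m))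
      ≈⟨ +-cong (q-Vandermonde K m) (*-cong (^-congʳ x (ℕₚ.+-comm m (suc K)))
           (trans (q-Vandermonde K (suc m)) (*-congˡ (reflexive (≡.cong P⁻¹ (ℕₚ.+-suc K m)))))) ⟩
    P⁻¹ K * P⁻¹ (K ℕ.+ m) + X * (P⁻¹ K * P⁻¹ (suc K ℕ.+ m))
      ≈⟨ +-congʳ (*-congˡ (sym (P⁻¹-suc (K ℕ.+ m)))) ⟩
    P⁻¹ K * ((1# - X) * P⁻¹ (suc K ℕ.+ m)) + X * (P⁻¹ K * P⁻¹ (suc K ℕ.+ m))
      ≈⟨ solve 3 (λ a b X → a :* ((:1 :- X) :* b) :+ X :* (a :* b) := a :* b) refl _ _ X ⟩
    P⁻¹ K * P⁻¹ (suc K ℕ.+ m)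
      ≈⟨ *-congʳ (sym (P⁻¹-suc K)) ⟩
    (1# - x ^ suc K) * P⁻¹ (suc K) * P⁻¹ (suc K ℕ.+ m)
      ≈⟨ *-assoc _ _ _ ⟩
    (1# - x ^ suc K) * (P⁻¹ (suc K) * P⁻¹ (suc K ℕ.+ m)) ∎)
    where
    X = x ^ (suc K ℕ.+ m)

  durfee-rectangle : ∀ N m → M ℕ.≤ N →
    ∑ N (λ k → x ^ (k ℕ.* (k ℕ.+ m)) * (P⁻¹ k * P⁻¹ (k ℕ.+ m))) ≈ P⁻¹ M
  durfee-rectangle N m M≤N = *-cancel (trans (*-comm _ _) (P-inverse M)) (begin
    P⁻¹ M * ∑ N F
      ≈⟨ *-congˡ (∑-truncate M≤N λ i M≤i → trans (*-congʳ (vanish i M≤i)) (zeroˡ _)) ⟩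
    P⁻¹ M * ∑ M F
      ≈⟨ trans (*-comm _ _) (∑-* M _) ⟩
    ∑ M (λ k → F k * P⁻¹ M)
      -- The choice K = M + M keeps K - k at least M for every k < M, so the third factor of each
      -- `T` has reached its limit.
      ≈⟨ ∑-cong M (λ k k<M → *-congˡ (sym (P⁻¹-stable (ℕₚ.≤-trans (ℕₚ.≤-reflexive (≡.sym (ℕₚ.m+n∸n≡m M M))) (ℕₚ.∸-monoʳ-≤ (M ℕ.+ M) (ℕₚ.<⇒≤ k<M)))))) ⟩
    ∑ M (T (M ℕ.+ M) m)
      ≈⟨ sym (∑-truncate (ℕₚ.m≤n⇒m≤1+n (ℕₚ.m≤m+n M M)) λ i M≤i → trans (*-congʳ (trans (*-congʳ (vanish i M≤i)) (zeroˡ _))) (zeroˡ _)) ⟩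
    ∑ (suc (M ℕ.+ M)) (T (M ℕ.+ M) m)
      ≈⟨ q-Vandermonde (M ℕ.+ M) m ⟩
    P⁻¹ (M ℕ.+ M) * P⁻¹ (M ℕ.+ M ℕ.+ m)
      ≈⟨ *-cong (P⁻¹-stable (ℕₚ.m≤m+n M M)) (P⁻¹-stable (ℕₚ.≤-trans (ℕₚ.m≤m+n M M) (ℕₚ.m≤m+n (M ℕ.+ M) m))) ⟩
    P⁻¹ M * P⁻¹ M ∎)
    where
    F : ℕ → Carrier
    F k = x ^ (k ℕ.* (k ℕ.+ m)) * (P⁻¹ k * P⁻¹ (k ℕ.+ m))
    vanish : ∀ i → M ℕ.≤ i → x ^ (i ℕ.* (i ℕ.+ m)) ≈ 0#
    vanish i M≤i = x^≥M (ℕₚ.≤-trans M≤i (n≤n*[n+m] i m))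

  ∏-reverse : ∀ n (F : ℕ → Carrier) → ∏ n F ≈ ∏ n (λ i → F (n ℕ.∸ suc i))
  ∏-reverse zero    F = refl
  ∏-reverse (suc n) F = begin
    ∏ n F * F n ≈⟨ *-comm _ _ ⟩
    F n * ∏ n F ≈⟨ *-congˡ (∏-reverse n F) ⟩
    F n * ∏ n (λ i → F (n ℕ.∸ suc i)) ≈⟨ sym (∏-head n) ⟩
    ∏ (suc n) (λ i → F (suc n ℕ.∸ suc i)) ∎

  private
    ∏-signed-powers : ∀ n → ∏ n (λ i → - x ^ suc i * g (suc i)) ≈ sg n * x ^ tri n * P⁻¹ n
    ∏-signed-powers zero    = solve 0 (:1 := :1 :* :1 :* :1) refl
    ∏-signed-powers (suc n) = begin
      ∏ n (λ i → - x ^ suc i * g (suc i)) * (- x ^ suc n * g (suc n))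
        ≈⟨ *-congʳ (∏-signed-powers n) ⟩
      sg n * x ^ tri n * P⁻¹ n * (- x ^ suc n * g (suc n))
        ≈⟨ solve 5 (λ s a p b c → s :* a :* p :* (:- b :* c) := :- s :* (a :* b) :* (p :* c)) refl (sg n) (x ^ tri n) _ (x ^ suc n) _ ⟩
      - sg n * (x ^ tri n * x ^ suc n) * (P⁻¹ n * g (suc n))
        ≈⟨ *-congʳ (*-congˡ (sym (^-homo-* x (tri n) (suc n)))) ⟩
      - sg n * x ^ tri (suc n) * P⁻¹ (suc n) ∎

  -- D n j stands for 1 / ((1 − x^(n+j+h)) (1 − x^(j−n))), with the factor j = n omitted.
  module SelfResidue (h : ℕ) (D : ℕ → ℕ → Carrier)
    (D-≡ : ∀ n → D n n ≈ 1#)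
    (D-< : ∀ n l → D n (n ℕ.+ suc l) ≈ g (suc l) * g (suc (n ℕ.+ n ℕ.+ h ℕ.+ l)))
    (D-> : ∀ j l → D (j ℕ.+ suc l) j ≈ - x ^ suc l * (g (suc l) * g (suc (j ℕ.+ j ℕ.+ h ℕ.+ l)))) where

    right : ∀ n k → ∏ k (λ l → D n (n ℕ.+ suc l)) ≈ P⁻¹ k * (P (n ℕ.+ n ℕ.+ h) * P⁻¹ (n ℕ.+ n ℕ.+ h ℕ.+ k))
    right n k = begin
      ∏ k (λ l → D n (n ℕ.+ suc l)) ≈⟨ trans (∏-cong k (λ l _ → D-< n l)) (∏-* k) ⟩
      P⁻¹ k * ∏ k (λ l → g (suc (e ℕ.+ l))) ≈⟨ *-congˡ (sym (*-identityˡ _)) ⟩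
      P⁻¹ k * (1# * ∏ k (λ l → g (suc (e ℕ.+ l)))) ≈⟨ *-congˡ (*-congʳ (sym (P-inverse e))) ⟩
      P⁻¹ k * (P e * P⁻¹ e * ∏ k (λ l → g (suc (e ℕ.+ l)))) ≈⟨ *-congˡ (*-assoc _ _ _) ⟩
      P⁻¹ k * (P e * (P⁻¹ e * ∏ k (λ l → g (suc (e ℕ.+ l))))) ≈⟨ *-congˡ (*-congˡ (sym (∏-split e k))) ⟩
      P⁻¹ k * (P e * P⁻¹ (e ℕ.+ k)) ∎
      where
      e = n ℕ.+ n ℕ.+ h

    -- Each j < n contributes a factor 1 - x^(j-n) of negative degree. Making these degrees positive
    -- produces the sign (-1)^n and the triangular exponent.
    left : ∀ n → ∏ n (D n) ≈ sg n * x ^ tri n * P⁻¹ n * ∏ n (λ j → g (n ℕ.+ j ℕ.+ h))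
    left n = begin
      ∏ n (D n) ≈⟨ trans (∏-cong n step) (∏-* n) ⟩
      ∏ n (λ j → - x ^ (n ℕ.∸ j) * g (n ℕ.∸ j)) * ∏ n (λ j → g (n ℕ.+ j ℕ.+ h))
        ≈⟨ *-congʳ (trans (∏-reverse n _) (∏-cong n λ i i<n → reflexive (≡.cong (λ k → - x ^ k * g k) (ℕₚ.m∸[m∸n]≡n i<n)))) ⟩
      ∏ n (λ i → - x ^ suc i * g (suc i)) * ∏ n (λ j → g (n ℕ.+ j ℕ.+ h))
        ≈⟨ *-congʳ (∏-signed-powers n) ⟩
      sg n * x ^ tri n * P⁻¹ n * ∏ n (λ j → g (n ℕ.+ j ℕ.+ h)) ∎
      where
      step : ∀ j → j ℕ.< n → D n j ≈ - x ^ (n ℕ.∸ j) * g (n ℕ.∸ j) * g (n ℕ.+ j ℕ.+ h)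
      step j j<n = begin
        D n j ≡⟨ ≡.cong (λ k → D k j) (≡.sym eq) ⟩
        D (j ℕ.+ suc l) j ≈⟨ D-> j l ⟩
        - x ^ suc l * (g (suc l) * g (suc (j ℕ.+ j ℕ.+ h ℕ.+ l))) ≈⟨ sym (*-assoc _ _ _) ⟩
        - x ^ suc l * g (suc l) * g (suc (j ℕ.+ j ℕ.+ h ℕ.+ l))
          ≡⟨ ≡.cong₂ (λ k k′ → - x ^ k * g k * g k′) eq′ (≡.trans (self-exponent j l h) (≡.cong (λ z → z ℕ.+ j ℕ.+ h) eq)) ⟩
        - x ^ (n ℕ.∸ j) * g (n ℕ.∸ j) * g (n ℕ.+ j ℕ.+ h) ∎
        where
        l = n ℕ.∸ suc j
        eq : j ℕ.+ suc l ≡ n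
        eq = ≡.trans (ℕₚ.+-suc j l) (ℕₚ.m+[n∸m]≡n j<n)
        eq′ : suc l ≡ n ℕ.∸ j
        eq′ = ≡.trans (≡.sym (ℕₚ.m+n∸m≡n j (suc l))) (≡.cong (ℕ._∸ j) eq)

    both : ∀ n k → ∏ (n ℕ.+ suc k) (D n) ≈ ∏ n (D n) * ∏ k (λ l → D n (n ℕ.+ suc l))
    both n k = begin
      ∏ (n ℕ.+ suc k) (D n) ≈⟨ ∏-split n (suc k) ⟩
      ∏ n (D n) * ∏ (suc k) (λ i → D n (n ℕ.+ i)) ≈⟨ *-congˡ (∏-head k) ⟩
      ∏ n (D n) * (D n (n ℕ.+ 0) * ∏ k (λ l → D n (n ℕ.+ suc l)))
        ≈⟨ *-congˡ (trans (*-congʳ (trans (reflexive (≡.cong (D n) (ℕₚ.+-identityʳ n))) (D-≡ n))) (*-identityˡ _)) ⟩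
      ∏ n (D n) * ∏ k (λ l → D n (n ℕ.+ suc l)) ∎

    -- The factors of exponents n + h, ..., 2n + h - 1 cancel, which leaves an initial piece and the
    -- top factor. The hypothesis excludes n = h = 0, where the top factor 1 - x⁰ would vanish.
    P-top : ∀ n e → n ℕ.+ h ≡ suc e →
      P (n ℕ.+ n ℕ.+ h) * ∏ n (λ j → g (n ℕ.+ j ℕ.+ h)) ≈ P e * (1# - x ^ (n ℕ.+ n ℕ.+ h))
    P-top n e eq = begin
      P (n ℕ.+ n ℕ.+ h) * ∏ n (λ j → g (n ℕ.+ j ℕ.+ h))
        ≡⟨ ≡.cong₂ (λ k k′ → P k * k′) top ≡.refl ⟩
      P (e ℕ.+ n) * (1# - x ^ suc (e ℕ.+ n)) * ∏ n (λ j → g (n ℕ.+ j ℕ.+ h))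
        ≈⟨ *-cong (*-congʳ (∏-split e n)) (∏-cong n λ j _ → reflexive (≡.cong g (shift j))) ⟩
      P e * ∏ n (λ j → 1# - x ^ suc (e ℕ.+ j)) * (1# - x ^ suc (e ℕ.+ n)) * ∏ n (λ j → g (suc (e ℕ.+ j)))
        ≈⟨ solve 4 (λ a b c d → a :* b :* c :* d := a :* c :* (b :* d)) refl _ _ _ _ ⟩
      P e * (1# - x ^ suc (e ℕ.+ n)) * (∏ n (λ j → 1# - x ^ suc (e ℕ.+ j)) * ∏ n (λ j → g (suc (e ℕ.+ j))))
        ≈⟨ trans (*-congˡ (∏-inverse n λ j _ → g-inverse (e ℕ.+ j))) (*-identityʳ _) ⟩
      P e * (1# - x ^ suc (e ℕ.+ n))
        ≡⟨ ≡.cong (λ k → P e * (1# - x ^ k)) (≡.sym top) ⟩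
      P e * (1# - x ^ (n ℕ.+ n ℕ.+ h)) ∎
      where
      shift : ∀ j → n ℕ.+ j ℕ.+ h ≡ suc (e ℕ.+ j)
      shift j = ≡.trans (shift-exponent n j h) (≡.cong (ℕ._+ j) eq)
      top : n ℕ.+ n ℕ.+ h ≡ suc (e ℕ.+ n)
      top = shift n

    product : ∀ n k e → n ℕ.+ h ≡ suc e →
      ∏ (n ℕ.+ suc k) (D n) ≈ sg n * x ^ tri n * (P⁻¹ n * P e * (1# - x ^ (n ℕ.+ n ℕ.+ h))) * (P⁻¹ k * P⁻¹ (n ℕ.+ n ℕ.+ h ℕ.+ k))
    product n k e eq = begin
      ∏ (n ℕ.+ suc k) (D n) ≈⟨ trans (both n k) (*-cong (left n) (right n k)) ⟩
      S * P⁻¹ n * Gn * (P⁻¹ k * (P (n ℕ.+ n ℕ.+ h) * Pk))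
        ≈⟨ solve 6 (λ s a b c d e → s :* a :* b :* (c :* (d :* e)) := s :* a :* (d :* b) :* (c :* e)) refl S (P⁻¹ n) Gn (P⁻¹ k) (P (n ℕ.+ n ℕ.+ h)) Pk ⟩
      S * P⁻¹ n * (P (n ℕ.+ n ℕ.+ h) * Gn) * (P⁻¹ k * Pk)
        ≈⟨ *-congʳ (*-congˡ (P-top n e eq)) ⟩
      S * P⁻¹ n * (P e * (1# - x ^ (n ℕ.+ n ℕ.+ h))) * (P⁻¹ k * Pk)
        ≈⟨ *-congʳ (solve 4 (λ s a b c → s :* a :* (b :* c) := s :* (a :* b :* c)) refl S _ _ _) ⟩
      S * (P⁻¹ n * P e * (1# - x ^ (n ℕ.+ n ℕ.+ h))) * (P⁻¹ k * Pk) ∎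
      where
      S  = sg n * x ^ tri n
      Gn = ∏ n (λ j → g (n ℕ.+ j ℕ.+ h))
      Pk = P⁻¹ (n ℕ.+ n ℕ.+ h ℕ.+ k)

-- Families of monomials in arithmetic progression; Durfee-type sums over one family.

tri-double : ∀ n → tri n ℕ.+ tri n ≡ n ℕ.* suc n
tri-double zero    = ≡.refl
tri-double (suc n) = ≡.trans (lemma (tri n) n) (≡.trans (≡.cong (ℕ._+ (suc n ℕ.+ suc n)) (tri-double n)) (lemma′ n))
  where
  open +-*-Solver
  lemma : ∀ t n → t ℕ.+ suc n ℕ.+ (t ℕ.+ suc n) ≡ t ℕ.+ t ℕ.+ (suc n ℕ.+ suc n)
  lemma = solve 2 (λ t n → t :+ (con 1 :+ n) :+ (t :+ (con 1 :+ n)) := t :+ t :+ ((con 1 :+ n) :+ (con 1 :+ n))) ≡.refl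
  lemma′ : ∀ n → n ℕ.* suc n ℕ.+ (suc n ℕ.+ suc n) ≡ suc n ℕ.* suc (suc n)
  lemma′ = solve 1 (λ n → n :* (con 1 :+ n) :+ ((con 1 :+ n) :+ (con 1 :+ n)) := (con 1 :+ n) :* (con 2 :+ n)) ≡.refl

-- With D = i + k, splitting i (i + 1) off from D (D + 1) leaves the exponent of a Durfee rectangle
-- of excess 2i + 1.
bailey-exponent : ∀ i k → (i ℕ.+ k) ℕ.* suc (i ℕ.+ k) ≡ i ℕ.* suc i ℕ.+ k ℕ.* (k ℕ.+ (i ℕ.+ i ℕ.+ 1))
bailey-exponent = solve 2 (λ i k → (i :+ k) :* (con 1 :+ (i :+ k)) := i :* (con 1 :+ i) :+ k :* (k :+ (i :+ i :+ con 1))) ≡.refl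
  where open +-*-Solver

module Families (R : CommutativeRing 0ℓ 0ℓ) (M : ℕ) (x : CommutativeRing.Carrier R) (x^M≈0 : Vanishes R M x) where
  open CommutativeRing R
  open IntegerSolver R
  open FiniteSums R
  open PartialFractions R
  open Nilpotent R M x x^M≈0
  open import Algebra.Properties.Semiring.Exp semiring
  open import Relation.Binary.Reasoning.Setoid setoid

  vanishes-^ : ∀ c → 1 ℕ.≤ c → Vanishes R M (x ^ c)
  vanishes-^ c 1≤c = trans (^-congˡ M (sym (*-identityˡ _))) (c*x^-nil 1# 1≤c)

  fam : {I : Set} → (ℕ → I) → ℕ → List I
  fam a zero    = []
  fam a (suc n) = a n ∷ fam a n

  module _ {I : Set} where
    ∏L-fam : ∀ (F : I → Carrier) (a : ℕ → I) n is → ∏L F (fam a n ++ is) ≈ ∏ n (λ i → F (a i)) * ∏L F is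
    ∏L-fam F a zero    is = sym (*-identityˡ _)
    ∏L-fam F a (suc n) is = trans (*-congˡ (∏L-fam F a n is))
      (solve 3 (λ a b c → a :* (b :* c) := b :* a :* c) refl _ _ _)

    ∑L-fam : ∀ (F : I → Carrier) (a : ℕ → I) n is → ∑L F (fam a n ++ is) ≈ ∑ n (λ i → F (a i)) + ∑L F is
    ∑L-fam F a zero    is = sym (+-identityˡ _)
    ∑L-fam F a (suc n) is = trans (+-congˡ (∑L-fam F a n is))
      (solve 3 (λ a b c → a :+ (b :+ c) := b :+ a :+ c) refl _ _ _)

    All-fam : ∀ {P : I → Set} (a : ℕ → I) n → (∀ i → P (a i)) → All P (fam a n)
    All-fam a zero    p = []
    All-fam a (suc n) p = p n ∷ All-fam a n p

    AllPairs-fam : ∀ {_~_ : I → I → Set} (a : ℕ → I) n → (∀ i j → i ℕ.< j → a j ~ a i) → AllPairs _~_ (fam a n)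
    AllPairs-fam         a zero    p = []
    AllPairs-fam {_~_} a (suc n) p = go n ℕₚ.≤-refl ∷ AllPairs-fam a n p
      where
      go : ∀ m → m ℕ.≤ n → All (a n ~_) (fam a m)
      go zero    _   = []
      go (suc m) m<n = p m n m<n ∷ go m (ℕₚ.<⇒≤ m<n)

  -- The condition on 2o makes the products `y (lab i) * y (lab j)` powers of x^c too, with exponent
  -- i + j + h, so all residues within the family are products in base x^c. The excess h is 1 for o
  -- = c/2 and 0 for o = 0.
  module Family (s : Sign) (c o h : ℕ) (1≤c : 1 ℕ.≤ c) (2o≡ch : o ℕ.+ o ≡ c ℕ.* h) where
    lab : ℕ → Label
    lab j = s , c ℕ.* j ℕ.+ o

    module PX = Pochhammer R M (x ^ c) (vanishes-^ c 1≤c)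

    lab-mono : ∀ i j → i ℕ.< j → lab i ≺ lab j
    lab-mono i j i<j = ℕₚ.+-monoˡ-< o (ℕₚ.*-monoʳ-< c {{ℕ.>-nonZero 1≤c}} i<j)

    private
      ratio-lab : ∀ n l → ratio (lab n) (lab (n ℕ.+ suc l)) ≈ (x ^ c) ^ suc l
      ratio-lab n l = begin
        σ s * σ s * x ^ ((c ℕ.* (n ℕ.+ suc l) ℕ.+ o) ℕ.∸ (c ℕ.* n ℕ.+ o))
          ≈⟨ *-cong (σ-sq s) (^-congʳ x eq) ⟩
        1# * x ^ (c ℕ.* suc l) ≈⟨ trans (*-identityˡ _) (sym (^-assocʳ x c (suc l))) ⟩
        (x ^ c) ^ suc l ∎
        where
        eq : (c ℕ.* (n ℕ.+ suc l) ℕ.+ o) ℕ.∸ (c ℕ.* n ℕ.+ o) ≡ c ℕ.* suc l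
        eq = ≡.trans (≡.cong₂ ℕ._∸_ (ℕₚ.+-comm (c ℕ.* (n ℕ.+ suc l)) o) (ℕₚ.+-comm (c ℕ.* n) o))
               (≡.trans (ℕₚ.[m+n]∸[m+o]≡n∸o o (c ℕ.* (n ℕ.+ suc l)) (c ℕ.* n))
               (≡.trans (≡.cong (ℕ._∸ c ℕ.* n) (ℕₚ.*-distribˡ-+ c n (suc l))) (ℕₚ.m+n∸m≡n (c ℕ.* n) _)))

      y*y-lab : ∀ n l → y (lab n) * y (lab (n ℕ.+ suc l)) ≈ (x ^ c) ^ suc (n ℕ.+ n ℕ.+ h ℕ.+ l)
      y*y-lab n l = begin
        y (lab n) * y (lab (n ℕ.+ suc l)) ≈⟨ y*y (lab n) (lab (n ℕ.+ suc l)) ⟩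
        σ s * σ s * x ^ (c ℕ.* n ℕ.+ o ℕ.+ (c ℕ.* (n ℕ.+ suc l) ℕ.+ o))
          ≈⟨ *-cong (σ-sq s) (^-congʳ x (≡.trans (lemma c n l o) (≡.trans (≡.cong (ℕ._+ c ℕ.* suc (n ℕ.+ n ℕ.+ l)) 2o≡ch) (lemma′ c n l h)))) ⟩
        1# * x ^ (c ℕ.* suc (n ℕ.+ n ℕ.+ h ℕ.+ l)) ≈⟨ trans (*-identityˡ _) (sym (^-assocʳ x c _)) ⟩
        (x ^ c) ^ suc (n ℕ.+ n ℕ.+ h ℕ.+ l) ∎
        where
        lemma : ∀ c n l o → c ℕ.* n ℕ.+ o ℕ.+ (c ℕ.* (n ℕ.+ suc l) ℕ.+ o) ≡ o ℕ.+ o ℕ.+ c ℕ.* suc (n ℕ.+ n ℕ.+ l)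
        lemma = N.solve 4 (λ c n l o → c N.:* n N.:+ o N.:+ (c N.:* (n N.:+ (N.con 1 N.:+ l)) N.:+ o)
                  N.:= o N.:+ o N.:+ c N.:* (N.con 1 N.:+ (n N.:+ n N.:+ l))) ≡.refl
          where module N = +-*-Solver
        lemma′ : ∀ c n l h → c ℕ.* h ℕ.+ c ℕ.* suc (n ℕ.+ n ℕ.+ l) ≡ c ℕ.* suc (n ℕ.+ n ℕ.+ h ℕ.+ l)
        lemma′ = N.solve 4 (λ c n l h → c N.:* h N.:+ c N.:* (N.con 1 N.:+ (n N.:+ n N.:+ l))
                   N.:= c N.:* (N.con 1 N.:+ (n N.:+ n N.:+ h N.:+ l))) ≡.refl
          where module N = +-*-Solver

      U-lab : ∀ n l → U (lab n) (lab (n ℕ.+ suc l)) ≈ PX.g (suc l) * PX.g (suc (n ℕ.+ n ℕ.+ h ℕ.+ l))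
      U-lab n l = *-cong (geo-cong (ratio-lab n l)) (geo-cong (y*y-lab n l))

      above : ∀ n l → lab n ≺ lab (n ℕ.+ suc l)
      above n l = lab-mono n (n ℕ.+ suc l) (ℕₚ.m<m+n n (s≤s z≤n))

      D-> : ∀ j l → d (lab (j ℕ.+ suc l)) (lab j) ≈ - (x ^ c) ^ suc l * (PX.g (suc l) * PX.g (suc (j ℕ.+ j ℕ.+ h ℕ.+ l)))
      D-> j l = trans (d-> {lab j} {lab (j ℕ.+ suc l)} (above j l)) (*-cong (-‿cong (ratio-lab j l)) (U-lab j l))

      D-< : ∀ n l → d (lab n) (lab (n ℕ.+ suc l)) ≈ PX.g (suc l) * PX.g (suc (n ℕ.+ n ℕ.+ h ℕ.+ l))
      D-< n l = trans (d-< {lab n} {lab (n ℕ.+ suc l)} (above n l)) (U-lab n l)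

      D-≡ : ∀ n → d (lab n) (lab n) ≈ 1#
      D-≡ n = d-refl (lab n)

      D : ℕ → ℕ → Carrier
      D i j = d (lab i) (lab j)

    open PX.SelfResidue h D D-≡ D-< D-> public using (product; both; right)

  -- With y = s x^e the factor L (s , e) is 1 + y² − y τ, where z e = x^e τ.
  module Spectral (z : ℕ → Carrier) (e₀ : ℕ) (z-geo : ∀ k e → e₀ ℕ.≤ e → z (k ℕ.+ e) ≈ x ^ k * z e) where

    L : Label → Carrier
    L l = 1# + y l * y l - σ (proj₁ l) * z (proj₂ l)

    -- `L m` and `ratio l m * L l` have the same coefficient of τ. Their difference is therefore the
    -- value of `L m` at the zero of `L l`, which is `u l m`.
    L-relation : ∀ {l m} → l ≺ m → e₀ ℕ.≤ proj₂ l → L m ≈ ratio l m * L l + u l m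
    L-relation {l@(s , e)} {m@(t , e′)} p b = begin
      1# + y m * y m - σ t * z e′
        ≈⟨ +-cong (+-congˡ (*-cong ym ym)) (-‿cong (trans (*-congˡ ze′) σz)) ⟩
      1# + r * v * (r * v) - r * (σ s * z e)
        ≈⟨ solve 3 (λ r v w → :1 :+ r :* v :* (r :* v) :- r :* w
             := r :* (:1 :+ v :* v :- w) :+ (:1 :- r) :* (:1 :- v :* (r :* v))) refl r v (σ s * z e) ⟩
      r * (1# + v * v - σ s * z e) + (1# - r) * (1# - v * (r * v))
        ≈⟨ +-congˡ (*-congˡ (+-congˡ (-‿cong (*-congˡ (sym ym))))) ⟩
      r * L l + u l m ∎
      where
      r = ratio l m
      v = y l
      ym : y m ≈ r * v
      ym = y-ratio {l} {m} p
      ze′ : z e′ ≈ x ^ (e′ ℕ.∸ e) * z e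
      ze′ = trans (reflexive (≡.cong z (≡.sym (ℕₚ.m∸n+n≡m (ℕₚ.<⇒≤ p))))) (z-geo (e′ ℕ.∸ e) e b)
      σz : σ t * (x ^ (e′ ℕ.∸ e) * z e) ≈ r * (σ s * z e)
      σz = begin
        σ t * (x ^ (e′ ℕ.∸ e) * z e) ≈⟨ *-congʳ (trans (sym (*-identityˡ _)) (*-congʳ (sym (σ-sq s)))) ⟩
        σ s * σ s * σ t * (x ^ (e′ ℕ.∸ e) * z e)
          ≈⟨ solve 4 (λ s t a b → s :* s :* t :* (a :* b) := s :* t :* a :* (s :* b)) refl (σ s) (σ t) (x ^ (e′ ℕ.∸ e)) (z e) ⟩
        r * (σ s * z e) ∎

    -- From degree e₀ on `z e` behaves as x^e τ; from e₁ on the forms are units. The two thresholds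
    -- are kept apart to admit a form of low degree without inverse.
    module _ (f : Label → Carrier) (e₁ : ℕ) (e₀≤e₁ : e₀ ℕ.≤ e₁) (f-inverse : ∀ l → e₁ ℕ.≤ proj₂ l → L l * f l ≈ 1#) where

      -- Division of `L l` by `L v` with remainder `u v l`. It is the splitting of 1 / (`L v` `L l`)
      -- multiplied by `L v`, and needs no inverse of `L v`.
      head-splits : ∀ {v l} → v ≺ l → e₀ ℕ.≤ proj₂ v → e₁ ℕ.≤ proj₂ l → f l ≈ d v l + d l v * (L v * f l)
      head-splits {v} {l} p b b′ = sym (begin
        d v l + d l v * (L v * f l) ≈⟨ +-cong (d-< {v} {l} p) (*-congʳ (d-> {v} {l} p)) ⟩
        U v l + - ratio v l * U v l * (L v * f l) ≈⟨ +-congʳ (trans (sym (*-identityʳ _)) (*-congˡ (sym (f-inverse l b′)))) ⟩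
        U v l * (L l * f l) + - ratio v l * U v l * (L v * f l)
          ≈⟨ +-congʳ (*-congˡ (*-congʳ (L-relation {v} {l} p b))) ⟩
        U v l * ((ratio v l * L v + u v l) * f l) + - ratio v l * U v l * (L v * f l)
          ≈⟨ solve 5 (λ U r L u f → U :* ((r :* L :+ u) :* f) :+ :- r :* U :* (L :* f) := u :* U :* f) refl (U v l) (ratio v l) (L v) (u v l) (f l) ⟩
        u v l * U v l * f l ≈⟨ trans (*-congʳ (u*U {v} {l} p)) (*-identityˡ _) ⟩
        f l ∎)

      private
        splits-< : ∀ {l m} → l ≺ m → e₁ ℕ.≤ proj₂ l → Splits f l m
        splits-< {l} {m} p b = begin
          f l * f m ≈⟨ *-congˡ (head-splits {l} {m} p (ℕₚ.≤-trans e₀≤e₁ b) (ℕₚ.≤-trans b (ℕₚ.<⇒≤ p))) ⟩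
          f l * (d l m + d m l * (L l * f m))
            ≈⟨ solve 5 (λ f g a b L → f :* (a :+ b :* (L :* g)) := a :* f :+ b :* ((L :* f) :* g)) refl (f l) (f m) (d l m) (d m l) (L l) ⟩
          d l m * f l + d m l * ((L l * f l) * f m)
            ≈⟨ +-congˡ (*-congˡ (trans (*-congʳ (f-inverse l b)) (*-identityˡ _))) ⟩
          d l m * f l + d m l * f m ∎

      splits : ∀ {l m} → e₁ ℕ.≤ proj₂ l → e₁ ℕ.≤ proj₂ m → Distinct l m → Splits f l m
      splits {l} {m} b b′ ne = go (ℕₚ.<-cmp (proj₂ l) (proj₂ m))
        where
        go : Tri (l ≺ m) (proj₂ l ≡ proj₂ m) (m ≺ l) → Splits f l m
        go (tri< p _ _) = splits-< {l} {m} p b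
        go (tri≈ _ e _) = ⊥-elim (ne e)
        go (tri> _ _ p) = trans (*-comm _ _) (trans (splits-< {m} {l} p b′) (+-comm _ _))

  module Bailey (z : ℕ → Carrier) (z-geo : ∀ k e → 1 ℕ.≤ e → z (k ℕ.+ e) ≈ x ^ k * z e)
                (f : Label → Carrier) where
    open Spectral z 1 z-geo
    open Family Sign.+ 2 1 1 (s≤s z≤n) ≡.refl
    open PX

    module _ (f-inverse : ∀ l → 1 ℕ.≤ proj₂ l → L l * f l ≈ 1#) where

      private
        X = x ^ 2

        1≤lab : ∀ i → 1 ℕ.≤ proj₂ (lab i)
        1≤lab i = ℕₚ.m≤n+m 1 (2 ℕ.* i)

        distinct : ∀ i j → i ℕ.< j → Distinct (lab j) (lab i)
        distinct i j i<j e = ℕₚ.<⇒≢ (lab-mono i j i<j) (≡.sym e)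

        expand : ∀ D → ∏ (suc D) (λ j → f (lab j)) ≈ ∑ (suc D) (λ i → f (lab i) * ∏ (suc D) (λ j → d (lab i) (lab j)))
        expand D = begin
          ∏ (suc D) (λ j → f (lab j)) ≈⟨ sym (∏-fam′ f) ⟩
          ∏L f (fam lab (suc D))
            ≈⟨ partial-fractions f (lab D) (fam lab D) (AllPairs-fam lab (suc D) distinct)
                 (AllPairs-fam lab (suc D) λ i j i<j → splits f 1 ℕₚ.≤-refl f-inverse {lab j} {lab i} (1≤lab j) (1≤lab i) (distinct i j i<j)) ⟩
          ∑L (λ i → f i * ∏L (d i) (fam lab (suc D))) (fam lab (suc D))
            ≈⟨ ∑-fam′ _ ⟩
          ∑ (suc D) (λ i → f (lab i) * ∏L (d (lab i)) (fam lab (suc D)))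
            ≈⟨ ∑-cong (suc D) (λ i _ → *-congˡ (∏-fam′ (d (lab i)))) ⟩
          ∑ (suc D) (λ i → f (lab i) * ∏ (suc D) (λ j → d (lab i) (lab j))) ∎
          where
          open import Data.List.Properties using (++-identityʳ)
          ∏-fam′ : ∀ F → ∏L F (fam lab (suc D)) ≈ ∏ (suc D) (λ j → F (lab j))
          ∏-fam′ F = trans (reflexive (≡.cong (∏L F) (≡.sym (++-identityʳ (fam lab (suc D)))))) (trans (∏L-fam F lab (suc D) []) (*-identityʳ _))
          ∑-fam′ : ∀ F → ∑L F (fam lab (suc D)) ≈ ∑ (suc D) (λ j → F (lab j))
          ∑-fam′ F = trans (reflexive (≡.cong (∑L F) (≡.sym (++-identityʳ (fam lab (suc D)))))) (trans (∑L-fam F lab (suc D) []) (+-identityʳ _))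

        C : ℕ → Carrier
        C i = sg i * X ^ (tri i ℕ.+ i ℕ.* suc i) * (1# - X ^ (i ℕ.+ i ℕ.+ 1)) * f (lab i)

        inner : ∀ i k → X ^ ((i ℕ.+ k) ℕ.* suc (i ℕ.+ k)) * (f (lab i) * ∏ (suc (i ℕ.+ k)) (λ j → d (lab i) (lab j)))
                ≈ C i * (X ^ (k ℕ.* (k ℕ.+ (i ℕ.+ i ℕ.+ 1))) * (P⁻¹ k * P⁻¹ (k ℕ.+ (i ℕ.+ i ℕ.+ 1))))
        inner i k = begin
          X ^ ((i ℕ.+ k) ℕ.* suc (i ℕ.+ k)) * (f (lab i) * ∏ (suc (i ℕ.+ k)) (λ j → d (lab i) (lab j)))
            ≈⟨ *-cong (trans (^-congʳ X (bailey-exponent i k)) (^-homo-* X (i ℕ.* suc i) _))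
                 (*-congˡ (trans (reflexive (≡.cong (λ N → ∏ N (λ j → d (lab i) (lab j))) (≡.sym (ℕₚ.+-suc i k))))
                   (product i k i (ℕₚ.+-comm i 1)))) ⟩
          X ^ (i ℕ.* suc i) * E * (f (lab i) * (sg i * X ^ tri i * (P⁻¹ i * P i * B) * (P⁻¹ k * P⁻¹ (i ℕ.+ i ℕ.+ 1 ℕ.+ k))))
            ≈⟨ *-congˡ (*-congˡ (*-cong (*-congˡ (trans (*-congʳ (trans (*-comm _ _) (P-inverse i))) (*-identityˡ _)))
                 (*-congˡ (reflexive (≡.cong P⁻¹ (ℕₚ.+-comm (i ℕ.+ i ℕ.+ 1) k)))))) ⟩
          X ^ (i ℕ.* suc i) * E * (f (lab i) * (sg i * X ^ tri i * B * (P⁻¹ k * P⁻¹ (k ℕ.+ (i ℕ.+ i ℕ.+ 1)))))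
            ≈⟨ solve 7 (λ a E f s t b p → a :* E :* (f :* (s :* t :* b :* p)) := s :* (t :* a) :* b :* f :* (E :* p))
                 refl (X ^ (i ℕ.* suc i)) E (f (lab i)) (sg i) (X ^ tri i) B _ ⟩
          sg i * (X ^ tri i * X ^ (i ℕ.* suc i)) * B * f (lab i) * (E * (P⁻¹ k * P⁻¹ (k ℕ.+ (i ℕ.+ i ℕ.+ 1))))
            ≈⟨ *-congʳ (*-congʳ (*-congʳ (*-congˡ (sym (^-homo-* X (tri i) (i ℕ.* suc i)))))) ⟩
          C i * (E * (P⁻¹ k * P⁻¹ (k ℕ.+ (i ℕ.+ i ℕ.+ 1)))) ∎
          where
          E = X ^ (k ℕ.* (k ℕ.+ (i ℕ.+ i ℕ.+ 1)))
          B = 1# - X ^ (i ℕ.+ i ℕ.+ 1)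

        open Nilpotent R M X (vanishes-^ 2 (s≤s z≤n)) using () renaming (x^≥M to X^≥M)

        C-large : ∀ i → M ℕ.≤ i → C i ≈ 0#
        C-large i M≤i = trans (*-congʳ (*-congʳ (*-congˡ (X^≥M (ℕₚ.≤-trans M≤i (ℕₚ.≤-trans (ℕₚ.m≤m*n i (suc i)) (ℕₚ.m≤n+m _ (tri i))))))))
          (solve 3 (λ a b c → a :* :0 :* b :* c := :0) refl _ _ _)

        summand : ℕ → Carrier
        summand D = X ^ (D ℕ.* suc D) * ∏ (suc D) (λ j → f (lab j))

        row : ∀ i → ∑ (M ℕ.+ M ℕ.∸ i) (λ k → X ^ ((i ℕ.+ k) ℕ.* suc (i ℕ.+ k)) * (f (lab i) * ∏ (suc (i ℕ.+ k)) (λ j → d (lab i) (lab j))))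
              ≈ C i * P⁻¹ M
        row i with M ℕₚ.≤? i
        ... | yes M≤i = trans (∑-zero (M ℕ.+ M ℕ.∸ i) λ k _ → trans (inner i k) (trans (*-congʳ (C-large i M≤i)) (zeroˡ _)))
                          (sym (trans (*-congʳ (C-large i M≤i)) (zeroˡ _)))
        ... | no M≰i = begin
          ∑ N _ ≈⟨ ∑-cong N (λ k _ → inner i k) ⟩
          ∑ N (λ k → C i * (X ^ (k ℕ.* (k ℕ.+ m)) * (P⁻¹ k * P⁻¹ (k ℕ.+ m)))) ≈⟨ sym (*-∑ N (C i)) ⟩
          C i * ∑ N (λ k → X ^ (k ℕ.* (k ℕ.+ m)) * (P⁻¹ k * P⁻¹ (k ℕ.+ m))) ≈⟨ *-congˡ (durfee-rectangle N m M≤N) ⟩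
          C i * P⁻¹ M ∎
          where
          N = M ℕ.+ M ℕ.∸ i
          m = i ℕ.+ i ℕ.+ 1
          M≤N : M ℕ.≤ N
          M≤N = ℕₚ.≤-trans (ℕₚ.≤-reflexive (≡.sym (ℕₚ.m+n∸n≡m M M))) (ℕₚ.∸-monoʳ-≤ (M ℕ.+ M) (ℕₚ.<⇒≤ (ℕₚ.≰⇒> M≰i)))

        unsummed : ∑ (M ℕ.+ M) summand ≈ ∑ M C * P⁻¹ M
        unsummed = begin
          -- The bound `M + M` leaves at least M terms in every row with i < M, as
          -- `durfee-rectangle` demands. The rows with i at least M vanish by `C-large`.
          ∑ (M ℕ.+ M) summand
            ≈⟨ ∑-cong (M ℕ.+ M) (λ D _ → trans (*-congˡ (expand D)) (*-∑ (suc D) _)) ⟩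
          ∑ (M ℕ.+ M) (λ D → ∑ (suc D) (λ i → X ^ (D ℕ.* suc D) * (f (lab i) * ∏ (suc D) (λ j → d (lab i) (lab j)))))
            ≈⟨ ∑-triangle (M ℕ.+ M) (λ D i → X ^ (D ℕ.* suc D) * (f (lab i) * ∏ (suc D) (λ j → d (lab i) (lab j)))) ⟩
          ∑ (M ℕ.+ M) (λ i → ∑ (M ℕ.+ M ℕ.∸ i) (λ k → X ^ ((i ℕ.+ k) ℕ.* suc (i ℕ.+ k)) * (f (lab i) * ∏ (suc (i ℕ.+ k)) (λ j → d (lab i) (lab j)))))
            ≈⟨ ∑-cong (M ℕ.+ M) (λ i _ → row i) ⟩
          ∑ (M ℕ.+ M) (λ i → C i * P⁻¹ M)
            ≈⟨ sym (∑-* (M ℕ.+ M) _) ⟩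
          ∑ (M ℕ.+ M) C * P⁻¹ M
            ≈⟨ *-congʳ (∑-truncate (ℕₚ.m≤m+n M M) C-large) ⟩
          ∑ M C * P⁻¹ M ∎

        truncated : ∀ {N} → M ℕ.≤ N → ∑ N summand ≈ ∑ M summand
        truncated M≤N = ∑-truncate M≤N λ D M≤D → trans (*-congʳ (X^≥M (ℕₚ.≤-trans M≤D (ℕₚ.m≤m*n D (suc D))))) (zeroˡ _)

      -- After the exchange of summations the sum over D at fixed i is a Durfee sum whose value
      -- `P⁻¹ M` does not depend on i. This constancy lets it leave as a common factor, so that a
      -- single series in i remains.
      bailey : ∀ {N} → M ℕ.≤ N →
        P M * ∑ N (λ D → X ^ (D ℕ.* suc D) * ∏ (suc D) (λ j → f (lab j)))
          ≈ ∑ M (λ i → sg i * X ^ (tri i ℕ.+ i ℕ.* suc i) * (1# - X ^ (i ℕ.+ i ℕ.+ 1)) * f (lab i))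
      bailey {N} M≤N = begin
        P M * ∑ N summand ≈⟨ *-congˡ (trans (truncated M≤N) (trans (sym (truncated (ℕₚ.m≤m+n M M))) unsummed)) ⟩
        P M * (∑ M C * P⁻¹ M) ≈⟨ solve 3 (λ a b c → a :* (b :* c) := a :* c :* b) refl _ _ _ ⟩
        P M * P⁻¹ M * ∑ M C ≈⟨ trans (*-congʳ (P-inverse M)) (*-identityˡ _) ⟩
        ∑ M C ∎

-- Residues between two families of opposite sign.

n≤tri[n] : ∀ n → n ℕ.≤ tri n
n≤tri[n] zero    = z≤n
n≤tri[n] (suc n) = ℕₚ.m≤n+m (suc n) (tri n)

predecessor : ∀ {n} → 1 ℕ.≤ n → ∃ λ k → n ≡ suc k
predecessor {suc n} _ = n , ≡.refl

module CrossResidues (R : CommutativeRing 0ℓ 0ℓ) (M : ℕ) (x : CommutativeRing.Carrier R) (x^M≈0 : Vanishes R M x) where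
  open CommutativeRing R
  open IntegerSolver R
  open FiniteSums R
  open PartialFractions R
  open Nilpotent R M x x^M≈0
  open Families R M x x^M≈0
  open import Algebra.Properties.Semiring.Exp semiring
  open import Relation.Binary.Reasoning.Setoid setoid

  γ : ℕ → Carrier
  γ k = geo (- x ^ k)

  γ-inverse : ∀ k → (1# + x ^ suc k) * γ (suc k) ≈ 1#
  γ-inverse k = trans (*-congʳ (+-congˡ (solve 1 (λ a → a := :- (:- a)) refl (x ^ suc k))))
    (geo-inverse (trans (^-congˡ M (solve 1 (λ a → :- a := :- :1 :* a) refl (x ^ suc k))) (c*x^-nil (- 1#) {suc k} (s≤s z≤n))))

  γ-large : ∀ {k} → M ℕ.≤ k → 1 ℕ.≤ k → γ k ≈ 1#
  γ-large {suc k} M≤k _ = inverse-unique {1# + x ^ suc k} (γ-inverse k)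
    (trans (*-identityʳ _) (trans (+-congˡ (x^≥M M≤k)) (+-identityʳ _)))

  -- E a b = 1 / (1 + x^(a − b)) for a ≠ b
  E : ℕ → ℕ → Carrier
  E a b with ℕₚ.<-cmp a b
  ... | tri< _ _ _ = x ^ (b ℕ.∸ a) * γ (b ℕ.∸ a)
  ... | tri≈ _ _ _ = 1#
  ... | tri> _ _ _ = γ (a ℕ.∸ b)

  E-> : ∀ k b → E (suc k ℕ.+ b) b ≈ γ (suc k)
  E-> k b with ℕₚ.<-cmp (suc k ℕ.+ b) b
  ... | tri< _ _ q = ⊥-elim (q (s≤s (ℕₚ.m≤n+m b k)))
  ... | tri≈ _ _ q = ⊥-elim (q (s≤s (ℕₚ.m≤n+m b k)))
  ... | tri> _ _ _ = reflexive (≡.cong γ (ℕₚ.m+n∸n≡m (suc k) b))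

  E-< : ∀ k a → E a (suc k ℕ.+ a) ≈ x ^ suc k * γ (suc k)
  E-< k a with ℕₚ.<-cmp a (suc k ℕ.+ a)
  ... | tri< _ _ _ = reflexive (≡.cong (λ k → x ^ k * γ k) (ℕₚ.m+n∸n≡m (suc k) a))
  ... | tri≈ q _ _ = ⊥-elim (q (s≤s (ℕₚ.m≤n+m a k)))
  ... | tri> q _ _ = ⊥-elim (q (s≤s (ℕₚ.m≤n+m a k)))

  E-≡ : ∀ {a b} → a ≡ b → E a b ≈ 1#
  E-≡ {a} {b} e with ℕₚ.<-cmp a b
  ... | tri< _ q _ = ⊥-elim (q e)
  ... | tri≈ _ _ _ = refl
  ... | tri> _ q _ = ⊥-elim (q e)

  private
    offset : ∀ {a b} → a ℕ.< b → ∃ λ k → b ≡ suc k ℕ.+ a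
    offset {a} {b} p = b ℕ.∸ suc a , ≡.trans (≡.sym (ℕₚ.m∸n+n≡m p)) (ℕₚ.+-suc (b ℕ.∸ suc a) a)

  E-shift : ∀ a b c → E (a ℕ.+ c) (b ℕ.+ c) ≈ E a b
  E-shift a b c = go (ℕₚ.<-cmp a b)
    where
    go : Tri (a ℕ.< b) (a ≡ b) (b ℕ.< a) → E (a ℕ.+ c) (b ℕ.+ c) ≈ E a b
    go (tri≈ _ e _) = trans (E-≡ (≡.cong (ℕ._+ c) e)) (sym (E-≡ e))
    go (tri< p _ _) with k , ≡.refl ← offset p = trans (reflexive (≡.cong (E (a ℕ.+ c)) (ℕₚ.+-assoc (suc k) a c))) (trans (E-< k (a ℕ.+ c)) (sym (E-< k a)))
    go (tri> _ _ p) with k , ≡.refl ← offset p = trans (reflexive (≡.cong (λ z → E z (b ℕ.+ c)) (ℕₚ.+-assoc (suc k) b c))) (trans (E-> k (b ℕ.+ c)) (sym (E-> k b)))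

  E-large : ∀ {a b} → b ℕ.+ M ℕ.< a → E a b ≈ 1#
  E-large {a} {b} p with k , ≡.refl ← offset (ℕₚ.≤-<-trans (ℕₚ.m≤m+n b M) p) = trans (E-> k b)
    (γ-large (ℕₚ.≤-trans (ℕₚ.+-cancelˡ-≤ b M (suc k) (ℕₚ.≤-trans (ℕₚ.<⇒≤ p) (ℕₚ.≤-reflexive (ℕₚ.+-comm (suc k) b)))) ℕₚ.≤-refl) (s≤s z≤n))

  -- Opposite signs turn (1 - y′/y)(1 - y y′) into (1 + x^(e′-e))(1 + x^(e+e′)). `E` covers both
  -- signs of e′ - e, so the formula does not depend on the order of the degrees.
  d-cross : ∀ s t e e′ → σ s * σ t ≈ - 1# → e ≢ e′ → d (s , e) (t , e′) ≈ E e′ e * γ (e ℕ.+ e′)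
  d-cross s t e e′ st ne = go (ℕₚ.<-cmp e e′)
    where
    neg : ∀ {a k} → a ≈ - 1# → geo (a * x ^ k) ≈ γ k
    neg {a} {k} p = geo-cong (trans (*-congʳ p) (solve 1 (λ a → :- :1 :* a := :- a) refl (x ^ k)))
    go : Tri (e ℕ.< e′) (e ≡ e′) (e′ ℕ.< e) → d (s , e) (t , e′) ≈ E e′ e * γ (e ℕ.+ e′)
    go (tri≈ _ p _) = ⊥-elim (ne p)
    go (tri< p _ _) with k , ≡.refl ← offset p = begin
      d (s , e) (t , suc k ℕ.+ e) ≈⟨ d-< {s , e} {t , suc k ℕ.+ e} p ⟩
      geo (σ s * σ t * x ^ (suc k ℕ.+ e ℕ.∸ e)) * geo (y (s , e) * y (t , suc k ℕ.+ e))
        ≈⟨ *-cong (trans (reflexive (≡.cong (λ k → geo (σ s * σ t * x ^ k)) (ℕₚ.m+n∸n≡m (suc k) e))) (neg {σ s * σ t} {suc k} st))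
             (trans (geo-cong (y*y (s , e) (t , suc k ℕ.+ e))) (neg {σ s * σ t} {e ℕ.+ (suc k ℕ.+ e)} st)) ⟩
      γ (suc k) * γ (e ℕ.+ (suc k ℕ.+ e)) ≈⟨ *-congʳ (sym (E-> k e)) ⟩
      E (suc k ℕ.+ e) e * γ (e ℕ.+ (suc k ℕ.+ e)) ∎
    go (tri> _ _ p) with k , ≡.refl ← offset p = begin
      d (s , suc k ℕ.+ e′) (t , e′) ≈⟨ d-> {t , e′} {s , suc k ℕ.+ e′} p ⟩
      - (σ t * σ s * x ^ (suc k ℕ.+ e′ ℕ.∸ e′)) * (geo (σ t * σ s * x ^ (suc k ℕ.+ e′ ℕ.∸ e′)) * geo (y (t , e′) * y (s , suc k ℕ.+ e′)))
        ≈⟨ *-cong (reflexive (≡.cong (λ k → - (σ t * σ s * x ^ k)) (ℕₚ.m+n∸n≡m (suc k) e′)))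
             (*-cong (trans (reflexive (≡.cong (λ k → geo (σ t * σ s * x ^ k)) (ℕₚ.m+n∸n≡m (suc k) e′))) (neg {σ t * σ s} {suc k} ts))
             (trans (geo-cong (y*y (t , e′) (s , suc k ℕ.+ e′))) (trans (neg {σ t * σ s} {e′ ℕ.+ (suc k ℕ.+ e′)} ts)
               (reflexive (≡.cong γ (ℕₚ.+-comm e′ (suc k ℕ.+ e′))))))) ⟩
      - (σ t * σ s * x ^ suc k) * (γ (suc k) * γ (suc k ℕ.+ e′ ℕ.+ e′))
        ≈⟨ *-congʳ (-‿cong (*-congʳ ts)) ⟩
      - (- 1# * x ^ suc k) * (γ (suc k) * γ (suc k ℕ.+ e′ ℕ.+ e′))
        ≈⟨ solve 3 (λ a b c → :- (:- :1 :* a) :* (b :* c) := a :* b :* c) refl (x ^ suc k) _ _ ⟩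
      x ^ suc k * γ (suc k) * γ (suc k ℕ.+ e′ ℕ.+ e′) ≈⟨ *-congʳ (sym (E-< k e′)) ⟩
      E e′ (suc k ℕ.+ e′) * γ (suc k ℕ.+ e′ ℕ.+ e′) ∎
      where
      ts : σ t * σ s ≈ - 1#
      ts = trans (*-comm _ _) st

  module Quasiperiod (c o N₁ : ℕ) where
    private
      N = suc N₁

    -- The reciprocal of the theta product (-x^(o-e), -x^(o+e); x^c)_∞, cut off after N factors; the
    -- missing factors are 1 as long as e stays small.
    Ψ : ℕ → Carrier
    Ψ e = ∏ N (λ m → E (c ℕ.* m ℕ.+ o) e) * ∏ N (λ m → γ (e ℕ.+ (c ℕ.* m ℕ.+ o)))

    module _ (e : ℕ) (large : e ℕ.+ M ℕ.< c ℕ.* N₁ ℕ.+ o) where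
      private
        next : ∀ m → c ℕ.* suc m ℕ.+ o ≡ c ℕ.* m ℕ.+ o ℕ.+ c
        next m = ≡.trans (≡.cong (ℕ._+ o) (≡.trans (ℕₚ.*-suc c m) (ℕₚ.+-comm c _)))
          (≡.trans (ℕₚ.+-assoc (c ℕ.* m) c o) (≡.trans (≡.cong (c ℕ.* m ℕ.+_) (ℕₚ.+-comm c o)) (≡.sym (ℕₚ.+-assoc (c ℕ.* m) o c))))

        c0 : c ℕ.* 0 ℕ.+ o ≡ o
        c0 = ≡.cong (ℕ._+ o) (ℕₚ.*-zeroʳ c)

      E-step : ∏ N (λ m → E (c ℕ.* m ℕ.+ o) (e ℕ.+ c)) ≈ E o (e ℕ.+ c) * ∏ N (λ m → E (c ℕ.* m ℕ.+ o) e)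
      E-step = begin
        ∏ N (λ m → E (c ℕ.* m ℕ.+ o) (e ℕ.+ c)) ≈⟨ ∏-head N₁ ⟩
        E (c ℕ.* 0 ℕ.+ o) (e ℕ.+ c) * ∏ N₁ (λ m → E (c ℕ.* suc m ℕ.+ o) (e ℕ.+ c))
          ≈⟨ *-cong (reflexive (≡.cong (λ z → E z (e ℕ.+ c)) c0))
               (∏-cong N₁ λ m _ → trans (reflexive (≡.cong (λ z → E z (e ℕ.+ c)) (next m))) (E-shift (c ℕ.* m ℕ.+ o) e c)) ⟩
        E o (e ℕ.+ c) * ∏ N₁ (λ m → E (c ℕ.* m ℕ.+ o) e)
          ≈⟨ *-congˡ (sym (trans (*-congˡ (E-large large)) (*-identityʳ _))) ⟩
        E o (e ℕ.+ c) * ∏ N (λ m → E (c ℕ.* m ℕ.+ o) e) ∎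

      γ-step : ∏ N (λ m → γ (e ℕ.+ (c ℕ.* m ℕ.+ o))) ≈ γ (e ℕ.+ o) * ∏ N (λ m → γ (e ℕ.+ c ℕ.+ (c ℕ.* m ℕ.+ o)))
      γ-step = begin
        ∏ N (λ m → γ (e ℕ.+ (c ℕ.* m ℕ.+ o))) ≈⟨ ∏-head N₁ ⟩
        γ (e ℕ.+ (c ℕ.* 0 ℕ.+ o)) * ∏ N₁ (λ m → γ (e ℕ.+ (c ℕ.* suc m ℕ.+ o)))
          ≈⟨ *-cong (reflexive (≡.cong (λ z → γ (e ℕ.+ z)) c0)) (∏-cong N₁ λ m _ → reflexive (≡.cong γ (eq m))) ⟩
        γ (e ℕ.+ o) * ∏ N₁ (λ m → γ (e ℕ.+ c ℕ.+ (c ℕ.* m ℕ.+ o)))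
          ≈⟨ *-congˡ (sym (trans (*-congˡ (γ-large M≤ 1≤)) (*-identityʳ _))) ⟩
        γ (e ℕ.+ o) * ∏ N (λ m → γ (e ℕ.+ c ℕ.+ (c ℕ.* m ℕ.+ o))) ∎
        where
        eq : ∀ m → e ℕ.+ (c ℕ.* suc m ℕ.+ o) ≡ e ℕ.+ c ℕ.+ (c ℕ.* m ℕ.+ o)
        eq m = ≡.trans (≡.cong (e ℕ.+_) (≡.trans (next m) (ℕₚ.+-comm _ c))) (≡.sym (ℕₚ.+-assoc e c _))
        big : e ℕ.+ M ℕ.< e ℕ.+ c ℕ.+ (c ℕ.* N₁ ℕ.+ o)
        big = ℕₚ.<-≤-trans large (ℕₚ.m≤n+m _ (e ℕ.+ c))
        M≤ : M ℕ.≤ e ℕ.+ c ℕ.+ (c ℕ.* N₁ ℕ.+ o)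
        M≤ = ℕₚ.≤-trans (ℕₚ.m≤n+m M e) (ℕₚ.<⇒≤ big)
        1≤ : 1 ℕ.≤ e ℕ.+ c ℕ.+ (c ℕ.* N₁ ℕ.+ o)
        1≤ = ℕₚ.≤-trans (s≤s z≤n) big

      -- The shift of e by c moves both products by one index. At the lower end `E o (e + c)` enters
      -- one of them and `γ (e + o)` leaves the other; at the upper end the factor in question is 1,
      -- because `large` puts it beyond degree M.
      Ψ-step : Ψ (e ℕ.+ c) * γ (e ℕ.+ o) ≈ E o (e ℕ.+ c) * Ψ e
      Ψ-step = begin
        ∏ N (λ m → E (c ℕ.* m ℕ.+ o) (e ℕ.+ c)) * ∏ N (λ m → γ (e ℕ.+ c ℕ.+ (c ℕ.* m ℕ.+ o))) * γ (e ℕ.+ o)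
          ≈⟨ *-congʳ (*-congʳ E-step) ⟩
        E o (e ℕ.+ c) * ∏ N (λ m → E (c ℕ.* m ℕ.+ o) e) * ∏ N (λ m → γ (e ℕ.+ c ℕ.+ (c ℕ.* m ℕ.+ o))) * γ (e ℕ.+ o)
          ≈⟨ solve 4 (λ a b c d → a :* b :* c :* d := a :* (b :* (d :* c))) refl _ _ _ _ ⟩
        E o (e ℕ.+ c) * (∏ N (λ m → E (c ℕ.* m ℕ.+ o) e) * (γ (e ℕ.+ o) * ∏ N (λ m → γ (e ℕ.+ c ℕ.+ (c ℕ.* m ℕ.+ o)))))
          ≈⟨ *-congˡ (*-congˡ (sym γ-step)) ⟩
        E o (e ℕ.+ c) * Ψ e ∎

    -- For c = 2o the two factors of `Ψ-step` are the inverses of 1 + x^(-(e+o)) and 1 + x^(e+o),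
    -- and their quotient is a power of x.
    Ψ-step-centred : ∀ e → c ≡ o ℕ.+ o → 1 ℕ.≤ o → e ℕ.+ M ℕ.< c ℕ.* N₁ ℕ.+ o → Ψ (e ℕ.+ c) ≈ x ^ (e ℕ.+ o) * Ψ e
    Ψ-step-centred e c≡2o 1≤o large with k , eo ← predecessor (ℕₚ.≤-trans 1≤o (ℕₚ.m≤n+m o e)) = *-cancel {γ (e ℕ.+ o)} γ-unit (begin
        γ (e ℕ.+ o) * Ψ (e ℕ.+ c) ≈⟨ trans (*-comm _ _) (Ψ-step e large) ⟩
        E o (e ℕ.+ c) * Ψ e ≡⟨ ≡.cong (λ z → E o z * Ψ e) (≡.trans (≡.cong (e ℕ.+_) c≡2o) (≡.trans (≡.sym (ℕₚ.+-assoc e o o)) (≡.cong (ℕ._+ o) eo))) ⟩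
        E o (suc k ℕ.+ o) * Ψ e ≈⟨ *-congʳ (E-< k o) ⟩
        x ^ suc k * γ (suc k) * Ψ e ≡⟨ ≡.cong (λ z → x ^ z * γ z * Ψ e) (≡.sym eo) ⟩
        x ^ (e ℕ.+ o) * γ (e ℕ.+ o) * Ψ e ≈⟨ solve 3 (λ a b c → a :* b :* c := b :* (a :* c)) refl (x ^ (e ℕ.+ o)) _ _ ⟩
        γ (e ℕ.+ o) * (x ^ (e ℕ.+ o) * Ψ e) ∎)
      where
      γ-unit : γ (e ℕ.+ o) * (1# + x ^ (e ℕ.+ o)) ≈ 1#
      γ-unit with k , eo ← predecessor (ℕₚ.≤-trans 1≤o (ℕₚ.m≤n+m o e)) rewrite eo = trans (*-comm _ _) (γ-inverse k)

    -- For o = 0 the two end factors have different degrees, e + c and e. The product (1 + x^e) Ψ e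
    -- is then the quasiperiodic quantity.
    Ψ-step-origin : ∀ k → o ≡ 0 → 1 ℕ.≤ c → suc k ℕ.+ M ℕ.< c ℕ.* N₁ ℕ.+ o →
      (1# + x ^ (suc k ℕ.+ c)) * Ψ (suc k ℕ.+ c) ≈ x ^ (suc k ℕ.+ c) * ((1# + x ^ suc k) * Ψ (suc k))
    Ψ-step-origin k o≡0 1≤c large = begin
      (1# + x ^ (e ℕ.+ c)) * Ψ (e ℕ.+ c)
        ≈⟨ *-congˡ (trans (sym (*-identityʳ _)) (*-congˡ (sym (trans (*-congˡ (reflexive (≡.cong γ e0))) (γ-inverse k))))) ⟩
      (1# + x ^ (e ℕ.+ c)) * (Ψ (e ℕ.+ c) * ((1# + x ^ e) * γ (e ℕ.+ o)))
        ≈⟨ solve 4 (λ a b c d → a :* (b :* (c :* d)) := a :* (b :* d) :* c) refl _ _ _ _ ⟩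
      (1# + x ^ (e ℕ.+ c)) * (Ψ (e ℕ.+ c) * γ (e ℕ.+ o)) * (1# + x ^ e)
        ≈⟨ *-congʳ (*-congˡ (trans (Ψ-step e large) (*-congʳ E0))) ⟩
      (1# + x ^ (e ℕ.+ c)) * (x ^ (e ℕ.+ c) * γ (e ℕ.+ c) * Ψ e) * (1# + x ^ e)
        ≈⟨ solve 5 (λ a b c d e → a :* (b :* c :* d) :* e := a :* c :* (b :* (e :* d))) refl (1# + x ^ (e ℕ.+ c)) (x ^ (e ℕ.+ c)) (γ (e ℕ.+ c)) (Ψ e) (1# + x ^ e) ⟩
      (1# + x ^ (e ℕ.+ c)) * γ (e ℕ.+ c) * (x ^ (e ℕ.+ c) * ((1# + x ^ e) * Ψ e))
        ≈⟨ trans (*-congʳ (γ-inverse (k ℕ.+ c))) (*-identityˡ _) ⟩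
      x ^ (e ℕ.+ c) * ((1# + x ^ e) * Ψ e) ∎
      where
      e = suc k
      e0 : e ℕ.+ o ≡ suc k
      e0 = ≡.trans (≡.cong (e ℕ.+_) o≡0) (ℕₚ.+-identityʳ e)
      E0 : E o (e ℕ.+ c) ≈ x ^ (e ℕ.+ c) * γ (e ℕ.+ c)
      E0 = trans (reflexive (≡.cong₂ E o≡0 (≡.sym (ℕₚ.+-identityʳ (e ℕ.+ c))))) (E-< (k ℕ.+ c) 0)

    d-product : ∀ s t e → σ s * σ t ≈ - 1# → (∀ m → e ≢ c ℕ.* m ℕ.+ o) → ∏ N (λ m → d (s , e) (t , c ℕ.* m ℕ.+ o)) ≈ Ψ e
    d-product s t e st ne = trans (∏-cong N λ m _ → d-cross s t e (c ℕ.* m ℕ.+ o) st (ne m)) (∏-* N)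

-- Partial fractions over two families, one form being allowed to have no inverse.

module TwoFamilies (R : CommutativeRing 0ℓ 0ℓ) (M : ℕ) (x : CommutativeRing.Carrier R) (x^M≈0 : Vanishes R M x) where
  open CommutativeRing R
  open IntegerSolver R
  open FiniteSums R
  open PartialFractions R
  open Nilpotent R M x x^M≈0
  open Families R M x x^M≈0
  open import Algebra.Properties.Semiring.Exp semiring
  open import Relation.Binary.Reasoning.Setoid setoid

  module Expansion
    (z : ℕ → Carrier) (e₀ : ℕ) (z-geo : ∀ k e → e₀ ℕ.≤ e → z (k ℕ.+ e) ≈ x ^ k * z e)
    (f : Label → Carrier) (e₁ : ℕ) (e₀≤e₁ : e₀ ℕ.≤ e₁) (f-inverse : ∀ l → e₁ ℕ.≤ proj₂ l → Spectral.L z e₀ z-geo l * f l ≈ 1#)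
    (lab₁ lab₂ : ℕ → Label)
    (mono₁ : ∀ i j → i ℕ.< j → lab₁ i ≺ lab₁ j) (mono₂ : ∀ i j → i ℕ.< j → lab₂ i ≺ lab₂ j)
    (cross : ∀ i j → Distinct (lab₁ i) (lab₂ j))
    (b₀ : e₀ ℕ.≤ proj₂ (lab₁ 0)) (b₁ : ∀ i → e₁ ℕ.≤ proj₂ (lab₁ (suc i))) (b₂ : ∀ j → e₁ ℕ.≤ proj₂ (lab₂ j))
    (below : ∀ j → lab₁ 0 ≺ lab₂ j) where

    open Spectral z e₀ z-geo

    V : Carrier
    V = L (lab₁ 0)

    -- V f (lab₁ i), read as 1 for i = 0
    scaled : ℕ → Carrier
    scaled zero    = 1#
    scaled (suc i) = V * f (lab₁ (suc i))

    -- This is `V` times the expansion over all labels, with `V * f (lab₁ 0)` read as 1. The form is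
    -- needed where `V` is not known to be a unit: the specialisations meet V = 2 and V = 2 (1 +
    -- x²).
    expansion : ∀ N₂ → let N₁ = suc N₂ ; N = suc N₁ in
      ∏ N₁ (λ i → f (lab₁ (suc i))) * ∏ N (λ j → f (lab₂ j))
        ≈ ∑ N (λ i → scaled i * (∏ N (λ k → d (lab₁ i) (lab₁ k)) * ∏ N (λ k → d (lab₁ i) (lab₂ k))))
        + ∑ N (λ j → V * f (lab₂ j) * (∏ N (λ k → d (lab₂ j) (lab₁ k)) * ∏ N (λ k → d (lab₂ j) (lab₂ k))))
    expansion N₂ = begin
      ∏ N₁ (λ i → f (lab₁ (suc i))) * ∏ N (λ j → f (lab₂ j)) ≈⟨ sym (∏-ys f) ⟩
      ∏L f ys
        ≈⟨ partial-fractions′ f V v _ _ (dist-v ∷ dist) splitting heads ⟩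
      ∏L (d v) (v ∷ ys) + ∑L (λ i → V * f i * ∏L (d i) (v ∷ ys)) ys
        ≈⟨ +-cong (trans (coefficient v) (sym (*-identityˡ _)))
             (trans (trans (∑L-fam _ (λ i → lab₁ (suc i)) N₁ _) (+-congˡ (trans (reflexive (≡.cong (∑L _) (≡.sym (++-identityʳ (fam lab₂ N))))) (trans (∑L-fam _ lab₂ N []) (+-identityʳ _)))))
               (+-cong (∑-cong N₁ λ i _ → *-congˡ (coefficient (lab₁ (suc i)))) (∑-cong N λ j _ → *-congˡ (coefficient (lab₂ j))))) ⟩
      scaled 0 * c v + (∑ N₁ (λ i → scaled (suc i) * c (lab₁ (suc i))) + ∑ N (λ j → V * f (lab₂ j) * c (lab₂ j)))
        ≈⟨ trans (sym (+-assoc _ _ _)) (+-congʳ (sym (∑-head N₁))) ⟩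
      ∑ N (λ i → scaled i * c (lab₁ i)) + ∑ N (λ j → V * f (lab₂ j) * c (lab₂ j)) ∎
      where
      N₁ = suc N₂
      N  = suc N₁
      v  = lab₁ 0
      ys = fam (λ i → lab₁ (suc i)) N₁ ++ fam lab₂ N
      c : Label → Carrier
      c l = ∏ N (λ k → d l (lab₁ k)) * ∏ N (λ k → d l (lab₂ k))
      ∏-ys : ∀ F → ∏L F ys ≈ ∏ N₁ (λ i → F (lab₁ (suc i))) * ∏ N (λ j → F (lab₂ j))
      ∏-ys F = trans (∏L-fam F (λ i → lab₁ (suc i)) N₁ _)
        (*-congˡ (trans (reflexive (≡.cong (∏L F) (≡.sym (++-identityʳ (fam lab₂ N))))) (trans (∏L-fam F lab₂ N []) (*-identityʳ _))))
      coefficient : ∀ l → ∏L (d l) (v ∷ ys) ≈ c l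
      coefficient l = trans (*-congˡ (∏-ys (d l))) (trans (sym (*-assoc _ _ _)) (*-congʳ (sym (∏-head N₁))))
      ne : ∀ {l m} → l ≺ m → Distinct m l
      ne p e = ℕₚ.<⇒≢ p (≡.sym e)
      all-ys : ∀ {Q : Label → Set} → (∀ i → Q (lab₁ (suc i))) → (∀ j → Q (lab₂ j)) → All Q ys
      all-ys p q = Allₚ.++⁺ (All-fam (λ i → lab₁ (suc i)) N₁ p) (All-fam lab₂ N q)
      pairs-ys : ∀ {_~_ : Label → Label → Set} →
        (∀ i j → i ℕ.< j → lab₁ (suc j) ~ lab₁ (suc i)) → (∀ i j → i ℕ.< j → lab₂ j ~ lab₂ i) →
        (∀ i j → lab₁ (suc i) ~ lab₂ j) → AllPairs _~_ ys
      pairs-ys p q r = AllPairsₚ.++⁺ (AllPairs-fam (λ i → lab₁ (suc i)) N₁ p) (AllPairs-fam lab₂ N q)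
        (All-fam (λ i → lab₁ (suc i)) N₁ (λ i → All-fam lab₂ N (r i)))
      dist-v : All (Distinct v) ys
      dist-v = all-ys (λ i → ℕₚ.<⇒≢ (mono₁ 0 (suc i) (s≤s z≤n))) (λ j → ℕₚ.<⇒≢ (below j))
      d₁ : ∀ i j → i ℕ.< j → Distinct (lab₁ (suc j)) (lab₁ (suc i))
      d₁ i j i<j = ne {lab₁ (suc i)} {lab₁ (suc j)} (mono₁ (suc i) (suc j) (s≤s i<j))
      d₂ : ∀ i j → i ℕ.< j → Distinct (lab₂ j) (lab₂ i)
      d₂ i j i<j = ne {lab₂ i} {lab₂ j} (mono₂ i j i<j)
      dist : AllPairs Distinct ys
      dist = pairs-ys d₁ d₂ (λ i j → cross (suc i) j)
      splits′ : ∀ {l m} → e₁ ℕ.≤ proj₂ l → e₁ ℕ.≤ proj₂ m → Distinct l m → Splits f l m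
      splits′ {l} {m} = splits f e₁ e₀≤e₁ f-inverse {l} {m}
      splitting : AllPairs (Splits f) ys
      splitting = pairs-ys (λ i j i<j → splits′ {lab₁ (suc j)} {lab₁ (suc i)} (b₁ j) (b₁ i) (d₁ i j i<j))
        (λ i j i<j → splits′ {lab₂ j} {lab₂ i} (b₂ j) (b₂ i) (d₂ i j i<j))
        (λ i j → splits′ {lab₁ (suc i)} {lab₂ j} (b₁ i) (b₂ j) (cross (suc i) j))
      heads : All (λ i → f i ≈ d v i + d i v * (V * f i)) ys
      heads = all-ys (λ i → head-splits f e₁ e₀≤e₁ f-inverse {v} {lab₁ (suc i)} (mono₁ 0 (suc i) (s≤s z≤n)) b₀ (b₁ i))
                     (λ j → head-splits f e₁ e₀≤e₁ f-inverse {v} {lab₂ j} (below j) b₀ (b₂ j))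

-- Theta products at the points of the other family.

module ThetaValues (R : CommutativeRing 0ℓ 0ℓ) (M : ℕ) (x : CommutativeRing.Carrier R) (x^M≈0 : Vanishes R M x) where
  open CommutativeRing R
  open IntegerSolver R
  open FiniteSums R
  open Nilpotent R M x x^M≈0
  open CrossResidues R M x x^M≈0
  open import Algebra.Properties.Semiring.Exp semiring
  open import Relation.Binary.Reasoning.Setoid setoid

  -- large enough for every product below to have reached its limit
  N₂ N₁ N : ℕ
  N₂ = 8 ℕ.* M ℕ.+ 7
  N₁ = suc N₂
  N  = suc N₁

  M≤N₁ : M ℕ.≤ N₁
  M≤N₁ = ℕₚ.≤-trans (ℕₚ.m≤n*m M 8) (ℕₚ.m≤n⇒m≤1+n (ℕₚ.m≤m+n _ 7))

  -- The value of `N₂` is chosen for this: N₁ = 8M + 8 exceeds e + M whenever e is at most 7M + 7,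
  -- and the arguments met below do not even exceed 4M + 1.
  large : ∀ {e} c o → 1 ℕ.≤ c → e ℕ.≤ 7 ℕ.* M ℕ.+ 7 → e ℕ.+ M ℕ.< c ℕ.* N₁ ℕ.+ o
  large {e} c o 1≤c e≤ = ℕₚ.≤-trans (s≤s (ℕₚ.+-monoˡ-≤ M e≤)) (ℕₚ.≤-trans (ℕₚ.≤-reflexive (eq M))
    (ℕₚ.≤-trans (ℕₚ.≤-trans (ℕₚ.≤-reflexive (≡.sym (ℕₚ.*-identityˡ N₁))) (ℕₚ.*-monoˡ-≤ N₁ 1≤c)) (ℕₚ.m≤m+n _ o)))
    where
    eq : ∀ M → suc (7 ℕ.* M ℕ.+ 7 ℕ.+ M) ≡ suc (8 ℕ.* M ℕ.+ 7)
    eq = S.solve 1 (λ M → S.con 1 S.:+ (S.con 7 S.:* M S.:+ S.con 7 S.:+ M) S.:= S.con 1 S.:+ (S.con 8 S.:* M S.:+ S.con 7)) ≡.refl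
      where module S = +-*-Solver

  -- ω = 1 / (−x ; x²)_∞
  ω ω₁ ω₃ : Carrier
  ω  = ∏ N (λ m → γ (suc (2 ℕ.* m)))
  ω₁ = ∏ N (λ m → γ (1 ℕ.+ 4 ℕ.* m))
  ω₃ = ∏ N (λ m → γ (3 ℕ.+ 4 ℕ.* m))

  private
    drop-last : ∀ a b → ∏ N (λ m → γ (suc a ℕ.+ suc b ℕ.* m)) ≈ ∏ N₁ (λ m → γ (suc a ℕ.+ suc b ℕ.* m))
    drop-last a b = trans (*-congˡ (γ-large (ℕₚ.≤-trans M≤N₁ (ℕₚ.≤-trans (ℕₚ.m≤n*m N₁ (suc b)) (ℕₚ.m≤n+m _ (suc a)))) (s≤s z≤n))) (*-identityʳ _)

  ω₁ω₃ : ω₁ * ω₃ ≈ ω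
  ω₁ω₃ = begin
    ω₁ * ω₃ ≈⟨ *-cong (∏-cong N λ m _ → reflexive (≡.cong γ (eq₁ m))) (∏-cong N λ m _ → reflexive (≡.cong γ (eq₃ m))) ⟩
    ∏ N (λ m → γ (suc (2 ℕ.* (m ℕ.+ m)))) * ∏ N (λ m → γ (suc (2 ℕ.* suc (m ℕ.+ m)))) ≈⟨ sym (∏-parity N) ⟩
    ∏ (N ℕ.+ N) (λ m → γ (suc (2 ℕ.* m))) ≈⟨ ∏-truncate (ℕₚ.m≤m+n N N) (λ m N≤m →
      γ-large (ℕₚ.m≤n⇒m≤1+n (ℕₚ.≤-trans (ℕₚ.≤-trans M≤N₁ (ℕₚ.n≤1+n N₁)) (ℕₚ.≤-trans N≤m (ℕₚ.m≤n*m m 2)))) (s≤s z≤n)) ⟩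
    ω ∎
    where
    module S = +-*-Solver
    eq₁ : ∀ m → 1 ℕ.+ 4 ℕ.* m ≡ suc (2 ℕ.* (m ℕ.+ m))
    eq₁ = S.solve 1 (λ m → S.con 1 S.:+ S.con 4 S.:* m S.:= S.con 1 S.:+ (S.con 2 S.:* (m S.:+ m))) ≡.refl
    eq₃ : ∀ m → 3 ℕ.+ 4 ℕ.* m ≡ suc (2 ℕ.* suc (m ℕ.+ m))
    eq₃ = S.solve 1 (λ m → S.con 3 S.:+ S.con 4 S.:* m S.:= S.con 1 S.:+ (S.con 2 S.:* (S.con 1 S.:+ (m S.:+ m)))) ≡.refl

  module Q42 = Quasiperiod 4 2 N₁
  module Q40 = Quasiperiod 4 0 N₁
  module Q21 = Quasiperiod 2 1 N₁

  private
    module S = +-*-Solver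

    E-at : ∀ {a} k b → a ≡ suc k ℕ.+ b → E a b ≈ γ (suc k)
    E-at k b e = trans (reflexive (≡.cong (λ z → E z b) e)) (E-> k b)

    γ-at : ∀ {a b} → a ≡ b → γ a ≈ γ b
    γ-at e = reflexive (≡.cong γ e)

    γ₅ : γ 1 * ∏ N (λ m → γ (5 ℕ.+ 4 ℕ.* m)) ≈ ω₁
    γ₅ = trans (*-congˡ (trans (drop-last 4 3) (∏-cong N₁ λ m _ → γ-at (eq m)))) (sym (∏-head N₁))
      where
      eq : ∀ m → 5 ℕ.+ 4 ℕ.* m ≡ 1 ℕ.+ 4 ℕ.* suc m
      eq = S.solve 1 (λ m → S.con 5 S.:+ S.con 4 S.:* m S.:= S.con 1 S.:+ S.con 4 S.:* (S.con 1 S.:+ m)) ≡.refl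

    Ψ42-1 : Q42.Ψ 1 ≈ ω
    Ψ42-1 = trans (*-cong (∏-cong N λ m _ → E-at (4 ℕ.* m) 1 (eq m)) (∏-cong N λ m _ → γ-at (eq′ m))) ω₁ω₃
      where
      eq : ∀ m → 4 ℕ.* m ℕ.+ 2 ≡ suc (4 ℕ.* m) ℕ.+ 1
      eq = S.solve 1 (λ m → S.con 4 S.:* m S.:+ S.con 2 S.:= S.con 1 S.:+ S.con 4 S.:* m S.:+ S.con 1) ≡.refl
      eq′ : ∀ m → 1 ℕ.+ (4 ℕ.* m ℕ.+ 2) ≡ 3 ℕ.+ 4 ℕ.* m
      eq′ = S.solve 1 (λ m → S.con 1 S.:+ (S.con 4 S.:* m S.:+ S.con 2) S.:= S.con 3 S.:+ S.con 4 S.:* m) ≡.refl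

    Ψ42-3 : Q42.Ψ 3 ≈ x ^ 1 * ω
    Ψ42-3 = begin
      ∏ N (λ m → E (4 ℕ.* m ℕ.+ 2) 3) * ∏ N (λ m → γ (3 ℕ.+ (4 ℕ.* m ℕ.+ 2)))
        ≈⟨ *-cong (∏-head N₁) (∏-cong N λ m _ → γ-at (eq m)) ⟩
      E 2 3 * ∏ N₁ (λ m → E (4 ℕ.* suc m ℕ.+ 2) 3) * ∏ N (λ m → γ (5 ℕ.+ 4 ℕ.* m))
        ≈⟨ *-congʳ (*-cong (E-< 0 2) (trans (∏-cong N₁ λ m _ → E-at (2 ℕ.+ 4 ℕ.* m) 3 (eq′ m)) (sym (drop-last 2 3)))) ⟩
      x ^ 1 * γ 1 * ω₃ * ∏ N (λ m → γ (5 ℕ.+ 4 ℕ.* m))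
        ≈⟨ solve 4 (λ a b c d → a :* b :* c :* d := a :* ((b :* d) :* c)) refl (x ^ 1) _ _ _ ⟩
      x ^ 1 * (γ 1 * ∏ N (λ m → γ (5 ℕ.+ 4 ℕ.* m)) * ω₃) ≈⟨ *-congˡ (trans (*-congʳ γ₅) ω₁ω₃) ⟩
      x ^ 1 * ω ∎
      where
      eq : ∀ m → 3 ℕ.+ (4 ℕ.* m ℕ.+ 2) ≡ 5 ℕ.+ 4 ℕ.* m
      eq = S.solve 1 (λ m → S.con 3 S.:+ (S.con 4 S.:* m S.:+ S.con 2) S.:= S.con 5 S.:+ S.con 4 S.:* m) ≡.refl
      eq′ : ∀ m → 4 ℕ.* suc m ℕ.+ 2 ≡ suc (2 ℕ.+ 4 ℕ.* m) ℕ.+ 3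
      eq′ = S.solve 1 (λ m → S.con 4 S.:* (S.con 1 S.:+ m) S.:+ S.con 2 S.:= S.con 1 S.:+ (S.con 2 S.:+ S.con 4 S.:* m) S.:+ S.con 3) ≡.refl

    bound : ∀ n → n ℕ.≤ M → 2 ℕ.* n ℕ.+ 1 ℕ.≤ 7 ℕ.* M ℕ.+ 7
    bound n n≤M = ℕₚ.+-mono-≤ (ℕₚ.*-mono-≤ {2} {7} (s≤s (s≤s z≤n)) n≤M) (s≤s z≤n)

  -- The period 4 in the argument is two steps in n, hence two starting values, at 1 and 3. A double
  -- step adds 2n + 3 to the exponent, which is tri (n + 2) - tri n.
  Ψ42-odd : ∀ n → n ℕ.≤ M → Q42.Ψ (2 ℕ.* n ℕ.+ 1) ≈ x ^ tri n * ω
  Ψ42-odd zero          _ = trans Ψ42-1 (sym (*-identityˡ _))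
  Ψ42-odd (suc zero)    _ = Ψ42-3
  Ψ42-odd (suc (suc n)) n≤M = begin
    Q42.Ψ (2 ℕ.* suc (suc n) ℕ.+ 1) ≡⟨ ≡.cong Q42.Ψ (eq n) ⟩
    Q42.Ψ (2 ℕ.* n ℕ.+ 1 ℕ.+ 4) ≈⟨ Q42.Ψ-step-centred (2 ℕ.* n ℕ.+ 1) ≡.refl (s≤s z≤n) (large 4 2 (s≤s z≤n) (bound n n≤M′)) ⟩
    x ^ (2 ℕ.* n ℕ.+ 1 ℕ.+ 2) * Q42.Ψ (2 ℕ.* n ℕ.+ 1) ≈⟨ *-congˡ (Ψ42-odd n n≤M′) ⟩
    x ^ (2 ℕ.* n ℕ.+ 1 ℕ.+ 2) * (x ^ tri n * ω) ≈⟨ trans (sym (*-assoc _ _ _)) (*-congʳ (sym (^-homo-* x (2 ℕ.* n ℕ.+ 1 ℕ.+ 2) (tri n)))) ⟩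
    x ^ (2 ℕ.* n ℕ.+ 1 ℕ.+ 2 ℕ.+ tri n) * ω ≈⟨ *-congʳ (^-congʳ x (eq′ n (tri n))) ⟩
    x ^ tri (suc (suc n)) * ω ∎
    where
    n≤M′ : n ℕ.≤ M
    n≤M′ = ℕₚ.≤-trans (ℕₚ.m≤n+m n 2) n≤M
    eq : ∀ n → 2 ℕ.* suc (suc n) ℕ.+ 1 ≡ 2 ℕ.* n ℕ.+ 1 ℕ.+ 4
    eq = S.solve 1 (λ n → S.con 2 S.:* (S.con 2 S.:+ n) S.:+ S.con 1 S.:= S.con 2 S.:* n S.:+ S.con 1 S.:+ S.con 4) ≡.refl
    eq′ : ∀ n t → 2 ℕ.* n ℕ.+ 1 ℕ.+ 2 ℕ.+ t ≡ t ℕ.+ suc n ℕ.+ suc (suc n)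
    eq′ = S.solve 2 (λ n t → S.con 2 S.:* n S.:+ S.con 1 S.:+ S.con 2 S.:+ t S.:= t S.:+ (S.con 1 S.:+ n) S.:+ (S.con 2 S.:+ n)) ≡.refl

  Ψ40-odd : ∀ n → n ℕ.≤ M → (1# + x ^ (2 ℕ.* n ℕ.+ 1)) * Q40.Ψ (2 ℕ.* n ℕ.+ 1) ≈ x ^ tri (suc n) * ω
  Ψ40-odd zero _ = begin
    (1# + x ^ 1) * (∏ N (λ m → E (4 ℕ.* m ℕ.+ 0) 1) * ∏ N (λ m → γ (1 ℕ.+ (4 ℕ.* m ℕ.+ 0))))
      ≈⟨ *-congˡ (*-cong (∏-head N₁) (∏-cong N λ m _ → γ-at (≡.cong suc (ℕₚ.+-identityʳ (4 ℕ.* m))))) ⟩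
    (1# + x ^ 1) * (E 0 1 * ∏ N₁ (λ m → E (4 ℕ.* suc m ℕ.+ 0) 1) * ω₁)
      ≈⟨ *-congˡ (*-congʳ (*-cong (E-< 0 0) (trans (∏-cong N₁ λ m _ → E-at (2 ℕ.+ 4 ℕ.* m) 1 (eq m)) (sym (drop-last 2 3))))) ⟩
    (1# + x ^ 1) * (x ^ 1 * γ 1 * ω₃ * ω₁)
      ≈⟨ solve 5 (λ a b c d e → a :* (b :* c :* d :* e) := a :* c :* (b :* (e :* d))) refl (1# + x ^ 1) (x ^ 1) (γ 1) ω₃ ω₁ ⟩
    (1# + x ^ 1) * γ 1 * (x ^ 1 * (ω₁ * ω₃)) ≈⟨ trans (*-congʳ (γ-inverse 0)) (trans (*-identityˡ _) (*-congˡ ω₁ω₃)) ⟩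
    x ^ 1 * ω ∎
    where
    eq : ∀ m → 4 ℕ.* suc m ℕ.+ 0 ≡ suc (2 ℕ.+ 4 ℕ.* m) ℕ.+ 1
    eq = S.solve 1 (λ m → S.con 4 S.:* (S.con 1 S.:+ m) S.:+ S.con 0 S.:= S.con 1 S.:+ (S.con 2 S.:+ S.con 4 S.:* m) S.:+ S.con 1) ≡.refl
  Ψ40-odd (suc zero) _ = begin
    (1# + x ^ 3) * (∏ N (λ m → E (4 ℕ.* m ℕ.+ 0) 3) * ∏ N (λ m → γ (3 ℕ.+ (4 ℕ.* m ℕ.+ 0))))
      ≈⟨ *-congˡ (*-cong (∏-head N₁) (∏-cong N λ m _ → γ-at (≡.cong (3 ℕ.+_) (ℕₚ.+-identityʳ (4 ℕ.* m))))) ⟩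
    (1# + x ^ 3) * (E 0 3 * ∏ N₁ (λ m → E (4 ℕ.* suc m ℕ.+ 0) 3) * ω₃)
      ≈⟨ *-congˡ (*-congʳ (*-cong (E-< 2 0) (trans (∏-cong N₁ λ m _ → E-at (4 ℕ.* m) 3 (eq m)) (sym (drop-last 0 3))))) ⟩
    (1# + x ^ 3) * (x ^ 3 * γ 3 * ω₁ * ω₃)
      ≈⟨ solve 5 (λ a b c d e → a :* (b :* c :* d :* e) := a :* c :* (b :* (d :* e))) refl (1# + x ^ 3) (x ^ 3) (γ 3) ω₁ ω₃ ⟩
    (1# + x ^ 3) * γ 3 * (x ^ 3 * (ω₁ * ω₃)) ≈⟨ trans (*-congʳ (γ-inverse 2)) (trans (*-identityˡ _) (*-congˡ ω₁ω₃)) ⟩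
    x ^ 3 * ω ∎
    where
    eq : ∀ m → 4 ℕ.* suc m ℕ.+ 0 ≡ suc (4 ℕ.* m) ℕ.+ 3
    eq = S.solve 1 (λ m → S.con 4 S.:* (S.con 1 S.:+ m) S.:+ S.con 0 S.:= S.con 1 S.:+ S.con 4 S.:* m S.:+ S.con 3) ≡.refl
  Ψ40-odd (suc (suc n)) n≤M = begin
    (1# + x ^ (2 ℕ.* suc (suc n) ℕ.+ 1)) * Q40.Ψ (2 ℕ.* suc (suc n) ℕ.+ 1) ≡⟨ ≡.cong (λ k → (1# + x ^ k) * Q40.Ψ k) (eq n) ⟩
    (1# + x ^ (suc (2 ℕ.* n) ℕ.+ 4)) * Q40.Ψ (suc (2 ℕ.* n) ℕ.+ 4)
      ≈⟨ Q40.Ψ-step-origin (2 ℕ.* n) ≡.refl (s≤s z≤n) (large 4 0 (s≤s z≤n) (ℕₚ.≤-trans (ℕₚ.≤-reflexive (ℕₚ.+-comm 1 (2 ℕ.* n))) (bound n n≤M′))) ⟩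
    x ^ (suc (2 ℕ.* n) ℕ.+ 4) * ((1# + x ^ suc (2 ℕ.* n)) * Q40.Ψ (suc (2 ℕ.* n)))
      ≈⟨ *-congˡ (trans (reflexive (≡.cong (λ k → (1# + x ^ k) * Q40.Ψ k) (ℕₚ.+-comm 1 (2 ℕ.* n)))) (Ψ40-odd n n≤M′)) ⟩
    x ^ (suc (2 ℕ.* n) ℕ.+ 4) * (x ^ tri (suc n) * ω) ≈⟨ trans (sym (*-assoc _ _ _)) (*-congʳ (sym (^-homo-* x (suc (2 ℕ.* n) ℕ.+ 4) (tri (suc n))))) ⟩
    x ^ (suc (2 ℕ.* n) ℕ.+ 4 ℕ.+ tri (suc n)) * ω ≈⟨ *-congʳ (^-congʳ x (eq′ n (tri (suc n)))) ⟩
    x ^ tri (suc (suc (suc n))) * ω ∎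
    where
    n≤M′ : n ℕ.≤ M
    n≤M′ = ℕₚ.≤-trans (ℕₚ.m≤n+m n 2) n≤M
    eq : ∀ n → 2 ℕ.* suc (suc n) ℕ.+ 1 ≡ suc (2 ℕ.* n) ℕ.+ 4
    eq = S.solve 1 (λ n → S.con 2 S.:* (S.con 2 S.:+ n) S.:+ S.con 1 S.:= S.con 1 S.:+ S.con 2 S.:* n S.:+ S.con 4) ≡.refl
    eq′ : ∀ n t → suc (2 ℕ.* n) ℕ.+ 4 ℕ.+ t ≡ t ℕ.+ suc (suc n) ℕ.+ suc (suc (suc n))
    eq′ = S.solve 2 (λ n t → S.con 1 S.:+ S.con 2 S.:* n S.:+ S.con 4 S.:+ t S.:= t S.:+ (S.con 2 S.:+ n) S.:+ (S.con 3 S.:+ n)) ≡.refl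

  -- At the argument 0 both halves of Ψ are ω. Each further step adds 2k + 1, the difference of
  -- consecutive squares.
  Ψ21-even : ∀ k → k ℕ.≤ suc (M ℕ.+ M) → Q21.Ψ (2 ℕ.* k) ≈ x ^ (k ℕ.* k) * (ω * ω)
  Ψ21-even zero _ = trans (*-cong (∏-cong N λ m _ → E-at (2 ℕ.* m) 0 (eq m)) (∏-cong N λ m _ → γ-at (ℕₚ.+-comm (2 ℕ.* m) 1))) (sym (*-identityˡ _))
    where
    eq : ∀ m → 2 ℕ.* m ℕ.+ 1 ≡ suc (2 ℕ.* m) ℕ.+ 0
    eq = S.solve 1 (λ m → S.con 2 S.:* m S.:+ S.con 1 S.:= S.con 1 S.:+ S.con 2 S.:* m S.:+ S.con 0) ≡.refl
  Ψ21-even (suc k) k≤ = begin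
    Q21.Ψ (2 ℕ.* suc k) ≡⟨ ≡.cong Q21.Ψ (eq k) ⟩
    Q21.Ψ (2 ℕ.* k ℕ.+ 2) ≈⟨ Q21.Ψ-step-centred (2 ℕ.* k) ≡.refl (s≤s z≤n) (large 2 1 (s≤s z≤n) bound′) ⟩
    x ^ (2 ℕ.* k ℕ.+ 1) * Q21.Ψ (2 ℕ.* k) ≈⟨ *-congˡ (Ψ21-even k (ℕₚ.<⇒≤ k≤)) ⟩
    x ^ (2 ℕ.* k ℕ.+ 1) * (x ^ (k ℕ.* k) * (ω * ω)) ≈⟨ trans (sym (*-assoc _ _ _)) (*-congʳ (sym (^-homo-* x (2 ℕ.* k ℕ.+ 1) (k ℕ.* k)))) ⟩
    x ^ (2 ℕ.* k ℕ.+ 1 ℕ.+ k ℕ.* k) * (ω * ω) ≈⟨ *-congʳ (^-congʳ x (eq′ k)) ⟩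
    x ^ (suc k ℕ.* suc k) * (ω * ω) ∎
    where
    eq : ∀ k → 2 ℕ.* suc k ≡ 2 ℕ.* k ℕ.+ 2
    eq = S.solve 1 (λ k → S.con 2 S.:* (S.con 1 S.:+ k) S.:= S.con 2 S.:* k S.:+ S.con 2) ≡.refl
    eq′ : ∀ k → 2 ℕ.* k ℕ.+ 1 ℕ.+ k ℕ.* k ≡ suc k ℕ.* suc k
    eq′ = S.solve 1 (λ k → S.con 2 S.:* k S.:+ S.con 1 S.:+ k S.:* k S.:= (S.con 1 S.:+ k) S.:* (S.con 1 S.:+ k)) ≡.refl
    bound′ : 2 ℕ.* k ℕ.≤ 7 ℕ.* M ℕ.+ 7
    bound′ = ℕₚ.≤-trans (ℕₚ.*-monoʳ-≤ 2 (ℕₚ.≤-pred k≤)) (ℕₚ.≤-trans (ℕₚ.≤-reflexive (eq″ M)) (ℕₚ.≤-trans (ℕₚ.*-monoˡ-≤ M {4} {7} (s≤s (s≤s (s≤s (s≤s z≤n))))) (ℕₚ.m≤m+n _ 7)))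
      where
      eq″ : ∀ M → 2 ℕ.* (M ℕ.+ M) ≡ 4 ℕ.* M
      eq″ = S.solve 1 (λ M → S.con 2 S.:* (M S.:+ M) S.:= S.con 4 S.:* M) ≡.refl

-- Lambert series in the bases x and x⁴.

2n+1≢4m+2 : ∀ n m → 2 ℕ.* n ℕ.+ 1 ≢ 4 ℕ.* m ℕ.+ 2
2n+1≢4m+2 n m e = ℕₚ.even≢odd (suc (2 ℕ.* m)) n (≡.trans (eq m) (≡.trans (≡.sym e) (ℕₚ.+-comm (2 ℕ.* n) 1)))
  where
  open +-*-Solver
  eq : ∀ m → 2 ℕ.* suc (2 ℕ.* m) ≡ 4 ℕ.* m ℕ.+ 2
  eq = solve 1 (λ m → con 2 :* (con 1 :+ con 2 :* m) := con 4 :* m :+ con 2) ≡.refl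

2n+1≢4m+0 : ∀ n m → 2 ℕ.* n ℕ.+ 1 ≢ 4 ℕ.* m ℕ.+ 0
2n+1≢4m+0 n m e = ℕₚ.even≢odd (2 ℕ.* m) n (≡.trans (eq m) (≡.trans (≡.sym e) (ℕₚ.+-comm (2 ℕ.* n) 1)))
  where
  open +-*-Solver
  eq : ∀ m → 2 ℕ.* (2 ℕ.* m) ≡ 4 ℕ.* m ℕ.+ 0
  eq = solve 1 (λ m → con 2 :* (con 2 :* m) := con 4 :* m :+ con 0) ≡.refl

4m+0≢2n+1 : ∀ m n → 4 ℕ.* m ℕ.+ 0 ≢ 2 ℕ.* n ℕ.+ 1
4m+0≢2n+1 m n e = 2n+1≢4m+0 n m (≡.sym e)

module LambertIdentities (R : CommutativeRing 0ℓ 0ℓ) (M : ℕ) (x : CommutativeRing.Carrier R) (x^M≈0 : Vanishes R M x) where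
  open CommutativeRing R
  open IntegerSolver R
  open FiniteSums R
  open Nilpotent R M x x^M≈0
  open Families R M x x^M≈0
  open TwoFamilies R M x x^M≈0
  open ThetaValues R M x x^M≈0
  open import Algebra.Properties.Semiring.Exp semiring
  open import Relation.Binary.Reasoning.Setoid setoid

  -- Paired as forms in w + 1/w, the three families are the factors of (wx, x/w; x²)_∞, of (-wx²,
  -- -x²/w; x⁴)_∞ and of (-w, -1/w; x⁴)_∞. The pair of degree 0 in the last one is the form without
  -- x.
  module FA = Family Sign.+ 2 1 1 (s≤s z≤n) ≡.refl
  module FB = Family Sign.- 4 2 1 (s≤s z≤n) ≡.refl
  module FO = Family Sign.- 4 0 0 (s≤s z≤n) ≡.refl
  module P2 = Pochhammer R M (x ^ 2) (vanishes-^ 2 (s≤s z≤n))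
  module P4 = Pochhammer R M (x ^ 4) (vanishes-^ 4 (s≤s z≤n))

  i₂ i₄ : Carrier
  i₂ = P2.P⁻¹ M
  i₄ = P4.P⁻¹ M

  private
    module S = +-*-Solver

    σ+- : 1# * - 1# ≈ - 1#
    σ+- = *-identityˡ _

    σ-+ : - 1# * 1# ≈ - 1#
    σ-+ = *-identityʳ _

    split-N : ∀ {n} → n ℕ.< N → n ℕ.+ suc (N ℕ.∸ suc n) ≡ N
    split-N {n} n<N = ≡.trans (ℕₚ.+-suc n _) (ℕₚ.m+[n∸m]≡n n<N)

    M<N : ∀ {n} → n ℕ.< M → n ℕ.< N
    M<N n<M = ℕₚ.<-≤-trans n<M (ℕₚ.m≤n⇒m≤1+n M≤N₁)

    M≤N∸1+n : ∀ {n} → n ℕ.< M → M ℕ.≤ N ℕ.∸ suc n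
    M≤N∸1+n {n} n<M = ℕₚ.m+n≤o⇒m≤o∸n M (ℕₚ.≤-trans (ℕₚ.+-monoʳ-≤ M n<M) (ℕₚ.≤-trans (ℕₚ.≤-reflexive (eq M))
      (ℕₚ.≤-trans (ℕₚ.*-monoˡ-≤ M {2} {8} (s≤s (s≤s z≤n))) (ℕₚ.≤-trans (ℕₚ.m≤m+n _ 7) (ℕₚ.m≤n+m _ 2)))))
      where
      eq : ∀ M → M ℕ.+ M ≡ 2 ℕ.* M
      eq = S.solve 1 (λ M → M S.:+ M S.:= S.con 2 S.:* M) ≡.refl

  module SelfValues (s : Sign) (c o : ℕ) (1≤c : 1 ℕ.≤ c) (2o≡c : o ℕ.+ o ≡ c ℕ.* 1) where
    open Family s c o 1 1≤c 2o≡c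
    open Nilpotent R M (x ^ c) (vanishes-^ c 1≤c) using () renaming (x^≥M to X^≥M)

    private
      X = x ^ c
      exact : ∀ n → n ℕ.< N → let k = N ℕ.∸ suc n in
        ∏ N (λ j → d (lab n) (lab j)) ≈ sg n * X ^ tri n * (1# - X ^ (n ℕ.+ n ℕ.+ 1)) * (PX.P⁻¹ k * PX.P⁻¹ (n ℕ.+ n ℕ.+ 1 ℕ.+ k))
      exact n n<N = begin
        ∏ N (λ j → d (lab n) (lab j)) ≡⟨ ≡.cong (λ k → ∏ k (λ j → d (lab n) (lab j))) (≡.sym (split-N n<N)) ⟩
        ∏ (n ℕ.+ suc k) (λ j → d (lab n) (lab j)) ≈⟨ product n k n (ℕₚ.+-comm n 1) ⟩
        sg n * X ^ tri n * (PX.P⁻¹ n * PX.P n * (1# - X ^ (n ℕ.+ n ℕ.+ 1))) * (PX.P⁻¹ k * PX.P⁻¹ (n ℕ.+ n ℕ.+ 1 ℕ.+ k))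
          ≈⟨ *-congʳ (*-congˡ (trans (*-congʳ (trans (*-comm _ _) (PX.P-inverse n))) (*-identityˡ _))) ⟩
        sg n * X ^ tri n * (1# - X ^ (n ℕ.+ n ℕ.+ 1)) * (PX.P⁻¹ k * PX.P⁻¹ (n ℕ.+ n ℕ.+ 1 ℕ.+ k)) ∎
        where
        k = N ℕ.∸ suc n

    -- For n < M both inverse symbols in `exact` have at least M factors and may be replaced by
    -- their limits. For larger n this can fail, but there X^(tri n) is 0, as used in `self-large`.
    self : ∀ n → n ℕ.< M → ∏ N (λ j → d (lab n) (lab j)) ≈ sg n * X ^ tri n * (1# - X ^ (n ℕ.+ n ℕ.+ 1)) * (PX.P⁻¹ M * PX.P⁻¹ M)
    self n n<M = trans (exact n (M<N n<M))
      (*-congˡ (*-cong (PX.P⁻¹-stable (M≤N∸1+n n<M)) (PX.P⁻¹-stable (ℕₚ.≤-trans (M≤N∸1+n n<M) (ℕₚ.m≤n+m _ (n ℕ.+ n ℕ.+ 1))))))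

    self-large : ∀ n → M ℕ.≤ n → n ℕ.< N → ∏ N (λ j → d (lab n) (lab j)) ≈ 0#
    self-large n M≤n n<N = trans (exact n n<N) (trans (*-congʳ (*-congʳ (*-congˡ (X^≥M (ℕₚ.≤-trans M≤n (n≤tri[n] n))))))
      (solve 3 (λ a b c → a :* :0 :* b :* c := :0) refl _ _ _))

  module SA = SelfValues Sign.+ 2 1 (s≤s z≤n) ≡.refl
  module SB = SelfValues Sign.- 4 2 (s≤s z≤n) ≡.refl

  -- For m > 0 this is (1 - X^(2m)) / (1 - X^m) with X = x⁴. At m = 0 the residue is just
  -- (X;X)_∞^(-2), so the value is 1 and not the 2 that 1 + X⁰ would give.
  κ : ℕ → Carrier
  κ zero    = 1#
  κ (suc m) = 1# + (x ^ 4) ^ suc m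

  private
    X₄ = x ^ 4
    open Nilpotent R M X₄ (vanishes-^ 4 (s≤s z≤n)) using () renaming (x^≥M to X₄^≥M)

    exact₀ : ∀ n → n ℕ.< N → let k = N ℕ.∸ suc n in
      ∏ N (λ j → d (FO.lab n) (FO.lab j)) ≈ sg n * X₄ ^ tri n * κ n * (P4.P⁻¹ k * P4.P⁻¹ (n ℕ.+ n ℕ.+ 0 ℕ.+ k))
    exact₀ zero n<N = begin
      ∏ N (λ j → d (FO.lab 0) (FO.lab j)) ≈⟨ trans (FO.both 0 N₁) (trans (*-identityˡ _) (FO.right 0 N₁)) ⟩
      P4.P⁻¹ N₁ * (1# * P4.P⁻¹ N₁) ≈⟨ solve 2 (λ a b → a :* (:1 :* b) := :1 :* :1 :* :1 :* (a :* b)) refl _ _ ⟩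
      1# * 1# * 1# * (P4.P⁻¹ N₁ * P4.P⁻¹ N₁) ∎
    exact₀ (suc n) n<N = begin
      ∏ N (λ j → d (FO.lab (suc n)) (FO.lab j)) ≡⟨ ≡.cong (λ k → ∏ k (λ j → d (FO.lab (suc n)) (FO.lab j))) (≡.sym (split-N n<N)) ⟩
      ∏ (suc n ℕ.+ suc k) (λ j → d (FO.lab (suc n)) (FO.lab j)) ≈⟨ FO.product (suc n) k n (ℕₚ.+-identityʳ (suc n)) ⟩
      S * (P4.P⁻¹ (suc n) * P4.P n * (1# - X₄ ^ (suc n ℕ.+ suc n ℕ.+ 0))) * Q
        ≈⟨ *-congʳ (*-congˡ (*-congˡ (+-congˡ (-‿cong (trans (^-congʳ X₄ (ℕₚ.+-identityʳ (suc n ℕ.+ suc n))) (^-homo-* X₄ (suc n) (suc n))))))) ⟩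
      S * (P4.P⁻¹ n * P4.g (suc n) * P4.P n * (1# - X₄ ^ suc n * X₄ ^ suc n)) * Q
        ≈⟨ *-congʳ (*-congˡ (solve 4 (λ a g p X → a :* g :* p :* (:1 :- X :* X) := p :* a :* ((:1 :- X) :* g) :* (:1 :+ X)) refl (P4.P⁻¹ n) (P4.g (suc n)) (P4.P n) (X₄ ^ suc n))) ⟩
      S * (P4.P n * P4.P⁻¹ n * ((1# - X₄ ^ suc n) * P4.g (suc n)) * (1# + X₄ ^ suc n)) * Q
        ≈⟨ *-congʳ (*-congˡ (trans (*-congʳ (trans (*-cong (P4.P-inverse n) (P4.g-inverse n)) (*-identityˡ _))) (*-identityˡ _))) ⟩
      S * κ (suc n) * Q ∎
      where
      k = N ℕ.∸ suc (suc n)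
      S = sg (suc n) * X₄ ^ tri (suc n)
      Q = P4.P⁻¹ k * P4.P⁻¹ (suc n ℕ.+ suc n ℕ.+ 0 ℕ.+ k)

    self₀ : ∀ n → n ℕ.< M → ∏ N (λ j → d (FO.lab n) (FO.lab j)) ≈ sg n * X₄ ^ tri n * κ n * (i₄ * i₄)
    self₀ n n<M = trans (exact₀ n (M<N n<M))
      (*-congˡ (*-cong (P4.P⁻¹-stable (M≤N∸1+n n<M)) (P4.P⁻¹-stable (ℕₚ.≤-trans (M≤N∸1+n n<M) (ℕₚ.m≤n+m _ (n ℕ.+ n ℕ.+ 0))))))

    self₀-large : ∀ n → M ℕ.≤ n → n ℕ.< N → ∏ N (λ j → d (FO.lab n) (FO.lab j)) ≈ 0#
    self₀-large n M≤n n<N = trans (exact₀ n n<N) (trans (*-congʳ (*-congʳ (*-congˡ (X₄^≥M (ℕₚ.≤-trans M≤n (n≤tri[n] n))))))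
      (solve 3 (λ a b c → a :* :0 :* b :* c := :0) refl _ _ _))

    cross-A-B : ∀ n → n ℕ.< M → ∏ N (λ j → d (FA.lab n) (FB.lab j)) ≈ x ^ tri n * ω
    cross-A-B n n<M = trans (Q42.d-product Sign.+ Sign.- (2 ℕ.* n ℕ.+ 1) σ+- (2n+1≢4m+2 n)) (Ψ42-odd n (ℕₚ.<⇒≤ n<M))

    cross-A-O : ∀ n → n ℕ.< M → (1# + x ^ (2 ℕ.* n ℕ.+ 1)) * ∏ N (λ j → d (FA.lab n) (FO.lab j)) ≈ x ^ tri (suc n) * ω
    cross-A-O n n<M = trans (*-congˡ (Q40.d-product Sign.+ Sign.- (2 ℕ.* n ℕ.+ 1) σ+- (2n+1≢4m+0 n))) (Ψ40-odd n (ℕₚ.<⇒≤ n<M))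

    cross-B-A : ∀ m → m ℕ.< M → ∏ N (λ j → d (FB.lab m) (FA.lab j)) ≈ x ^ (suc (2 ℕ.* m) ℕ.* suc (2 ℕ.* m)) * (ω * ω)
    cross-B-A m m<M = trans (Q21.d-product Sign.- Sign.+ (4 ℕ.* m ℕ.+ 2) σ-+ (λ k e → 2n+1≢4m+2 k m (≡.sym e)))
      (trans (reflexive (≡.cong Q21.Ψ (eq m))) (Ψ21-even (suc (2 ℕ.* m)) (s≤s (ℕₚ.≤-trans (ℕₚ.≤-reflexive (eq′ m)) (ℕₚ.+-mono-≤ (ℕₚ.<⇒≤ m<M) (ℕₚ.<⇒≤ m<M))))))
      where
      eq : ∀ m → 4 ℕ.* m ℕ.+ 2 ≡ 2 ℕ.* suc (2 ℕ.* m)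
      eq = S.solve 1 (λ m → S.con 4 S.:* m S.:+ S.con 2 S.:= S.con 2 S.:* (S.con 1 S.:+ S.con 2 S.:* m)) ≡.refl
      eq′ : ∀ m → 2 ℕ.* m ≡ m ℕ.+ m
      eq′ = S.solve 1 (λ m → S.con 2 S.:* m S.:= m S.:+ m) ≡.refl

    cross-O-A : ∀ m → m ℕ.< M → ∏ N (λ j → d (FO.lab m) (FA.lab j)) ≈ x ^ (2 ℕ.* m ℕ.* (2 ℕ.* m)) * (ω * ω)
    cross-O-A m m<M = trans (Q21.d-product Sign.- Sign.+ (4 ℕ.* m ℕ.+ 0) σ-+ (λ k e → 2n+1≢4m+0 k m (≡.sym e)))
      (trans (reflexive (≡.cong Q21.Ψ (eq m))) (Ψ21-even (2 ℕ.* m) (ℕₚ.m≤n⇒m≤1+n (ℕₚ.≤-trans (ℕₚ.≤-reflexive (eq′ m)) (ℕₚ.+-mono-≤ (ℕₚ.<⇒≤ m<M) (ℕₚ.<⇒≤ m<M))))))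
      where
      eq : ∀ m → 4 ℕ.* m ℕ.+ 0 ≡ 2 ℕ.* (2 ℕ.* m)
      eq = S.solve 1 (λ m → S.con 4 S.:* m S.:+ S.con 0 S.:= S.con 2 S.:* (S.con 2 S.:* m)) ≡.refl
      eq′ : ∀ m → 2 ℕ.* m ≡ m ℕ.+ m
      eq′ = S.solve 1 (λ m → S.con 2 S.:* m S.:= m S.:+ m) ≡.refl

    merge : ∀ c a b e → c ℕ.* a ℕ.+ b ≡ e → (x ^ c) ^ a * x ^ b ≈ x ^ e
    merge c a b e p = trans (*-congʳ (^-assocʳ x c a)) (trans (sym (^-homo-* x (c ℕ.* a) b)) (^-congʳ x p))

    coefficient-A-B : ∀ n → n ℕ.< M → ∏ N (λ j → d (FA.lab n) (FA.lab j)) * ∏ N (λ j → d (FA.lab n) (FB.lab j))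
      ≈ sg n * x ^ (tri n ℕ.+ n ℕ.* suc n) * (1# - (x ^ 2) ^ (n ℕ.+ n ℕ.+ 1)) * (i₂ * i₂ * ω)
    coefficient-A-B n n<M = begin
      ∏ N (λ j → d (FA.lab n) (FA.lab j)) * ∏ N (λ j → d (FA.lab n) (FB.lab j))
        ≈⟨ *-cong (SA.self n n<M) (cross-A-B n n<M) ⟩
      sg n * (x ^ 2) ^ tri n * B * (i₂ * i₂) * (x ^ tri n * ω)
        ≈⟨ solve 6 (λ s a b i t w → s :* a :* b :* i :* (t :* w) := s :* (a :* t) :* b :* (i :* w)) refl (sg n) ((x ^ 2) ^ tri n) B (i₂ * i₂) (x ^ tri n) ω ⟩
      sg n * ((x ^ 2) ^ tri n * x ^ tri n) * B * (i₂ * i₂ * ω)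
        ≈⟨ *-congʳ (*-congʳ (*-congˡ (merge 2 (tri n) (tri n) (tri n ℕ.+ n ℕ.* suc n) (≡.trans (eq (tri n)) (≡.cong (tri n ℕ.+_) (tri-double n)))))) ⟩
      sg n * x ^ (tri n ℕ.+ n ℕ.* suc n) * B * (i₂ * i₂ * ω) ∎
      where
      B = 1# - (x ^ 2) ^ (n ℕ.+ n ℕ.+ 1)
      eq : ∀ t → 2 ℕ.* t ℕ.+ t ≡ t ℕ.+ (t ℕ.+ t)
      eq = S.solve 1 (λ t → S.con 2 S.:* t S.:+ t S.:= t S.:+ (t S.:+ t)) ≡.refl

    -- Since (2m + 1)² = 1 + 4m(m + 1), the square from the cross residue completes the triangular
    -- exponent in base x⁴ to three times itself and leaves one factor x. This is why both bases
    -- carry Lambert series of the same shape.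
    coefficient-B-A : ∀ m → m ℕ.< M → ∏ N (λ j → d (FB.lab m) (FA.lab j)) * ∏ N (λ j → d (FB.lab m) (FB.lab j))
      ≈ sg m * X₄ ^ (tri m ℕ.+ m ℕ.* suc m) * (1# - X₄ ^ (m ℕ.+ m ℕ.+ 1)) * (x * (i₄ * i₄ * (ω * ω)))
    coefficient-B-A m m<M = begin
      ∏ N (λ j → d (FB.lab m) (FA.lab j)) * ∏ N (λ j → d (FB.lab m) (FB.lab j))
        ≈⟨ *-cong (cross-B-A m m<M) (SB.self m m<M) ⟩
      x ^ e * (ω * ω) * (sg m * X₄ ^ tri m * B * (i₄ * i₄))
        ≈⟨ solve 6 (λ s a b i t w → t :* w :* (s :* a :* b :* i) := s :* (a :* t) :* b :* (i :* w)) refl (sg m) (X₄ ^ tri m) B (i₄ * i₄) (x ^ e) (ω * ω) ⟩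
      sg m * (X₄ ^ tri m * x ^ e) * B * (i₄ * i₄ * (ω * ω))
        ≈⟨ *-congʳ (*-congʳ (*-congˡ (trans (merge 4 (tri m) e (suc (4 ℕ.* (tri m ℕ.+ m ℕ.* suc m))) (eq (tri m) m)) (*-congˡ (sym (^-assocʳ x 4 (tri m ℕ.+ m ℕ.* suc m))))))) ⟩
      sg m * (x * X₄ ^ (tri m ℕ.+ m ℕ.* suc m)) * B * (i₄ * i₄ * (ω * ω))
        ≈⟨ solve 5 (λ s x a b i → s :* (x :* a) :* b :* i := s :* a :* b :* (x :* i)) refl (sg m) x (X₄ ^ (tri m ℕ.+ m ℕ.* suc m)) B _ ⟩
      sg m * X₄ ^ (tri m ℕ.+ m ℕ.* suc m) * B * (x * (i₄ * i₄ * (ω * ω))) ∎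
      where
      B = 1# - X₄ ^ (m ℕ.+ m ℕ.+ 1)
      e = suc (2 ℕ.* m) ℕ.* suc (2 ℕ.* m)
      eq : ∀ t m → 4 ℕ.* t ℕ.+ suc (2 ℕ.* m) ℕ.* suc (2 ℕ.* m) ≡ suc (4 ℕ.* (t ℕ.+ m ℕ.* suc m))
      eq = S.solve 2 (λ t m → S.con 4 S.:* t S.:+ (S.con 1 S.:+ S.con 2 S.:* m) S.:* (S.con 1 S.:+ S.con 2 S.:* m)
             S.:= S.con 1 S.:+ S.con 4 S.:* (t S.:+ m S.:* (S.con 1 S.:+ m))) ≡.refl

    coefficient-O-A : ∀ m → m ℕ.< M → ∏ N (λ j → d (FO.lab m) (FO.lab j)) * ∏ N (λ j → d (FO.lab m) (FA.lab j))
      ≈ sg m * X₄ ^ (tri m ℕ.+ m ℕ.* m) * κ m * (i₄ * i₄ * (ω * ω))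
    coefficient-O-A m m<M = begin
      ∏ N (λ j → d (FO.lab m) (FO.lab j)) * ∏ N (λ j → d (FO.lab m) (FA.lab j))
        ≈⟨ *-cong (self₀ m m<M) (cross-O-A m m<M) ⟩
      sg m * X₄ ^ tri m * κ m * (i₄ * i₄) * (x ^ e * (ω * ω))
        ≈⟨ solve 6 (λ s a b i t w → s :* a :* b :* i :* (t :* w) := s :* (a :* t) :* b :* (i :* w)) refl (sg m) (X₄ ^ tri m) (κ m) (i₄ * i₄) (x ^ e) (ω * ω) ⟩
      sg m * (X₄ ^ tri m * x ^ e) * κ m * (i₄ * i₄ * (ω * ω))
        ≈⟨ *-congʳ (*-congʳ (*-congˡ (trans (merge 4 (tri m) e (4 ℕ.* (tri m ℕ.+ m ℕ.* m)) (eq (tri m) m)) (sym (^-assocʳ x 4 (tri m ℕ.+ m ℕ.* m)))))) ⟩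
      sg m * X₄ ^ (tri m ℕ.+ m ℕ.* m) * κ m * (i₄ * i₄ * (ω * ω)) ∎
      where
      e = 2 ℕ.* m ℕ.* (2 ℕ.* m)
      eq : ∀ t m → 4 ℕ.* t ℕ.+ 2 ℕ.* m ℕ.* (2 ℕ.* m) ≡ 4 ℕ.* (t ℕ.+ m ℕ.* m)
      eq = S.solve 2 (λ t m → S.con 4 S.:* t S.:+ S.con 2 S.:* m S.:* (S.con 2 S.:* m) S.:= S.con 4 S.:* (t S.:+ m S.:* m)) ≡.refl

    coefficient-A-O : ∀ n → n ℕ.< M → ∏ N (λ j → d (FA.lab n) (FO.lab j)) * ∏ N (λ j → d (FA.lab n) (FA.lab j))
      ≈ sg n * x ^ (n ℕ.* suc n ℕ.+ tri (suc n)) * (1# - x ^ (2 ℕ.* n ℕ.+ 1)) * (i₂ * i₂ * ω)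
    coefficient-A-O n n<M = begin
      C * ∏ N (λ j → d (FA.lab n) (FA.lab j)) ≈⟨ *-congˡ (SA.self n n<M) ⟩
      C * (sg n * (x ^ 2) ^ tri n * (1# - (x ^ 2) ^ (n ℕ.+ n ℕ.+ 1)) * (i₂ * i₂))
        ≈⟨ *-congˡ (*-congʳ (*-congˡ (+-congˡ (-‿cong (trans (^-assocʳ x 2 (n ℕ.+ n ℕ.+ 1)) (trans (^-congʳ x (eq n)) (^-homo-* x e e))))))) ⟩
      C * (sg n * (x ^ 2) ^ tri n * (1# - x ^ e * x ^ e) * (i₂ * i₂))
        -- 1 - x^(2e) = (1 - x^e)(1 + x^e) supplies the factor 1 + x^e with which `cross-A-O` is
        -- stated.
        ≈⟨ solve 5 (λ c s a X i → c :* (s :* a :* (:1 :- X :* X) :* i) := s :* a :* (:1 :- X) :* i :* ((:1 :+ X) :* c)) refl C (sg n) ((x ^ 2) ^ tri n) (x ^ e) (i₂ * i₂) ⟩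
      sg n * (x ^ 2) ^ tri n * (1# - x ^ e) * (i₂ * i₂) * ((1# + x ^ e) * C)
        ≈⟨ *-congˡ (cross-A-O n n<M) ⟩
      sg n * (x ^ 2) ^ tri n * (1# - x ^ e) * (i₂ * i₂) * (x ^ tri (suc n) * ω)
        ≈⟨ solve 6 (λ s a b i t w → s :* a :* b :* i :* (t :* w) := s :* (a :* t) :* b :* (i :* w)) refl (sg n) ((x ^ 2) ^ tri n) (1# - x ^ e) (i₂ * i₂) (x ^ tri (suc n)) ω ⟩
      sg n * ((x ^ 2) ^ tri n * x ^ tri (suc n)) * (1# - x ^ e) * (i₂ * i₂ * ω)
        ≈⟨ *-congʳ (*-congʳ (*-congˡ (merge 2 (tri n) (tri (suc n)) (n ℕ.* suc n ℕ.+ tri (suc n)) (≡.cong (ℕ._+ tri (suc n)) (≡.trans (eq′ (tri n)) (tri-double n)))))) ⟩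
      sg n * x ^ (n ℕ.* suc n ℕ.+ tri (suc n)) * (1# - x ^ e) * (i₂ * i₂ * ω) ∎
      where
      C = ∏ N (λ j → d (FA.lab n) (FO.lab j))
      e = 2 ℕ.* n ℕ.+ 1
      eq : ∀ n → 2 ℕ.* (n ℕ.+ n ℕ.+ 1) ≡ 2 ℕ.* n ℕ.+ 1 ℕ.+ (2 ℕ.* n ℕ.+ 1)
      eq = S.solve 1 (λ n → S.con 2 S.:* (n S.:+ n S.:+ S.con 1) S.:= S.con 2 S.:* n S.:+ S.con 1 S.:+ (S.con 2 S.:* n S.:+ S.con 1)) ≡.refl
      eq′ : ∀ t → 2 ℕ.* t ≡ t ℕ.+ t
      eq′ = S.solve 1 (λ t → S.con 2 S.:* t S.:= t S.:+ t) ≡.refl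

    collect : ∀ (h a c : ℕ → Carrier) K → (∀ n → n ℕ.< M → c n ≈ a n * K) → (∀ n → M ℕ.≤ n → n ℕ.< N → c n ≈ 0#) →
      ∑ N (λ n → h n * c n) ≈ K * ∑ M (λ n → a n * h n)
    collect h a c K small zeros = begin
      ∑ N (λ n → h n * c n) ≈⟨ ∑-truncate< (ℕₚ.m≤n⇒m≤1+n M≤N₁) (λ n M≤n n<N → trans (*-congˡ (zeros n M≤n n<N)) (zeroʳ _)) ⟩
      ∑ M (λ n → h n * c n) ≈⟨ ∑-cong M (λ n n<M → trans (*-congˡ (small n n<M)) (solve 3 (λ h a K → h :* (a :* K) := K :* (a :* h)) refl _ _ _)) ⟩
      ∑ M (λ n → K * (a n * h n)) ≈⟨ sym (*-∑ M K) ⟩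
      K * ∑ M (λ n → a n * h n) ∎

    zeroˡ′ : ∀ {a b} → a ≈ 0# → a * b ≈ 0#
    zeroˡ′ e = trans (*-congʳ e) (zeroˡ _)

    zeroʳ′ : ∀ {a b} → b ≈ 0# → a * b ≈ 0#
    zeroʳ′ e = trans (*-congˡ e) (zeroʳ _)

  module Even (z : ℕ → Carrier) (z-geo : ∀ k e → 1 ℕ.≤ e → z (k ℕ.+ e) ≈ x ^ k * z e)
    (f : Label → Carrier) (f-inverse : ∀ l → 2 ℕ.≤ proj₂ l → Spectral.L z 1 z-geo l * f l ≈ 1#) where

    private
      2≤A : ∀ i → 2 ℕ.≤ 2 ℕ.* suc i ℕ.+ 1
      2≤A i = ℕₚ.≤-trans (ℕₚ.*-monoʳ-≤ 2 {1} {suc i} (s≤s z≤n)) (ℕₚ.m≤m+n _ 1)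
      2≤B : ∀ j → 2 ℕ.≤ 4 ℕ.* j ℕ.+ 2
      2≤B j = ℕₚ.m≤n+m 2 (4 ℕ.* j)

    open Expansion z 1 z-geo f 2 (s≤s z≤n) f-inverse FA.lab FB.lab FA.lab-mono FB.lab-mono 2n+1≢4m+2 ℕₚ.≤-refl 2≤A 2≤B 2≤B public

    even : ∏ N₁ (λ i → f (FA.lab (suc i))) * ∏ N (λ j → f (FB.lab j))
      ≈ i₂ * i₂ * ω * ∑ M (λ n → sg n * x ^ (tri n ℕ.+ n ℕ.* suc n) * (1# - (x ^ 2) ^ (n ℕ.+ n ℕ.+ 1)) * scaled n)
      + x * (i₄ * i₄ * (ω * ω)) * ∑ M (λ m → sg m * (x ^ 4) ^ (tri m ℕ.+ m ℕ.* suc m) * (1# - (x ^ 4) ^ (m ℕ.+ m ℕ.+ 1)) * (V * f (FB.lab m)))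
    even = trans (expansion N₂) (+-cong
      (collect scaled _ _ _ coefficient-A-B (λ n M≤n n<N → zeroˡ′ (SA.self-large n M≤n n<N)))
      (collect (λ m → V * f (FB.lab m)) _ _ _ coefficient-B-A (λ m M≤m m<N → zeroʳ′ (SB.self-large m M≤m m<N))))

    -- Multiplying `even` by `f (FA.lab 0)` restores the omitted factor on the left and removes `V`
    -- from every term on the right.
    even-unit : V * f (FA.lab 0) ≈ 1# → ∏ N (λ i → f (FA.lab i)) * ∏ N (λ j → f (FB.lab j))
      ≈ i₂ * i₂ * ω * ∑ M (λ n → sg n * x ^ (tri n ℕ.+ n ℕ.* suc n) * (1# - (x ^ 2) ^ (n ℕ.+ n ℕ.+ 1)) * f (FA.lab n))
      + x * (i₄ * i₄ * (ω * ω)) * ∑ M (λ m → sg m * (x ^ 4) ^ (tri m ℕ.+ m ℕ.* suc m) * (1# - (x ^ 4) ^ (m ℕ.+ m ℕ.+ 1)) * f (FB.lab m))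
    even-unit unit = begin
      ∏ N (λ i → f (FA.lab i)) * ΠB ≈⟨ trans (*-congʳ (∏-head N₁)) (*-assoc _ _ _) ⟩
      f₀ * (∏ N₁ (λ i → f (FA.lab (suc i))) * ΠB) ≈⟨ *-congˡ even ⟩
      f₀ * (c * ∑ M (λ n → α n * scaled n) + c′ * ∑ M (λ m → β m * (V * f (FB.lab m))))
        ≈⟨ solve 5 (λ f c a d b → f :* (c :* a :+ d :* b) := c :* (a :* f) :+ d :* (b :* f)) refl f₀ c _ c′ _ ⟩
      c * (∑ M (λ n → α n * scaled n) * f₀) + c′ * (∑ M (λ m → β m * (V * f (FB.lab m))) * f₀)
        ≈⟨ +-cong (*-congˡ (trans (∑-* M f₀) (∑-cong M λ n _ → trans (*-assoc _ _ _) (*-congˡ (unscale n)))))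
             (*-congˡ (trans (∑-* M f₀) (∑-cong M λ m _ → trans (*-assoc _ _ _) (*-congˡ (cancel (f (FB.lab m))))))) ⟩
      c * ∑ M (λ n → α n * f (FA.lab n)) + c′ * ∑ M (λ m → β m * f (FB.lab m)) ∎
      where
      f₀ = f (FA.lab 0)
      ΠB = ∏ N (λ j → f (FB.lab j))
      c  = i₂ * i₂ * ω
      c′ = x * (i₄ * i₄ * (ω * ω))
      α β : ℕ → Carrier
      α n = sg n * x ^ (tri n ℕ.+ n ℕ.* suc n) * (1# - (x ^ 2) ^ (n ℕ.+ n ℕ.+ 1))
      β m = sg m * (x ^ 4) ^ (tri m ℕ.+ m ℕ.* suc m) * (1# - (x ^ 4) ^ (m ℕ.+ m ℕ.+ 1))
      cancel : ∀ a → V * a * f₀ ≈ a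
      cancel a = trans (solve 3 (λ v a f → v :* a :* f := v :* f :* a) refl V a f₀) (trans (*-congʳ unit) (*-identityˡ a))
      unscale : ∀ n → scaled n * f₀ ≈ f (FA.lab n)
      unscale zero    = *-identityˡ f₀
      unscale (suc n) = cancel (f (FA.lab (suc n)))

  module Odd (z : ℕ → Carrier) (z-geo : ∀ k e → 0 ℕ.≤ e → z (k ℕ.+ e) ≈ x ^ k * z e)
    (f : Label → Carrier) (f-inverse : ∀ l → 1 ℕ.≤ proj₂ l → Spectral.L z 0 z-geo l * f l ≈ 1#) where

    private
      1≤O : ∀ i → 1 ℕ.≤ 4 ℕ.* suc i ℕ.+ 0
      1≤O i = ℕₚ.≤-trans (s≤s z≤n) (ℕₚ.m≤m+n _ 0)
      1≤A : ∀ j → 1 ℕ.≤ 2 ℕ.* j ℕ.+ 1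
      1≤A j = ℕₚ.m≤n+m 1 (2 ℕ.* j)

    open Expansion z 0 z-geo f 1 z≤n f-inverse FO.lab FA.lab FO.lab-mono FA.lab-mono 4m+0≢2n+1 z≤n 1≤O 1≤A 1≤A public

    odd : ∏ N₁ (λ i → f (FO.lab (suc i))) * ∏ N (λ j → f (FA.lab j))
      ≈ i₄ * i₄ * (ω * ω) * ∑ M (λ m → sg m * (x ^ 4) ^ (tri m ℕ.+ m ℕ.* m) * κ m * scaled m)
      + i₂ * i₂ * ω * ∑ M (λ n → sg n * x ^ (n ℕ.* suc n ℕ.+ tri (suc n)) * (1# - x ^ (2 ℕ.* n ℕ.+ 1)) * (V * f (FA.lab n)))
    odd = trans (expansion N₂) (+-cong
      (collect scaled _ _ _ coefficient-O-A (λ m M≤m m<N → zeroˡ′ (self₀-large m M≤m m<N)))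
      (collect (λ n → V * f (FA.lab n)) _ _ _ coefficient-A-O (λ n M≤n n<N → zeroʳ′ (SA.self-large n M≤n n<N))))

-- The Jacobi triple product.

tri-+ : ∀ a b → tri (a ℕ.+ b) ≡ tri a ℕ.+ tri b ℕ.+ a ℕ.* b
tri-+ zero    b = ≡.sym (ℕₚ.+-identityʳ (tri b))
tri-+ (suc a) b = ≡.trans (≡.cong (ℕ._+ suc (a ℕ.+ b)) (tri-+ a b)) (lemma (tri a) (tri b) a b)
  where
  open +-*-Solver
  lemma : ∀ s t a b → s ℕ.+ t ℕ.+ a ℕ.* b ℕ.+ suc (a ℕ.+ b) ≡ s ℕ.+ suc a ℕ.+ t ℕ.+ suc a ℕ.* b
  lemma = solve 4 (λ s t a b → s :+ t :+ a :* b :+ (con 1 :+ (a :+ b)) := s :+ (con 1 :+ a) :+ t :+ (con 1 :+ a) :* b) ≡.refl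

-- `tri (k ∸ 1)` is k(k - 1)/2 for every k, including 0. The added j comes from (u u′)^j = y^j.
diagonal-exponent : ∀ j m → tri (j ℕ.+ m ℕ.∸ 1) ℕ.+ tri (j ℕ.∸ 1) ℕ.+ j ≡ tri (m ℕ.∸ 1) ℕ.+ j ℕ.* (j ℕ.+ m)
diagonal-exponent zero    m       = ℕₚ.+-identityʳ _
diagonal-exponent (suc j) zero    = ≡.trans (≡.cong (λ k → tri k ℕ.+ tri j ℕ.+ suc j) (ℕₚ.+-identityʳ j))
  (≡.trans (≡.cong (ℕ._+ suc j) (tri-double j)) (lemma j))
  where
  open +-*-Solver
  lemma : ∀ j → j ℕ.* suc j ℕ.+ suc j ≡ suc j ℕ.* (suc j ℕ.+ 0)
  lemma = solve 1 (λ j → j :* (con 1 :+ j) :+ (con 1 :+ j) := (con 1 :+ j) :* (con 1 :+ j :+ con 0)) ≡.refl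
diagonal-exponent (suc j) (suc m) = ≡.trans (≡.cong (λ k → k ℕ.+ tri j ℕ.+ suc j) (tri-+ j (suc m)))
  (≡.trans (lemma (tri j) (tri m) j m) (≡.trans (≡.cong (ℕ._+ (tri m ℕ.+ suc m ℕ.+ j ℕ.* suc m ℕ.+ suc j)) (tri-double j)) (lemma′ (tri m) j m)))
  where
  open +-*-Solver
  lemma : ∀ s t j m → s ℕ.+ (t ℕ.+ suc m) ℕ.+ j ℕ.* suc m ℕ.+ s ℕ.+ suc j ≡ s ℕ.+ s ℕ.+ (t ℕ.+ suc m ℕ.+ j ℕ.* suc m ℕ.+ suc j)
  lemma = solve 4 (λ s t j m → s :+ (t :+ (con 1 :+ m)) :+ j :* (con 1 :+ m) :+ s :+ (con 1 :+ j)
            := s :+ s :+ (t :+ (con 1 :+ m) :+ j :* (con 1 :+ m) :+ (con 1 :+ j))) ≡.refl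
  lemma′ : ∀ t j m → j ℕ.* suc j ℕ.+ (t ℕ.+ suc m ℕ.+ j ℕ.* suc m ℕ.+ suc j) ≡ t ℕ.+ suc j ℕ.* (suc j ℕ.+ suc m)
  lemma′ = solve 3 (λ t j m → j :* (con 1 :+ j) :+ (t :+ (con 1 :+ m) :+ j :* (con 1 :+ m) :+ (con 1 :+ j))
             := t :+ (con 1 :+ j) :* (con 1 :+ j :+ (con 1 :+ m))) ≡.refl

module TripleProduct (R : CommutativeRing 0ℓ 0ℓ) (M : ℕ) (y : CommutativeRing.Carrier R) (y^M≈0 : Vanishes R M y) where
  open CommutativeRing R
  open IntegerSolver R
  open FiniteSums R
  open Nilpotent R M y y^M≈0 using () renaming (x^≥M to y^≥M)
  open Pochhammer R M y y^M≈0
  open import Algebra.Properties.Semiring.Exp semiring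
  open import Algebra.Properties.CommutativeSemiring.Exp commutativeSemiring using (^-distrib-*)
  open import Relation.Binary.Reasoning.Setoid setoid

  ∑-swap : ∀ m n (H : ℕ → ℕ → Carrier) → ∑ m (λ i → ∑ n (H i)) ≈ ∑ n (λ j → ∑ m (λ i → H i j))
  ∑-swap zero    n H = sym (∑-zero n λ _ _ → refl)
  ∑-swap (suc m) n H = trans (+-congʳ (∑-swap m n H)) (sym (∑-+ n))

  ∑-square : ∀ n (H : ℕ → ℕ → Carrier) →
    ∑ n (λ i → ∑ n (H i)) ≈ ∑ n (λ i → ∑ (suc i) (H i)) + ∑ n (λ j → ∑ j (λ i → H i j))
  ∑-square zero    H = sym (+-identityˡ _)
  ∑-square (suc n) H = begin
    ∑ n (λ i → ∑ n (H i) + H i n) + ∑ (suc n) (H n) ≈⟨ +-congʳ (trans (∑-+ n) (+-congʳ (∑-square n H))) ⟩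
    ∑ n (λ i → ∑ (suc i) (H i)) + ∑ n (λ j → ∑ j (λ i → H i j)) + ∑ n (λ i → H i n) + ∑ (suc n) (H n)
      ≈⟨ solve 4 (λ a b c d → a :+ b :+ c :+ d := a :+ d :+ (b :+ c)) refl _ _ _ _ ⟩
    ∑ (suc n) (λ i → ∑ (suc i) (H i)) + ∑ (suc n) (λ j → ∑ j (λ i → H i j)) ∎

  -- The terms of Euler's series for (-u;y)_∞. No nilpotency of u is assumed: the terms vanish
  -- because of y^(i(i-1)/2), and the shift in this exponent is the reason for M + 1 terms instead
  -- of M.
  a : Carrier → ℕ → Carrier
  a u i = y ^ tri (i ℕ.∸ 1) * u ^ i * P⁻¹ i

  private
    K = suc M

    Σa : Carrier → Carrier
    Σa u = ∑ K (a u)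

    Σa-step : ∀ u → Σa u ≈ (1# + u) * Σa (u * y)
    Σa-step u = begin
      Σa u ≈⟨ solve 2 (λ a b → a := a :- b :+ b) refl _ _ ⟩
      Σa u - Σa (u * y) + Σa (u * y) ≈⟨ +-congʳ difference ⟩
      u * Σa (u * y) + Σa (u * y) ≈⟨ solve 2 (λ u a → u :* a :+ a := (:1 :+ u) :* a) refl _ _ ⟩
      (1# + u) * Σa (u * y) ∎
      where
      b : ℕ → Carrier
      b i = y ^ tri i * u ^ suc i * P⁻¹ i
      term : ∀ i → a u (suc i) - a (u * y) (suc i) ≈ b i
      term i = begin
        y ^ tri i * u ^ suc i * P⁻¹ (suc i) - y ^ tri i * (u * y) ^ suc i * P⁻¹ (suc i)
          ≈⟨ +-congˡ (-‿cong (*-congʳ (*-congˡ (^-distrib-* u y (suc i))))) ⟩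
        y ^ tri i * u ^ suc i * P⁻¹ (suc i) - y ^ tri i * (u ^ suc i * y ^ suc i) * P⁻¹ (suc i)
          ≈⟨ solve 4 (λ t u y p → t :* u :* p :- t :* (u :* y) :* p := t :* u :* ((:1 :- y) :* p)) refl (y ^ tri i) (u ^ suc i) (y ^ suc i) _ ⟩
        y ^ tri i * u ^ suc i * ((1# - y ^ suc i) * P⁻¹ (suc i)) ≈⟨ *-congˡ (P⁻¹-suc i) ⟩
        b i ∎
      term′ : ∀ i → u * a (u * y) i ≈ b i
      term′ i = begin
        u * (y ^ tri (i ℕ.∸ 1) * (u * y) ^ i * P⁻¹ i) ≈⟨ *-congˡ (*-congʳ (*-congˡ (^-distrib-* u y i))) ⟩
        u * (y ^ tri (i ℕ.∸ 1) * (u ^ i * y ^ i) * P⁻¹ i)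
          ≈⟨ solve 5 (λ u t v y p → u :* (t :* (v :* y) :* p) := (t :* y) :* (u :* v) :* p) refl u (y ^ tri (i ℕ.∸ 1)) (u ^ i) (y ^ i) _ ⟩
        y ^ tri (i ℕ.∸ 1) * y ^ i * u ^ suc i * P⁻¹ i ≈⟨ *-congʳ (*-congʳ (trans (sym (^-homo-* y (tri (i ℕ.∸ 1)) i)) (^-congʳ y (eq i)))) ⟩
        b i ∎
        where
        eq : ∀ i → tri (i ℕ.∸ 1) ℕ.+ i ≡ tri i
        eq zero    = ≡.refl
        eq (suc i) = ≡.refl
      difference : Σa u - Σa (u * y) ≈ u * Σa (u * y)
      difference = begin
        Σa u - Σa (u * y) ≈⟨ +-cong (∑-head M) (-‿cong (∑-head M)) ⟩
        a u 0 + ∑ M (λ i → a u (suc i)) - (a (u * y) 0 + ∑ M (λ i → a (u * y) (suc i)))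
          ≈⟨ solve 3 (λ a b c → a :+ b :- (a :+ c) := b :+ :- :1 :* c) refl _ _ _ ⟩
        ∑ M (λ i → a u (suc i)) + - 1# * ∑ M (λ i → a (u * y) (suc i)) ≈⟨ trans (+-congˡ (*-∑ M _)) (sym (∑-+ M)) ⟩
        ∑ M (λ i → a u (suc i) + - 1# * a (u * y) (suc i))
          ≈⟨ ∑-cong M (λ i _ → trans (+-congˡ (solve 1 (λ a → :- :1 :* a := :- a) refl _)) (term i)) ⟩
        ∑ M b ≈⟨ sym (trans (+-congˡ (trans (*-congʳ (*-congʳ (y^≥M (n≤tri[n] M)))) (solve 2 (λ a b → :0 :* a :* b := :0) refl _ _))) (+-identityʳ _)) ⟩
        ∑ K b ≈⟨ ∑-cong K (λ i _ → sym (term′ i)) ⟩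
        ∑ K (λ i → u * a (u * y) i) ≈⟨ sym (*-∑ K u) ⟩
        u * Σa (u * y) ∎

    a-cong : ∀ {u v} → u ≈ v → Σa u ≈ Σa v
    a-cong e = ∑-cong K λ i _ → *-congʳ (*-congˡ (^-congˡ i e))

    iterate : ∀ u n → Σa u ≈ ∏ n (λ k → 1# + u * y ^ k) * Σa (u * y ^ n)
    iterate u zero    = trans (a-cong (sym (*-identityʳ u))) (sym (*-identityˡ _))
    iterate u (suc n) = begin
      Σa u ≈⟨ iterate u n ⟩
      ∏ n (λ k → 1# + u * y ^ k) * Σa (u * y ^ n) ≈⟨ *-congˡ (Σa-step (u * y ^ n)) ⟩
      ∏ n (λ k → 1# + u * y ^ k) * ((1# + u * y ^ n) * Σa (u * y ^ n * y))
        ≈⟨ trans (sym (*-assoc _ _ _)) (*-congˡ (a-cong (solve 3 (λ u v y → u :* v :* y := u :* (y :* v)) refl u (y ^ n) y))) ⟩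
      ∏ (suc n) (λ k → 1# + u * y ^ k) * Σa (u * y ^ suc n) ∎

  -- The functional equation `Σa-step`, iterated M times, replaces u by u y^M, which is 0, and the
  -- series at 0 is 1.
  euler : ∀ u → ∑ (suc M) (a u) ≈ ∏ M (λ k → 1# + u * y ^ k)
  euler u = begin
    Σa u ≈⟨ iterate u M ⟩
    ∏ M (λ k → 1# + u * y ^ k) * Σa (u * y ^ M) ≈⟨ *-congˡ (trans (a-cong (trans (*-congˡ y^M≈0) (zeroʳ u))) (trans (∑-head M) (+-congˡ (∑-zero M vanish)))) ⟩
    ∏ M (λ k → 1# + u * y ^ k) * (1# * 1# * 1# + 0#) ≈⟨ solve 1 (λ p → p :* (:1 :* :1 :* :1 :+ :0) := p) refl _ ⟩
    ∏ M (λ k → 1# + u * y ^ k) ∎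
    where
    vanish : ∀ i → i ℕ.< M → a 0# (suc i) ≈ 0#
    vanish i _ = solve 3 (λ t z p → t :* (:0 :* z) :* p := :0) refl (y ^ tri i) (0# ^ i) _

  module _ (u u′ : Carrier) (uu′≈y : u * u′ ≈ y) where
    private
      D : ℕ → ℕ → Carrier
      D m j = y ^ (j ℕ.* (j ℕ.+ m)) * (P⁻¹ j * P⁻¹ (j ℕ.+ m))

      diagonal : ∀ {u u′} → u * u′ ≈ y → ∀ j m → a u (j ℕ.+ m) * a u′ j ≈ y ^ tri (m ℕ.∸ 1) * u ^ m * D m j
      diagonal {u} {u′} e j m = begin
        y ^ tri (j ℕ.+ m ℕ.∸ 1) * u ^ (j ℕ.+ m) * P⁻¹ (j ℕ.+ m) * (y ^ tri (j ℕ.∸ 1) * u′ ^ j * P⁻¹ j)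
          ≈⟨ *-congʳ (*-congʳ (*-congˡ (^-homo-* u j m))) ⟩
        y ^ tri (j ℕ.+ m ℕ.∸ 1) * (u ^ j * u ^ m) * P⁻¹ (j ℕ.+ m) * (y ^ tri (j ℕ.∸ 1) * u′ ^ j * P⁻¹ j)
          ≈⟨ solve 7 (λ s v w p t v′ q → s :* (v :* w) :* p :* (t :* v′ :* q) := s :* t :* (v :* v′) :* w :* (q :* p)) refl
               (y ^ tri (j ℕ.+ m ℕ.∸ 1)) (u ^ j) (u ^ m) (P⁻¹ (j ℕ.+ m)) (y ^ tri (j ℕ.∸ 1)) (u′ ^ j) (P⁻¹ j) ⟩
        y ^ tri (j ℕ.+ m ℕ.∸ 1) * y ^ tri (j ℕ.∸ 1) * (u ^ j * u′ ^ j) * u ^ m * (P⁻¹ j * P⁻¹ (j ℕ.+ m))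
          ≈⟨ *-congʳ (*-congʳ (*-cong (sym (^-homo-* y (tri (j ℕ.+ m ℕ.∸ 1)) (tri (j ℕ.∸ 1)))) (trans (sym (^-distrib-* u u′ j)) (^-congˡ j e)))) ⟩
        y ^ (tri (j ℕ.+ m ℕ.∸ 1) ℕ.+ tri (j ℕ.∸ 1)) * y ^ j * u ^ m * (P⁻¹ j * P⁻¹ (j ℕ.+ m))
          ≈⟨ *-congʳ (*-congʳ (trans (sym (^-homo-* y (tri (j ℕ.+ m ℕ.∸ 1) ℕ.+ tri (j ℕ.∸ 1)) j)) (trans (^-congʳ y (diagonal-exponent j m)) (^-homo-* y (tri (m ℕ.∸ 1)) (j ℕ.* (j ℕ.+ m)))))) ⟩
        y ^ tri (m ℕ.∸ 1) * y ^ (j ℕ.* (j ℕ.+ m)) * u ^ m * (P⁻¹ j * P⁻¹ (j ℕ.+ m))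
          ≈⟨ solve 4 (λ t s w p → t :* s :* w :* p := t :* w :* (s :* p)) refl (y ^ tri (m ℕ.∸ 1)) (y ^ (j ℕ.* (j ℕ.+ m))) (u ^ m) _ ⟩
        y ^ tri (m ℕ.∸ 1) * u ^ m * D m j ∎

      -- Terms beyond the cut-off of a diagonal are 0, so that each diagonal can be lengthened to
      -- the range that `durfee-rectangle` needs.
      vanish : ∀ v j m → M ℕ.< j ℕ.+ m → y ^ tri (m ℕ.∸ 1) * v * D m j ≈ 0#
      vanish v zero (suc m) (s≤s M≤m) = trans (*-congʳ (*-congʳ (y^≥M (ℕₚ.≤-trans M≤m (n≤tri[n] m))))) (solve 2 (λ a b → :0 :* a :* b := :0) refl _ _)
      vanish v (suc j) m M<j+m = trans (*-congˡ (*-congʳ (y^≥M {suc j ℕ.* (suc j ℕ.+ m)} (ℕₚ.≤-trans (ℕₚ.<⇒≤ M<j+m) (ℕₚ.m≤n*m (suc j ℕ.+ m) (suc j))))))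
        (solve 2 (λ a b → a :* (:0 :* b) := :0) refl _ _)

      triangle : ∀ {u u′} → u * u′ ≈ y → ∀ n s → M ℕ.≤ n → suc M ℕ.≤ n ℕ.+ s →
        ∑ n (λ D′ → ∑ (suc D′) (λ i → a u (s ℕ.+ D′) * a u′ i))
          ≈ ∑ n (λ m → y ^ tri (s ℕ.+ m ℕ.∸ 1) * u ^ (s ℕ.+ m)) * P⁻¹ M
      triangle {u} {u′} e n s M≤n K≤n+s = begin
        ∑ n (λ D′ → ∑ (suc D′) (λ i → a u (s ℕ.+ D′) * a u′ i))
          ≈⟨ ∑-triangle n (λ D′ i → a u (s ℕ.+ D′) * a u′ i) ⟩
        ∑ n (λ i → ∑ (n ℕ.∸ i) (λ m → a u (s ℕ.+ (i ℕ.+ m)) * a u′ i))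
          ≈⟨ ∑-cong n (λ i i<n → trans (∑-cong (n ℕ.∸ i) λ m _ → trans (*-congʳ (reflexive (≡.cong (a u) (eq i m)))) (diagonal e i (s ℕ.+ m)))
               (sym (∑-truncate {F = λ m → y ^ tri (s ℕ.+ m ℕ.∸ 1) * u ^ (s ℕ.+ m) * D (s ℕ.+ m) i} (ℕₚ.m∸n≤m n i) λ m n∸i≤m → vanish (u ^ (s ℕ.+ m)) i (s ℕ.+ m)
                 (ℕₚ.≤-trans K≤n+s (ℕₚ.≤-trans (ℕₚ.+-monoˡ-≤ s (ℕₚ.≤-trans (ℕₚ.≤-reflexive (≡.sym (ℕₚ.m+[n∸m]≡n (ℕₚ.<⇒≤ i<n)))) (ℕₚ.+-monoʳ-≤ i n∸i≤m)))
                   (ℕₚ.≤-reflexive (≡.trans (ℕₚ.+-assoc i m s) (≡.cong (i ℕ.+_) (ℕₚ.+-comm m s)))))))) ) ⟩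
        ∑ n (λ i → ∑ n (λ m → y ^ tri (s ℕ.+ m ℕ.∸ 1) * u ^ (s ℕ.+ m) * D (s ℕ.+ m) i))
          ≈⟨ ∑-swap n n _ ⟩
        ∑ n (λ m → ∑ n (λ i → y ^ tri (s ℕ.+ m ℕ.∸ 1) * u ^ (s ℕ.+ m) * D (s ℕ.+ m) i))
          ≈⟨ ∑-cong n (λ m _ → trans (sym (*-∑ n _)) (*-congˡ (durfee-rectangle n (s ℕ.+ m) M≤n))) ⟩
        ∑ n (λ m → y ^ tri (s ℕ.+ m ℕ.∸ 1) * u ^ (s ℕ.+ m) * P⁻¹ M) ≈⟨ sym (∑-* n _) ⟩
        ∑ n (λ m → y ^ tri (s ℕ.+ m ℕ.∸ 1) * u ^ (s ℕ.+ m)) * P⁻¹ M ∎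
        where
        eq : ∀ i m → s ℕ.+ (i ℕ.+ m) ≡ i ℕ.+ (s ℕ.+ m)
        eq i m = ≡.trans (≡.sym (ℕₚ.+-assoc s i m)) (≡.trans (≡.cong (ℕ._+ m) (ℕₚ.+-comm s i)) (ℕₚ.+-assoc i s m))

    -- The product of the two Euler series is summed along its diagonals. There u^(j+m) u′^j = y^j
    -- u^m, and the sum over j is a Durfee sum of excess m with value `P⁻¹ M` for every m.
    jacobi : P M * (∏ M (λ k → 1# + u * y ^ k) * ∏ M (λ k → 1# + u′ * y ^ k))
      ≈ 1# + ∑ M (λ k → y ^ tri k * (u ^ suc k + u′ ^ suc k))
    jacobi = begin
      P M * (∏ M (λ k → 1# + u * y ^ k) * ∏ M (λ k → 1# + u′ * y ^ k)) ≈⟨ *-congˡ (*-cong (sym (euler u)) (sym (euler u′))) ⟩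
      P M * (Σa u * Σa u′) ≈⟨ *-congˡ (trans (∑-* K _) (∑-cong K λ i _ → *-∑ K _)) ⟩
      P M * ∑ K (λ i → ∑ K (λ j → a u i * a u′ j)) ≈⟨ *-congˡ (∑-square K _) ⟩
      P M * (∑ K (λ i → ∑ (suc i) (λ j → a u i * a u′ j)) + ∑ K (λ j → ∑ j (λ i → a u i * a u′ j)))
        ≈⟨ *-congˡ (+-cong (triangle uu′≈y K 0 (ℕₚ.n≤1+n M) (ℕₚ.m≤m+n K 0)) upper) ⟩
      P M * (∑ K (λ m → y ^ tri (m ℕ.∸ 1) * u ^ m) * P⁻¹ M + ∑ M (λ m → y ^ tri m * u′ ^ suc m) * P⁻¹ M)
        ≈⟨ solve 4 (λ p a q b → p :* (a :* q :+ b :* q) := p :* q :* (a :+ b)) refl _ _ _ _ ⟩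
      P M * P⁻¹ M * (∑ K (λ m → y ^ tri (m ℕ.∸ 1) * u ^ m) + ∑ M (λ m → y ^ tri m * u′ ^ suc m))
        ≈⟨ trans (*-congʳ (P-inverse M)) (*-identityˡ _) ⟩
      ∑ K (λ m → y ^ tri (m ℕ.∸ 1) * u ^ m) + ∑ M (λ m → y ^ tri m * u′ ^ suc m)
        ≈⟨ +-congʳ (trans (∑-head M) (+-congʳ (*-identityˡ 1#))) ⟩
      1# + ∑ M (λ m → y ^ tri m * u ^ suc m) + ∑ M (λ m → y ^ tri m * u′ ^ suc m)
        ≈⟨ trans (+-assoc _ _ _) (+-congˡ (trans (sym (∑-+ M)) (∑-cong M λ m _ → sym (distribˡ _ _ _)))) ⟩
      1# + ∑ M (λ k → y ^ tri k * (u ^ suc k + u′ ^ suc k)) ∎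
      where
      upper : ∑ K (λ j → ∑ j (λ i → a u i * a u′ j)) ≈ ∑ M (λ m → y ^ tri m * u′ ^ suc m) * P⁻¹ M
      upper = begin
        ∑ K (λ j → ∑ j (λ i → a u i * a u′ j)) ≈⟨ trans (∑-head M) (+-identityˡ _) ⟩
        ∑ M (λ j → ∑ (suc j) (λ i → a u i * a u′ (suc j))) ≈⟨ ∑-cong M (λ j _ → ∑-cong (suc j) λ i _ → *-comm _ _) ⟩
        ∑ M (λ j → ∑ (suc j) (λ i → a u′ (suc j) * a u i)) ≈⟨ triangle (trans (*-comm u′ u) uu′≈y) M 1 ℕₚ.≤-refl (ℕₚ.≤-reflexive (ℕₚ.+-comm 1 M)) ⟩
        ∑ M (λ m → y ^ tri m * u′ ^ suc m) * P⁻¹ M ∎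

-- Theta products and the dissection of φ.

even-square : ∀ i → suc (suc (i ℕ.+ i)) ℕ.* suc (suc (i ℕ.+ i)) ≡ 4 ℕ.* (suc i ℕ.* suc i)
even-square = solve 1 (λ i → (con 2 :+ (i :+ i)) :* (con 2 :+ (i :+ i)) := con 4 :* ((con 1 :+ i) :* (con 1 :+ i))) ≡.refl
  where open +-*-Solver

odd-square : ∀ i → suc (i ℕ.+ i) ℕ.* suc (i ℕ.+ i) ≡ suc (4 ℕ.* (i ℕ.* suc i))
odd-square = solve 1 (λ i → (con 1 :+ (i :+ i)) :* (con 1 :+ (i :+ i)) := con 1 :+ con 4 :* (i :* (con 1 :+ i))) ≡.refl
  where open +-*-Solver

module ThetaProducts (R : CommutativeRing 0ℓ 0ℓ) (M : ℕ) where
  open CommutativeRing R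
  open IntegerSolver R
  open FiniteSums R
  open import Algebra.Properties.Semiring.Exp semiring
  open import Relation.Binary.Reasoning.Setoid setoid

  -- In a ring where y^M = 0 these are (y;y)_∞, (y;y²)_∞, (−y;y²)_∞ and (−y;y)_∞.
  pinf ainf winf vinf : Carrier → Carrier
  pinf y = ∏ M (λ j → 1# - y ^ suc j)
  ainf y = ∏ M (λ k → 1# - y * (y ^ 2) ^ k)
  winf y = ∏ M (λ k → 1# + y * (y ^ 2) ^ k)
  vinf y = ∏ M (λ k → 1# + y * y ^ k)

  pinf-cong : ∀ {y z} → y ≈ z → pinf y ≈ pinf z
  pinf-cong e = ∏-cong M λ j _ → +-congˡ (-‿cong (^-congˡ (suc j) e))

  sq-^ : ∀ y k → (y ^ 2) ^ k ≈ y ^ (k ℕ.+ k)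
  sq-^ y k = trans (^-assocʳ y 2 k) (^-congʳ y (≡.cong (k ℕ.+_) (ℕₚ.+-identityʳ k)))

  module _ (x : Carrier) (x^M≈0 : Vanishes R M x) where
    open Pochhammer R M x x^M≈0 using (P-stable; P-inverse; P⁻¹)

    pinf⁻¹ : Carrier
    pinf⁻¹ = P⁻¹ M

    pinf-inverse : pinf x * pinf⁻¹ ≈ 1#
    pinf-inverse = P-inverse M

    pinf-halve : pinf x ≈ ainf x * pinf (x ^ 2)
    pinf-halve = begin
      pinf x ≈⟨ sym (P-stable (ℕₚ.m≤m+n M M)) ⟩
      ∏ (M ℕ.+ M) (λ j → 1# - x ^ suc j) ≈⟨ ∏-parity M ⟩
      ∏ M (λ i → 1# - x ^ suc (i ℕ.+ i)) * ∏ M (λ i → 1# - x ^ suc (suc (i ℕ.+ i)))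
        ≈⟨ *-cong (∏-cong M λ i _ → +-congˡ (-‿cong (*-congˡ (sym (sq-^ x i)))))
             (∏-cong M λ i _ → +-congˡ (-‿cong (sym (trans (sq-^ x (suc i)) (^-congʳ x (≡.cong suc (ℕₚ.+-suc i i))))))) ⟩
      ainf x * pinf (x ^ 2) ∎

    ainf-square : ainf (x ^ 2) ≈ ainf x * winf x
    ainf-square = begin
      ainf (x ^ 2) ≈⟨ ∏-cong M (λ k _ → trans (+-congˡ (-‿cong (*-congˡ (trans (sq-^ (x ^ 2) k) (^-homo-* (x ^ 2) k k)))))
        (solve 2 (λ x b → :1 :- x :^ 2 :* (b :* b) := (:1 :- x :* b) :* (:1 :+ x :* b)) refl x ((x ^ 2) ^ k))) ⟩
      ∏ M (λ k → (1# - x * (x ^ 2) ^ k) * (1# + x * (x ^ 2) ^ k)) ≈⟨ ∏-* M ⟩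
      ainf x * winf x ∎

    pinf-vinf : pinf x * vinf x ≈ pinf (x ^ 2)
    pinf-vinf = trans (sym (∏-* M)) (∏-cong M λ k _ → trans
      (solve 1 (λ a → (:1 :- a) :* (:1 :+ a) := :1 :- a :* a) refl (x ^ suc k))
      (+-congˡ (-‿cong (trans (sym (^-homo-* x (suc k) (suc k))) (sym (sq-^ x (suc k)))))))

  module _ (x : Carrier) (x^M≈0 : Vanishes R M x) where
    open Nilpotent R M x x^M≈0
    open Families R M x x^M≈0 using (vanishes-^)

    x²-nil : Vanishes R M (x ^ 2)
    x²-nil = vanishes-^ 2 (s≤s z≤n)

    pinf-odd : pinf (x ^ 2) ≈ ainf x * winf x * pinf (x ^ 4)
    pinf-odd = begin
      pinf (x ^ 2) ≈⟨ pinf-halve (x ^ 2) x²-nil ⟩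
      ainf (x ^ 2) * pinf ((x ^ 2) ^ 2) ≈⟨ *-cong (ainf-square x x^M≈0) (pinf-cong (^-assocʳ x 2 2)) ⟩
      ainf x * winf x * pinf (x ^ 4) ∎

    -- Cleared of denominators, this is the eta quotient J₂² / (J₁ J₄) of (-x;x²)_∞.
    pinf-winf : pinf (x ^ 2) * pinf (x ^ 2) ≈ pinf x * winf x * pinf (x ^ 4)
    pinf-winf = begin
      pinf (x ^ 2) * pinf (x ^ 2) ≈⟨ *-congʳ pinf-odd ⟩
      ainf x * winf x * pinf (x ^ 4) * pinf (x ^ 2) ≈⟨ solve 4 (λ a w p q → a :* w :* p :* q := a :* q :* w :* p) refl _ _ _ _ ⟩
      ainf x * pinf (x ^ 2) * winf x * pinf (x ^ 4) ≈⟨ *-congʳ (*-congʳ (sym (pinf-halve x x^M≈0))) ⟩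
      pinf x * winf x * pinf (x ^ 4) ∎

    φ-product : pinf (x ^ 2) * (winf x * winf x) ≈ 1# + ∑ M (λ k → x ^ (suc k ℕ.* suc k) + x ^ (suc k ℕ.* suc k))
    φ-product = trans (TripleProduct.jacobi R M (x ^ 2) x²-nil x x (*-congˡ (sym (*-identityʳ x))))
      (+-congˡ (∑-cong M λ k _ → trans (distribˡ _ _ _) (+-cong (e k) (e k))))
      where
      e : ∀ k → (x ^ 2) ^ tri k * x ^ suc k ≈ x ^ (suc k ℕ.* suc k)
      e k = trans (*-congʳ (trans (sq-^ x (tri k)) (^-congʳ x (tri-double k)))) (trans (sym (^-homo-* x (k ℕ.* suc k) (suc k))) (^-congʳ x (ℕₚ.+-comm (k ℕ.* suc k) (suc k))))

    -- The triple product with u′ = 1 contains the factor 1 + 1. Since 2 need not be cancellable in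
    -- the ring, the product formula for ψ is kept doubled.
    ψ-product : pinf x * (vinf x * vinf x) + pinf x * (vinf x * vinf x) ≈ ∑ M (λ k → x ^ tri k) + ∑ M (λ k → x ^ tri k)
    ψ-product = begin
      pinf x * (vinf x * vinf x) + pinf x * (vinf x * vinf x)
        ≈⟨ solve 2 (λ p v → p :* (v :* v) :+ p :* (v :* v) := p :* (v :* ((:1 :+ :1 :* :1) :* v))) refl (pinf x) (vinf x) ⟩
      pinf x * (vinf x * ((1# + 1# * 1#) * vinf x))
        ≈⟨ *-congˡ (*-congˡ (sym (trans doubled (*-congˡ (∏-cong M λ k _ → +-congˡ (*-identityˡ _)))))) ⟩
      pinf x * (vinf x * ∏ M (λ k → 1# + 1# * x ^ k))
        ≈⟨ TripleProduct.jacobi R M x x^M≈0 x 1# (*-identityʳ x) ⟩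
      1# + ∑ M (λ k → x ^ tri k * (x ^ suc k + 1# ^ suc k))
        ≈⟨ +-congˡ (∑-cong M λ k _ → trans (distribˡ _ _ _) (+-cong (sym (^-homo-* x (tri k) (suc k))) (trans (*-congˡ (one-^ (suc k))) (*-identityʳ _)))) ⟩
      1# + ∑ M (λ k → x ^ tri (suc k) + x ^ tri k) ≈⟨ +-congˡ (∑-+ M) ⟩
      1# + (∑ M (λ k → x ^ tri (suc k)) + ∑ M (λ k → x ^ tri k)) ≈⟨ trans (sym (+-assoc _ _ _)) (+-congʳ (sym (∑-head M))) ⟩
      ∑ (suc M) (λ k → x ^ tri k) + ∑ M (λ k → x ^ tri k) ≈⟨ +-congʳ (trans (+-congˡ (x^≥M (n≤tri[n] M))) (+-identityʳ _)) ⟩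
      ∑ M (λ k → x ^ tri k) + ∑ M (λ k → x ^ tri k) ∎
      where
      one-^ : ∀ k → 1# ^ k ≈ 1#
      one-^ zero    = refl
      one-^ (suc k) = trans (*-identityˡ _) (one-^ k)
      doubled : ∏ M (λ k → 1# + 1# * x ^ k) ≈ (1# + 1# * 1#) * ∏ M (λ k → 1# + 1# * x ^ suc k)
      doubled = begin
        ∏ M (λ k → 1# + 1# * x ^ k) ≈⟨ sym (trans (*-congˡ (trans (+-congˡ (trans (*-identityˡ _) x^M≈0)) (+-identityʳ _))) (*-identityʳ _)) ⟩
        ∏ (suc M) (λ k → 1# + 1# * x ^ k) ≈⟨ ∏-head M ⟩
        (1# + 1# * 1#) * ∏ M (λ k → 1# + 1# * x ^ suc k) ∎

  module _ (x : Carrier) (x^M≈0 : Vanishes R M x) where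
    open Nilpotent R M x x^M≈0
    open Families R M x x^M≈0 using (vanishes-^)

    private
      p = x ^ 4
      p-nil : Vanishes R M p
      p-nil = vanishes-^ 4 (s≤s z≤n)

    -- φ(x) = φ(x⁴) + 2 x ψ(x⁸)
    φ-dissection : pinf (x ^ 2) * (winf x * winf x)
      ≈ pinf (p ^ 2) * (winf p * winf p)
        + x * (pinf (p ^ 2) * (vinf (p ^ 2) * vinf (p ^ 2)) + pinf (p ^ 2) * (vinf (p ^ 2) * vinf (p ^ 2)))
    φ-dissection = begin
      pinf (x ^ 2) * (winf x * winf x) ≈⟨ φ-product x x^M≈0 ⟩
      1# + ∑ M F ≈⟨ +-congˡ (sym (∑-truncate (ℕₚ.m≤m+n M M) F-large)) ⟩
      -- `F k` carries the square of k + 1: even k gives the odd squares, which make up 2x ψ(x⁸),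
      -- and odd k gives the even squares of φ(x⁴).
      1# + ∑ (M ℕ.+ M) F ≈⟨ +-congˡ (∑-parity M) ⟩
      1# + (∑ M (λ i → F (i ℕ.+ i)) + ∑ M (λ i → F (suc (i ℕ.+ i))))
        ≈⟨ +-congˡ (+-cong (∑-cong M λ i _ → +-cong (odd-term i) (odd-term i)) (∑-cong M λ i _ → +-cong (even-term i) (even-term i))) ⟩
      1# + (∑ M (λ i → x * (p ^ 2) ^ tri i + x * (p ^ 2) ^ tri i) + ∑ M (λ i → p ^ (suc i ℕ.* suc i) + p ^ (suc i ℕ.* suc i)))
        ≈⟨ +-congˡ (+-congʳ (trans (∑-+ M) (+-cong (sym (*-∑ M x)) (sym (*-∑ M x))))) ⟩
      1# + (x * T + x * T + Φ) ≈⟨ solve 3 (λ x t f → :1 :+ (x :* t :+ x :* t :+ f) := :1 :+ f :+ x :* (t :+ t)) refl x T Φ ⟩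
      1# + Φ + x * (T + T) ≈⟨ +-cong (sym (φ-product p p-nil)) (*-congˡ (sym (ψ-product (p ^ 2) (x²-nil p p-nil)))) ⟩
      pinf (p ^ 2) * (winf p * winf p)
        + x * (pinf (p ^ 2) * (vinf (p ^ 2) * vinf (p ^ 2)) + pinf (p ^ 2) * (vinf (p ^ 2) * vinf (p ^ 2))) ∎
      where
      T = ∑ M (λ k → (p ^ 2) ^ tri k)
      Φ = ∑ M (λ k → p ^ (suc k ℕ.* suc k) + p ^ (suc k ℕ.* suc k))
      F : ℕ → Carrier
      F k = x ^ (suc k ℕ.* suc k) + x ^ (suc k ℕ.* suc k)
      F-large : ∀ k → M ℕ.≤ k → F k ≈ 0#
      F-large k M≤k = trans (+-cong z z) (+-identityˡ _)
        where
        z : x ^ (suc k ℕ.* suc k) ≈ 0#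
        z = x^≥M (ℕₚ.≤-trans M≤k (ℕₚ.≤-trans (ℕₚ.n≤1+n k) (ℕₚ.m≤m*n (suc k) (suc k))))
      even-term : ∀ i → x ^ (suc (suc (i ℕ.+ i)) ℕ.* suc (suc (i ℕ.+ i))) ≈ p ^ (suc i ℕ.* suc i)
      even-term i = trans (^-congʳ x (even-square i)) (sym (^-assocʳ x 4 (suc i ℕ.* suc i)))
      odd-term : ∀ i → x ^ (suc (i ℕ.+ i) ℕ.* suc (i ℕ.+ i)) ≈ x * (p ^ 2) ^ tri i
      odd-term i = trans (^-congʳ x (odd-square i)) (*-congˡ (sym (trans (sq-^ p (tri i)) (trans (^-congʳ p (tri-double i)) (^-assocʳ x 4 (i ℕ.* suc i))))))

  module Cleared (x : Carrier) (x^M≈0 : Vanishes R M x) where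
    open Nilpotent R M x x^M≈0
    open Families R M x x^M≈0
    open LambertIdentities R M x x^M≈0
    open ThetaValues R M x x^M≈0
    open CrossResidues R M x x^M≈0 using (γ-inverse)

    j₁ j₂ j₄ w : Carrier
    j₁ = pinf x
    j₂ = pinf (x ^ 2)
    j₄ = pinf (x ^ 4)
    w  = winf x

    winf-stable : ∀ n → M ℕ.≤ n → ∏ n (λ m → 1# + x ^ suc (2 ℕ.* m)) ≈ w
    winf-stable n M≤n = trans (∏-truncate M≤n λ m M≤m → trans (+-congˡ (x^≥M (ℕₚ.m≤n⇒m≤1+n (ℕₚ.≤-trans M≤m (ℕₚ.m≤n*m m 2))))) (+-identityʳ _))
      (∏-cong M λ m _ → +-congˡ (*-congˡ (sym (^-assocʳ x 2 m))))

    w*ω : w * ω ≈ 1#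
    w*ω = trans (*-congʳ (sym (winf-stable N (ℕₚ.m≤n⇒m≤1+n M≤N₁)))) (∏-inverse N λ m _ → γ-inverse (2 ℕ.* m))

    j₂*i₂ : j₂ * i₂ ≈ 1#
    j₂*i₂ = P2.P-inverse M

    j₄*i₄ : j₄ * i₄ ≈ 1#
    j₄*i₄ = P4.P-inverse M

    private
      clear₂ : j₁ * (j₄ * j₄) * (w * w) * (i₂ * i₂ * ω) ≈ j₄
      clear₂ = begin
        j₁ * (j₄ * j₄) * (w * w) * (i₂ * i₂ * ω)
          ≈⟨ solve 5 (λ a b w i o → a :* (b :* b) :* (w :* w) :* (i :* i :* o) := b :* (a :* w :* b :* (i :* i)) :* (w :* o)) refl j₁ j₄ w i₂ ω ⟩
        j₄ * (j₁ * w * j₄ * (i₂ * i₂)) * (w * ω) ≈⟨ *-cong (*-congˡ (*-congʳ (sym (pinf-winf x x^M≈0)))) w*ω ⟩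
        j₄ * (j₂ * j₂ * (i₂ * i₂)) * 1# ≈⟨ trans (*-identityʳ _) (trans (*-congˡ (inverse-* j₂*i₂ j₂*i₂)) (*-identityʳ _)) ⟩
        j₄ ∎

      clear₄ : j₁ * (j₄ * j₄) * (w * w) * (i₄ * i₄ * (ω * ω)) ≈ j₁
      clear₄ = begin
        j₁ * (j₄ * j₄) * (w * w) * (i₄ * i₄ * (ω * ω))
          ≈⟨ solve 5 (λ a b w i o → a :* (b :* b) :* (w :* w) :* (i :* i :* (o :* o)) := a :* (b :* b :* (i :* i) :* (w :* w :* (o :* o)))) refl j₁ j₄ w i₄ ω ⟩
        j₁ * (j₄ * j₄ * (i₄ * i₄) * (w * w * (ω * ω))) ≈⟨ *-congˡ (*-cong (inverse-* j₄*i₄ j₄*i₄) (inverse-* w*ω w*ω)) ⟩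
        j₁ * (1# * 1#) ≈⟨ trans (*-congˡ (*-identityˡ _)) (*-identityʳ _) ⟩
        j₁ ∎

    -- The multiplier j₁ j₄² w² removes all inverses at once: by `pinf-winf` it turns the
    -- coefficient of A into j₄, and the coefficient of B into x j₁.
    even-cleared : ∀ {Π A B} → Π ≈ i₂ * i₂ * ω * A + x * (i₄ * i₄ * (ω * ω)) * B →
      j₁ * (j₄ * j₄) * (w * w) * Π ≈ j₄ * A + x * j₁ * B
    even-cleared {Π} {A} {B} e = begin
      c * Π ≈⟨ *-congˡ e ⟩
      c * (i₂ * i₂ * ω * A + x * (i₄ * i₄ * (ω * ω)) * B)
        ≈⟨ solve 6 (λ c s t x A B → c :* (s :* A :+ x :* t :* B) := c :* s :* A :+ x :* (c :* t) :* B) refl c (i₂ * i₂ * ω) (i₄ * i₄ * (ω * ω)) x A B ⟩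
      c * (i₂ * i₂ * ω) * A + x * (c * (i₄ * i₄ * (ω * ω))) * B ≈⟨ +-cong (*-congʳ clear₂) (*-congʳ (*-congˡ clear₄)) ⟩
      j₄ * A + x * j₁ * B ∎
      where c = j₁ * (j₄ * j₄) * (w * w)

    odd-cleared : ∀ {Π A B} → Π ≈ i₄ * i₄ * (ω * ω) * B + i₂ * i₂ * ω * A →
      j₁ * (j₄ * j₄) * (w * w) * Π ≈ j₁ * B + j₄ * A
    odd-cleared {Π} {A} {B} e = begin
      c * Π ≈⟨ *-congˡ e ⟩
      c * (i₄ * i₄ * (ω * ω) * B + i₂ * i₂ * ω * A)
        ≈⟨ solve 5 (λ c s t A B → c :* (t :* B :+ s :* A) := c :* t :* B :+ c :* s :* A) refl c (i₂ * i₂ * ω) (i₄ * i₄ * (ω * ω)) A B ⟩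
      c * (i₄ * i₄ * (ω * ω)) * B + c * (i₂ * i₂ * ω) * A ≈⟨ +-cong (*-congʳ clear₄) (*-congʳ clear₂) ⟩
      j₁ * B + j₄ * A ∎
      where c = j₁ * (j₄ * j₄) * (w * w)

-- Lambert series and the specialisations w = i, w = -1 and w = -1/x.

e₃ : ℕ → ℕ
e₃ n = tri n ℕ.+ n ℕ.* suc n

lab-A : ∀ n → 2 ℕ.* n ℕ.+ 1 ≡ n ℕ.+ n ℕ.+ 1
lab-A = solve 1 (λ n → con 2 :* n :+ con 1 := n :+ n :+ con 1) ≡.refl
  where open +-*-Solver

double-A : ∀ n → 2 ℕ.* n ℕ.+ 1 ℕ.+ (2 ℕ.* n ℕ.+ 1) ≡ 2 ℕ.* (n ℕ.+ n ℕ.+ 1)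
double-A = solve 1 (λ n → con 2 :* n :+ con 1 :+ (con 2 :* n :+ con 1) := con 2 :* (n :+ n :+ con 1)) ≡.refl
  where open +-*-Solver

double-B : ∀ n → 4 ℕ.* n ℕ.+ 2 ℕ.+ (4 ℕ.* n ℕ.+ 2) ≡ 4 ℕ.* (n ℕ.+ n ℕ.+ 1)
double-B = solve 1 (λ n → con 4 :* n :+ con 2 :+ (con 4 :* n :+ con 2) := con 4 :* (n :+ n :+ con 1)) ≡.refl
  where open +-*-Solver

double-O : ∀ n → 4 ℕ.* n ℕ.+ 0 ℕ.+ (4 ℕ.* n ℕ.+ 0) ≡ 4 ℕ.* (n ℕ.+ n)
double-O = solve 1 (λ n → con 4 :* n :+ con 0 :+ (con 4 :* n :+ con 0) := con 4 :* (n :+ n)) ≡.refl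
  where open +-*-Solver

suc-double : ∀ n → suc (2 ℕ.* n) ≡ n ℕ.+ n ℕ.+ 1
suc-double = solve 1 (λ n → con 1 :+ con 2 :* n := n :+ n :+ con 1) ≡.refl
  where open +-*-Solver

pred-A : ∀ n → 2 ℕ.* suc n ℕ.+ 1 ℕ.∸ 1 ≡ suc n ℕ.+ suc n
pred-A n = ≡.trans (ℕₚ.m+n∸n≡m (2 ℕ.* suc n) 1) (≡.cong (suc n ℕ.+_) (ℕₚ.+-identityʳ (suc n)))

suc-A : ∀ n → suc (2 ℕ.* suc n ℕ.+ 1) ≡ suc (suc n) ℕ.+ suc (suc n)
suc-A = solve 1 (λ n → con 1 :+ (con 2 :* (con 1 :+ n) :+ con 1) := (con 2 :+ n) :+ (con 2 :+ n)) ≡.refl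
  where open +-*-Solver

pred-B : ∀ m → 4 ℕ.* m ℕ.+ 2 ℕ.∸ 1 ≡ 4 ℕ.* m ℕ.+ 1
pred-B m = ℕₚ.+-∸-assoc (4 ℕ.* m) {2} {1} (s≤s z≤n)

suc-B : ∀ m → suc (4 ℕ.* m ℕ.+ 2) ≡ 4 ℕ.* m ℕ.+ 3
suc-B m = ≡.sym (ℕₚ.+-suc (4 ℕ.* m) 2)

parity-B₁ : ∀ i → 4 ℕ.* i ℕ.+ 1 ≡ suc (2 ℕ.* (i ℕ.+ i))
parity-B₁ = solve 1 (λ i → con 4 :* i :+ con 1 := con 1 :+ con 2 :* (i :+ i)) ≡.refl
  where open +-*-Solver

parity-B₃ : ∀ i → 4 ℕ.* i ℕ.+ 3 ≡ suc (2 ℕ.* suc (i ℕ.+ i))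
parity-B₃ = solve 1 (λ i → con 4 :* i :+ con 3 := con 1 :+ con 2 :* (con 1 :+ (i :+ i))) ≡.refl
  where open +-*-Solver

shifted-exponent : ∀ t n → t ℕ.+ n ℕ.* suc n ℕ.+ (suc n ℕ.+ suc n) ≡ t ℕ.+ suc n ℕ.+ suc n ℕ.* suc n
shifted-exponent = solve 2 (λ t n → t :+ n :* (con 1 :+ n) :+ ((con 1 :+ n) :+ (con 1 :+ n)) := t :+ (con 1 :+ n) :+ (con 1 :+ n) :* (con 1 :+ n)) ≡.refl
  where open +-*-Solver

split-exponent : ∀ t n → t ℕ.+ n ℕ.* suc n ≡ t ℕ.+ n ℕ.* n ℕ.+ n
split-exponent = solve 2 (λ t n → t :+ n :* (con 1 :+ n) := t :+ n :* n :+ n) ≡.refl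
  where open +-*-Solver

module LambertSums (R : CommutativeRing 0ℓ 0ℓ) (M : ℕ) where
  open CommutativeRing R
  open IntegerSolver R
  open FiniteSums R
  open Geometric R M
  open import Algebra.Properties.Semiring.Exp semiring

  two : Carrier
  two = 1# + 1#

  -- `SA` and `SC` carry the coefficients of 1 and ζ₈ in the rank series. `S₂₄` and `S₁₄` are
  -- (q⁴;q⁴)_∞ times g(q²;q⁴) and g(q;q⁴). `SE` and `SZ` are the auxiliary series through which the
  -- former are related to the latter. The exponent `e₃ n` is 3n(n + 1)/2.
  SA SC SE SZ S₂₄ S₁₄ : Carrier → Carrier
  SA q = ∑ M (λ n → sg n * q ^ e₃ n * (1# - (q ^ 2) ^ (n ℕ.+ n ℕ.+ 1)) * geo (- (q ^ 2) ^ (n ℕ.+ n ℕ.+ 1)))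
  SC q = ∑ M (λ n → sg n * q ^ (n ℕ.* suc n ℕ.+ tri (suc n)) * (1# - q ^ (n ℕ.+ n ℕ.+ 1)) * geo (- (q ^ 2) ^ (n ℕ.+ n ℕ.+ 1)))
  SE q = ∑ M (λ n → sg n * q ^ e₃ n * (1# - q ^ (n ℕ.+ n ℕ.+ 1)) * geo (- q ^ (n ℕ.+ n ℕ.+ 1)))
  S₂₄ q = ∑ M (λ m → sg m * (q ^ 4) ^ e₃ m * (1# - (q ^ 4) ^ (m ℕ.+ m ℕ.+ 1)) * (geo (q ^ (4 ℕ.* m ℕ.+ 2)) * geo (q ^ (4 ℕ.* m ℕ.+ 2))))
  S₁₄ q = ∑ M (λ m → sg m * (q ^ 4) ^ e₃ m * (1# - (q ^ 4) ^ (m ℕ.+ m ℕ.+ 1)) * (geo (q ^ (4 ℕ.* m ℕ.+ 1)) * geo (q ^ (4 ℕ.* m ℕ.+ 3))))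

  -- ρ q m = 2 / (1 + q^(2m)), also for m = 0 where 1 + q^(2m) need not be a unit
  ρ kap : Carrier → ℕ → Carrier
  ρ q zero    = 1#
  ρ q (suc m) = two * geo (- q ^ (suc m ℕ.+ suc m))
  kap q zero    = 1#
  kap q (suc m) = 1# + q ^ suc m

  SZ q = ∑ M (λ m → sg m * q ^ (tri m ℕ.+ m ℕ.* m) * kap q m * ρ q m)

module Specialisations (R : CommutativeRing 0ℓ 0ℓ) (M : ℕ) (x : CommutativeRing.Carrier R) (x^M≈0 : Vanishes R M x) where
  open CommutativeRing R
  open IntegerSolver R
  open FiniteSums R
  open Nilpotent R M x x^M≈0
  open Families R M x x^M≈0
  open LambertIdentities R M x x^M≈0
  open ThetaValues R M x x^M≈0
  open CrossResidues R M x x^M≈0 using (γ; γ-inverse; γ-large)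
  open ThetaProducts R M
  open LambertSums R M
  open Cleared x x^M≈0
  open import Algebra.Properties.Semiring.Exp semiring
  open import Relation.Binary.Reasoning.Setoid setoid

  private
    module C2 = Cleared (x ^ 2) (vanishes-^ 2 (s≤s z≤n))
    module C4 = Cleared (x ^ 4) (vanishes-^ 4 (s≤s z≤n))

    M≤N : M ℕ.≤ N
    M≤N = ℕₚ.m≤n⇒m≤1+n M≤N₁

    neg-geo : ∀ {a b} → a ≈ b → geo (- a) ≈ geo (- b)
    neg-geo e = geo-cong (-‿cong e)

    γ-inverse′ : ∀ e → 1 ℕ.≤ e → (1# + x ^ e) * γ e ≈ 1#
    γ-inverse′ (suc e) _ = γ-inverse e

    j₁-unit : j₁ * pinf⁻¹ x x^M≈0 ≈ 1#
    j₁-unit = pinf-inverse x x^M≈0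

  -- w = i. The form is 1 + y², which does not see the sign of a label. The first expansion ties
  -- `SA x` to `SE (x ^ 4)`, the second ties `SC x` to `SZ (x ^ 4)`.
  module τ=0 where
    z : ℕ → Carrier
    z _ = 0#

    z-geo : ∀ e₀ k e → e₀ ℕ.≤ e → z (k ℕ.+ e) ≈ x ^ k * z e
    z-geo e₀ k e _ = sym (zeroʳ _)

    f : Label → Carrier
    f (s , e) = γ (e ℕ.+ e)

    f-inverse : ∀ e₀ l → 1 ℕ.≤ proj₂ l → Spectral.L z e₀ (z-geo e₀) l * f l ≈ 1#
    f-inverse e₀ (s , e) 1≤e = trans (*-congʳ (begin
      1# + σ s * x ^ e * (σ s * x ^ e) - σ s * 0#
        ≈⟨ solve 2 (λ s a → :1 :+ s :* a :* (s :* a) :- s :* :0 := :1 :+ s :* s :* (a :* a)) refl (σ s) (x ^ e) ⟩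
      1# + σ s * σ s * (x ^ e * x ^ e) ≈⟨ +-congˡ (trans (*-cong (σ-sq s) (sym (^-homo-* x e e))) (*-identityˡ _)) ⟩
      1# + x ^ (e ℕ.+ e) ∎)) (γ-inverse′ (e ℕ.+ e) (ℕₚ.≤-trans 1≤e (ℕₚ.m≤m+n e e)))

    module Ev = Even z (z-geo 1) f (λ l 2≤l → f-inverse 1 l (ℕₚ.≤-trans (s≤s z≤n) 2≤l))
    module Od = Odd z (z-geo 0) f (f-inverse 0)

    f-A : ∀ n → f (FA.lab n) ≈ geo (- (x ^ 2) ^ (n ℕ.+ n ℕ.+ 1))
    f-A n = neg-geo (trans (^-congʳ x (double-A n)) (sym (^-assocʳ x 2 (n ℕ.+ n ℕ.+ 1))))

    f-B : ∀ n → f (FB.lab n) ≈ geo (- (x ^ 4) ^ (n ℕ.+ n ℕ.+ 1))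
    f-B n = neg-geo (trans (^-congʳ x (double-B n)) (sym (^-assocʳ x 4 (n ℕ.+ n ℕ.+ 1))))

    f-O : ∀ n → f (FO.lab n) ≈ geo (- (x ^ 4) ^ (n ℕ.+ n))
    f-O n = neg-geo (trans (^-congʳ x (double-O n)) (sym (^-assocʳ x 4 (n ℕ.+ n))))

    ΠA ΠB ΠO : Carrier
    ΠA = ∏ N (λ i → f (FA.lab i))
    ΠB = ∏ N (λ j → f (FB.lab j))
    ΠO = ∏ N₁ (λ i → f (FO.lab (suc i)))

    ΠA-inverse : winf (x ^ 2) * ΠA ≈ 1#
    ΠA-inverse = trans (*-congʳ (sym (C2.winf-stable N M≤N))) (∏-inverse N λ i _ →
      trans (*-congʳ (+-congˡ (trans (^-assocʳ x 2 (suc (2 ℕ.* i))) (^-congʳ x (≡.trans (≡.cong (2 ℕ.*_) (suc-double i)) (≡.sym (double-A i)))))))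
        (γ-inverse′ _ (ℕₚ.≤-trans (ℕₚ.m≤n+m 1 (2 ℕ.* i)) (ℕₚ.m≤m+n _ _))))

    ΠB-inverse : winf (x ^ 4) * ΠB ≈ 1#
    ΠB-inverse = trans (*-congʳ (sym (C4.winf-stable N M≤N))) (∏-inverse N λ i _ →
      trans (*-congʳ (+-congˡ (trans (^-assocʳ x 4 (suc (2 ℕ.* i))) (^-congʳ x (≡.trans (≡.cong (4 ℕ.*_) (suc-double i)) (≡.sym (double-B i)))))))
        (γ-inverse′ _ (ℕₚ.≤-trans (ℕₚ.≤-trans (s≤s z≤n) (ℕₚ.m≤n+m 2 (4 ℕ.* i))) (ℕₚ.m≤m+n _ _))))

    ΠO-inverse : vinf ((x ^ 4) ^ 2) * ΠO ≈ 1#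
    ΠO-inverse = trans (*-congʳ (sym stable)) (∏-inverse N₁ λ i _ →
      trans (*-congʳ (+-congˡ (trans (^-assocʳ (x ^ 4) 2 (suc i)) (trans (^-assocʳ x 4 (2 ℕ.* suc i)) (^-congʳ x (eq i))))))
        (γ-inverse′ (4 ℕ.* suc i ℕ.+ 0 ℕ.+ (4 ℕ.* suc i ℕ.+ 0)) (s≤s z≤n)))
      where
      open Nilpotent R M ((x ^ 4) ^ 2) (x²-nil (x ^ 4) (vanishes-^ 4 (s≤s z≤n))) using () renaming (x^≥M to P^≥M)
      stable : ∏ N₁ (λ i → 1# + ((x ^ 4) ^ 2) ^ suc i) ≈ vinf ((x ^ 4) ^ 2)
      stable = ∏-truncate M≤N₁ λ i M≤i → trans (+-congˡ (P^≥M (ℕₚ.m≤n⇒m≤1+n M≤i))) (+-identityʳ _)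
      eq : ∀ i → 4 ℕ.* (2 ℕ.* suc i) ≡ 4 ℕ.* suc i ℕ.+ 0 ℕ.+ (4 ℕ.* suc i ℕ.+ 0)
      eq i = ≡.trans (≡.cong (λ k → 4 ℕ.* (suc i ℕ.+ k)) (ℕₚ.+-identityʳ (suc i))) (≡.sym (double-O (suc i)))

    even₀ : j₁ * (j₄ * j₄) * (w * w) * (ΠA * ΠB) ≈ j₄ * SA x + x * j₁ * SE (x ^ 4)
    even₀ = even-cleared (trans (Ev.even-unit (f-inverse 1 (FA.lab 0) (s≤s z≤n)))
      (+-cong (*-congˡ (∑-cong M λ n _ → *-congˡ (f-A n))) (*-congˡ (∑-cong M λ m _ → *-congˡ (f-B m)))))

    odd₀ : j₁ * (j₄ * j₄) * (w * w) * (ΠO * ΠA) ≈ j₁ * SZ (x ^ 4) + j₄ * (two * SC x)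
    odd₀ = odd-cleared (trans Od.odd (+-cong (*-congˡ (∑-cong M λ m _ → *-cong (*-congˡ (κ-kap m)) (scaled-ρ m)))
      (*-congˡ (trans (∑-cong M λ n _ → trans (*-cong (*-congˡ (+-congˡ (-‿cong (^-congʳ x (lab-A n))))) (*-cong V≈2 (f-A n)))
        (solve 3 (λ a t b → a :* (t :* b) := t :* (a :* b)) refl _ two _)) (sym (*-∑ M two))))))
      where
      V≈2 : Od.V ≈ two
      V≈2 = solve 0 (:1 :+ (:- :1 :* :1) :* (:- :1 :* :1) :- (:- :1) :* :0 := :1 :+ :1) refl
      κ-kap : ∀ m → κ m ≈ kap (x ^ 4) m
      κ-kap zero    = refl
      κ-kap (suc m) = refl
      scaled-ρ : ∀ m → Od.scaled m ≈ ρ (x ^ 4) m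
      scaled-ρ zero    = refl
      scaled-ρ (suc m) = *-cong V≈2 (f-O (suc m))

  -- w = -1. Every form is the square (1 + y)². On the odd powers of x one of the two equal factors
  -- cancels against 1 - x^(2e), which leaves `SE x`; on the labels -x^(4m+2) the double
  -- denominators are those of g(x²;x⁴).
  module τ=-2 where
    z : ℕ → Carrier
    z e = - (x ^ e + x ^ e)

    z-geo : ∀ k e → 1 ℕ.≤ e → z (k ℕ.+ e) ≈ x ^ k * z e
    z-geo k e _ = trans (-‿cong (+-cong (^-homo-* x k e) (^-homo-* x k e)))
      (solve 2 (λ a b → :- (a :* b :+ a :* b) := a :* (:- (b :+ b))) refl (x ^ k) (x ^ e))

    f : Label → Carrier
    f l = geo (- y l) * geo (- y l)

    f-inverse : ∀ l → 1 ℕ.≤ proj₂ l → Spectral.L z 1 z-geo l * f l ≈ 1#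
    f-inverse l@(s , e) 1≤e = trans (*-congʳ (solve 2 (λ s a → :1 :+ s :* a :* (s :* a) :- s :* (:- (a :+ a))
        := (:1 :- (:- (s :* a))) :* (:1 :- (:- (s :* a)))) refl (σ s) (x ^ e)))
      (inverse-* unit unit)
      where
      unit : (1# - - y l) * geo (- y l) ≈ 1#
      unit = geo-inverse (trans (^-congˡ M (solve 2 (λ s a → :- (s :* a) := (:- s) :* a) refl (σ s) (x ^ e))) (c*x^-nil (- σ s) 1≤e))

    module Ev = Even z z-geo f (λ l 2≤l → f-inverse l (ℕₚ.≤-trans (s≤s z≤n) 2≤l))

    geo-A : ∀ n → geo (- y (FA.lab n)) ≈ γ (n ℕ.+ n ℕ.+ 1)
    geo-A n = neg-geo (trans (*-identityˡ _) (^-congʳ x (lab-A n)))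

    geo-B : ∀ m → geo (- y (FB.lab m)) ≈ geo (x ^ (4 ℕ.* m ℕ.+ 2))
    geo-B m = geo-cong (solve 1 (λ a → :- (:- :1 :* a) := a) refl _)

    ΠA : ∏ N (λ i → f (FA.lab i)) ≈ ω * ω
    ΠA = trans (∏-* N) (*-cong e e)
      where
      e : ∏ N (λ i → geo (- y (FA.lab i))) ≈ ω
      e = ∏-cong N λ i _ → trans (geo-A i) (reflexive (≡.cong γ (≡.sym (suc-double i))))

    ΠB : ∏ N (λ j → f (FB.lab j)) * (j₂ * j₂) ≈ j₄ * j₄
    ΠB = begin
      ∏ N (λ j → f (FB.lab j)) * (j₂ * j₂) ≈⟨ *-cong (trans (∏-* N) (*-cong (∏-cong N λ m _ → geo-B m) (∏-cong N λ m _ → geo-B m))) (*-cong halve halve) ⟩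
      b * b * (a * j₄ * (a * j₄)) ≈⟨ solve 3 (λ b a j → b :* b :* (a :* j :* (a :* j)) := a :* b :* (a :* b) :* (j :* j)) refl b a j₄ ⟩
      a * b * (a * b) * (j₄ * j₄) ≈⟨ *-congʳ (trans (*-cong ab ab) (*-identityˡ _)) ⟩
      1# * (j₄ * j₄) ≈⟨ *-identityˡ _ ⟩
      j₄ * j₄ ∎
      where
      a = ainf (x ^ 2)
      b = ∏ N (λ m → geo (x ^ (4 ℕ.* m ℕ.+ 2)))
      halve : j₂ ≈ a * j₄
      halve = trans (pinf-halve (x ^ 2) (vanishes-^ 2 (s≤s z≤n))) (*-congˡ (pinf-cong (^-assocʳ x 2 2)))
      ab : a * b ≈ 1#
      ab = trans (*-congʳ (sym stable)) (∏-inverse N λ m _ → geo-inverse (trans (^-congˡ M (sym (*-identityˡ _))) (c*x^-nil 1# (ℕₚ.≤-trans (s≤s z≤n) (ℕₚ.m≤n+m 2 (4 ℕ.* m))))))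
        where
        stable : ∏ N (λ m → 1# - x ^ (4 ℕ.* m ℕ.+ 2)) ≈ a
        stable = trans (∏-truncate M≤N λ m M≤m → trans (+-congˡ (-‿cong (x^≥M (ℕₚ.≤-trans M≤m (ℕₚ.≤-trans (ℕₚ.m≤n*m m 4) (ℕₚ.m≤m+n _ 2)))))) (solve 0 (:1 :- :0 := :1) refl))
          (∏-cong M λ m _ → +-congˡ (-‿cong (trans (^-congʳ x (ℕₚ.+-comm (4 ℕ.* m) 2)) (trans (^-homo-* x 2 (4 ℕ.* m)) (*-congˡ (sym (trans (^-congˡ m (^-assocʳ x 2 2)) (^-assocʳ x 4 m))))))))

    collapse : ∀ n → (1# - (x ^ 2) ^ (n ℕ.+ n ℕ.+ 1)) * f (FA.lab n) ≈ (1# - x ^ (n ℕ.+ n ℕ.+ 1)) * γ (n ℕ.+ n ℕ.+ 1)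
    collapse n = begin
      (1# - (x ^ 2) ^ e) * f (FA.lab n) ≈⟨ *-cong (+-congˡ (-‿cong (trans (sq-^ x e) (^-homo-* x e e)))) (*-cong (geo-A n) (geo-A n)) ⟩
      (1# - x ^ e * x ^ e) * (γ e * γ e) ≈⟨ solve 2 (λ a g → (:1 :- a :* a) :* (g :* g) := (:1 :- a) :* g :* ((:1 :+ a) :* g)) refl (x ^ e) (γ e) ⟩
      (1# - x ^ e) * γ e * ((1# + x ^ e) * γ e) ≈⟨ trans (*-congˡ (γ-inverse′ e (ℕₚ.m≤n+m 1 (n ℕ.+ n)))) (*-identityʳ _) ⟩
      (1# - x ^ e) * γ e ∎
      where e = n ℕ.+ n ℕ.+ 1

    even₂ : j₁ * (j₄ * j₄) * (w * w) * (∏ N (λ i → f (FA.lab i)) * ∏ N (λ j → f (FB.lab j))) ≈ j₄ * SE x + x * j₁ * S₂₄ x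
    even₂ = even-cleared (trans (Ev.even-unit (f-inverse (FA.lab 0) (s≤s z≤n)))
      (+-cong (*-congˡ (∑-cong M λ n _ → trans (*-assoc _ _ _) (trans (*-congˡ (collapse n)) (sym (*-assoc _ _ _)))))
        (*-congˡ (∑-cong M λ m _ → *-congˡ (*-cong (geo-B m) (geo-B m))))))

  -- ε + x g(x²;x⁴) = J₄³ / J₂², where J₁ ε = SE x
  ε-identity : ∀ {ε G} → j₁ * ε ≈ SE x → j₄ * G ≈ S₂₄ x → j₂ * j₂ * (ε + x * G) ≈ j₄ * j₄ * j₄
  ε-identity {ε} {G} hε hG = *-cancel (inverse-* j₁-unit j₄*i₄) (begin
    j₁ * j₄ * (j₂ * j₂ * (ε + x * G))
      ≈⟨ solve 6 (λ a b c e x g → a :* b :* (c :* c :* (e :+ x :* g)) := c :* c :* (b :* (a :* e) :+ x :* a :* (b :* g))) refl j₁ j₄ j₂ ε x G ⟩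
    j₂ * j₂ * (j₄ * (j₁ * ε) + x * j₁ * (j₄ * G)) ≈⟨ *-congˡ (+-cong (*-congˡ hε) (*-congˡ hG)) ⟩
    j₂ * j₂ * (j₄ * SE x + x * j₁ * S₂₄ x) ≈⟨ *-congˡ (sym even₂) ⟩
    j₂ * j₂ * (j₁ * (j₄ * j₄) * (w * w) * (∏ N (λ i → f (FA.lab i)) * ∏ N (λ j → f (FB.lab j))))
      ≈⟨ *-congˡ (*-congˡ (*-congʳ ΠA)) ⟩
    j₂ * j₂ * (j₁ * (j₄ * j₄) * (w * w) * (ω * ω * ∏ N (λ j → f (FB.lab j))))
      ≈⟨ solve 6 (λ c a b w o p → c :* c :* (a :* (b :* b) :* (w :* w) :* (o :* o :* p)) := a :* (b :* b) :* ((w :* o) :* (w :* o)) :* (p :* (c :* c))) refl j₂ j₁ j₄ w ω _ ⟩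
    j₁ * (j₄ * j₄) * ((w * ω) * (w * ω)) * (∏ N (λ j → f (FB.lab j)) * (j₂ * j₂)) ≈⟨ *-cong (*-congˡ (trans (*-cong w*ω w*ω) (*-identityˡ _))) ΠB ⟩
    j₁ * (j₄ * j₄) * 1# * (j₄ * j₄) ≈⟨ solve 2 (λ a b → a :* (b :* b) :* :1 :* (b :* b) := a :* b :* (b :* b :* b)) refl j₁ j₄ ⟩
    j₁ * j₄ * (j₄ * j₄ * j₄) ∎)
    where open τ=-2

  -- w = -1/x. The form of (s , e) factors as (1 + s x^(e-1))(1 + s x^(e+1)). On the labels
  -- -x^(4m+2) these are the denominators of g(x;x⁴); at the label x the form is 2 (1 + x²), so
  -- units are claimed from degree 2 on only.
  module τ=-[x+x⁻¹] where
    z : ℕ → Carrier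
    -- A dummy value: τ itself would contain 1/x, and `z-geo` is asked for from degree 1 on only.
    z zero    = 0#
    z (suc e) = - (x ^ e + x ^ suc (suc e))

    z-geo : ∀ k e → 1 ℕ.≤ e → z (k ℕ.+ e) ≈ x ^ k * z e
    z-geo k (suc e) _ = begin
      z (k ℕ.+ suc e) ≡⟨ ≡.cong z (ℕₚ.+-suc k e) ⟩
      - (x ^ (k ℕ.+ e) + x * (x * x ^ (k ℕ.+ e))) ≈⟨ -‿cong (+-cong (^-homo-* x k e) (*-congˡ (*-congˡ (^-homo-* x k e)))) ⟩
      - (x ^ k * x ^ e + x * (x * (x ^ k * x ^ e))) ≈⟨ solve 3 (λ x a b → :- (a :* b :+ x :* (x :* (a :* b))) := a :* (:- (b :+ x :* (x :* b)))) refl x (x ^ k) (x ^ e) ⟩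
      x ^ k * z (suc e) ∎

    f : Label → Carrier
    f (s , e) = geo (- (σ s * x ^ (e ℕ.∸ 1))) * geo (- (σ s * x ^ suc e))

    f-inverse : ∀ l → 2 ℕ.≤ proj₂ l → Spectral.L z 1 z-geo l * f l ≈ 1#
    f-inverse (s , suc (suc e)) (s≤s (s≤s _)) = trans (*-congʳ (solve 3 (λ s x a →
        :1 :+ s :* (x :* a) :* (s :* (x :* a)) :- s :* (:- (a :+ x :* (x :* a)))
          := (:1 :- (:- (s :* a))) :* (:1 :- (:- (s :* (x :* (x :* a)))))) refl (σ s) x (x ^ suc e)))
      (inverse-* (unit e) (unit (suc (suc e))))
      where
      unit : ∀ k → (1# - - (σ s * x ^ suc k)) * geo (- (σ s * x ^ suc k)) ≈ 1#
      unit k = geo-inverse (trans (^-congˡ M (solve 2 (λ s a → :- (s :* a) := (:- s) :* a) refl (σ s) (x ^ suc k))) (c*x^-nil (- σ s) {suc k} (s≤s z≤n)))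

    module Ev = Even z z-geo f f-inverse

    V≈ : Ev.V ≈ two * (1# + x ^ 2)
    V≈ = solve 1 (λ x → :1 :+ :1 :* (x :* :1) :* (:1 :* (x :* :1)) :- :1 :* (:- (:1 :+ x :* (x :* :1)))
           := (:1 :+ :1) :* (:1 :+ x :* (x :* :1))) refl x

    f-A : ∀ n → f (FA.lab (suc n)) ≈ γ (suc n ℕ.+ suc n) * γ (suc (suc n) ℕ.+ suc (suc n))
    f-A n = *-cong (neg-geo (trans (*-identityˡ _) (^-congʳ x (pred-A n)))) (neg-geo (trans (*-identityˡ _) (^-congʳ x (suc-A n))))

    f-B : ∀ m → f (FB.lab m) ≈ geo (x ^ (4 ℕ.* m ℕ.+ 1)) * geo (x ^ (4 ℕ.* m ℕ.+ 3))
    f-B m = *-cong (geo-cong (trans (neg _) (^-congʳ x (pred-B m)))) (geo-cong (trans (neg _) (^-congʳ x (suc-B m))))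
      where
      neg : ∀ a → - (- 1# * a) ≈ a
      neg = solve 1 (λ a → :- (:- :1 :* a) := a) refl

    -- With X = x^(2n) and Y = x^(2n+2), (1 - XY) / ((1 + X)(1 + Y)) = 1/(1 + X) - Y/(1 + Y)
    -- separates neighbouring indices. At n = 0 the fraction 1/(1 + X) would be 1/2; the 2 in `V`
    -- compensates for it.
    collapse : ∀ n → (1# - (x ^ 2) ^ (n ℕ.+ n ℕ.+ 1)) * Ev.scaled n ≈ (1# + x ^ 2) * (ρ x n - x ^ (suc n ℕ.+ suc n) * ρ x (suc n))
    collapse zero = begin
      (1# - (x ^ 2) ^ 1) * 1# ≈⟨ solve 1 (λ x → (:1 :- x :* :1) :* :1 := :1 :+ x :- x :* ((:1 :+ :1) :* :1)) refl (x ^ 2) ⟩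
      1# + x ^ 2 - x ^ 2 * (two * 1#) ≈⟨ +-congˡ (-‿cong (*-congˡ (*-congˡ (sym (γ-inverse 1))))) ⟩
      1# + x ^ 2 - x ^ 2 * (two * ((1# + x ^ 2) * γ 2)) ≈⟨ solve 3 (λ x t g → :1 :+ x :- x :* (t :* ((:1 :+ x) :* g)) := (:1 :+ x) :* (:1 :- x :* (t :* g))) refl (x ^ 2) two (γ 2) ⟩
      (1# + x ^ 2) * (1# - x ^ 2 * (two * γ 2)) ∎
    collapse (suc n) = begin
      (1# - (x ^ 2) ^ (suc n ℕ.+ suc n ℕ.+ 1)) * (Ev.V * f (FA.lab (suc n)))
        ≈⟨ *-cong (+-congˡ (-‿cong (trans (sq-^ x (suc n ℕ.+ suc n ℕ.+ 1)) (trans (^-congʳ x (eq n)) (^-homo-* x a b))))) (*-cong V≈ (f-A n)) ⟩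
      (1# - x ^ a * x ^ b) * (two * (1# + x ^ 2) * (γ a * γ b))
        ≈⟨ solve 6 (λ X Y t u g h → (:1 :- X :* Y) :* (t :* u :* (g :* h)) := u :* (t :* (g :* ((:1 :+ Y) :* h)) :- Y :* (t :* (((:1 :+ X) :* g) :* h)))) refl (x ^ a) (x ^ b) two (1# + x ^ 2) (γ a) (γ b) ⟩
      (1# + x ^ 2) * (two * (γ a * ((1# + x ^ b) * γ b)) - x ^ b * (two * (((1# + x ^ a) * γ a) * γ b)))
        ≈⟨ *-congˡ (+-cong (*-congˡ (trans (*-congˡ (γ-inverse′ b (s≤s z≤n))) (*-identityʳ _))) (-‿cong (*-congˡ (*-congˡ (trans (*-congʳ (γ-inverse′ a (s≤s z≤n))) (*-identityˡ _)))))) ⟩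
      (1# + x ^ 2) * (two * γ a - x ^ b * (two * γ b)) ∎
      where
      a = suc n ℕ.+ suc n
      b = suc (suc n) ℕ.+ suc (suc n)
      module S = +-*-Solver
      eq : ∀ n → suc n ℕ.+ suc n ℕ.+ 1 ℕ.+ (suc n ℕ.+ suc n ℕ.+ 1) ≡ suc n ℕ.+ suc n ℕ.+ (suc (suc n) ℕ.+ suc (suc n))
      eq = S.solve 1 (λ n → let m = S.con 1 S.:+ n in m S.:+ m S.:+ S.con 1 S.:+ (m S.:+ m S.:+ S.con 1) S.:= m S.:+ m S.:+ ((S.con 1 S.:+ m) S.:+ (S.con 1 S.:+ m))) ≡.refl

    -- Summation by parts: the second term of index n and the first of index n + 1 have the same
    -- denominator. Their exponents differ by n + 1, which yields the factor `kap`.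
    regroup : ∑ M (λ n → sg n * x ^ e₃ n * (ρ x n - x ^ (suc n ℕ.+ suc n) * ρ x (suc n))) ≈ SZ x
    regroup = begin
      ∑ M (λ n → sg n * x ^ e₃ n * (ρ x n - x ^ (suc n ℕ.+ suc n) * ρ x (suc n))) ≈⟨ trans (∑-cong M λ n _ → open-up n) (∑-+ M) ⟩
      ∑ M α + ∑ M (λ n → β (suc n)) ≈⟨ +-congʳ (trans (sym (∑-truncate (ℕₚ.n≤1+n M) α-large)) (∑-head M)) ⟩
      α 0 + ∑ M (λ n → α (suc n)) + ∑ M (λ n → β (suc n)) ≈⟨ trans (+-assoc _ _ _) (+-cong (*-congʳ (sym (*-identityʳ _))) (trans (sym (∑-+ M)) (∑-cong M λ n _ → sym (t-suc n)))) ⟩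
      τ 0 + ∑ M (λ n → τ (suc n)) ≈⟨ sym (∑-head M) ⟩
      ∑ (suc M) τ ≈⟨ ∑-truncate (ℕₚ.n≤1+n M) τ-large ⟩
      SZ x ∎
      where
      α β τ : ℕ → Carrier
      α n = sg n * x ^ e₃ n * ρ x n
      β n = sg n * x ^ (tri n ℕ.+ n ℕ.* n) * ρ x n
      τ n = sg n * x ^ (tri n ℕ.+ n ℕ.* n) * kap x n * ρ x n
      α-large : ∀ n → M ℕ.≤ n → α n ≈ 0#
      α-large n M≤n = trans (*-congʳ (*-congˡ (x^≥M (ℕₚ.≤-trans M≤n (ℕₚ.≤-trans (n≤tri[n] n) (ℕₚ.m≤m+n _ _)))))) (solve 2 (λ a b → a :* :0 :* b := :0) refl _ _)
      τ-large : ∀ n → M ℕ.≤ n → τ n ≈ 0#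
      τ-large n M≤n = trans (*-congʳ (*-congʳ (*-congˡ (x^≥M (ℕₚ.≤-trans M≤n (ℕₚ.≤-trans (n≤tri[n] n) (ℕₚ.m≤m+n _ _))))))) (solve 3 (λ a b c → a :* :0 :* b :* c := :0) refl _ _ _)
      open-up : ∀ n → sg n * x ^ e₃ n * (ρ x n - x ^ (suc n ℕ.+ suc n) * ρ x (suc n)) ≈ α n + β (suc n)
      open-up n = begin
        sg n * x ^ e₃ n * (ρ x n - x ^ (suc n ℕ.+ suc n) * ρ x (suc n))
          ≈⟨ solve 5 (λ s a r b r′ → s :* a :* (r :- b :* r′) := s :* a :* r :+ (:- s) :* (a :* b) :* r′) refl (sg n) (x ^ e₃ n) (ρ x n) (x ^ (suc n ℕ.+ suc n)) (ρ x (suc n)) ⟩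
        α n + - sg n * (x ^ e₃ n * x ^ (suc n ℕ.+ suc n)) * ρ x (suc n)
          ≈⟨ +-congˡ (*-congʳ (*-congˡ (trans (sym (^-homo-* x (e₃ n) (suc n ℕ.+ suc n))) (^-congʳ x (shifted-exponent (tri n) n))))) ⟩
        α n + β (suc n) ∎
      t-suc : ∀ n → τ (suc n) ≈ α (suc n) + β (suc n)
      t-suc n = begin
        sg m * X * (1# + x ^ m) * ρ x m ≈⟨ solve 4 (λ s X b r → s :* X :* (:1 :+ b) :* r := s :* (X :* b) :* r :+ s :* X :* r) refl (sg m) X (x ^ m) (ρ x m) ⟩
        sg m * (X * x ^ m) * ρ x m + β m ≈⟨ +-congʳ (*-congʳ (*-congˡ (trans (sym (^-homo-* x (tri m ℕ.+ m ℕ.* m) m)) (^-congʳ x (≡.sym (split-exponent (tri m) m)))))) ⟩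
        α m + β m ∎
        where
        m = suc n
        X = x ^ (tri m ℕ.+ m ℕ.* m)

    private
      g h b : Carrier
      g = ∏ N₁ (λ i → γ (suc i ℕ.+ suc i))
      h = ∏ N₁ (λ i → γ (suc (suc i) ℕ.+ suc (suc i)))
      b = ∏ N (λ j → f (FB.lab j))

      h≈ : h ≈ (1# + x ^ 2) * g
      h≈ = sym (begin
        (1# + x ^ 2) * g ≈⟨ *-congˡ (sym (trans (*-congˡ (γ-large (ℕₚ.≤-trans M≤N (ℕₚ.m≤m+n (suc N₁) _)) (s≤s z≤n))) (*-identityʳ _))) ⟩
        (1# + x ^ 2) * ∏ (suc N₁) (λ i → γ (suc i ℕ.+ suc i)) ≈⟨ *-congˡ (∏-head N₁) ⟩
        (1# + x ^ 2) * (γ 2 * h) ≈⟨ trans (sym (*-assoc _ _ _)) (trans (*-congʳ (γ-inverse 1)) (*-identityˡ _)) ⟩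
        h ∎)

      j₄g : j₄ * g ≈ j₂
      j₄g = begin
        j₄ * g ≈⟨ *-congʳ (trans (pinf-cong (sym (^-assocʳ x 2 2))) (sym (pinf-vinf (x ^ 2) (vanishes-^ 2 (s≤s z≤n))))) ⟩
        j₂ * vinf (x ^ 2) * g ≈⟨ trans (*-assoc _ _ _) (*-congˡ vg) ⟩
        j₂ * 1# ≈⟨ *-identityʳ _ ⟩
        j₂ ∎
        where
        stable : ∏ N₁ (λ i → 1# + x ^ (suc i ℕ.+ suc i)) ≈ vinf (x ^ 2)
        stable = trans (∏-truncate M≤N₁ λ i M≤i → trans (+-congˡ (x^≥M (ℕₚ.≤-trans M≤i (ℕₚ.≤-trans (ℕₚ.n≤1+n i) (ℕₚ.m≤m+n (suc i) _))))) (+-identityʳ _))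
          (∏-cong M λ i _ → +-congˡ (sym (sq-^ x (suc i))))
        vg : vinf (x ^ 2) * g ≈ 1#
        vg = trans (*-congʳ (sym stable)) (∏-inverse N₁ λ i _ → γ-inverse′ (suc i ℕ.+ suc i) (s≤s z≤n))

      j₁b : j₁ * b ≈ j₂
      j₁b = begin
        j₁ * b ≈⟨ *-cong (pinf-halve x x^M≈0) (trans (∏-cong N λ m _ → f-B m) (∏-* N)) ⟩
        ainf x * j₂ * (b₁ * b₃) ≈⟨ *-congʳ (*-congʳ (sym stable)) ⟩
        a₁ * a₃ * j₂ * (b₁ * b₃) ≈⟨ solve 5 (λ a c j b d → a :* c :* j :* (b :* d) := j :* (a :* b :* (c :* d))) refl a₁ a₃ j₂ b₁ b₃ ⟩
        j₂ * (a₁ * b₁ * (a₃ * b₃)) ≈⟨ *-congˡ (trans (*-cong (∏-inverse N λ m _ → unit (ℕₚ.m≤n+m 1 (4 ℕ.* m))) (∏-inverse N λ m _ → unit (ℕₚ.≤-trans (s≤s z≤n) (ℕₚ.m≤n+m 3 (4 ℕ.* m))))) (*-identityˡ _)) ⟩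
        j₂ * 1# ≈⟨ *-identityʳ _ ⟩
        j₂ ∎
        where
        a₁ = ∏ N (λ m → 1# - x ^ (4 ℕ.* m ℕ.+ 1))
        a₃ = ∏ N (λ m → 1# - x ^ (4 ℕ.* m ℕ.+ 3))
        b₁ = ∏ N (λ m → geo (x ^ (4 ℕ.* m ℕ.+ 1)))
        b₃ = ∏ N (λ m → geo (x ^ (4 ℕ.* m ℕ.+ 3)))
        unit : ∀ {k} → 1 ℕ.≤ k → (1# - x ^ k) * geo (x ^ k) ≈ 1#
        unit {k} 1≤k = geo-inverse (trans (^-congˡ M (sym (*-identityˡ (x ^ k)))) (c*x^-nil 1# {k} 1≤k))
        stable : a₁ * a₃ ≈ ainf x
        stable = begin
          a₁ * a₃ ≈⟨ *-cong (∏-cong N λ m _ → +-congˡ (-‿cong (^-congʳ x (parity-B₁ m)))) (∏-cong N λ m _ → +-congˡ (-‿cong (^-congʳ x (parity-B₃ m)))) ⟩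
          ∏ N (λ m → 1# - x ^ suc (2 ℕ.* (m ℕ.+ m))) * ∏ N (λ m → 1# - x ^ suc (2 ℕ.* suc (m ℕ.+ m))) ≈⟨ sym (∏-parity N) ⟩
          ∏ (N ℕ.+ N) (λ m → 1# - x ^ suc (2 ℕ.* m))
            ≈⟨ ∏-truncate (ℕₚ.≤-trans M≤N (ℕₚ.m≤m+n N N)) (λ m M≤m → trans (+-congˡ (-‿cong (x^≥M (ℕₚ.m≤n⇒m≤1+n (ℕₚ.≤-trans M≤m (ℕₚ.m≤n*m m 2)))))) (solve 0 (:1 :- :0 := :1) refl)) ⟩
          ∏ M (λ m → 1# - x ^ suc (2 ℕ.* m)) ≈⟨ ∏-cong M (λ m _ → +-congˡ (-‿cong (*-congˡ (sym (^-assocʳ x 2 m))))) ⟩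
          ainf x ∎

    even₁ : j₁ * (j₄ * j₄) * (w * w) * ((1# + x ^ 2) * (g * g) * b) ≈ j₄ * ((1# + x ^ 2) * SZ x) + x * j₁ * (two * (1# + x ^ 2) * S₁₄ x)
    even₁ = trans (*-congˡ (*-congʳ (sym ΠA))) (even-cleared (trans Ev.even (+-cong
      (*-congˡ (trans (∑-cong M λ n _ → trans (*-assoc _ _ _) (trans (*-congˡ (collapse n)) (solve 3 (λ a b c → a :* (b :* c) := b :* (a :* c)) refl _ _ _)))
        (trans (sym (*-∑ M _)) (*-congˡ regroup))))
      (*-congˡ (trans (∑-cong M λ m _ → trans (*-congˡ (*-cong V≈ (f-B m))) (solve 3 (λ a b c → a :* (b :* c) := b :* (a :* c)) refl _ _ _))
        (sym (*-∑ M _)))))))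
      where
      ΠA : ∏ N₁ (λ i → f (FA.lab (suc i))) ≈ (1# + x ^ 2) * (g * g)
      ΠA = trans (trans (∏-cong N₁ λ i _ → f-A i) (∏-* N₁)) (trans (*-congˡ h≈) (solve 2 (λ g u → g :* (u :* g) := u :* (g :* g)) refl g (1# + x ^ 2)))

    -- SZ + 2 x J₁ g(x;x⁴) = J₂³ (−x;x²)² / J₄
    Z-identity : ∀ {G} → j₄ * G ≈ S₁₄ x → j₄ * (SZ x + two * (x * j₁ * G)) ≈ j₂ * j₂ * j₂ * (w * w)
    Z-identity {G} hG = *-cancel (γ-inverse 1) (begin
      (1# + x ^ 2) * (j₄ * (SZ x + two * (x * j₁ * G)))
        ≈⟨ solve 7 (λ u j z t x k G → u :* (j :* (z :+ t :* (x :* k :* G))) := j :* (u :* z) :+ x :* k :* (t :* u :* (j :* G))) refl (1# + x ^ 2) j₄ (SZ x) two x j₁ G ⟩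
      j₄ * ((1# + x ^ 2) * SZ x) + x * j₁ * (two * (1# + x ^ 2) * (j₄ * G)) ≈⟨ +-congˡ (*-congˡ (*-congˡ hG)) ⟩
      j₄ * ((1# + x ^ 2) * SZ x) + x * j₁ * (two * (1# + x ^ 2) * S₁₄ x) ≈⟨ sym even₁ ⟩
      j₁ * (j₄ * j₄) * (w * w) * ((1# + x ^ 2) * (g * g) * b)
        ≈⟨ solve 6 (λ k j w u g b → k :* (j :* j) :* (w :* w) :* (u :* (g :* g) :* b) := u :* (k :* b :* (j :* g) :* (j :* g) :* (w :* w))) refl j₁ j₄ w (1# + x ^ 2) g b ⟩
      (1# + x ^ 2) * (j₁ * b * (j₄ * g) * (j₄ * g) * (w * w)) ≈⟨ *-congˡ (*-congʳ (*-cong (*-cong j₁b j₄g) j₄g)) ⟩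
      (1# + x ^ 2) * (j₂ * j₂ * j₂ * (w * w)) ∎)

  open τ=-[x+x⁻¹] public using (Z-identity)

  module Dissection where
    open τ=0

    p P₂ P₄ W₂ W₄ v : Carrier
    p  = x ^ 4
    P₂ = pinf (p ^ 2)
    P₄ = pinf (p ^ 4)
    W₂ = winf (x ^ 2)
    W₄ = winf p
    v  = vinf (p ^ 2)

    private
      p-nil : Vanishes R M p
      p-nil = vanishes-^ 4 (s≤s z≤n)

      P₂-unit : P₂ * pinf⁻¹ (p ^ 2) (x²-nil p p-nil) ≈ 1#
      P₂-unit = pinf-inverse (p ^ 2) (x²-nil p p-nil)

      P₄-unit : P₄ * pinf⁻¹ (p ^ 4) (Families.vanishes-^ R M p p-nil 4 (s≤s z≤n)) ≈ 1#
      P₄-unit = pinf-inverse (p ^ 4) (Families.vanishes-^ R M p p-nil 4 (s≤s z≤n))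

      -- `H₁` and `H₂` are `pinf-winf` in the bases x² and x⁴, and `H₃` is `pinf-vinf` in base x⁸.
      -- They reduce the product side to the products that occur in `φ-dissection`.
      H₁ : j₄ * j₄ ≈ j₂ * W₂ * P₂
      H₁ = trans (*-cong e e) (trans (pinf-winf (x ^ 2) (vanishes-^ 2 (s≤s z≤n))) (*-congˡ (pinf-cong (trans (^-assocʳ x 2 4) (sym (^-assocʳ x 4 2))))))
        where
        e : j₄ ≈ pinf ((x ^ 2) ^ 2)
        e = pinf-cong (sym (^-assocʳ x 2 2))

      H₂ : P₂ * P₂ ≈ j₄ * W₄ * P₄
      H₂ = pinf-winf p p-nil

      H₃ : P₂ * v ≈ P₄
      H₃ = trans (pinf-vinf (p ^ 2) (x²-nil p p-nil)) (pinf-cong (^-assocʳ p 2 2))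

      φ : j₂ * (w * w) ≈ P₂ * (W₄ * W₄) + x * (P₂ * (v * v) + P₂ * (v * v))
      φ = φ-dissection x x^M≈0

    -- a + x ε = J₂(p)⁴ / (J₁(p)² J₄(p)) + 2 x J₄(p)³ / J₂(p)²
    rank-0 : ∀ {a ε F E} → j₁ * a ≈ SA x → j₄ * ε ≈ SE p → j₄ * j₄ * P₄ * F ≈ P₂ * P₂ * P₂ * P₂ → P₂ * P₂ * E ≈ P₄ * P₄ * P₄ →
      a + x * ε ≈ F + x * (E + E)
    rank-0 {a} {ε} {F} {E} ha hε hF hE = begin
      s ≈⟨ *-cancel P₂-unit (begin
        P₂ * s ≈⟨ step₂ ⟩
        -- `s` is φ(x) P₄ / P₂. The dissection of φ gives `F` from φ(x⁴) and twice `E` from x ψ(x⁸).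
        j₂ * (w * w) * P₄ ≈⟨ *-congʳ φ ⟩
        (P₂ * (W₄ * W₄) + x * (P₂ * (v * v) + P₂ * (v * v))) * P₄
          ≈⟨ solve 5 (λ P W x v Q → (P :* (W :* W) :+ x :* (P :* (v :* v) :+ P :* (v :* v))) :* Q := P :* (Q :* (W :* W) :+ x :* (Q :* (v :* v) :+ Q :* (v :* v)))) refl P₂ W₄ x v P₄ ⟩
        P₂ * (P₄ * (W₄ * W₄) + x * (P₄ * (v * v) + P₄ * (v * v))) ∎) ⟩
      P₄ * (W₄ * W₄) + x * (P₄ * (v * v) + P₄ * (v * v)) ≈⟨ +-cong F≈ (*-congˡ (+-cong E≈ E≈)) ⟩
      F + x * (E + E) ∎
      where
      s = a + x * ε
      step₁ : s * (W₂ * W₄) ≈ j₄ * (w * w)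
      step₁ = *-cancel (inverse-* j₁-unit j₄*i₄) (begin
        j₁ * j₄ * (s * (W₂ * W₄))
          ≈⟨ solve 7 (λ k j a x e W V → k :* j :* ((a :+ x :* e) :* (W :* V)) := (j :* (k :* a) :+ x :* k :* (j :* e)) :* (W :* V)) refl j₁ j₄ a x ε W₂ W₄ ⟩
        (j₄ * (j₁ * a) + x * j₁ * (j₄ * ε)) * (W₂ * W₄) ≈⟨ *-congʳ (+-cong (*-congˡ ha) (*-congˡ hε)) ⟩
        (j₄ * SA x + x * j₁ * SE p) * (W₂ * W₄) ≈⟨ *-congʳ (sym even₀) ⟩
        j₁ * (j₄ * j₄) * (w * w) * (ΠA * ΠB) * (W₂ * W₄)
          ≈⟨ solve 7 (λ k j w A B W V → k :* (j :* j) :* (w :* w) :* (A :* B) :* (W :* V) := k :* j :* (j :* (w :* w)) :* ((W :* A) :* (V :* B))) refl j₁ j₄ w ΠA ΠB W₂ W₄ ⟩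
        j₁ * j₄ * (j₄ * (w * w)) * ((W₂ * ΠA) * (W₄ * ΠB)) ≈⟨ trans (*-congˡ (trans (*-cong ΠA-inverse ΠB-inverse) (*-identityˡ _))) (*-identityʳ _) ⟩
        j₁ * j₄ * (j₄ * (w * w)) ∎)
      step₂ : P₂ * s ≈ j₂ * (w * w) * P₄
      step₂ = *-cancel (inverse-* (inverse-* j₄*i₄ j₄*i₄) P₂-unit) (begin
        j₄ * j₄ * P₂ * (P₂ * s) ≈⟨ solve 3 (λ J P s → J :* P :* (P :* s) := J :* (P :* P) :* s) refl (j₄ * j₄) P₂ s ⟩
        j₄ * j₄ * (P₂ * P₂) * s ≈⟨ *-congʳ (*-cong H₁ H₂) ⟩
        j₂ * W₂ * P₂ * (j₄ * W₄ * P₄) * s ≈⟨ solve 7 (λ k W P j V Q s → k :* W :* P :* (j :* V :* Q) :* s := k :* P :* j :* Q :* (s :* (W :* V))) refl j₂ W₂ P₂ j₄ W₄ P₄ s ⟩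
        j₂ * P₂ * j₄ * P₄ * (s * (W₂ * W₄)) ≈⟨ *-congˡ step₁ ⟩
        j₂ * P₂ * j₄ * P₄ * (j₄ * (w * w)) ≈⟨ solve 5 (λ k P j Q w → k :* P :* j :* Q :* (j :* (w :* w)) := j :* j :* P :* (k :* (w :* w) :* Q)) refl j₂ P₂ j₄ P₄ w ⟩
        j₄ * j₄ * P₂ * (j₂ * (w * w) * P₄) ∎)
      F≈ : P₄ * (W₄ * W₄) ≈ F
      F≈ = *-cancel (inverse-* (inverse-* j₄*i₄ j₄*i₄) P₄-unit) (begin
        j₄ * j₄ * P₄ * (P₄ * (W₄ * W₄)) ≈⟨ solve 3 (λ j P W → j :* j :* P :* (P :* (W :* W)) := (j :* W :* P) :* (j :* W :* P)) refl j₄ P₄ W₄ ⟩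
        (j₄ * W₄ * P₄) * (j₄ * W₄ * P₄) ≈⟨ *-cong (sym H₂) (sym H₂) ⟩
        P₂ * P₂ * (P₂ * P₂) ≈⟨ trans (sym (*-assoc _ _ _)) (sym hF) ⟩
        j₄ * j₄ * P₄ * F ∎)
      E≈ : P₄ * (v * v) ≈ E
      E≈ = *-cancel (inverse-* P₂-unit P₂-unit) (begin
        P₂ * P₂ * (P₄ * (v * v)) ≈⟨ solve 3 (λ P Q v → P :* P :* (Q :* (v :* v)) := Q :* (P :* v) :* (P :* v)) refl P₂ P₄ v ⟩
        P₄ * (P₂ * v) * (P₂ * v) ≈⟨ *-cong (*-congˡ H₃) H₃ ⟩
        P₄ * P₄ * P₄ ≈⟨ sym hE ⟩
        P₂ * P₂ * E ∎)

    -- c = p g(p;p⁴) + x J₂(p) J₄(p) / J₁(p), up to the factor 2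
    rank-1 : ∀ {c G F} → j₁ * c ≈ SC x → P₄ * (SZ p + two * (p * j₄ * G)) ≈ P₂ * P₂ * P₂ * (W₄ * W₄) → j₄ * F ≈ P₂ * P₄ →
      two * c ≈ two * (p * G + x * F)
    rank-1 {c} {G} {F} hc hZ hF = *-cancel j₄*i₄ (begin
      -- The expansion at w = i determines only `s`, the wanted multiple of `c` plus `SZ p`. The
      -- hypothesis `hZ`, obtained at w = -1/p, then trades `SZ p` for `G`.
      j₄ * (two * c) ≈⟨ solve 3 (λ S j c → j :* c := S :+ j :* c :- S) refl (SZ p) j₄ (two * c) ⟩
      SZ p + j₄ * (two * c) - SZ p ≈⟨ +-congʳ step₃ ⟩
      SZ p + two * (p * j₄ * G) + x * (P₂ * P₄ + P₂ * P₄) - SZ p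
        ≈⟨ +-congʳ (+-congˡ (*-congˡ (+-cong (sym hF) (sym hF)))) ⟩
      SZ p + two * (p * j₄ * G) + x * (j₄ * F + j₄ * F) - SZ p
        ≈⟨ solve 6 (λ S p j G x F → S :+ (:1 :+ :1) :* (p :* j :* G) :+ x :* (j :* F :+ j :* F) :- S := j :* ((:1 :+ :1) :* (p :* G :+ x :* F))) refl (SZ p) p j₄ G x F ⟩
      j₄ * (two * (p * G + x * F)) ∎)
      where
      s = SZ p + j₄ * (two * c)
      step₁ : s * (v * W₂) ≈ j₄ * j₄ * (w * w)
      step₁ = *-cancel j₁-unit (begin
        j₁ * (s * (v * W₂)) ≈⟨ solve 7 (λ k S j t c v W → k :* ((S :+ j :* (t :* c)) :* (v :* W)) := (k :* S :+ j :* (t :* (k :* c))) :* (v :* W)) refl j₁ (SZ p) j₄ two c v W₂ ⟩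
        (j₁ * SZ p + j₄ * (two * (j₁ * c))) * (v * W₂) ≈⟨ *-congʳ (+-congˡ (*-congˡ (*-congˡ hc))) ⟩
        (j₁ * SZ p + j₄ * (two * SC x)) * (v * W₂) ≈⟨ *-congʳ (sym odd₀) ⟩
        j₁ * (j₄ * j₄) * (w * w) * (ΠO * ΠA) * (v * W₂)
          ≈⟨ solve 7 (λ k j w O A v W → k :* (j :* j) :* (w :* w) :* (O :* A) :* (v :* W) := k :* (j :* j :* (w :* w)) :* ((v :* O) :* (W :* A))) refl j₁ j₄ w ΠO ΠA v W₂ ⟩
        j₁ * (j₄ * j₄ * (w * w)) * ((v * ΠO) * (W₂ * ΠA)) ≈⟨ trans (*-congˡ (trans (*-cong ΠO-inverse ΠA-inverse) (*-identityˡ _))) (*-identityʳ _) ⟩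
        j₁ * (j₄ * j₄ * (w * w)) ∎)
      step₂ : s * v ≈ j₂ * (w * w) * P₂
      step₂ = *-cancel (inverse-* j₄*i₄ j₄*i₄) (begin
        j₄ * j₄ * (s * v) ≈⟨ *-congʳ H₁ ⟩
        j₂ * W₂ * P₂ * (s * v) ≈⟨ solve 5 (λ k W P s v → k :* W :* P :* (s :* v) := k :* P :* (s :* (v :* W))) refl j₂ W₂ P₂ s v ⟩
        j₂ * P₂ * (s * (v * W₂)) ≈⟨ *-congˡ step₁ ⟩
        j₂ * P₂ * (j₄ * j₄ * (w * w)) ≈⟨ solve 4 (λ k P j w → k :* P :* (j :* j :* (w :* w)) := j :* j :* (k :* (w :* w) :* P)) refl j₂ P₂ j₄ w ⟩
        j₄ * j₄ * (j₂ * (w * w) * P₂) ∎)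
      step₃ : s ≈ SZ p + two * (p * j₄ * G) + x * (P₂ * P₄ + P₂ * P₄)
      step₃ = *-cancel P₄-unit (begin
        P₄ * s ≈⟨ *-congʳ (sym H₃) ⟩
        P₂ * v * s ≈⟨ solve 3 (λ P v s → P :* v :* s := P :* (s :* v)) refl P₂ v s ⟩
        P₂ * (s * v) ≈⟨ *-congˡ (trans step₂ (*-congʳ φ)) ⟩
        P₂ * ((P₂ * (W₄ * W₄) + x * (P₂ * (v * v) + P₂ * (v * v))) * P₂)
          ≈⟨ solve 4 (λ P W x v → P :* ((P :* (W :* W) :+ x :* (P :* (v :* v) :+ P :* (v :* v))) :* P)
               := P :* P :* P :* (W :* W) :+ x :* (P :* ((P :* v) :* (P :* v)) :+ P :* ((P :* v) :* (P :* v)))) refl P₂ W₄ x v ⟩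
        P₂ * P₂ * P₂ * (W₄ * W₄) + x * (P₂ * ((P₂ * v) * (P₂ * v)) + P₂ * ((P₂ * v) * (P₂ * v)))
          ≈⟨ +-cong (sym hZ) (*-congˡ (+-cong (*-congˡ (*-cong H₃ H₃)) (*-congˡ (*-cong H₃ H₃)))) ⟩
        P₄ * (SZ p + two * (p * j₄ * G)) + x * (P₂ * (P₄ * P₄) + P₂ * (P₄ * P₄))
          ≈⟨ solve 4 (λ Q S x P → Q :* S :+ x :* (P :* (Q :* Q) :+ P :* (Q :* Q)) := Q :* (S :+ x :* (P :* Q :+ P :* Q))) refl P₄ (SZ p + two * (p * j₄ * G)) x P₂ ⟩
        P₄ * (SZ p + two * (p * j₄ * G) + x * (P₂ * P₄ + P₂ * P₄)) ∎)

-- Power series modulo q^M and the substitution of q⁸ for q.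

tail : PS → PS
tail f n = f (suc n)

-- The Cauchy product by recursion on the index, splitting off the constant term of the first
-- factor. In this form the ring laws are direct inductions, unlike for the list sum in `_⊗_`.
conv : PS → PS → PS
conv f g zero    = f 0 ℤ.* g 0
conv f g (suc n) = f 0 ℤ.* g (suc n) ℤ.+ conv (tail f) g n

private
  map-suc : ∀ {A : Set} (h : ℕ → A) m → map h (applyUpTo suc m) ≡ map (λ k → h (suc k)) (upTo m)
  map-suc h m = ≡.trans (map-applyUpTo suc h m) (≡.sym (map-applyUpTo (λ k → k) (λ k → h (suc k)) m))

⊗≗conv : ∀ f g n → (f ⊗ g) n ≡ conv f g n
⊗≗conv f g zero    = ℤₚ.+-identityʳ _
⊗≗conv f g (suc n) = ≡.cong (λ z → f 0 ℤ.* g (suc n) ℤ.+ z)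
  (≡.trans (≡.cong sumℤ (map-suc (λ k → f k ℤ.* g (suc n ℕ.∸ k)) (suc n))) (⊗≗conv (tail f) g n))

module ConvolutionLaws where
  open ℤSolver.+-*-Solver

  conv-cong : ∀ {f f′ g g′} n → (∀ k → k ℕ.≤ n → f k ≡ f′ k) → (∀ k → k ℕ.≤ n → g k ≡ g′ k) → conv f g n ≡ conv f′ g′ n
  conv-cong zero    p q = ≡.cong₂ ℤ._*_ (p 0 z≤n) (q 0 z≤n)
  conv-cong (suc n) p q = ≡.cong₂ ℤ._+_ (≡.cong₂ ℤ._*_ (p 0 z≤n) (q (suc n) ℕₚ.≤-refl))
    (conv-cong n (λ k k≤n → p (suc k) (s≤s k≤n)) (λ k k≤n → q k (ℕₚ.m≤n⇒m≤1+n k≤n)))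

  conv-⊕ˡ : ∀ f g h n → conv (f ⊕ g) h n ≡ conv f h n ℤ.+ conv g h n
  conv-⊕ˡ f g h zero    = ℤₚ.*-distribʳ-+ (h 0) (f 0) (g 0)
  conv-⊕ˡ f g h (suc n) = ≡.trans (≡.cong (λ z → (f 0 ℤ.+ g 0) ℤ.* h (suc n) ℤ.+ z) (conv-⊕ˡ (tail f) (tail g) h n))
    (solve 5 (λ a b c d e → (a :+ b) :* c :+ (d :+ e) := (a :* c :+ d) :+ (b :* c :+ e)) ≡.refl (f 0) (g 0) (h (suc n)) _ _)

  conv-scaleˡ : ∀ c f h n → conv (λ k → c ℤ.* f k) h n ≡ c ℤ.* conv f h n
  conv-scaleˡ c f h zero    = ℤₚ.*-assoc c (f 0) (h 0)
  conv-scaleˡ c f h (suc n) = ≡.trans (≡.cong (λ z → c ℤ.* f 0 ℤ.* h (suc n) ℤ.+ z) (conv-scaleˡ c (tail f) h n))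
    (solve 4 (λ c a b d → c :* a :* b :+ c :* d := c :* (a :* b :+ d)) ≡.refl c (f 0) (h (suc n)) _)

  -- Splits off the constant term of the second factor instead of the first, which is what the
  -- induction for commutativity needs.
  conv-sucʳ : ∀ f g n → conv f g (suc n) ≡ g 0 ℤ.* f (suc n) ℤ.+ conv f (tail g) n
  conv-sucʳ f g zero    = solve 4 (λ a b c d → a :* b :+ c :* d := d :* c :+ a :* b) ≡.refl (f 0) (g 1) (f 1) (g 0)
  conv-sucʳ f g (suc n) = ≡.trans (≡.cong (λ z → f 0 ℤ.* g (suc (suc n)) ℤ.+ z) (conv-sucʳ (tail f) g n))
    (solve 3 (λ a b c → a :+ (b :+ c) := b :+ (a :+ c)) ≡.refl (f 0 ℤ.* g (suc (suc n))) (g 0 ℤ.* f (suc (suc n))) _)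

  conv-comm : ∀ f g n → conv f g n ≡ conv g f n
  conv-comm f g zero    = ℤₚ.*-comm (f 0) (g 0)
  conv-comm f g (suc n) = ≡.trans (≡.cong (λ z → f 0 ℤ.* g (suc n) ℤ.+ z) (conv-comm (tail f) g n)) (≡.sym (conv-sucʳ g f n))

  conv-assoc : ∀ f g h n → conv (conv f g) h n ≡ conv f (conv g h) n
  conv-assoc f g h zero    = ℤₚ.*-assoc (f 0) (g 0) (h 0)
  conv-assoc f g h (suc n) = ≡.trans (≡.cong (λ z → f 0 ℤ.* g 0 ℤ.* h (suc n) ℤ.+ z)
      (≡.trans (conv-⊕ˡ (λ k → f 0 ℤ.* g (suc k)) (conv (tail f) g) h n) (≡.cong₂ ℤ._+_ (conv-scaleˡ (f 0) (tail g) h n) (conv-assoc (tail f) g h n))))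
    (solve 5 (λ a b c d e → a :* b :* c :+ (a :* d :+ e) := a :* (b :* c :+ d) :+ e) ≡.refl (f 0) (g 0) (h (suc n)) _ _)

  conv-zeroˡ : ∀ g n → conv (λ _ → ℤ.0ℤ) g n ≡ ℤ.0ℤ
  conv-zeroˡ g zero    = ≡.refl
  conv-zeroˡ g (suc n) = ≡.trans (ℤₚ.+-identityˡ _) (conv-zeroˡ g n)

  conv-identityˡ : ∀ g n → conv 𝟙 g n ≡ g n
  conv-identityˡ g zero    = ℤₚ.*-identityˡ (g 0)
  conv-identityˡ g (suc n) = ≡.trans (≡.cong₂ ℤ._+_ (ℤₚ.*-identityˡ (g (suc n))) (conv-zeroˡ g n)) (ℤₚ.+-identityʳ _)

open ConvolutionLaws

-- power series modulo q^M
PSR : ℕ → CommutativeRing 0ℓ 0ℓ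
PSR M = record
  { Carrier = PS ; _≈_ = _≈_ ; _+_ = _⊕_ ; _*_ = _⊗_ ; -_ = λ f n → ℤ.- f n ; 0# = λ _ → ℤ.0ℤ ; 1# = 𝟙
  ; isCommutativeRing = record
    { isRing = record
      { +-isAbelianGroup = record
        { isGroup = record
          { isMonoid = record
            { isSemigroup = record
              { isMagma = record
                { isEquivalence = record { refl = λ _ _ → ≡.refl ; sym = λ p n l → ≡.sym (p n l) ; trans = λ p q n l → ≡.trans (p n l) (q n l) }
                ; ∙-cong = λ p q n l → ≡.cong₂ ℤ._+_ (p n l) (q n l) }
              ; assoc = λ f g h n _ → ℤₚ.+-assoc (f n) (g n) (h n) }
            ; identity = (λ f n _ → ℤₚ.+-identityˡ (f n)) , (λ f n _ → ℤₚ.+-identityʳ (f n)) }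
          ; inverse = (λ f n _ → ℤₚ.+-inverseˡ (f n)) , (λ f n _ → ℤₚ.+-inverseʳ (f n))
          ; ⁻¹-cong = λ p n l → ≡.cong ℤ.-_ (p n l) }
        ; comm = λ f g n _ → ℤₚ.+-comm (f n) (g n) }
      ; *-cong = λ {f} {f′} {g} {g′} → ⊗-cong {f} {f′} {g} {g′}
      ; *-assoc = λ f g h n _ → ⊗-assoc f g h n
      ; *-identity = (λ f n _ → ⊗-identityˡ f n) , (λ f n _ → ≡.trans (⊗-comm f 𝟙 n) (⊗-identityˡ f n))
      ; distrib = (λ f g h n _ → ≡.trans (⊗-comm f (g ⊕ h) n) (≡.trans (⊗-distribʳ f g h n) (≡.cong₂ ℤ._+_ (⊗-comm g f n) (⊗-comm h f n))))
                , (λ f g h n _ → ⊗-distribʳ f g h n) }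
    ; *-comm = λ f g n _ → ⊗-comm f g n } }
  where
  _≈_ : PS → PS → Set
  f ≈ g = ∀ n → n ℕ.< M → f n ≡ g n
  ⊗-cong : ∀ {f f′ g g′} → f ≈ f′ → g ≈ g′ → (f ⊗ g) ≈ (f′ ⊗ g′)
  ⊗-cong {f} {f′} {g} {g′} p q n l = ≡.trans (⊗≗conv f g n)
    (≡.trans (conv-cong n (λ k k≤n → p k (ℕₚ.≤-<-trans k≤n l)) (λ k k≤n → q k (ℕₚ.≤-<-trans k≤n l))) (≡.sym (⊗≗conv f′ g′ n)))
  ⊗-comm : ∀ f g n → (f ⊗ g) n ≡ (g ⊗ f) n
  ⊗-comm f g n = ≡.trans (⊗≗conv f g n) (≡.trans (conv-comm f g n) (≡.sym (⊗≗conv g f n)))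
  ⊗-identityˡ : ∀ f n → (𝟙 ⊗ f) n ≡ f n
  ⊗-identityˡ f n = ≡.trans (⊗≗conv 𝟙 f n) (conv-identityˡ f n)
  ⊗-distribʳ : ∀ f g h n → ((g ⊕ h) ⊗ f) n ≡ (g ⊗ f) n ℤ.+ (h ⊗ f) n
  ⊗-distribʳ f g h n = ≡.trans (⊗≗conv (g ⊕ h) f n) (≡.trans (conv-⊕ˡ g h f n) (≡.sym (≡.cong₂ ℤ._+_ (⊗≗conv g f n) (⊗≗conv h f n))))
  ⊗-assoc : ∀ f g h n → ((f ⊗ g) ⊗ h) n ≡ (f ⊗ (g ⊗ h)) n
  ⊗-assoc f g h n = ≡.trans (⊗≗conv (f ⊗ g) h n) (≡.trans (conv-cong n (λ k _ → ⊗≗conv f g k) (λ _ _ → ≡.refl))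
    (≡.trans (conv-assoc f g h n) (≡.trans (conv-cong {f} n (λ _ _ → ≡.refl) (λ k _ → ≡.sym (⊗≗conv g h k))) (≡.sym (⊗≗conv f (g ⊗ h) n)))))

X^-suc : ∀ k n → X^ (suc k) (suc n) ≡ X^ k n
X^-suc k n with n ℕ.≡ᵇ k
... | true  = ≡.refl
... | false = ≡.refl

X^-vanish : ∀ {k n} → n ℕ.< k → X^ k n ≡ ℤ.0ℤ
X^-vanish {suc k} {zero}  _         = ≡.refl
X^-vanish {suc k} {suc n} (s≤s n<k) = ≡.trans (X^-suc k n) (X^-vanish n<k)

X^-shift : ∀ k f n → (X^ k ⊗ f) (k ℕ.+ n) ≡ f n
X^-shift k f n = ≡.trans (⊗≗conv (X^ k) f (k ℕ.+ n)) (go k n)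
  where
  go : ∀ k n → conv (X^ k) f (k ℕ.+ n) ≡ f n
  go zero    n = conv-identityˡ f n
  go (suc k) n = ≡.trans (ℤₚ.+-identityˡ _) (≡.trans (conv-cong (k ℕ.+ n) (λ j _ → X^-suc k j) (λ _ _ → ≡.refl)) (go k n))

X^-below : ∀ k f n → n ℕ.< k → (X^ k ⊗ f) n ≡ ℤ.0ℤ
X^-below k f n n<k = ≡.trans (⊗≗conv (X^ k) f n) (≡.trans (conv-cong {X^ k} {λ _ → ℤ.0ℤ} {f} {f} n (λ j j≤n → X^-vanish (ℕₚ.≤-<-trans j≤n n<k)) (λ _ _ → ≡.refl)) (conv-zeroˡ f n))

X^-* : ∀ a b n → (X^ a ⊗ X^ b) n ≡ X^ (a ℕ.+ b) n
X^-* a b n = ≡.trans (⊗≗conv (X^ a) (X^ b) n) (go a n)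
  where
  go : ∀ a n → conv (X^ a) (X^ b) n ≡ X^ (a ℕ.+ b) n
  go zero    n       = conv-identityˡ (X^ b) n
  go (suc a) zero    = ≡.refl
  go (suc a) (suc n) = ≡.trans (ℤₚ.+-identityˡ _) (≡.trans (conv-cong n (λ j _ → X^-suc a j) (λ _ _ → ≡.refl))
    (≡.trans (go a n) (≡.sym (X^-suc (a ℕ.+ b) n))))

private
  -- `invVec` lists the coefficients from the highest down, so the zipped sum is a Cauchy product.
  inv-suc : ∀ f a n → sumℤ (zipWith ℤ._*_ (map a (upTo (suc n))) (Vec.toList (invVec f n))) ≡ conv a (inv f) n
  inv-suc f a zero    = ℤₚ.+-identityʳ _
  inv-suc f a (suc n) = ≡.cong (λ z → a 0 ℤ.* inv f (suc n) ℤ.+ z)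
    (≡.trans (≡.cong (λ xs → sumℤ (zipWith ℤ._*_ xs (Vec.toList (invVec f n)))) (map-suc a (suc n))) (inv-suc f (tail a) n))

inv-inverse : ∀ f → f 0 ≡ ℤ.1ℤ → ∀ n → (f ⊗ inv f) n ≡ 𝟙 n
inv-inverse f f0 n = ≡.trans (⊗≗conv f (inv f) n) (go n)
  where
  go : ∀ n → conv f (inv f) n ≡ 𝟙 n
  go zero    rewrite f0 = ≡.refl
  go (suc n) rewrite inv-suc f (tail f) n | f0 =
    ≡.trans (≡.cong₂ ℤ._+_ (≡.trans (ℤₚ.*-identityˡ _) (≡.cong ℤ.-_ (ℤₚ.*-identityˡ C))) ≡.refl) (ℤₚ.+-inverseˡ C)
    where C = conv (tail f) (inv f) n

⊗-constant : ∀ f g → f 0 ≡ ℤ.1ℤ → g 0 ≡ ℤ.1ℤ → (f ⊗ g) 0 ≡ ℤ.1ℤ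
⊗-constant f g p q rewrite p | q = ≡.refl

-- pad c f is q^c f(q⁸)
pad : ℕ → PS → PS
pad zero    f zero    = f 0
pad zero    f (suc n) = pad 7 (tail f) n
pad (suc c) f zero    = ℤ.0ℤ
pad (suc c) f (suc n) = pad c f n

δ : PS → PS
δ = pad 0

pad-cong : ∀ {f g} c n → (∀ k → k ℕ.≤ n → f k ≡ g k) → pad c f n ≡ pad c g n
pad-cong zero    zero    p = p 0 z≤n
pad-cong zero    (suc n) p = pad-cong 7 n λ k k≤n → p (suc k) (s≤s k≤n)
pad-cong (suc c) zero    p = ≡.refl
pad-cong (suc c) (suc n) p = pad-cong c n λ k k≤n → p k (ℕₚ.m≤n⇒m≤1+n k≤n)

pad-⊕ : ∀ c f g n → pad c (f ⊕ g) n ≡ pad c f n ℤ.+ pad c g n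
pad-⊕ zero    f g zero    = ≡.refl
pad-⊕ zero    f g (suc n) = pad-⊕ 7 (tail f) (tail g) n
pad-⊕ (suc c) f g zero    = ≡.refl
pad-⊕ (suc c) f g (suc n) = pad-⊕ c f g n

pad-neg : ∀ c f n → pad c (λ k → ℤ.- f k) n ≡ ℤ.- pad c f n
pad-neg zero    f zero    = ≡.refl
pad-neg zero    f (suc n) = pad-neg 7 (tail f) n
pad-neg (suc c) f zero    = ≡.refl
pad-neg (suc c) f (suc n) = pad-neg c f n

pad-scale : ∀ c a f n → pad c (λ k → a ℤ.* f k) n ≡ a ℤ.* pad c f n
pad-scale zero    a f zero    = ≡.refl
pad-scale zero    a f (suc n) = pad-scale 7 a (tail f) n
pad-scale (suc c) a f zero    = ≡.sym (ℤₚ.*-zeroʳ a)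
pad-scale (suc c) a f (suc n) = pad-scale c a f n

pad-zero : ∀ c n → pad c (λ _ → ℤ.0ℤ) n ≡ ℤ.0ℤ
pad-zero zero    zero    = ≡.refl
pad-zero zero    (suc n) = pad-zero 7 n
pad-zero (suc c) zero    = ≡.refl
pad-zero (suc c) (suc n) = pad-zero c n

-- Stated for every offset c because unfolding `pad` at offset 0 continues at offset 7. Only the
-- first factor carries the offset.
pad-conv : ∀ c f g n → pad c (conv f g) n ≡ conv (pad c f) (δ g) n
pad-conv zero    f g zero    = ≡.refl
pad-conv zero    f g (suc n) = ≡.trans (pad-⊕ 7 (λ k → f 0 ℤ.* g (suc k)) (conv (tail f) g) n)
  (≡.cong₂ ℤ._+_ (pad-scale 7 (f 0) (tail g) n) (pad-conv 7 (tail f) g n))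
pad-conv (suc c) f g zero    = ≡.refl
pad-conv (suc c) f g (suc n) = ≡.trans (pad-conv c f g n) (≡.sym (ℤₚ.+-identityˡ _))

δ-⊗ : ∀ f g n → δ (f ⊗ g) n ≡ (δ f ⊗ δ g) n
δ-⊗ f g n = ≡.trans (pad-cong 0 n λ k _ → ⊗≗conv f g k) (≡.trans (pad-conv 0 f g n) (≡.sym (⊗≗conv (δ f) (δ g) n)))

pad-𝟙 : ∀ c n → pad c 𝟙 n ≡ X^ c n
pad-𝟙 zero    zero    = ≡.refl
pad-𝟙 zero    (suc n) = pad-zero 7 n
pad-𝟙 (suc c) zero    = ≡.refl
pad-𝟙 (suc c) (suc n) = ≡.trans (pad-𝟙 c n) (≡.sym (X^-suc c n))

δ-X : ∀ n → δ (X^ 1) n ≡ X^ 8 n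
δ-X zero    = ≡.refl
δ-X (suc n) = ≡.trans (pad-cong 7 n λ k _ → X^-suc 0 k) (≡.trans (pad-𝟙 7 n) (≡.sym (X^-suc 7 n)))

pad-below : ∀ c f n → n ℕ.< c → pad c f n ≡ ℤ.0ℤ
pad-below (suc c) f zero    _         = ≡.refl
pad-below (suc c) f (suc n) (s≤s n<c) = pad-below c f n n<c

δ-multiple : ∀ f n → δ f (8 ℕ.* n) ≡ f n
δ-multiple f zero    = ≡.refl
δ-multiple f (suc n) = ≡.trans (≡.cong (δ f) (ℕₚ.*-suc 8 n)) (δ-multiple (tail f) n)

δ-residue : ∀ f r n → r ℕ.< 7 → δ f (8 ℕ.* n ℕ.+ suc r) ≡ ℤ.0ℤ
δ-residue f r zero    r<7 = pad-below 7 (tail f) r r<7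
δ-residue f r (suc n) r<7 = ≡.trans (≡.cong (λ k → δ f (k ℕ.+ suc r)) (ℕₚ.*-suc 8 n)) (δ-residue (tail f) r n r<7)

record IsHom (R S : CommutativeRing 0ℓ 0ℓ) (h : CommutativeRing.Carrier R → CommutativeRing.Carrier S) : Set where
  private
    module R = CommutativeRing R
    module S = CommutativeRing S
  field
    h-cong : ∀ {a b} → a R.≈ b → h a S.≈ h b
    h-+ : ∀ a b → h (a R.+ b) S.≈ h a S.+ h b
    h-* : ∀ a b → h (a R.* b) S.≈ h a S.* h b
    h-neg : ∀ a → h (R.- a) S.≈ S.- h a
    h-0 : h R.0# S.≈ S.0#
    h-1 : h R.1# S.≈ S.1#

module Homomorphism {R S : CommutativeRing 0ℓ 0ℓ} {h : CommutativeRing.Carrier R → CommutativeRing.Carrier S} (hom : IsHom R S h) where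
  private
    module R = CommutativeRing R
    module RB = FiniteSums R
    module SB = FiniteSums S
  open CommutativeRing S
  open IsHom hom
  open import Algebra.Properties.Semiring.Exp semiring
  open import Algebra.Properties.Semiring.Exp R.semiring using () renaming (_^_ to _^ᴿ_)

  h-∑ : ∀ n F → h (RB.∑ n F) ≈ SB.∑ n (λ i → h (F i))
  h-∑ zero    F = h-0
  h-∑ (suc n) F = trans (h-+ _ _) (+-congʳ (h-∑ n F))

  h-∏ : ∀ n F → h (RB.∏ n F) ≈ SB.∏ n (λ i → h (F i))
  h-∏ zero    F = h-1
  h-∏ (suc n) F = trans (h-* _ _) (*-congʳ (h-∏ n F))

  h-^ : ∀ a n → h (a ^ᴿ n) ≈ h a ^ n
  h-^ a zero    = h-1
  h-^ a (suc n) = trans (h-* _ _) (*-congˡ (h-^ a n))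

  h-sg : ∀ n → h (RB.sg n) ≈ SB.sg n
  h-sg zero    = h-1
  h-sg (suc n) = trans (h-neg _) (-‿cong (h-sg n))

  h-1- : ∀ a → h (R.1# R.- a) ≈ 1# - h a
  h-1- a = trans (h-+ _ _) (+-cong h-1 (h-neg a))

-- The function g as a Lambert series.

double-∸ : ∀ k e b → b ℕ.≤ 2 ℕ.* e → 2 ℕ.* (k ℕ.+ e) ℕ.∸ b ≡ 2 ℕ.* k ℕ.+ (2 ℕ.* e ℕ.∸ b)
double-∸ k e b b≤ = ≡.trans (≡.cong (ℕ._∸ b) (ℕₚ.*-distribˡ-+ 2 k e)) (ℕₚ.+-∸-assoc (2 ℕ.* k) b≤)

double-+ : ∀ k e b → 2 ℕ.* (k ℕ.+ e) ℕ.+ b ≡ 2 ℕ.* k ℕ.+ (2 ℕ.* e ℕ.+ b)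
double-+ k e b = ≡.trans (≡.cong (ℕ._+ b) (ℕₚ.*-distribˡ-+ 2 k e)) (ℕₚ.+-assoc (2 ℕ.* k) (2 ℕ.* e) b)

central-∸ : ∀ j b → b ℕ.≤ 2 → 2 ℕ.* (2 ℕ.* j ℕ.+ 1) ℕ.∸ b ≡ 4 ℕ.* j ℕ.+ (2 ℕ.∸ b)
central-∸ j b b≤2 = ≡.trans (≡.cong (ℕ._∸ b) (eq j)) (ℕₚ.+-∸-assoc (4 ℕ.* j) b≤2)
  where
  open +-*-Solver
  eq : ∀ j → 2 ℕ.* (2 ℕ.* j ℕ.+ 1) ≡ 4 ℕ.* j ℕ.+ 2
  eq = solve 1 (λ j → con 2 :* (con 2 :* j :+ con 1) := con 4 :* j :+ con 2) ≡.refl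

central-+ : ∀ j b → 2 ℕ.* (2 ℕ.* j ℕ.+ 1) ℕ.+ b ≡ 4 ℕ.* j ℕ.+ (2 ℕ.+ b)
central-+ = solve 2 (λ j b → con 2 :* (con 2 :* j :+ con 1) :+ b := con 4 :* j :+ (con 2 :+ b)) ≡.refl
  where open +-*-Solver

telescope-exponent : ∀ n → 4 ℕ.* n ℕ.* n ℕ.+ 4 ℕ.* suc (n ℕ.+ n) ≡ 4 ℕ.* suc n ℕ.* suc n
telescope-exponent = solve 1 (λ n → con 4 :* n :* n :+ con 4 :* (con 1 :+ (n :+ n)) := con 4 :* (con 1 :+ n) :* (con 1 :+ n)) ≡.refl
  where open +-*-Solver

telescope-exponent′ : ∀ n → 4 ℕ.* n ℕ.* n ℕ.+ 4 ℕ.* n ≡ 4 ℕ.* (n ℕ.* suc n)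
telescope-exponent′ = solve 1 (λ n → con 4 :* n :* n :+ con 4 :* n := con 4 :* (n :* (con 1 :+ n))) ≡.refl
  where open +-*-Solver

telescope-exponent″ : ∀ a b n → a ℕ.+ 4 ℕ.* n ℕ.+ (b ℕ.+ 4 ℕ.* n) ≡ a ℕ.+ b ℕ.+ 4 ℕ.* (n ℕ.+ n)
telescope-exponent″ = solve 3 (λ a b n → a :+ con 4 :* n :+ (b :+ con 4 :* n) := a :+ b :+ con 4 :* (n :+ n)) ≡.refl
  where open +-*-Solver

module MockTheta (R : CommutativeRing 0ℓ 0ℓ) (M : ℕ) (x : CommutativeRing.Carrier R) (x^M≈0 : Vanishes R M x) where
  open CommutativeRing R
  open IntegerSolver R
  open FiniteSums R
  open Nilpotent R M x x^M≈0 using (geo; geo-cong; geo-inverse; c*x^-nil; x^≥M)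
  open ThetaProducts R M
  open import Algebra.Properties.Semiring.Exp semiring
  open import Relation.Binary.Reasoning.Setoid setoid

  private
    X = x ^ 2
    X-nil : Vanishes R M X
    X-nil = x²-nil x x^M≈0

  open Nilpotent R M X X-nil using (Label; σ; y)
  open Families R M X X-nil

  -- In base X = x² the labels are x^(4j+2), and τ = x^b + x^(-b) factors the form as (1 -
  -- x^(4j+2-b))(1 - x^(4j+2+b)). Thus b = 0 yields g(x²;x⁴) and b = 1 yields g(x;x⁴), both by the
  -- same sum that produces the rank series.
  module Central (b : ℕ) (b≤1 : b ℕ.≤ 1) where
    private
      z : ℕ → Carrier
      z e = x ^ (2 ℕ.* e ℕ.∸ b) + x ^ (2 ℕ.* e ℕ.+ b)

      b<2e : ∀ e → 1 ℕ.≤ e → b ℕ.< 2 ℕ.* e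
      b<2e e 1≤e = ℕₚ.≤-trans (s≤s b≤1) (ℕₚ.*-monoʳ-≤ 2 1≤e)

      z-geo : ∀ k e → 1 ℕ.≤ e → z (k ℕ.+ e) ≈ X ^ k * z e
      z-geo k e 1≤e = begin
        x ^ (2 ℕ.* (k ℕ.+ e) ℕ.∸ b) + x ^ (2 ℕ.* (k ℕ.+ e) ℕ.+ b)
          ≈⟨ +-cong (trans (^-congʳ x (double-∸ k e b (ℕₚ.<⇒≤ (b<2e e 1≤e)))) (^-homo-* x (2 ℕ.* k) (2 ℕ.* e ℕ.∸ b)))
                    (trans (^-congʳ x (double-+ k e b)) (^-homo-* x (2 ℕ.* k) (2 ℕ.* e ℕ.+ b))) ⟩
        x ^ (2 ℕ.* k) * x ^ (2 ℕ.* e ℕ.∸ b) + x ^ (2 ℕ.* k) * x ^ (2 ℕ.* e ℕ.+ b) ≈⟨ sym (distribˡ _ _ _) ⟩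
        x ^ (2 ℕ.* k) * z e ≈⟨ *-congʳ (sym (^-assocʳ x 2 k)) ⟩
        X ^ k * z e ∎

      f : Label → Carrier
      f (s , e) = geo (σ s * x ^ (2 ℕ.* e ℕ.∸ b)) * geo (σ s * x ^ (2 ℕ.* e ℕ.+ b))

      f-inverse : ∀ l → 1 ℕ.≤ proj₂ l → Spectral.L z 1 z-geo l * f l ≈ 1#
      f-inverse l@(s , e) 1≤e = trans (*-congʳ (begin
        1# + σ s * X ^ e * (σ s * X ^ e) - σ s * (A + B)
          ≈⟨ +-congʳ (+-congˡ (trans (solve 2 (λ s a → s :* a :* (s :* a) := s :* s :* (a :* a)) refl (σ s) (X ^ e)) (*-congˡ XX))) ⟩
        1# + σ s * σ s * (A * B) - σ s * (A + B)
          ≈⟨ solve 3 (λ s A B → :1 :+ s :* s :* (A :* B) :- s :* (A :+ B) := (:1 :- s :* A) :* (:1 :- s :* B)) refl (σ s) A B ⟩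
        (1# - σ s * A) * (1# - σ s * B) ∎))
        (inverse-* (geo-inverse (c*x^-nil (σ s) (ℕₚ.m<n⇒0<n∸m (b<2e e 1≤e))))
                   (geo-inverse (c*x^-nil (σ s) (ℕₚ.≤-trans (ℕₚ.≤-trans (s≤s z≤n) (b<2e e 1≤e)) (ℕₚ.m≤m+n (2 ℕ.* e) b)))))
        where
        A = x ^ (2 ℕ.* e ℕ.∸ b)
        B = x ^ (2 ℕ.* e ℕ.+ b)
        XX : X ^ e * X ^ e ≈ A * B
        XX = begin
          X ^ e * X ^ e ≈⟨ *-cong (^-assocʳ x 2 e) (^-assocʳ x 2 e) ⟩
          x ^ (2 ℕ.* e) * x ^ (2 ℕ.* e) ≈⟨ sym (^-homo-* x (2 ℕ.* e) (2 ℕ.* e)) ⟩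
          x ^ (2 ℕ.* e ℕ.+ 2 ℕ.* e) ≈⟨ ^-congʳ x (≡.trans (≡.cong (ℕ._+ 2 ℕ.* e) (≡.sym (ℕₚ.m∸n+n≡m (ℕₚ.<⇒≤ (b<2e e 1≤e)))))
               (≡.trans (ℕₚ.+-assoc (2 ℕ.* e ℕ.∸ b) b (2 ℕ.* e)) (≡.cong (2 ℕ.* e ℕ.∸ b ℕ.+_) (ℕₚ.+-comm b (2 ℕ.* e))))) ⟩
          x ^ (2 ℕ.* e ℕ.∸ b ℕ.+ (2 ℕ.* e ℕ.+ b)) ≈⟨ ^-homo-* x (2 ℕ.* e ℕ.∸ b) (2 ℕ.* e ℕ.+ b) ⟩
          A * B ∎

      module B = Bailey z z-geo f
      open Family Sign.+ 2 1 1 (s≤s z≤n) ≡.refl using (lab)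

      f-lab : ∀ j → f (lab j) ≈ geo (x ^ (4 ℕ.* j ℕ.+ (2 ℕ.∸ b))) * geo (x ^ (4 ℕ.* j ℕ.+ (2 ℕ.+ b)))
      f-lab j = *-cong (geo-cong (trans (*-identityˡ _) (^-congʳ x (central-∸ j b (ℕₚ.≤-trans b≤1 (s≤s z≤n))))))
                       (geo-cong (trans (*-identityˡ _) (^-congʳ x (central-+ j b))))

    lambert : ∀ {N} → M ℕ.≤ N →
      pinf (x ^ 4) * ∑ N (λ D → (x ^ 4) ^ (D ℕ.* suc D) * ∏ (suc D) (λ j → geo (x ^ (4 ℕ.* j ℕ.+ (2 ℕ.∸ b))) * geo (x ^ (4 ℕ.* j ℕ.+ (2 ℕ.+ b)))))
        ≈ ∑ M (λ m → sg m * (x ^ 4) ^ e₃ m * (1# - (x ^ 4) ^ (m ℕ.+ m ℕ.+ 1)) * (geo (x ^ (4 ℕ.* m ℕ.+ (2 ℕ.∸ b))) * geo (x ^ (4 ℕ.* m ℕ.+ (2 ℕ.+ b)))))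
    lambert {N} M≤N = trans
      (*-cong (pinf-cong (sym X²)) (∑-cong N λ D _ → *-cong (^-congˡ (D ℕ.* suc D) (sym X²)) (∏-cong (suc D) λ j _ → sym (f-lab j))))
      (trans (B.bailey f-inverse M≤N)
        (∑-cong M λ m _ → *-cong (*-cong (*-congˡ (^-congˡ (e₃ m) X²)) (+-congˡ (-‿cong (^-congˡ (m ℕ.+ m ℕ.+ 1) X²)))) (f-lab m)))
      where
      X² : X ^ 2 ≈ x ^ 4
      X² = ^-assocʳ x 2 2

  -- t n = x^(4n²) / ((x^a;x⁴)_n (x^b;x⁴)_n) telescopes the difference of the two forms of g(x^a;x⁴).
  module Telescope (a b : ℕ) (a+b≡4 : a ℕ.+ b ≡ 4) (α β : ℕ → Carrier)
    (α-inverse : ∀ k → (1# - x ^ (a ℕ.+ 4 ℕ.* k)) * α k ≈ 1#) (β-inverse : ∀ k → (1# - x ^ (b ℕ.+ 4 ℕ.* k)) * β k ≈ 1#) where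

    t t′ : ℕ → Carrier
    t n  = x ^ (4 ℕ.* n ℕ.* n) * ∏ n (λ k → α k * β k)
    t′ n = x ^ (4 ℕ.* (n ℕ.* suc n)) * ∏ (suc n) (λ k → α k * β k)

    step : ∀ n → t n * α n ≈ t n - t (suc n) + x ^ a * t′ n
    step n = begin
      t n * α n ≈⟨ trans (sym (*-identityʳ _)) (*-congˡ (sym (β-inverse n))) ⟩
      t n * α n * ((1# - B) * β n)
        -- The identity 1 - B = (1 - A)(1 - B) - AB + A: its three terms become t n, t (n + 1) and
        -- the summand x^a t′ n of the other form.
        ≈⟨ solve 5 (λ t α B β A → t :* α :* ((:1 :- B) :* β) := t :* ((:1 :- A) :* α) :* ((:1 :- B) :* β) :- t :* (A :* B) :* (α :* β) :+ t :* A :* (α :* β)) refl (t n) (α n) B (β n) A ⟩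
      t n * ((1# - A) * α n) * ((1# - B) * β n) - t n * (A * B) * (α n * β n) + t n * A * (α n * β n)
        ≈⟨ +-cong (+-cong (trans (*-cong (trans (*-congˡ (α-inverse n)) (*-identityʳ _)) (β-inverse n)) (*-identityʳ _)) (-‿cong next)) low ⟩
      t n - t (suc n) + x ^ a * t′ n ∎
      where
      A = x ^ (a ℕ.+ 4 ℕ.* n)
      B = x ^ (b ℕ.+ 4 ℕ.* n)
      Π = ∏ n (λ k → α k * β k)
      next : t n * (A * B) * (α n * β n) ≈ t (suc n)
      next = begin
        x ^ (4 ℕ.* n ℕ.* n) * Π * (A * B) * (α n * β n) ≈⟨ solve 4 (λ y p c q → y :* p :* c :* q := y :* c :* (p :* q)) refl (x ^ (4 ℕ.* n ℕ.* n)) Π (A * B) (α n * β n) ⟩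
        x ^ (4 ℕ.* n ℕ.* n) * (A * B) * (Π * (α n * β n)) ≈⟨ *-congʳ (trans (*-congˡ (trans (sym (^-homo-* x (a ℕ.+ 4 ℕ.* n) (b ℕ.+ 4 ℕ.* n))) (^-congʳ x (≡.trans (telescope-exponent″ a b n) (≡.trans (≡.cong (ℕ._+ 4 ℕ.* (n ℕ.+ n)) a+b≡4) (≡.sym (ℕₚ.*-suc 4 (n ℕ.+ n))))))))
             (trans (sym (^-homo-* x (4 ℕ.* n ℕ.* n) (4 ℕ.* suc (n ℕ.+ n)))) (^-congʳ x (telescope-exponent n)))) ⟩
        t (suc n) ∎
      low : t n * A * (α n * β n) ≈ x ^ a * t′ n
      low = begin
        x ^ (4 ℕ.* n ℕ.* n) * Π * A * (α n * β n) ≈⟨ *-congʳ (*-congˡ (^-homo-* x a (4 ℕ.* n))) ⟩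
        x ^ (4 ℕ.* n ℕ.* n) * Π * (x ^ a * x ^ (4 ℕ.* n)) * (α n * β n)
          ≈⟨ solve 5 (λ y p c d q → y :* p :* (c :* d) :* q := c :* ((y :* d) :* (p :* q))) refl (x ^ (4 ℕ.* n ℕ.* n)) Π (x ^ a) (x ^ (4 ℕ.* n)) (α n * β n) ⟩
        x ^ a * ((x ^ (4 ℕ.* n ℕ.* n) * x ^ (4 ℕ.* n)) * (Π * (α n * β n)))
          ≈⟨ *-congˡ (*-congʳ (trans (sym (^-homo-* x (4 ℕ.* n ℕ.* n) (4 ℕ.* n))) (^-congʳ x (telescope-exponent′ n)))) ⟩
        x ^ a * t′ n ∎

    telescoped : ∀ N → ∑ N (λ n → t n * α n) ≈ 1# - t N + x ^ a * ∑ N t′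
    telescoped zero    = solve 1 (λ x → :0 := :1 :- :1 :* :1 :+ x :* :0) refl (x ^ a)
    telescoped (suc N) = trans (+-cong (telescoped N) (step N))
      (solve 5 (λ p q x s u → :1 :- p :+ x :* s :+ (p :- q :+ x :* u) := :1 :- q :+ x :* (s :+ u)) refl (t N) (t (suc N)) (x ^ a) (∑ N t′) (t′ N))

    mock : ∀ {N} → M ℕ.≤ N → - 1# + ∑ N (λ n → t n * α n) ≈ x ^ a * ∑ N t′
    mock {N} M≤N = begin
      - 1# + ∑ N (λ n → t n * α n) ≈⟨ +-congˡ (telescoped N) ⟩
      - 1# + (1# - t N + x ^ a * ∑ N t′) ≈⟨ +-congˡ (+-congʳ (+-congˡ (-‿cong (trans (*-congʳ (x^≥M M≤4NN)) (zeroˡ _))))) ⟩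
      - 1# + (1# - 0# + x ^ a * ∑ N t′) ≈⟨ solve 1 (λ s → :- :1 :+ (:1 :- :0 :+ s) := s) refl _ ⟩
      x ^ a * ∑ N t′ ∎
      where
      M≤4NN : M ℕ.≤ 4 ℕ.* N ℕ.* N
      M≤4NN = ℕₚ.≤-trans M≤N (ℕₚ.≤-trans (≤-sq N) (ℕₚ.*-monoˡ-≤ N (ℕₚ.m≤n*m N 4)))
        where
        ≤-sq : ∀ n → n ℕ.≤ n ℕ.* n
        ≤-sq zero    = z≤n
        ≤-sq (suc n) = ℕₚ.m≤m*n (suc n) (suc n)

-- The series of the statement inside the truncated rings.

module Series (M : ℕ) where
  R = PSR M
  open CommutativeRing R
  open FiniteSums R
  open ThetaProducts R M
  open import Algebra.Properties.Semiring.Exp semiring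

  X : PS
  X = X^ 1

  X-^ : ∀ k n → (X ^ k) n ≡ X^ k n
  X-^ zero    n = ≡.refl
  X-^ (suc k) n = ≡.trans (≡.trans (⊗≗conv X (X ^ k) n) (≡.trans (ConvolutionLaws.conv-cong n (λ _ _ → ≡.refl) (λ j _ → X-^ k j)) (≡.sym (⊗≗conv X (X^ k) n)))) (X^-* 1 k n)

  X^≈ : ∀ k → X^ k ≈ X ^ k
  X^≈ k n _ = ≡.sym (X-^ k n)

  X-nil : Vanishes R M X
  X-nil n n<M = ≡.trans (X-^ M n) (X^-vanish n<M)

  prodUpTo≈∏ : ∀ n F → prodUpTo n F ≈ ∏ n F
  prodUpTo≈∏ zero    F = refl
  prodUpTo≈∏ (suc n) F = *-congʳ {F n} (prodUpTo≈∏ n F)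

  sumUpTo≈∑ : ∀ n F → sumUpTo n F ≈ ∑ n F
  sumUpTo≈∑ zero    F m m<M = ≡.refl
  sumUpTo≈∑ (suc n) F m m<M = ≡.cong (ℤ._+ F n m) (sumUpTo≈∑ n F m m<M)

-- The cut-off of `infProd` varies with the coefficient n. The comparison takes place modulo
-- q^(n+1), where every factor of index above n is 1.
infProd-truncate : ∀ F → (∀ k n → n ℕ.≤ k → F k n ≡ 𝟙 n) → ∀ N n → n ℕ.< N → infProd F n ≡ prodUpTo N F n
infProd-truncate F F≡1 N n n<N = ≡.sym (≡.trans (prodUpTo≈∏ N F n ℕₚ.≤-refl)
  (≡.trans (∏-truncate {F} n<N (λ k n<k m m<1+n → F≡1 k m (ℕₚ.≤-trans (ℕₚ.≤-pred m<1+n) (ℕₚ.<⇒≤ n<k))) n ℕₚ.≤-refl)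
    (≡.sym (prodUpTo≈∏ (suc n) F n ℕₚ.≤-refl))))
  where
  open Series (suc n)
  open FiniteSums (PSR (suc n))

infSum-truncate : ∀ F → (∀ k n → n ℕ.< k → F k n ≡ ℤ.0ℤ) → ∀ N n → n ℕ.< N → infSum F n ≡ sumUpTo N F n
infSum-truncate F F≡0 N n n<N = ≡.sym (≡.trans (sumUpTo≈∑ N F n ℕₚ.≤-refl)
  (≡.trans (∑-truncate {F} n<N (λ k n<k m m<1+n → F≡0 k m (ℕₚ.≤-<-trans (ℕₚ.≤-pred m<1+n) n<k)) n ℕₚ.≤-refl)
    (≡.sym (sumUpTo≈∑ (suc n) F n ℕₚ.≤-refl))))
  where
  open Series (suc n)
  open FiniteSums (PSR (suc n))

J-factor : ∀ m k n → n ℕ.≤ k → (𝟙 ⊖ X^ (suc m ℕ.* suc k)) n ≡ 𝟙 n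
J-factor m k n n≤k = ≡.trans (≡.cong (λ z → 𝟙 n ℤ.- z) (X^-vanish (ℕₚ.≤-<-trans n≤k (ℕₚ.m≤n*m (suc k) (suc m))))) (ℤₚ.+-identityʳ _)

module _ (M : ℕ) where
  open Series M
  open CommutativeRing R
  open FiniteSums R
  open ThetaProducts R M
  open import Algebra.Properties.Semiring.Exp semiring

  J≈pinf : ∀ m → J (suc m) ≈ pinf (X ^ suc m)
  J≈pinf m n n<M = ≡.trans (infProd-truncate (λ k → 𝟙 ⊖ X^ (suc m ℕ.* suc k)) (J-factor m) M n n<M)
    (trans {prodUpTo M _} {∏ M _} (prodUpTo≈∏ M _)
      (∏-cong M λ k _ → +-congˡ {𝟙} (-‿cong {X^ (suc m ℕ.* suc k)} (trans {j = X ^ (suc m ℕ.* suc k)} (X^≈ (suc m ℕ.* suc k)) (sym {(X ^ suc m) ^ suc k} (^-assocʳ X (suc m) (suc k)))))) n n<M)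

  δ-isHom : IsHom R R δ
  δ-isHom = record
    { h-cong = λ p n n<M → pad-cong 0 n (λ k k≤n → p k (ℕₚ.≤-<-trans k≤n n<M))
    ; h-+ = λ f g n _ → pad-⊕ 0 f g n
    ; h-* = λ f g n _ → δ-⊗ f g n
    ; h-neg = λ f n _ → pad-neg 0 f n
    ; h-0 = λ n _ → pad-zero 0 n
    ; h-1 = λ n _ → pad-𝟙 0 n }

factor : ℕ → ℕ → PS
factor a k = 𝟙 ⊖ X^ (a ℕ.+ 4 ℕ.* k)

α : ℕ → ℕ → PS
α a k = inv (factor a k)

factor-constant : ∀ a k → 1 ℕ.≤ a → factor a k 0 ≡ ℤ.1ℤ
factor-constant (suc a) k _ = ≡.refl

α-inverse : ∀ a k → 1 ℕ.≤ a → ∀ n → (factor a k ⊗ α a k) n ≡ 𝟙 n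
α-inverse a k 1≤a = inv-inverse (factor a k) (factor-constant a k 1≤a)

-- g(q^a;q⁴) as Σ q^(4n(n+1)) / ((q^a;q⁴)_{n+1} (q^(4−a);q⁴)_{n+1}), up to n < N
gq-sum : ℕ → ℕ → PS
gq-sum N a = sumUpTo N (λ D → X^ (4 ℕ.* (D ℕ.* suc D)) ⊗ prodUpTo (suc D) (λ k → α a k ⊗ α (4 ℕ.∸ a) k))

gq-term : ℕ → ℕ → PS
gq-term a n = X^ (4 ℕ.* n ℕ.* n) ⊗ inv (poch a 4 (suc n) ⊗ poch (4 ℕ.∸ a) 4 n)

poch-constant : ∀ a n → 1 ℕ.≤ a → poch a 4 n 0 ≡ ℤ.1ℤ
poch-constant a zero    _   = ≡.refl
poch-constant a (suc n) 1≤a = ⊗-constant (poch a 4 n) (factor a n) (poch-constant a n 1≤a) (factor-constant a n 1≤a)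

module MockThetaSeries (a : ℕ) (1≤a : 1 ℕ.≤ a) (1≤b : 1 ℕ.≤ 4 ℕ.∸ a) (a+b≡4 : a ℕ.+ (4 ℕ.∸ a) ≡ 4) where
  private
    b = 4 ℕ.∸ a

  module _ (M : ℕ) where
    open Series M
    open CommutativeRing R
    open IntegerSolver R
    open FiniteSums R
    open import Algebra.Properties.Semiring.Exp semiring
    open import Relation.Binary.Reasoning.Setoid setoid

    private
      inverse : ∀ a → 1 ℕ.≤ a → ∀ k → (1# - X ^ (a ℕ.+ 4 ℕ.* k)) * α a k ≈ 1#
      inverse a 1≤a k = trans (*-congʳ {α a k} (+-congˡ {𝟙} (-‿cong {X ^ (a ℕ.+ 4 ℕ.* k)} (sym (X^≈ (a ℕ.+ 4 ℕ.* k)))))) (λ n _ → α-inverse a k 1≤a n)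

    open MockTheta.Telescope R M X X-nil a b a+b≡4 (α a) (α b) (inverse a 1≤a) (inverse b 1≤b)

    gq-term≈ : ∀ n → gq-term a n ≈ t n * α a n
    gq-term≈ n = begin
      X^ (4 ℕ.* n ℕ.* n) * inv (poch a 4 (suc n) * poch b 4 n) ≈⟨ *-cong (X^≈ (4 ℕ.* n ℕ.* n)) unique ⟩
      X ^ (4 ℕ.* n ℕ.* n) * (∏ (suc n) (α a) * ∏ n (α b))
        ≈⟨ solve 4 (λ x p q r → x :* (p :* r :* q) := x :* (p :* q) :* r) refl (X ^ (4 ℕ.* n ℕ.* n)) (∏ n (α a)) (∏ n (α b)) (α a n) ⟩
      X ^ (4 ℕ.* n ℕ.* n) * (∏ n (α a) * ∏ n (α b)) * α a n ≈⟨ *-congʳ {α a n} {X ^ (4 ℕ.* n ℕ.* n) * (∏ n (α a) * ∏ n (α b))} {t n} (*-congˡ {X ^ (4 ℕ.* n ℕ.* n)} {∏ n (α a) * ∏ n (α b)} {∏ n (λ k → α a k * α b k)} (sym (∏-* {α a} {α b} n))) ⟩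
      t n * α a n ∎
      where
      product : ∀ a n → 1 ℕ.≤ a → poch a 4 n * ∏ n (α a) ≈ 1#
      product a n 1≤a = trans (*-congʳ {∏ n (α a)} {poch a 4 n} {∏ n (factor a)} (prodUpTo≈∏ n (factor a))) (∏-inverse {factor a} {α a} n λ k _ m _ → α-inverse a k 1≤a m)
      unique : inv (poch a 4 (suc n) * poch b 4 n) ≈ ∏ (suc n) (α a) * ∏ n (α b)
      unique = inverse-unique {poch a 4 (suc n) * poch b 4 n}
        (λ m _ → inv-inverse (poch a 4 (suc n) ⊗ poch b 4 n) (⊗-constant (poch a 4 (suc n)) (poch b 4 n) (poch-constant a (suc n) 1≤a) (poch-constant b n 1≤b)) m)
        (inverse-* {poch a 4 (suc n)} (product a (suc n) 1≤a) (product b n 1≤b))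

    gq-bracket : ∀ {N} → M ℕ.≤ N → (- 1# + sumUpTo N (gq-term a)) ≈ X^ a * gq-sum N a
    gq-bracket {N} M≤N = begin
      - 1# + sumUpTo N (gq-term a) ≈⟨ +-congˡ { - 1# } (trans (sumUpTo≈∑ N (gq-term a)) (∑-cong N λ n _ → gq-term≈ n)) ⟩
      - 1# + ∑ N (λ n → t n * α a n) ≈⟨ mock M≤N ⟩
      X ^ a * ∑ N t′ ≈⟨ *-cong (sym (X^≈ a)) (sym (trans (sumUpTo≈∑ N _) (∑-cong N λ D _ → *-cong (X^≈ (4 ℕ.* (D ℕ.* suc D))) (prodUpTo≈∏ (suc D) _)))) ⟩
      X^ a * gq-sum N a ∎

  gq-term-vanish : ∀ k n → n ℕ.< k → gq-term a k n ≡ ℤ.0ℤ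
  gq-term-vanish (suc k) n n<k = X^-below (4 ℕ.* suc k ℕ.* suc k) (inv (poch a 4 (suc (suc k)) ⊗ poch b 4 (suc k))) n
    (ℕₚ.<-≤-trans n<k (ℕₚ.m≤n*m (suc k) (4 ℕ.* suc k)))

  -- `gq` divides its bracket by q^a, so its coefficients below M need the bracket up to M + a;
  -- hence the enlarged precision.
  gq≡gq-sum : ∀ M n → n ℕ.< M → gq a 4 n ≡ gq-sum (M ℕ.+ a) a n
  gq≡gq-sum M n n<M = ≡.trans (≡.cong (λ z → ℤ.- 𝟙 (n ℕ.+ a) ℤ.+ z) (infSum-truncate (gq-term a) gq-term-vanish (M ℕ.+ a) (n ℕ.+ a) n+a<))
    (≡.trans (gq-bracket (M ℕ.+ a) ℕₚ.≤-refl (n ℕ.+ a) n+a<)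
      (≡.trans (≡.cong (X^ a ⊗ gq-sum (M ℕ.+ a) a) (ℕₚ.+-comm n a)) (X^-shift a (gq-sum (M ℕ.+ a) a) n)))
    where
    n+a< : n ℕ.+ a ℕ.< M ℕ.+ a
    n+a< = ℕₚ.+-monoˡ-< a n<M

  module Dilated (M : ℕ) (p : PS) (δX≈p : CommutativeRing._≈_ (PSR M) (δ (X^ 1)) p) where
    open Series M
    open CommutativeRing R
    open FiniteSums R
    open Geometric R M
    open IsHom (δ-isHom M)
    open Homomorphism (δ-isHom M)
    open import Algebra.Properties.Semiring.Exp semiring
    open import Relation.Binary.Reasoning.Setoid setoid

    δ-X^ : ∀ k → δ (X^ k) ≈ p ^ k
    δ-X^ k = trans (h-cong (X^≈ k)) (trans (h-^ X k) (^-congˡ k δX≈p))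

    p-nil : Vanishes R M p
    p-nil = trans (sym (δ-X^ M)) (trans (h-cong (λ n n<M → X^-vanish n<M)) h-0)

    δ-gq : δ (gq a 4) ≈ ∑ (M ℕ.+ a) (λ D → (p ^ 4) ^ (D ℕ.* suc D) * ∏ (suc D) (λ k → geo (p ^ (4 ℕ.* k ℕ.+ a)) * geo (p ^ (4 ℕ.* k ℕ.+ b))))
    δ-gq = begin
      δ (gq a 4) ≈⟨ h-cong (λ n n<M → gq≡gq-sum M n n<M) ⟩
      δ (gq-sum (M ℕ.+ a) a) ≈⟨ h-cong (sumUpTo≈∑ (M ℕ.+ a) _) ⟩
      δ (∑ (M ℕ.+ a) (λ D → X^ (4 ℕ.* (D ℕ.* suc D)) * prodUpTo (suc D) (λ k → α a k * α b k))) ≈⟨ h-∑ (M ℕ.+ a) _ ⟩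
      ∑ (M ℕ.+ a) (λ D → δ (X^ (4 ℕ.* (D ℕ.* suc D)) * prodUpTo (suc D) (λ k → α a k * α b k)))
        ≈⟨ ∑-cong (M ℕ.+ a) (λ D _ → summand D) ⟩
      ∑ (M ℕ.+ a) (λ D → (p ^ 4) ^ (D ℕ.* suc D) * ∏ (suc D) (λ k → geo (p ^ (4 ℕ.* k ℕ.+ a)) * geo (p ^ (4 ℕ.* k ℕ.+ b)))) ∎
      where
      open Nilpotent R M p p-nil using (c*x^-nil)
      -- The recursive inverse `inv` and the finite geometric sum `geo` are identified by uniqueness
      -- of inverses.
      δ-α : ∀ a k → 1 ℕ.≤ a → δ (α a k) ≈ geo (p ^ (4 ℕ.* k ℕ.+ a))
      δ-α a k 1≤a = inverse-unique {1# - p ^ (4 ℕ.* k ℕ.+ a)}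
        (trans (*-congʳ {δ (α a k)} {1# - p ^ (4 ℕ.* k ℕ.+ a)} {δ (factor a k)} (sym image))
          (trans (sym (h-* (factor a k) (α a k))) (trans (h-cong {factor a k * α a k} {1#} (λ n _ → α-inverse a k 1≤a n)) h-1)))
        (geo-inverse (trans (^-congˡ M (sym (*-identityˡ (p ^ (4 ℕ.* k ℕ.+ a))))) (c*x^-nil 1# (ℕₚ.≤-trans 1≤a (ℕₚ.m≤n+m a (4 ℕ.* k))))))
        where
        image : δ (factor a k) ≈ 1# - p ^ (4 ℕ.* k ℕ.+ a)
        image = trans (h-1- (X^ (a ℕ.+ 4 ℕ.* k))) (+-congˡ {1#} (-‿cong {δ (X^ (a ℕ.+ 4 ℕ.* k))} {p ^ (4 ℕ.* k ℕ.+ a)}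
          (trans (δ-X^ (a ℕ.+ 4 ℕ.* k)) (^-congʳ p (ℕₚ.+-comm a (4 ℕ.* k))))))
      factors : ℕ → PS
      factors k = α a k * α b k
      factors≈ : ∀ k → δ (factors k) ≈ geo (p ^ (4 ℕ.* k ℕ.+ a)) * geo (p ^ (4 ℕ.* k ℕ.+ b))
      factors≈ k = trans (h-* (α a k) (α b k)) (*-cong (δ-α a k 1≤a) (δ-α b k 1≤b))
      products≈ : ∀ D → δ (prodUpTo (suc D) factors) ≈ ∏ (suc D) (λ k → geo (p ^ (4 ℕ.* k ℕ.+ a)) * geo (p ^ (4 ℕ.* k ℕ.+ b)))
      products≈ D = trans (h-cong (prodUpTo≈∏ (suc D) factors)) (trans (h-∏ (suc D) factors) (∏-cong (suc D) λ k _ → factors≈ k))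
      summand : ∀ D → δ (X^ (4 ℕ.* (D ℕ.* suc D)) * prodUpTo (suc D) factors)
                ≈ (p ^ 4) ^ (D ℕ.* suc D) * ∏ (suc D) (λ k → geo (p ^ (4 ℕ.* k ℕ.+ a)) * geo (p ^ (4 ℕ.* k ℕ.+ b)))
      summand D = trans (h-* (X^ (4 ℕ.* (D ℕ.* suc D))) (prodUpTo (suc D) factors))
        (*-cong (trans (δ-X^ (4 ℕ.* (D ℕ.* suc D))) (sym (^-assocʳ p 4 (D ℕ.* suc D)))) (products≈ D))

-- Adjoining an eighth root of unity.

module QuadraticExtension (R : CommutativeRing 0ℓ 0ℓ) (D : CommutativeRing.Carrier R) where
  open CommutativeRing R
  open IntegerSolver R

  private
    C : Set
    C = Carrier × Carrier

    _≋_ : C → C → Set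
    (a , b) ≋ (c , d) = (a ≈ c) × (b ≈ d)

    _⊞_ _⊠_ : C → C → C
    (a , b) ⊞ (c , d) = a + c , b + d
    (a , b) ⊠ (c , d) = a * c + D * (b * d) , a * d + b * c

  -- R[√D]; (a , b) stands for a + b √D
  extension : CommutativeRing 0ℓ 0ℓ
  extension = record
    { Carrier = C ; _≈_ = _≋_ ; _+_ = _⊞_ ; _*_ = _⊠_ ; -_ = λ (a , b) → - a , - b ; 0# = 0# , 0# ; 1# = 1# , 0#
    ; isCommutativeRing = record
      { isRing = record
        { +-isAbelianGroup = record
          { isGroup = record
            { isMonoid = record
              { isSemigroup = record
                { isMagma = record
                  { isEquivalence = record { refl = refl , refl ; sym = λ (p , q) → sym p , sym q ; trans = λ (p , q) (r , s) → trans p r , trans q s }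
                  ; ∙-cong = λ (p , q) (r , s) → +-cong p r , +-cong q s }
                ; assoc = λ _ _ _ → +-assoc _ _ _ , +-assoc _ _ _ }
              ; identity = (λ _ → +-identityˡ _ , +-identityˡ _) , (λ _ → +-identityʳ _ , +-identityʳ _) }
            ; inverse = (λ _ → -‿inverseˡ _ , -‿inverseˡ _) , (λ _ → -‿inverseʳ _ , -‿inverseʳ _)
            ; ⁻¹-cong = λ (p , q) → -‿cong p , -‿cong q }
          ; comm = λ _ _ → +-comm _ _ , +-comm _ _ }
        ; *-cong = λ (p , q) (r , s) → +-cong (*-cong p r) (*-congˡ (*-cong q s)) , +-cong (*-cong p s) (*-cong q r)
        ; *-assoc = λ (a , b) (c , d) (e , f) →
            solve 7 (λ D a b c d e f → (a :* c :+ D :* (b :* d)) :* e :+ D :* ((a :* d :+ b :* c) :* f)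
              := a :* (c :* e :+ D :* (d :* f)) :+ D :* (b :* (c :* f :+ d :* e))) refl D a b c d e f
          , solve 7 (λ D a b c d e f → (a :* c :+ D :* (b :* d)) :* f :+ (a :* d :+ b :* c) :* e
              := a :* (c :* f :+ d :* e) :+ b :* (c :* e :+ D :* (d :* f))) refl D a b c d e f
        ; *-identity = (λ (a , b) → solve 3 (λ D a b → :1 :* a :+ D :* (:0 :* b) := a) refl D a b , solve 2 (λ a b → :1 :* b :+ :0 :* a := b) refl a b)
                     , (λ (a , b) → solve 3 (λ D a b → a :* :1 :+ D :* (b :* :0) := a) refl D a b , solve 2 (λ a b → a :* :0 :+ b :* :1 := b) refl a b)
        ; distrib = (λ (a , b) (c , d) (e , f) →
              solve 7 (λ D a b c d e f → a :* (c :+ e) :+ D :* (b :* (d :+ f)) := a :* c :+ D :* (b :* d) :+ (a :* e :+ D :* (b :* f))) refl D a b c d e f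
            , solve 6 (λ a b c d e f → a :* (d :+ f) :+ b :* (c :+ e) := a :* d :+ b :* c :+ (a :* f :+ b :* e)) refl a b c d e f)
                  , (λ (a , b) (c , d) (e , f) →
              solve 7 (λ D a b c d e f → (c :+ e) :* a :+ D :* ((d :+ f) :* b) := c :* a :+ D :* (d :* b) :+ (e :* a :+ D :* (f :* b))) refl D a b c d e f
            , solve 6 (λ a b c d e f → (c :+ e) :* b :+ (d :+ f) :* a := c :* b :+ d :* a :+ (e :* b :+ f :* a)) refl a b c d e f) }
      ; *-comm = λ (a , b) (c , d) → solve 5 (λ D a b c d → a :* c :+ D :* (b :* d) := c :* a :+ D :* (d :* b)) refl D a b c d
                                   , solve 4 (λ a b c d → a :* d :+ b :* c := c :* b :+ d :* a) refl a b c d } }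

  emb : Carrier → C
  emb a = a , 0#

  emb-isHom : IsHom R extension emb
  emb-isHom = record
    { h-cong = λ p → p , refl
    ; h-+ = λ a b → refl , sym (+-identityˡ _)
    ; h-* = λ a b → solve 3 (λ D a b → a :* b := a :* b :+ D :* (:0 :* :0)) refl D a b , solve 2 (λ a b → :0 := a :* :0 :+ :0 :* b) refl a b
    ; h-neg = λ a → refl , solve 0 (:0 := :- :0) refl
    ; h-0 = refl , refl
    ; h-1 = refl , refl }

-- R[ζ] with ζ⁴ = −1, built as R[i][√i]
module EighthRoot (R : CommutativeRing 0ℓ 0ℓ) where
  private
    module R = CommutativeRing R
    module E₁ = QuadraticExtension R (R.- R.1#)
    module E₂ = QuadraticExtension E₁.extension (R.0# , R.1#)

  K : CommutativeRing 0ℓ 0ℓ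
  K = E₂.extension

  open CommutativeRing K
  open IntegerSolver R
  open import Algebra.Properties.Semiring.Exp semiring
  open import Relation.Binary.Reasoning.Setoid setoid

  emb : R.Carrier → Carrier
  emb a = E₂.emb (E₁.emb a)

  emb-isHom : IsHom R K emb
  emb-isHom = record
    { h-cong = λ p → h₂.h-cong (h₁.h-cong p)
    ; h-+ = λ a b → trans {j = E₂.emb (E₁.emb a E₁+ E₁.emb b)} (h₂.h-cong (h₁.h-+ a b)) (h₂.h-+ (E₁.emb a) (E₁.emb b))
    ; h-* = λ a b → trans {j = E₂.emb (E₁.emb a E₁* E₁.emb b)} (h₂.h-cong (h₁.h-* a b)) (h₂.h-* (E₁.emb a) (E₁.emb b))
    ; h-neg = λ a → trans {j = E₂.emb (E₁- E₁.emb a)} (h₂.h-cong (h₁.h-neg a)) (h₂.h-neg (E₁.emb a))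
    ; h-0 = refl
    ; h-1 = refl }
    where
    module h₁ = IsHom E₁.emb-isHom
    module h₂ = IsHom E₂.emb-isHom
    open CommutativeRing E₁.extension using () renaming (_+_ to _E₁+_; _*_ to _E₁*_; -_ to E₁-_)

  -- With i = ζ², the element ((a , b) , (c , d)) is a + cζ + bζ² + dζ³. Hence `ω`, which is -iζ =
  -- -ζ³, is the inverse of `ζ`.
  ζ ω : Carrier
  ζ = (R.0# , R.0#) , (R.1# , R.0#)
  ω = (R.0# , R.0#) , (R.0# , R.- R.1#)

  -- coefficients of 1 and ζ
  c₀ c₁ : Carrier → R.Carrier
  c₀ ((a , _) , _) = a
  c₁ (_ , (c , _)) = c

  ζ*_ : Carrier → Carrier
  ζ* ((a , b) , (c , d)) = (R.- d , c) , (a , b)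

  ζ-action : ∀ k → ζ * k ≈ (ζ* k)
  ζ-action ((a , b) , (c , d)) =
    ( solve 4 (λ a b c d → :0 :* a :+ :- :1 :* (:0 :* b) :+ (:0 :* (:1 :* c :+ :- :1 :* (:0 :* d)) :+ :- :1 :* (:1 :* (:1 :* d :+ :0 :* c))) := :- d) R.refl a b c d
    , solve 4 (λ a b c d → :0 :* b :+ :0 :* a :+ (:0 :* (:1 :* d :+ :0 :* c) :+ :1 :* (:1 :* c :+ :- :1 :* (:0 :* d))) := c) R.refl a b c d)
    , ( solve 4 (λ a b c d → :0 :* c :+ :- :1 :* (:0 :* d) :+ (:1 :* a :+ :- :1 :* (:0 :* b)) := a) R.refl a b c d
      , solve 4 (λ a b c d → :0 :* d :+ :0 :* c :+ (:1 :* b :+ :0 :* a) := b) R.refl a b c d)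

  c₀-emb : ∀ p k → c₀ (emb p * k) R.≈ p R.* c₀ k
  c₀-emb p ((a , b) , (c , d)) = solve 5 (λ p a b c d →
    p :* a :+ :- :1 :* (:0 :* b) :+ (:0 :* (:0 :* c :+ :- :1 :* (:0 :* d)) :+ :- :1 :* (:1 :* (:0 :* d :+ :0 :* c))) := p :* a) R.refl p a b c d

  c₁-emb : ∀ p k → c₁ (emb p * k) R.≈ p R.* c₁ k
  c₁-emb p ((a , b) , (c , d)) = solve 5 (λ p a b c d →
    p :* c :+ :- :1 :* (:0 :* d) :+ (:0 :* a :+ :- :1 :* (:0 :* b)) := p :* c) R.refl p a b c d

  √2 : Carrier
  √2 = ζ + ω

  ζω≈1 : ζ * ω ≈ 1#
  ζω≈1 = trans (ζ-action ω) ((solve 0 (:- (:- :1) := :1) R.refl , R.refl) , (R.refl , R.refl))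

  √2*√2 : √2 * √2 ≈ 1# + 1#
  √2*√2 = (solve 0 ((:0 :+ :0) :* (:0 :+ :0) :+ :- :1 :* ((:0 :+ :0) :* (:0 :+ :0)) :+ (:0 :* ((:1 :+ :0) :* (:1 :+ :0) :+ :- :1 :* ((:0 :+ :- :1) :* (:0 :+ :- :1))) :+ :- :1 :* (:1 :* ((:1 :+ :0) :* (:0 :+ :- :1) :+ (:0 :+ :- :1) :* (:1 :+ :0)))) := :1 :+ :1) R.refl
    , solve 0 ((:0 :+ :0) :* (:0 :+ :0) :+ (:0 :+ :0) :* (:0 :+ :0) :+ (:0 :* ((:1 :+ :0) :* (:0 :+ :- :1) :+ (:0 :+ :- :1) :* (:1 :+ :0)) :+ :1 :* ((:1 :+ :0) :* (:1 :+ :0) :+ :- :1 :* ((:0 :+ :- :1) :* (:0 :+ :- :1)))) := :0 :+ :0) R.refl)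
    , (solve 0 ((:0 :+ :0) :* (:1 :+ :0) :+ :- :1 :* ((:0 :+ :0) :* (:0 :+ :- :1)) :+ ((:1 :+ :0) :* (:0 :+ :0) :+ :- :1 :* ((:0 :+ :- :1) :* (:0 :+ :0))) := :0 :+ :0) R.refl
    , solve 0 ((:0 :+ :0) :* (:0 :+ :- :1) :+ (:0 :+ :0) :* (:1 :+ :0) :+ ((:1 :+ :0) :* (:0 :+ :0) :+ (:0 :+ :- :1) :* (:0 :+ :0)) := :0 :+ :0) R.refl)

  -- Here √2 = ζ - ζ³, so the element is A + Bζ - Bζ³, and its two components can be read off in the
  -- basis of powers of ζ.
  c₀-split : ∀ A B → c₀ (emb A + √2 * emb B) R.≈ A
  c₀-split A B = solve 2 (λ A B → A :+ ((:0 :+ :0) :* B :+ :- :1 :* ((:0 :+ :0) :* :0) :+ (:0 :* ((:1 :+ :0) :* :0 :+ :- :1 :* ((:0 :+ :- :1) :* :0)) :+ :- :1 :* (:1 :* ((:1 :+ :0) :* :0 :+ (:0 :+ :- :1) :* :0)))) := A) R.refl A B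

  c₁-split : ∀ A B → c₁ (emb A + √2 * emb B) R.≈ B
  c₁-split A B = solve 2 (λ A B → :0 :+ ((:0 :+ :0) :* :0 :+ :- :1 :* ((:0 :+ :0) :* :0) :+ ((:1 :+ :0) :* B :+ :- :1 :* ((:0 :+ :- :1) :* :0))) := B) R.refl A B

  private
    module KB = FiniteSums K

    rot : ℕ → Carrier → Carrier
    rot zero    k = k
    rot (suc n) k = ζ* (rot n k)

    ζ^-rot : ∀ n k → ζ ^ n * k ≈ rot n k
    ζ^-rot zero    k = *-identityˡ k
    ζ^-rot (suc n) k = trans (*-assoc ζ (ζ ^ n) k) (trans (*-congˡ {ζ} (ζ^-rot n k)) (ζ-action (rot n k)))

    neg-neg-0 : R.- (R.- R.0#) R.≈ R.0#
    neg-neg-0 = solve 0 (:- (:- :0) := :0) R.refl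

    neg-0 : R.- R.0# R.≈ R.0#
    neg-0 = solve 0 (:- :0 := :0) R.refl

  ζ⁸≈1 : ζ ^ 8 ≈ 1#
  ζ⁸≈1 = trans (sym (*-identityʳ (ζ ^ 8))) (trans (ζ^-rot 8 1#) ((solve 0 (:- (:- :1) := :1) R.refl , neg-neg-0) , (neg-neg-0 , neg-neg-0)))

  ω≈ζ⁷ : ω ≈ ζ ^ 7
  ω≈ζ⁷ = KB.inverse-unique {ζ} ζω≈1 ζ⁸≈1

  ζω-power : ∀ l l′ → ζ ^ l * ω ^ l′ ≈ ζ ^ ((l ℕ.+ 7 ℕ.* l′) % 8)
  ζω-power l l′ = begin
    ζ ^ l * ω ^ l′ ≈⟨ *-congˡ {ζ ^ l} (trans (^-congˡ l′ ω≈ζ⁷) (^-assocʳ ζ 7 l′)) ⟩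
    ζ ^ l * ζ ^ (7 ℕ.* l′) ≈⟨ sym (^-homo-* ζ l (7 ℕ.* l′)) ⟩
    ζ ^ k ≡⟨ ≡.cong (ζ ^_) (≡.trans (m≡m%n+[m/n]*n k 8) (≡.cong (k % 8 ℕ.+_) (ℕₚ.*-comm (k / 8) 8))) ⟩
    ζ ^ (k % 8 ℕ.+ 8 ℕ.* (k / 8)) ≈⟨ ^-homo-* ζ (k % 8) (8 ℕ.* (k / 8)) ⟩
    ζ ^ (k % 8) * ζ ^ (8 ℕ.* (k / 8)) ≈⟨ *-congˡ {ζ ^ (k % 8)} (trans (sym (^-assocʳ ζ 8 (k / 8))) (trans (^-congˡ (k / 8) ζ⁸≈1) (one-^ (k / 8)))) ⟩
    ζ ^ (k % 8) * 1# ≈⟨ *-identityʳ _ ⟩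
    ζ ^ (k % 8) ∎
    where
    k = l ℕ.+ 7 ℕ.* l′
    one-^ : ∀ n → 1# ^ n ≈ 1#
    one-^ zero    = refl
    one-^ (suc n) = trans (*-identityˡ (1# ^ n)) (one-^ n)

  -- coefficients of 1 and ζ in ζ^r, for r < 8
  coeff₀ coeff₁ : ℕ → R.Carrier → R.Carrier
  coeff₀ 0 a = a
  coeff₀ 4 a = R.- a
  coeff₀ _ a = R.0#
  coeff₁ 1 a = a
  coeff₁ 5 a = R.- a
  coeff₁ _ a = R.0#

  c₀-ζ^ : ∀ r a → r ℕ.< 8 → c₀ (ζ ^ r * emb a) R.≈ coeff₀ r a
  c₀-ζ^ r a r<8 = R.trans (proj₁ (proj₁ (ζ^-rot r (emb a)))) (go r r<8)
    where
    go : ∀ r → r ℕ.< 8 → c₀ (rot r (emb a)) R.≈ coeff₀ r a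
    go 0 _ = R.refl
    go 1 _ = neg-0
    go 2 _ = neg-0
    go 3 _ = neg-0
    go 4 _ = R.refl
    go 5 _ = neg-neg-0
    go 6 _ = neg-neg-0
    go 7 _ = neg-neg-0
    go (suc (suc (suc (suc (suc (suc (suc (suc _)))))))) (s≤s (s≤s (s≤s (s≤s (s≤s (s≤s (s≤s (s≤s ()))))))))

  c₁-ζ^ : ∀ r a → r ℕ.< 8 → c₁ (ζ ^ r * emb a) R.≈ coeff₁ r a
  c₁-ζ^ r a r<8 = R.trans (proj₁ (proj₂ (ζ^-rot r (emb a)))) (go r r<8)
    where
    go : ∀ r → r ℕ.< 8 → c₁ (rot r (emb a)) R.≈ coeff₁ r a
    go 0 _ = R.refl
    go 1 _ = R.refl
    go 2 _ = neg-0
    go 3 _ = neg-0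
    go 4 _ = neg-0
    go 5 _ = R.refl
    go 6 _ = neg-neg-0
    go 7 _ = neg-neg-0
    go (suc (suc (suc (suc (suc (suc (suc (suc _)))))))) (s≤s (s≤s (s≤s (s≤s (s≤s (s≤s (s≤s (s≤s ()))))))))

-- Rows of odd Durfee symbols and their generating functions.

parity-odd : ∀ i → isOdd (suc (i ℕ.+ i)) ≡ true
parity-odd i = ≡.cong (_≡ᵇ 1) (≡.trans (≡.cong (λ k → suc k % 2) (eq i)) ([m+kn]%n≡m%n 1 i 2))
  where
  eq : ∀ i → i ℕ.+ i ≡ i ℕ.* 2
  eq = solve 1 (λ i → i :+ i := i :* con 2) ≡.refl
    where open +-*-Solver

parity-even : ∀ i → isOdd (i ℕ.+ i) ≡ false
parity-even i = ≡.cong (_≡ᵇ 1) (≡.trans (≡.cong (_% 2) (eq i)) ([m+kn]%n≡m%n 0 i 2))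
  where
  eq : ∀ i → i ℕ.+ i ≡ i ℕ.* 2
  eq = solve 1 (λ i → i :+ i := i :* con 2) ≡.refl
    where open +-*-Solver

≤ᵇ-true : ∀ {m n} → m ℕ.≤ n → (m ≤ᵇ n) ≡ true
≤ᵇ-true m≤n = Equivalence.to T-≡ (ℕₚ.≤⇒≤ᵇ m≤n)

≤ᵇ-false : ∀ {m n} → n ℕ.< m → (m ≤ᵇ n) ≡ false
≤ᵇ-false {m} {n} n<m with m ≤ᵇ n in e
... | false = ≡.refl
... | true  = ⊥-elim (ℕₚ.<⇒≱ n<m (ℕₚ.≤ᵇ⇒≤ m n (Equivalence.from T-≡ e)))

bounded : ℕ → ℕ → Bool
bounded B x = isOdd x ∧ (x ≤ᵇ B)

-- In a non-increasing row only the first entry needs to be compared with the bound.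
nonIncreasing-bounded : ∀ x B r → x ℕ.≤ B →
  nonIncreasing (x ∷ r) ∧ allᵇ (bounded B) r ≡ nonIncreasing r ∧ allᵇ (bounded x) r
nonIncreasing-bounded x B []       x≤B = ≡.refl
nonIncreasing-bounded x B (y ∷ r) x≤B with y ℕₚ.≤? x
... | no y≰x rewrite ≤ᵇ-false (ℕₚ.≰⇒> y≰x) | ∧-zeroʳ (isOdd y) = ≡.sym (∧-zeroʳ (nonIncreasing (y ∷ r)))
... | yes y≤x rewrite ≤ᵇ-true y≤x | ≤ᵇ-true (ℕₚ.≤-trans y≤x x≤B) = begin
    a ∧ (o ∧ true) ∧ allᵇ (bounded B) r ≡⟨ swap a (o ∧ true) (allᵇ (bounded B) r) ⟩
    (o ∧ true) ∧ (a ∧ allᵇ (bounded B) r) ≡⟨ ≡.cong ((o ∧ true) ∧_) (≡.trans (nonIncreasing-bounded y B r (ℕₚ.≤-trans y≤x x≤B)) (≡.sym (nonIncreasing-bounded y x r y≤x))) ⟩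
    (o ∧ true) ∧ (a ∧ allᵇ (bounded x) r) ≡⟨ swap a (o ∧ true) (allᵇ (bounded x) r) ⟨
    a ∧ (o ∧ true) ∧ allᵇ (bounded x) r ∎
  where
  open ≡.≡-Reasoning
  a = nonIncreasing (y ∷ r)
  o = isOdd y
  swap : ∀ a b c → a ∧ b ∧ c ≡ b ∧ (a ∧ c)
  swap a b c = ≡.trans (≡.sym (∧-assoc a b c)) (≡.trans (≡.cong (_∧ c) (∧-comm a b)) (∧-assoc b a c))

private
  odd-bound : ∀ i → 2 ℕ.* i ℕ.+ 1 ≡ suc (i ℕ.+ i)
  odd-bound = solve 1 (λ i → con 2 :* i :+ con 1 := con 1 :+ (i :+ i)) ≡.refl
    where open +-*-Solver

-- What follows a first entry 2i + 1 is again a row, for the parameter i instead of D.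
-- `H-recurrence` rests on this self-similarity.
validRow-cons : ∀ D i r → i ℕ.≤ D → validRow D (suc (i ℕ.+ i) ∷ r) ≡ validRow i r
validRow-cons D i r i≤D rewrite odd-bound D | odd-bound i | parity-odd i | ≤ᵇ-true (s≤s (ℕₚ.+-mono-≤ i≤D i≤D)) =
  nonIncreasing-bounded (suc (i ℕ.+ i)) (suc (D ℕ.+ D)) r (s≤s (ℕₚ.+-mono-≤ i≤D i≤D))

validRow-large : ∀ D i r → D ℕ.< i → validRow D (suc (i ℕ.+ i) ∷ r) ≡ false
validRow-large D i r D<i rewrite odd-bound D | parity-odd i | ≤ᵇ-false (s≤s (ℕₚ.+-mono-< D<i D<i)) = ∧-zeroʳ _

validRow-even : ∀ D i r → validRow D ((i ℕ.+ i) ∷ r) ≡ false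
validRow-even D i r rewrite parity-even i = ∧-zeroʳ _

module ListSums (R : CommutativeRing 0ℓ 0ℓ) where
  open CommutativeRing R
  open IntegerSolver R
  open FiniteSums R
  open PartialFractions R
  open import Relation.Binary.Reasoning.Setoid setoid

  ∑L-ext : {I : Set} {F G : I → Carrier} (is : List I) → (∀ i → F i ≈ G i) → ∑L F is ≈ ∑L G is
  ∑L-ext []       e = refl
  ∑L-ext (i ∷ is) e = +-cong (e i) (∑L-ext is e)

  ∑L-++ : {I : Set} (F : I → Carrier) (is js : List I) → ∑L F (is ++ js) ≈ ∑L F is + ∑L F js
  ∑L-++ F []       js = sym (+-identityˡ _)
  ∑L-++ F (i ∷ is) js = trans (+-congˡ (∑L-++ F is js)) (sym (+-assoc _ _ _))

  ∑L-map : {I I′ : Set} (F : I′ → Carrier) (h : I → I′) (is : List I) → ∑L F (map h is) ≈ ∑L (λ i → F (h i)) is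
  ∑L-map F h []       = refl
  ∑L-map F h (i ∷ is) = +-congˡ (∑L-map F h is)

  ∑L-concatMap : {I I′ : Set} (F : I′ → Carrier) (h : I → List I′) (is : List I) → ∑L F (concatMap h is) ≈ ∑L (λ i → ∑L F (h i)) is
  ∑L-concatMap F h []       = refl
  ∑L-concatMap F h (i ∷ is) = trans (∑L-++ F (h i) (concatMap h is)) (+-congˡ (∑L-concatMap F h is))

  ∑L-upTo : (F : ℕ → Carrier) (n : ℕ) → ∑L F (upTo n) ≈ ∑ n F
  ∑L-upTo F n = go n (λ k → k)
    where
    go : ∀ n (h : ℕ → ℕ) → ∑L F (applyUpTo h n) ≈ ∑ n (λ i → F (h i))
    go zero    h = refl
    go (suc n) h = trans (+-congˡ (go n (λ k → h (suc k)))) (sym (∑-head n))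

  *-∑L : {I : Set} (c : Carrier) (F : I → Carrier) (is : List I) → c * ∑L F is ≈ ∑L (λ i → c * F i) is
  *-∑L c F []       = zeroʳ c
  *-∑L c F (i ∷ is) = trans (distribˡ _ _ _) (+-congˡ (*-∑L c F is))

  ∑L-zero : {I : Set} (is : List I) → ∑L {I} (λ _ → 0#) is ≈ 0#
  ∑L-zero []       = refl
  ∑L-zero (i ∷ is) = trans (+-identityˡ _) (∑L-zero is)

  ∑L-+ : {I : Set} (F G : I → Carrier) (is : List I) → ∑L (λ i → F i + G i) is ≈ ∑L F is + ∑L G is
  ∑L-+ F G []       = sym (+-identityˡ _)
  ∑L-+ F G (i ∷ is) = trans (+-congˡ (∑L-+ F G is)) (solve 4 (λ a b c d → a :+ b :+ (c :+ d) := a :+ c :+ (b :+ d)) refl _ _ _ _)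

  ∑L-swap : {I I′ : Set} (H : I → I′ → Carrier) (is : List I) (js : List I′) → ∑L (λ i → ∑L (H i) js) is ≈ ∑L (λ j → ∑L (λ i → H i j) is) js
  ∑L-swap H []       js = sym (∑L-zero js)
  ∑L-swap H (i ∷ is) js = trans (+-congˡ (∑L-swap H is js)) (sym (∑L-+ (H i) (λ j → ∑L (λ i → H i j) is) js))

module Rows (R : CommutativeRing 0ℓ 0ℓ) (M : ℕ) (x : CommutativeRing.Carrier R) (x^M≈0 : Vanishes R M x) (z : CommutativeRing.Carrier R) where
  open CommutativeRing R
  open IntegerSolver R
  open FiniteSums R
  open PartialFractions R
  open ListSums R
  open Nilpotent R M x x^M≈0 using (geo; geo-inverse; c*x^-nil; x^≥M)
  open import Algebra.Properties.Semiring.Exp semiring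
  open import Relation.Binary.Reasoning.Setoid setoid

  part : ℕ → Carrier
  part d = z * x ^ suc (d ℕ.+ d)

  h : ℕ → Carrier
  h n = ∏ n (λ j → geo (part j))

  -- Classification by the largest part: `h n` generates the rows with parts 1, 3, ..., 2n - 1, and
  -- `part d * h (suc d)` those whose largest part is 2d + 1.
  h-recurrence : ∀ n → h n ≈ 1# + ∑ n (λ d → part d * h (suc d))
  h-recurrence zero    = sym (+-identityʳ _)
  h-recurrence (suc n) = begin
    h n * geo (part n) ≈⟨ solve 3 (λ h u g → h :* g := h :* ((:1 :- u) :* g) :+ u :* (h :* g)) refl (h n) (part n) (geo (part n)) ⟩
    h n * ((1# - part n) * geo (part n)) + part n * h (suc n) ≈⟨ +-congʳ (trans (*-congˡ (geo-inverse (c*x^-nil z {suc (n ℕ.+ n)} (s≤s z≤n)))) (*-identityʳ _)) ⟩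
    h n + part n * h (suc n) ≈⟨ trans (+-congʳ (h-recurrence n)) (+-assoc _ _ _) ⟩
    1# + ∑ (suc n) (λ d → part d * h (suc d)) ∎

  weight : ℕ → List ℕ → Carrier
  weight D r = if validRow D r then z ^ length r * x ^ sum r else 0#

  module _ (b : ℕ) (M≤1+b : M ℕ.≤ suc b) where
    H : ℕ → ℕ → Carrier
    H L D = ∑L (weight D) (allLists L b)

    private
      contribution : ℕ → ℕ → ℕ → Carrier
      contribution L D k = ∑L (λ r → weight D (k ∷ r)) (allLists L b)

      cons : ∀ k r → z ^ suc (length r) * x ^ (k ℕ.+ sum r) ≈ z * x ^ k * (z ^ length r * x ^ sum r)
      cons k r = trans (*-congˡ (^-homo-* x k (sum r))) (solve 4 (λ z a x b → z :* a :* (x :* b) := z :* x :* (a :* b)) refl z (z ^ length r) (x ^ k) (x ^ sum r))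

      even-entry : ∀ L D i → contribution L D (i ℕ.+ i) ≈ 0#
      even-entry L D i = trans (∑L-ext (allLists L b) (λ r → reflexive (≡.cong (λ t → if t then z ^ suc (length r) * x ^ (i ℕ.+ i ℕ.+ sum r) else 0#) (validRow-even D i r)))) (∑L-zero (allLists L b))

      large-entry : ∀ L D i → D ℕ.< i → contribution L D (suc (i ℕ.+ i)) ≈ 0#
      large-entry L D i D<i = trans (∑L-ext (allLists L b) (λ r → reflexive (≡.cong (λ t → if t then z ^ suc (length r) * x ^ (suc (i ℕ.+ i) ℕ.+ sum r) else 0#) (validRow-large D i r D<i)))) (∑L-zero (allLists L b))

      odd-entry : ∀ L D i → i ℕ.≤ D → contribution L D (suc (i ℕ.+ i)) ≈ part i * H L i
      odd-entry L D i i≤D = trans (∑L-ext (allLists L b) step) (sym (*-∑L (part i) (weight i) (allLists L b)))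
        where
        step : ∀ r → weight D (suc (i ℕ.+ i) ∷ r) ≈ part i * weight i r
        step r rewrite validRow-cons D i r i≤D with validRow i r
        ... | true  = cons (suc (i ℕ.+ i)) r
        ... | false = sym (zeroʳ _)

      big-entry : ∀ L D k → M ℕ.≤ k → contribution L D k ≈ 0#
      big-entry L D k M≤k = trans (∑L-ext (allLists L b) step) (∑L-zero (allLists L b))
        where
        step : ∀ r → weight D (k ∷ r) ≈ 0#
        step r with validRow D (k ∷ r)
        ... | true  = trans (cons k r) (trans (*-congʳ (*-congˡ (x^≥M M≤k))) (solve 2 (λ a b → a :* :0 :* b := :0) refl z _))
        ... | false = refl

    H-recurrence : ∀ L D → H (suc L) D ≈ 1# + ∑ (suc D) (λ d → part d * H L d)
    H-recurrence L D = begin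
      1# * 1# + ∑L (weight D) (concatMap (λ k → map (k ∷_) (allLists L b)) (upTo (suc b)))
        ≈⟨ +-cong (*-identityˡ _) (trans (∑L-concatMap (weight D) (λ k → map (k ∷_) (allLists L b)) (upTo (suc b)))
             (trans (∑L-ext (upTo (suc b)) (λ k → ∑L-map (weight D) (k ∷_) (allLists L b))) (∑L-upTo (contribution L D) (suc b)))) ⟩
      1# + ∑ (suc b) (contribution L D)
        ≈⟨ +-congˡ (sym (∑-truncate {F = contribution L D} (ℕₚ.≤-trans (ℕₚ.m≤m+n (suc b) (suc D)) (ℕₚ.m≤m+n B B)) (λ k b<k → big-entry L D k (ℕₚ.≤-trans M≤1+b b<k)))) ⟩
      1# + ∑ (B ℕ.+ B) (contribution L D) ≈⟨ +-congˡ (∑-parity B) ⟩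
      1# + (∑ B (λ i → contribution L D (i ℕ.+ i)) + ∑ B (λ i → contribution L D (suc (i ℕ.+ i))))
        ≈⟨ +-congˡ (+-cong (∑-zero B λ i _ → even-entry L D i) (∑-truncate {F = λ i → contribution L D (suc (i ℕ.+ i))} (ℕₚ.m≤n+m (suc D) (suc b)) λ i D<i → large-entry L D i D<i)) ⟩
      1# + (0# + ∑ (suc D) (λ i → contribution L D (suc (i ℕ.+ i))))
        ≈⟨ +-congˡ (trans (+-identityˡ _) (∑-cong (suc D) λ i i≤D → odd-entry L D i (ℕₚ.≤-pred i≤D))) ⟩
      1# + ∑ (suc D) (λ d → part d * H L d) ∎
      where
      -- Large enough that 2B covers all entries up to b and B covers all i up to D: the sum is
      -- first lengthened to 2B terms by zeros and then split by the parity of the entry.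
      B = suc b ℕ.+ suc D

    -- rows of length > L have weight divisible by x^(L+1)
    H≈h : ∀ L k D → M ℕ.≤ suc (k ℕ.+ L) → x ^ k * H L D ≈ x ^ k * h (suc D)
    H≈h zero k D M≤ = sym (begin
      x ^ k * h (suc D) ≈⟨ *-congˡ (h-recurrence (suc D)) ⟩
      x ^ k * (1# + ∑ (suc D) (λ d → part d * h (suc d))) ≈⟨ trans (distribˡ _ _ _) (+-congˡ (*-∑ (suc D) (x ^ k))) ⟩
      x ^ k * 1# + ∑ (suc D) (λ d → x ^ k * (part d * h (suc d))) ≈⟨ +-congˡ (∑-zero (suc D) λ d _ → vanish d) ⟩
      x ^ k * 1# + 0# ≈⟨ solve 1 (λ a → a :* :1 :+ :0 := a :* (:1 :* :1 :+ :0)) refl (x ^ k) ⟩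
      x ^ k * (1# * 1# + 0#) ∎)
      where
      vanish : ∀ d → x ^ k * (part d * h (suc d)) ≈ 0#
      vanish d = begin
        x ^ k * (z * x ^ suc (d ℕ.+ d) * h (suc d)) ≈⟨ solve 4 (λ a z b h → a :* (z :* b :* h) := a :* b :* (z :* h)) refl (x ^ k) z (x ^ suc (d ℕ.+ d)) (h (suc d)) ⟩
        x ^ k * x ^ suc (d ℕ.+ d) * (z * h (suc d)) ≈⟨ *-congʳ (trans (sym (^-homo-* x k (suc (d ℕ.+ d)))) (x^≥M (ℕₚ.≤-trans M≤ (ℕₚ.≤-trans (ℕₚ.≤-reflexive (≡.trans (≡.cong suc (ℕₚ.+-identityʳ k)) (ℕₚ.+-comm 1 k))) (ℕₚ.+-monoʳ-≤ k (s≤s z≤n)))))) ⟩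
        0# * (z * h (suc d)) ≈⟨ zeroˡ _ ⟩
        0# ∎
    H≈h (suc L) k D M≤ = begin
      x ^ k * H (suc L) D ≈⟨ *-congˡ (H-recurrence L D) ⟩
      x ^ k * (1# + ∑ (suc D) (λ d → part d * H L d)) ≈⟨ trans (distribˡ _ _ _) (+-congˡ (*-∑ (suc D) (x ^ k))) ⟩
      x ^ k * 1# + ∑ (suc D) (λ d → x ^ k * (part d * H L d)) ≈⟨ +-congˡ (∑-cong (suc D) λ d _ → step d) ⟩
      x ^ k * 1# + ∑ (suc D) (λ d → x ^ k * (part d * h (suc d))) ≈⟨ sym (trans (distribˡ _ _ _) (+-congˡ (*-∑ (suc D) (x ^ k)))) ⟩
      x ^ k * (1# + ∑ (suc D) (λ d → part d * h (suc d))) ≈⟨ *-congˡ (sym (h-recurrence (suc D))) ⟩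
      x ^ k * h (suc D) ∎
      where
      reorder : ∀ d y → x ^ k * (part d * y) ≈ z * (x ^ (k ℕ.+ suc (d ℕ.+ d)) * y)
      reorder d y = trans (solve 4 (λ a z b y → a :* (z :* b :* y) := z :* (a :* b :* y)) refl (x ^ k) z (x ^ suc (d ℕ.+ d)) y)
        (*-congˡ (*-congʳ (sym (^-homo-* x k (suc (d ℕ.+ d))))))
      step : ∀ d → x ^ k * (part d * H L d) ≈ x ^ k * (part d * h (suc d))
      step d = trans (reorder d (H L d)) (trans (*-congˡ (H≈h L (k ℕ.+ suc (d ℕ.+ d)) d bound)) (sym (reorder d (h (suc d)))))
        where
        bound : M ℕ.≤ suc (k ℕ.+ suc (d ℕ.+ d) ℕ.+ L)
        bound = ℕₚ.≤-trans M≤ (s≤s (ℕₚ.≤-trans (ℕₚ.+-monoʳ-≤ k (s≤s (ℕₚ.m≤n+m L (d ℕ.+ d)))) (ℕₚ.≤-reflexive (≡.sym (ℕₚ.+-assoc k (suc (d ℕ.+ d)) L)))))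

-- The rank generating function at an eighth root of unity.

rank-exponent : ∀ D → 2 ℕ.* D ℕ.* D ℕ.+ 2 ℕ.* D ℕ.+ 1 ≡ suc (2 ℕ.* (D ℕ.* suc D))
rank-exponent = solve 1 (λ D → con 2 :* D :* D :+ con 2 :* D :+ con 1 := con 1 :+ con 2 :* (D :* (con 1 :+ D))) ≡.refl
  where open +-*-Solver

-- The extension enters only through ζω = 1 and (ζ + ω)² = 2, that is, with τ = ζ + ω as a square
-- root of 2. Its coordinates stay out of the computation.
module RankSeries (R K : CommutativeRing 0ℓ 0ℓ) (emb : CommutativeRing.Carrier R → CommutativeRing.Carrier K) (emb-isHom : IsHom R K emb)
  (ζ ω : CommutativeRing.Carrier K) (ζω≈1 : CommutativeRing._≈_ K (CommutativeRing._*_ K ζ ω) (CommutativeRing.1# K))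
  ([ζ+ω]²≈2 : CommutativeRing._≈_ K (CommutativeRing._*_ K (CommutativeRing._+_ K ζ ω) (CommutativeRing._+_ K ζ ω)) (CommutativeRing._+_ K (CommutativeRing.1# K) (CommutativeRing.1# K)))
  (M : ℕ) (x : CommutativeRing.Carrier R) (x^M≈0 : Vanishes R M x) where
  private
    module R = CommutativeRing R
    module RB = FiniteSums R
    module RG = Geometric R M
    module RT = ThetaProducts R M
    module RS = LambertSums R M
    module RE where
      open import Algebra.Properties.Semiring.Exp R.semiring public
    open RE using () renaming (_^_ to _^ᴿ_)
  open CommutativeRing K
  open IntegerSolver K
  open FiniteSums K
  open IsHom emb-isHom
  open Homomorphism emb-isHom
  open import Algebra.Properties.Semiring.Exp semiring
  open import Relation.Binary.Reasoning.Setoid setoid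

  √2 X : Carrier
  √2 = ζ + ω
  X  = emb x

  X-nil : Vanishes K M X
  X-nil = trans (sym (h-^ x M)) (trans (h-cong x^M≈0) h-0)

  open Nilpotent K M X X-nil using (Label; σ; geo; geo-cong; geo-inverse; c*x^-nil)
  open Families K M X X-nil
  module Hζ = Rows K M X X-nil ζ
  module Hω = Rows K M X X-nil ω

  private
    z : ℕ → Carrier
    z e = √2 * X ^ e

    z-geo : ∀ k e → 1 ℕ.≤ e → z (k ℕ.+ e) ≈ X ^ k * z e
    z-geo k e _ = trans (*-congˡ (^-homo-* X k e)) (solve 3 (λ s a b → s :* (a :* b) := a :* (s :* b)) refl √2 (X ^ k) (X ^ e))

    f : Label → Carrier
    f (s , e) = geo (σ s * ζ * X ^ e) * geo (σ s * ω * X ^ e)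

    f-inverse : ∀ l → 1 ℕ.≤ proj₂ l → Spectral.L z 1 z-geo l * f l ≈ 1#
    f-inverse (s , e) 1≤e = trans (*-congʳ (begin
      1# + σ s * a * (σ s * a) - σ s * ((ζ + ω) * a)
        ≈⟨ solve 4 (λ s a z w → :1 :+ s :* a :* (s :* a) :- s :* ((z :+ w) :* a) := (:1 :- s :* z :* a) :* (:1 :- s :* w :* a) :+ s :* a :* (s :* a) :* (:1 :- z :* w)) refl (σ s) a ζ ω ⟩
      (1# - σ s * ζ * a) * (1# - σ s * ω * a) + σ s * a * (σ s * a) * (1# - ζ * ω)
        ≈⟨ +-congˡ (*-congˡ (+-congˡ (-‿cong ζω≈1))) ⟩
      (1# - σ s * ζ * a) * (1# - σ s * ω * a) + σ s * a * (σ s * a) * (1# - 1#)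
        ≈⟨ solve 2 (λ p q → p :+ q :* (:1 :- :1) := p) refl _ _ ⟩
      (1# - σ s * ζ * a) * (1# - σ s * ω * a) ∎))
      (inverse-* (geo-inverse (c*x^-nil (σ s * ζ) 1≤e)) (geo-inverse (c*x^-nil (σ s * ω) 1≤e)))
      where a = X ^ e

    module B = Bailey z z-geo f
    open Family Sign.+ 2 1 1 (s≤s z≤n) ≡.refl using (lab)

    f-lab : ∀ j → f (lab j) ≈ geo (Hζ.part j) * geo (Hω.part j)
    f-lab j = *-cong (geo-cong (*-cong (*-identityˡ ζ) (^-congʳ X (eq j)))) (geo-cong (*-cong (*-identityˡ ω) (^-congʳ X (eq j))))
      where
      eq : ∀ j → 2 ℕ.* j ℕ.+ 1 ≡ suc (j ℕ.+ j)
      eq j = ≡.trans (ℕₚ.+-comm (2 ℕ.* j) 1) (≡.cong (λ k → suc (j ℕ.+ k)) (ℕₚ.+-identityʳ j))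

  Gen : Carrier
  Gen = ∑ M (λ D → X ^ (2 ℕ.* D ℕ.* D ℕ.+ 2 ℕ.* D ℕ.+ 1) * (Hζ.h (suc D) * Hω.h (suc D)))

  private
    Q = X ^ 2

    Gen≈ : Gen ≈ X * ∑ M (λ D → Q ^ (D ℕ.* suc D) * ∏ (suc D) (λ j → f (lab j)))
    Gen≈ = trans (∑-cong M λ D _ → trans (*-cong (trans (^-congʳ X (rank-exponent D)) (*-congˡ (sym (^-assocʳ X 2 (D ℕ.* suc D)))))
        (trans (sym (∏-* (suc D))) (∏-cong (suc D) λ j _ → sym (f-lab j)))) (*-assoc _ _ _))
      (sym (*-∑ M X))

    g : ℕ → Carrier
    g i = emb (RG.geo (R.- (((x ^ᴿ 2) ^ᴿ 2) ^ᴿ (i ℕ.+ i ℕ.+ 1))))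

    Y : ℕ → Carrier
    Y i = X ^ (i ℕ.+ i ℕ.+ 1)

    emb-Q^ : ∀ k → emb ((x ^ᴿ 2) ^ᴿ k) ≈ Q ^ k
    emb-Q^ k = trans (h-^ (x ^ᴿ 2) k) (^-congˡ k (h-^ x 2))

    Q^odd : ∀ i → Q ^ (i ℕ.+ i ℕ.+ 1) ≈ Y i * Y i
    Q^odd i = trans (ThetaProducts.sq-^ K M X (i ℕ.+ i ℕ.+ 1)) (^-homo-* X (i ℕ.+ i ℕ.+ 1) (i ℕ.+ i ℕ.+ 1))

    QQ^odd : ∀ i → emb (((x ^ᴿ 2) ^ᴿ 2) ^ᴿ (i ℕ.+ i ℕ.+ 1)) ≈ Q ^ (i ℕ.+ i ℕ.+ 1) * Q ^ (i ℕ.+ i ℕ.+ 1)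
    QQ^odd i = trans (h-^ ((x ^ᴿ 2) ^ᴿ 2) (i ℕ.+ i ℕ.+ 1)) (trans (^-congˡ (i ℕ.+ i ℕ.+ 1) (emb-Q^ 2))
      (trans (ThetaProducts.sq-^ K M Q (i ℕ.+ i ℕ.+ 1)) (^-homo-* Q (i ℕ.+ i ℕ.+ 1) (i ℕ.+ i ℕ.+ 1))))

    g-inverse : ∀ i → (1# + Q ^ (i ℕ.+ i ℕ.+ 1) * Q ^ (i ℕ.+ i ℕ.+ 1)) * g i ≈ 1#
    g-inverse i = trans (*-congʳ (sym image)) (trans (sym (h-* _ _)) (trans (h-cong unit) h-1))
      where
      u = ((x ^ᴿ 2) ^ᴿ 2) ^ᴿ (i ℕ.+ i ℕ.+ 1)
      image : emb (R.1# R.- (R.- u)) ≈ 1# + Q ^ (i ℕ.+ i ℕ.+ 1) * Q ^ (i ℕ.+ i ℕ.+ 1)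
      image = trans (h-1- (R.- u)) (+-congˡ (trans (-‿cong (h-neg u)) (trans (solve 1 (λ a → :- (:- a) := a) refl (emb u)) (QQ^odd i))))
      unit : (R.1# R.- (R.- u)) R.* RG.geo (R.- u) R.≈ R.1#
      unit = RG.geo-inverse (R.trans (RE.^-congˡ M (R.sym (-1*x≈-x u))) nil)
        where
        open import Algebra.Properties.Ring R.ring using (-1*x≈-x)
        nil : (R.- R.1# R.* u) ^ᴿ M R.≈ R.0#
        nil = Nilpotent.c*x^-nil R M ((x ^ᴿ 2) ^ᴿ 2) (RT.x²-nil (x ^ᴿ 2) (RT.x²-nil x x^M≈0)) (R.- R.1#) (ℕₚ.m≤n+m 1 (i ℕ.+ i))

    -- (1 + y² − √2 y) (1 + y² + √2 y) = 1 + y⁴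
    f≈ : ∀ i → f (lab i) ≈ (1# + Y i * Y i + √2 * Y i) * g i
    f≈ i = inverse-unique (f-inverse (lab i) (ℕₚ.m≤n+m 1 (2 ℕ.* i))) (begin
      (1# + 1# * X ^ (2 ℕ.* i ℕ.+ 1) * (1# * X ^ (2 ℕ.* i ℕ.+ 1)) - 1# * (√2 * X ^ (2 ℕ.* i ℕ.+ 1))) * ((1# + y * y + √2 * y) * g i)
        ≈⟨ *-congʳ (trans (+-cong (+-congˡ (*-cong (*-identityˡ _) (*-identityˡ _))) (-‿cong (*-identityˡ _)))
             (reflexive (≡.cong (λ k → 1# + X ^ k * X ^ k - √2 * X ^ k) (lab-A i)))) ⟩
      (1# + y * y - √2 * y) * ((1# + y * y + √2 * y) * g i)
        ≈⟨ solve 3 (λ y t g → (:1 :+ y :* y :- t :* y) :* ((:1 :+ y :* y :+ t :* y) :* g)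
             := ((:1 :+ y :* y) :* (:1 :+ y :* y) :- t :* t :* (y :* y)) :* g) refl y √2 (g i) ⟩
      ((1# + y * y) * (1# + y * y) - √2 * √2 * (y * y)) * g i ≈⟨ *-congʳ (+-congˡ (-‿cong (*-congʳ [ζ+ω]²≈2))) ⟩
      ((1# + y * y) * (1# + y * y) - (1# + 1#) * (y * y)) * g i
        ≈⟨ *-congʳ (trans (solve 1 (λ y → (:1 :+ y) :* (:1 :+ y) :- (:1 :+ :1) :* y := :1 :+ y :* y) refl (y * y)) (+-congˡ (*-cong (sym (Q^odd i)) (sym (Q^odd i))))) ⟩
      (1# + Q ^ (i ℕ.+ i ℕ.+ 1) * Q ^ (i ℕ.+ i ℕ.+ 1)) * g i ≈⟨ g-inverse i ⟩
      1# ∎)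
      where y = Y i

    emb-1-Q : ∀ k → emb (R.1# R.- ((x ^ᴿ 2) ^ᴿ k)) ≈ 1# - Q ^ k
    emb-1-Q k = trans (h-1- _) (+-congˡ (-‿cong (emb-Q^ k)))

    emb-pinf : emb (RT.pinf (x ^ᴿ 2)) ≈ ∏ M (λ j → 1# - Q ^ suc j)
    emb-pinf = trans (h-∏ M _) (∏-cong M λ j _ → emb-1-Q (suc j))

    A C : ℕ → Carrier
    A i = sg i * Q ^ e₃ i * (1# - Q ^ (i ℕ.+ i ℕ.+ 1) * Q ^ (i ℕ.+ i ℕ.+ 1)) * g i
    C i = sg i * Q ^ (i ℕ.* suc i ℕ.+ tri (suc i)) * (1# - Q ^ (i ℕ.+ i ℕ.+ 1)) * g i

    emb-SA : emb (RS.SA (x ^ᴿ 2)) ≈ ∑ M A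
    emb-SA = trans (h-∑ M _) (∑-cong M λ i _ → trans (h-* _ _) (*-congʳ (trans (h-* _ _) (*-cong (trans (h-* _ _) (*-cong (h-sg i) (emb-Q^ (e₃ i))))
      (trans (h-1- _) (+-congˡ (-‿cong (QQ^odd i))))))))

    emb-SC : emb (RS.SC (x ^ᴿ 2)) ≈ ∑ M C
    emb-SC = trans (h-∑ M _) (∑-cong M λ i _ → trans (h-* _ _) (*-congʳ (trans (h-* _ _) (*-cong (trans (h-* _ _) (*-cong (h-sg i) (emb-Q^ (i ℕ.* suc i ℕ.+ tri (suc i)))))
      (emb-1-Q (i ℕ.+ i ℕ.+ 1))))))

    -- With q = y², the part free of √2 completes (1 - q)(1 + q) to 1 - q². In the other part the
    -- odd power y of X meets the leading X, and X y = Q^(i+1) turns it into a power of Q.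
    term : ∀ i → X * (sg i * Q ^ e₃ i * (1# - Q ^ (i ℕ.+ i ℕ.+ 1)) * f (lab i)) ≈ X * A i + √2 * C i
    term i = begin
      X * (sg i * Q ^ e₃ i * (1# - q) * f (lab i)) ≈⟨ *-congˡ (*-congˡ (f≈ i)) ⟩
      X * (sg i * Q ^ e₃ i * (1# - q) * ((1# + y * y + √2 * y) * g i)) ≈⟨ *-congˡ (*-congˡ (*-congʳ (+-congʳ (+-congˡ (sym (Q^odd i)))))) ⟩
      X * (sg i * Q ^ e₃ i * (1# - q) * ((1# + q + √2 * y) * g i))
        ≈⟨ solve 7 (λ x s e q t y g → x :* (s :* e :* (:1 :- q) :* ((:1 :+ q :+ t :* y) :* g))
             := x :* (s :* e :* (:1 :- q :* q) :* g) :+ t :* (s :* (e :* (x :* y)) :* (:1 :- q) :* g)) refl X (sg i) (Q ^ e₃ i) q √2 y (g i) ⟩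
      X * A i + √2 * (sg i * (Q ^ e₃ i * (X * y)) * (1# - q) * g i)
        ≈⟨ +-congˡ (*-congˡ (*-congʳ (*-congʳ (*-congˡ (trans (*-congˡ Xy) (trans (sym (^-homo-* Q (e₃ i) (suc i))) (^-congʳ Q (exponent (tri i) i)))))))) ⟩
      X * A i + √2 * C i ∎
      where
      q = Q ^ (i ℕ.+ i ℕ.+ 1)
      y = Y i
      Xy : X * X ^ (i ℕ.+ i ℕ.+ 1) ≈ Q ^ suc i
      Xy = trans (^-congʳ X (≡.trans (≡.cong suc (ℕₚ.+-comm (i ℕ.+ i) 1)) (≡.cong suc (≡.sym (ℕₚ.+-suc i i))))) (sym (ThetaProducts.sq-^ K M X (suc i)))
      exponent : ∀ t i → t ℕ.+ i ℕ.* suc i ℕ.+ suc i ≡ i ℕ.* suc i ℕ.+ (t ℕ.+ suc i)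
      exponent t i = ≡.trans (≡.cong (ℕ._+ suc i) (ℕₚ.+-comm t _)) (ℕₚ.+-assoc (i ℕ.* suc i) t (suc i))

  rank-series : emb (RT.pinf (x ^ᴿ 2)) * Gen ≈ emb (x R.* RS.SA (x ^ᴿ 2)) + √2 * emb (RS.SC (x ^ᴿ 2))
  rank-series = begin
    emb (RT.pinf (x ^ᴿ 2)) * Gen ≈⟨ *-cong emb-pinf Gen≈ ⟩
    ∏ M (λ j → 1# - Q ^ suc j) * (X * ∑ M (λ D → Q ^ (D ℕ.* suc D) * ∏ (suc D) (λ j → f (lab j))))
      ≈⟨ solve 3 (λ p x s → p :* (x :* s) := x :* (p :* s)) refl _ X _ ⟩
    X * (∏ M (λ j → 1# - Q ^ suc j) * ∑ M (λ D → Q ^ (D ℕ.* suc D) * ∏ (suc D) (λ j → f (lab j))))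
      ≈⟨ *-congˡ (B.bailey f-inverse ℕₚ.≤-refl) ⟩
    X * ∑ M (λ i → sg i * Q ^ e₃ i * (1# - Q ^ (i ℕ.+ i ℕ.+ 1)) * f (lab i)) ≈⟨ trans (*-∑ M X) (∑-cong M λ i _ → term i) ⟩
    ∑ M (λ i → X * A i + √2 * C i) ≈⟨ trans (∑-+ M) (+-cong (sym (*-∑ M X)) (sym (*-∑ M √2))) ⟩
    X * ∑ M A + √2 * ∑ M C ≈⟨ +-cong (sym (trans (h-* _ _) (*-congˡ emb-SA))) (*-congˡ (sym emb-SC)) ⟩
    emb (x R.* RS.SA (x ^ᴿ 2)) + √2 * emb (RS.SC (x ^ᴿ 2)) ∎

  module _ (n : ℕ) (M≡1+n : M ≡ suc n) where
    open PartialFractions K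
    open ListSums K

    symbol : ℕ → List ℕ → List ℕ → Carrier
    symbol D a b = X ^ (2 ℕ.* D ℕ.* D ℕ.+ 2 ℕ.* D ℕ.+ 1) * (Hζ.weight D a * Hω.weight D b)

    private
      AL = allLists n n

      M≤ : M ℕ.≤ suc n
      M≤ = ℕₚ.≤-reflexive M≡1+n

      ζ-rows : ∀ D → ∑L (Hζ.weight D) AL ≈ Hζ.h (suc D)
      ζ-rows D = trans (sym (*-identityˡ _)) (trans (Hζ.H≈h n M≤ n 0 D M≤) (*-identityˡ _))

      ω-rows : ∀ D → ∑L (Hω.weight D) AL ≈ Hω.h (suc D)
      ω-rows D = trans (sym (*-identityˡ _)) (trans (Hω.H≈h n M≤ n 0 D M≤) (*-identityˡ _))

    -- For M = n + 1 the restriction of `allLists n n` to length and entries at most n is invisible: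
    -- longer rows and larger entries have degree at least M.
    Gen-symbols : ∑L (λ D → ∑L (λ a → ∑L (symbol D a) AL) AL) (upTo (suc n)) ≈ Gen
    Gen-symbols = begin
      ∑L (λ D → ∑L (λ a → ∑L (symbol D a) AL) AL) (upTo (suc n))
        ≈⟨ ∑L-ext (upTo (suc n)) (λ D → trans (∑L-ext AL λ a → trans (sym (*-∑L (e D) (λ b → Hζ.weight D a * Hω.weight D b) AL))
             (*-congˡ (trans (sym (*-∑L (Hζ.weight D a) (Hω.weight D) AL)) (trans (*-comm _ _) (*-congʳ (ω-rows D))))))
             (trans (sym (*-∑L (e D) (λ a → Hω.h (suc D) * Hζ.weight D a) AL)) (*-congˡ (trans (sym (*-∑L (Hω.h (suc D)) (Hζ.weight D) AL)) (trans (*-comm _ _) (*-congʳ (ζ-rows D))))))) ⟩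
      ∑L (λ D → e D * (Hζ.h (suc D) * Hω.h (suc D))) (upTo (suc n)) ≈⟨ ∑L-upTo (λ D → e D * (Hζ.h (suc D) * Hω.h (suc D))) (suc n) ⟩
      ∑ (suc n) (λ D → e D * (Hζ.h (suc D) * Hω.h (suc D))) ≡⟨ ≡.cong (λ m → ∑ m (λ D → e D * (Hζ.h (suc D) * Hω.h (suc D)))) (≡.sym M≡1+n) ⟩
      Gen ∎
      where
      e : ℕ → Carrier
      e D = X ^ (2 ℕ.* D ℕ.* D ℕ.+ 2 ℕ.* D ℕ.+ 1)

    symbol-valid : ∀ D a b → validRow D a ≡ true → validRow D b ≡ true →
      symbol D a b ≈ ζ ^ length a * ω ^ length b * emb (x ^ᴿ (sum a ℕ.+ sum b ℕ.+ 2 ℕ.* D ℕ.* D ℕ.+ 2 ℕ.* D ℕ.+ 1))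
    symbol-valid D a b va vb rewrite va | vb = begin
      X ^ e * (ζ ^ length a * X ^ sum a * (ω ^ length b * X ^ sum b))
        ≈⟨ solve 5 (λ e z s w t → e :* (z :* s :* (w :* t)) := z :* w :* (s :* t :* e)) refl (X ^ e) (ζ ^ length a) (X ^ sum a) (ω ^ length b) (X ^ sum b) ⟩
      ζ ^ length a * ω ^ length b * (X ^ sum a * X ^ sum b * X ^ e)
        ≈⟨ *-congˡ (trans (*-congʳ (sym (^-homo-* X (sum a) (sum b)))) (trans (sym (^-homo-* X (sum a ℕ.+ sum b) e)) (trans (^-congʳ X (eq (sum a ℕ.+ sum b) D)) (sym (h-^ x (sum a ℕ.+ sum b ℕ.+ 2 ℕ.* D ℕ.* D ℕ.+ 2 ℕ.* D ℕ.+ 1)))))) ⟩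
      ζ ^ length a * ω ^ length b * emb (x ^ᴿ (sum a ℕ.+ sum b ℕ.+ 2 ℕ.* D ℕ.* D ℕ.+ 2 ℕ.* D ℕ.+ 1)) ∎
      where
      e = 2 ℕ.* D ℕ.* D ℕ.+ 2 ℕ.* D ℕ.+ 1
      eq : ∀ s D → s ℕ.+ (2 ℕ.* D ℕ.* D ℕ.+ 2 ℕ.* D ℕ.+ 1) ≡ s ℕ.+ 2 ℕ.* D ℕ.* D ℕ.+ 2 ℕ.* D ℕ.+ 1
      eq s D = ≡.trans (≡.sym (ℕₚ.+-assoc s (2 ℕ.* D ℕ.* D ℕ.+ 2 ℕ.* D) 1)) (≡.cong (ℕ._+ 1) (≡.sym (ℕₚ.+-assoc s (2 ℕ.* D ℕ.* D) (2 ℕ.* D))))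

    symbol-invalidˡ : ∀ D a b → validRow D a ≡ false → symbol D a b ≈ 0#
    symbol-invalidˡ D a b va rewrite va = solve 2 (λ e w → e :* (:0 :* w) := :0) refl _ (Hω.weight D b)

    symbol-invalidʳ : ∀ D a b → validRow D b ≡ false → symbol D a b ≈ 0#
    symbol-invalidʳ D a b vb rewrite vb = solve 2 (λ e w → e :* (w :* :0) := :0) refl _ (Hζ.weight D a)

-- Ranks modulo 8 and the counting of symbols.

residue-unique : ∀ p q v → p ℕ.< 8 → q ℕ.< 8 → + p ℤ.- + q ≡ v ℤ.* + 8 → p ≡ q
residue-unique p q v p<8 q<8 e = go v (≡.trans (lemma (+ p) (+ q)) (≡.cong (ℤ._+ + q) e))
  where
  open ℤSolver.+-*-Solver
  lemma : ∀ p q → p ≡ p ℤ.- q ℤ.+ q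
  lemma = solve 2 (λ p q → p := p :- q :+ q) ≡.refl
  large : ∀ {a b} w → a ≡ suc w ℕ.* 8 ℕ.+ b → ¬ (a ℕ.< 8)
  large {b = b} w e a<8 = ℕₚ.<⇒≱ a<8 (ℕₚ.≤-trans (ℕₚ.m≤m+n 8 _) (ℕₚ.≤-trans (ℕₚ.m≤m+n (suc w ℕ.* 8) b) (ℕₚ.≤-reflexive (≡.sym e))))
  go : ∀ v → + p ≡ v ℤ.* + 8 ℤ.+ + q → p ≡ q
  go (+ zero)  e = ℤₚ.+-injective e
  go (+ suc w) e = ⊥-elim (large w (ℤₚ.+-injective e) p<8)
  go -[1+ w ]  e = ⊥-elim (large w (ℤₚ.+-injective (≡.trans (≡.trans (lemma′ (+ q) -[1+ w ]) (≡.cong (ℤ._+ + (suc w ℕ.* 8)) (≡.sym e))) (ℤₚ.+-comm (+ p) (+ (suc w ℕ.* 8))))) q<8)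
    where
    lemma′ : ∀ q v → q ≡ v ℤ.* + 8 ℤ.+ q ℤ.+ (ℤ.- v) ℤ.* + 8
    lemma′ = solve 2 (λ q v → q := v :* con (+ 8) :+ q :+ (:- v) :* con (+ 8)) ≡.refl

-- The factor 7 stands for -1 modulo 8 and keeps the residue of the rank in ℕ. It matches ω = ζ⁷, so
-- that ζ^l ω^l′ is ζ to this power.
rank-residue : ℕ → ℕ → ℕ
rank-residue l l′ = (l ℕ.+ 7 ℕ.* l′) % 8

rank-residue<8 : ∀ l l′ → rank-residue l l′ ℕ.< 8
rank-residue<8 l l′ = m%n<n (l ℕ.+ 7 ℕ.* l′) 8

private
  bool-ext : ∀ {a b} → (a ≡ true → b ≡ true) → (b ≡ true → a ≡ true) → a ≡ b
  bool-ext {true}  {b}     f g = ≡.sym (f ≡.refl)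
  bool-ext {false} {false} f g = ≡.refl
  bool-ext {false} {true}  f g = g ≡.refl

  ≡ᵇ-true : ∀ {m n} → m ≡ n → (m ≡ᵇ n) ≡ true
  ≡ᵇ-true {m} {n} e = Equivalence.to T-≡ (ℕₚ.≡⇒≡ᵇ m n e)

  true-≡ᵇ : ∀ {m n} → (m ≡ᵇ n) ≡ true → m ≡ n
  true-≡ᵇ {m} {n} e = ℕₚ.≡ᵇ⇒≡ m n (Equivalence.from T-≡ e)

  residue-split : ∀ l l′ → + l ℤ.- + l′ ≡ + rank-residue l l′ ℤ.+ (+ ((l ℕ.+ 7 ℕ.* l′) / 8) ℤ.- + l′) ℤ.* + 8
  residue-split l l′ = begin
    + l ℤ.- + l′ ≡⟨ lemma (+ l) (+ l′) ⟩
    + l ℤ.+ + 7 ℤ.* + l′ ℤ.- + l′ ℤ.* + 8 ≡⟨ ≡.cong (λ z → + l ℤ.+ z ℤ.- + l′ ℤ.* + 8) (≡.sym (ℤₚ.pos-* 7 l′)) ⟩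
    + k ℤ.- + l′ ℤ.* + 8 ≡⟨ ≡.cong (λ z → + z ℤ.- + l′ ℤ.* + 8) (m≡m%n+[m/n]*n k 8) ⟩
    + (k % 8) ℤ.+ + (k / 8 ℕ.* 8) ℤ.- + l′ ℤ.* + 8 ≡⟨ ≡.cong (λ z → + (k % 8) ℤ.+ z ℤ.- + l′ ℤ.* + 8) (ℤₚ.pos-* (k / 8) 8) ⟩
    + (k % 8) ℤ.+ + (k / 8) ℤ.* + 8 ℤ.- + l′ ℤ.* + 8 ≡⟨ lemma′ (+ (k % 8)) (+ (k / 8)) (+ l′) ⟩
    + (k % 8) ℤ.+ (+ (k / 8) ℤ.- + l′) ℤ.* + 8 ∎
    where
    open ≡.≡-Reasoning
    k = l ℕ.+ 7 ℕ.* l′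
    open ℤSolver.+-*-Solver
    lemma : ∀ a b → a ℤ.- b ≡ a ℤ.+ + 7 ℤ.* b ℤ.- b ℤ.* + 8
    lemma = solve 2 (λ a b → a :- b := a :+ con (+ 7) :* b :- b :* con (+ 8)) ≡.refl
    lemma′ : ∀ r t b → r ℤ.+ t ℤ.* + 8 ℤ.- b ℤ.* + 8 ≡ r ℤ.+ (t ℤ.- b) ℤ.* + 8
    lemma′ = solve 3 (λ r t b → r :+ t :* con (+ 8) :- b :* con (+ 8) := r :+ (t :- b) :* con (+ 8)) ≡.refl

-- Two representations of the same integer modulo 8 are compared. All remainders involved are below
-- 8, so `residue-unique` decides.
rank-test : ∀ l l′ a → a ℕ.< 8 → (((+ l ℤ.- + l′) ℤ.- + a) %ℕ 8 ≡ᵇ 0) ≡ (rank-residue l l′ ≡ᵇ a)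
rank-test l l′ a a<8 = bool-ext forwards backwards
  where
  open ℤSolver.+-*-Solver
  i = (+ l ℤ.- + l′) ℤ.- + a
  m = i %ℕ 8
  q = i /ℕ 8
  r = rank-residue l l′
  t = + ((l ℕ.+ 7 ℕ.* l′) / 8) ℤ.- + l′
  two-ways : + m ℤ.+ q ℤ.* + 8 ≡ + r ℤ.+ t ℤ.* + 8 ℤ.- + a
  two-ways = ≡.trans (≡.sym (a≡a%ℕn+[a/ℕn]*n i 8)) (≡.cong (ℤ._- + a) (residue-split l l′))
  forwards : (m ≡ᵇ 0) ≡ true → (r ≡ᵇ a) ≡ true
  forwards e = ≡ᵇ-true (residue-unique r a (q ℤ.- t) (rank-residue<8 l l′) a<8 (begin
    + r ℤ.- + a ≡⟨ solve 3 (λ r a t → r :- a := r :+ t :* con (+ 8) :- a :- t :* con (+ 8)) ≡.refl (+ r) (+ a) t ⟩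
    + r ℤ.+ t ℤ.* + 8 ℤ.- + a ℤ.- t ℤ.* + 8 ≡⟨ ≡.cong (ℤ._- t ℤ.* + 8) (≡.sym two-ways) ⟩
    + m ℤ.+ q ℤ.* + 8 ℤ.- t ℤ.* + 8 ≡⟨ ≡.cong (λ m → + m ℤ.+ q ℤ.* + 8 ℤ.- t ℤ.* + 8) (true-≡ᵇ {m} {0} e) ⟩
    + 0 ℤ.+ q ℤ.* + 8 ℤ.- t ℤ.* + 8 ≡⟨ solve 2 (λ q t → con (+ 0) :+ q :* con (+ 8) :- t :* con (+ 8) := (q :- t) :* con (+ 8)) ≡.refl q t ⟩
    (q ℤ.- t) ℤ.* + 8 ∎))
    where open ≡.≡-Reasoning
  backwards : (r ≡ᵇ a) ≡ true → (m ≡ᵇ 0) ≡ true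
  backwards e = ≡ᵇ-true (residue-unique m 0 (t ℤ.- q) (n%ℕd<d i 8) (s≤s z≤n) (begin
    + m ℤ.- + 0 ≡⟨ solve 2 (λ m q → m :- con (+ 0) := m :+ q :* con (+ 8) :- q :* con (+ 8)) ≡.refl (+ m) q ⟩
    + m ℤ.+ q ℤ.* + 8 ℤ.- q ℤ.* + 8 ≡⟨ ≡.cong (ℤ._- q ℤ.* + 8) two-ways ⟩
    + r ℤ.+ t ℤ.* + 8 ℤ.- + a ℤ.- q ℤ.* + 8 ≡⟨ ≡.cong (λ r → + r ℤ.+ t ℤ.* + 8 ℤ.- + a ℤ.- q ℤ.* + 8) (true-≡ᵇ {r} {a} e) ⟩
    + a ℤ.+ t ℤ.* + 8 ℤ.- + a ℤ.- q ℤ.* + 8 ≡⟨ solve 3 (λ a t q → a :+ t :* con (+ 8) :- a :- q :* con (+ 8) := (t :- q) :* con (+ 8)) ≡.refl (+ a) t q ⟩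
    (t ℤ.- q) ℤ.* + 8 ∎))
    where open ≡.≡-Reasoning

-- Exchanging the rows negates the rank, so the two residues add up to a multiple of 8, as do 5 and
-- 3.
rank-swap : ∀ l l′ → (rank-residue l l′ ≡ᵇ 5) ≡ (rank-residue l′ l ≡ᵇ 3)
rank-swap l l′ = bool-ext
  (λ e → ≡ᵇ-true (residue-unique r′ 3 (v ℤ.- + 1) (rank-residue<8 l′ l) (s≤s (s≤s (s≤s (s≤s z≤n)))) (from r r′ 5 3 (+ 1) ≡.refl (true-≡ᵇ {r} {5} e) total)))
  (λ e → ≡ᵇ-true (residue-unique r 5 (v ℤ.- + 1) (rank-residue<8 l l′) (s≤s (s≤s (s≤s (s≤s (s≤s (s≤s z≤n)))))) (from r′ r 3 5 (+ 1) ≡.refl (true-≡ᵇ {r′} {3} e) (≡.trans (ℤₚ.+-comm (+ r′) (+ r)) total))))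
  where
  open ℤSolver.+-*-Solver
  r  = rank-residue l l′
  r′ = rank-residue l′ l
  t t′ v : ℤ
  t  = + ((l ℕ.+ 7 ℕ.* l′) / 8) ℤ.- + l′
  t′ = + ((l′ ℕ.+ 7 ℕ.* l) / 8) ℤ.- + l
  v  = ℤ.- (t ℤ.+ t′)
  total : + r ℤ.+ + r′ ≡ v ℤ.* + 8
  total = begin
    + r ℤ.+ + r′ ≡⟨ solve 4 (λ r r′ t t′ → r :+ r′ := (r :+ t :* con (+ 8)) :+ (r′ :+ t′ :* con (+ 8)) :+ (:- (t :+ t′)) :* con (+ 8)) ≡.refl (+ r) (+ r′) t t′ ⟩
    (+ r ℤ.+ t ℤ.* + 8) ℤ.+ (+ r′ ℤ.+ t′ ℤ.* + 8) ℤ.+ v ℤ.* + 8 ≡⟨ ≡.cong₂ (λ a b → a ℤ.+ b ℤ.+ v ℤ.* + 8) (≡.sym (residue-split l l′)) (≡.sym (residue-split l′ l)) ⟩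
    (+ l ℤ.- + l′) ℤ.+ (+ l′ ℤ.- + l) ℤ.+ v ℤ.* + 8 ≡⟨ solve 3 (λ a b v → (a :- b) :+ (b :- a) :+ v := v) ≡.refl (+ l) (+ l′) (v ℤ.* + 8) ⟩
    v ℤ.* + 8 ∎
    where open ≡.≡-Reasoning
  from : ∀ r r′ c c′ d → + c ℤ.+ + c′ ≡ d ℤ.* + 8 → r ≡ c → + r ℤ.+ + r′ ≡ v ℤ.* + 8 → + r′ ℤ.- + c′ ≡ (v ℤ.- d) ℤ.* + 8
  from r r′ c c′ d cc ≡.refl e = begin
    + r′ ℤ.- + c′ ≡⟨ solve 3 (λ r r′ c → r′ :- c := (r :+ r′) :- (r :+ c)) ≡.refl (+ r) (+ r′) (+ c′) ⟩
    (+ r ℤ.+ + r′) ℤ.- (+ r ℤ.+ + c′) ≡⟨ ≡.cong₂ ℤ._-_ e cc ⟩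
    v ℤ.* + 8 ℤ.- d ℤ.* + 8 ≡⟨ solve 2 (λ v d → v :* con (+ 8) :- d :* con (+ 8) := (v :- d) :* con (+ 8)) ≡.refl v d ⟩
    (v ℤ.- d) ℤ.* + 8 ∎
    where open ≡.≡-Reasoning

[_] : Bool → ℤ
[ true ]  = ℤ.1ℤ
[ false ] = ℤ.0ℤ

ℤ-ring : CommutativeRing 0ℓ 0ℓ
ℤ-ring = ℤₚ.+-*-commutativeRing

open PartialFractions ℤ-ring using () renaming (∑L to ∑ℤ)
private
  module ℤL = ListSums ℤ-ring

length-filter : ∀ {A : Set} (p q : A → Bool) xs → + length (filterᵇ p (filterᵇ q xs)) ≡ ∑ℤ (λ s → [ q s ] ℤ.* [ p s ]) xs
length-filter p q []       = ≡.refl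
length-filter p q (x ∷ xs) with q x
... | false = ≡.trans (length-filter p q xs) (≡.sym (ℤₚ.+-identityˡ _))
... | true with p x
...   | false = ≡.trans (length-filter p q xs) (≡.sym (ℤₚ.+-identityˡ _))
...   | true  = ≡.cong (λ z → ℤ.1ℤ ℤ.+ z) (length-filter p q xs)

symbol-size : ℕ → List ℕ → List ℕ → ℕ
symbol-size D a b = sum a ℕ.+ sum b ℕ.+ 2 ℕ.* D ℕ.* D ℕ.+ 2 ℕ.* D ℕ.+ 1

module Counting (n : ℕ) where
  AL : List (List ℕ)
  AL = allLists n n

  ∑∑∑ : (ℕ → List ℕ → List ℕ → ℤ) → ℤ
  ∑∑∑ W = ∑ℤ (λ D → ∑ℤ (λ a → ∑ℤ (λ b → W D a b) AL) AL) (upTo (suc n))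

  ∑∑∑-ext : ∀ {W W′} → (∀ D a b → W D a b ≡ W′ D a b) → ∑∑∑ W ≡ ∑∑∑ W′
  ∑∑∑-ext e = ℤL.∑L-ext (upTo (suc n)) λ D → ℤL.∑L-ext AL λ a → ℤL.∑L-ext AL λ b → e D a b

  ∑∑∑-- : ∀ W W′ → ∑∑∑ W ℤ.- ∑∑∑ W′ ≡ ∑∑∑ (λ D a b → W D a b ℤ.- W′ D a b)
  ∑∑∑-- W W′ = ≡.trans (minus (upTo (suc n)) (λ D → ∑ℤ (λ a → ∑ℤ (W D a) AL) AL) (λ D → ∑ℤ (λ a → ∑ℤ (W′ D a) AL) AL)) (ℤL.∑L-ext (upTo (suc n)) λ D →
    ≡.trans (minus AL (λ a → ∑ℤ (W D a) AL) (λ a → ∑ℤ (W′ D a) AL)) (ℤL.∑L-ext AL λ a → minus AL (W D a) (W′ D a)))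
    where
    open ℤSolver.+-*-Solver
    minus : ∀ {I : Set} (is : List I) (F G : I → ℤ) → ∑ℤ F is ℤ.- ∑ℤ G is ≡ ∑ℤ (λ i → F i ℤ.- G i) is
    minus []       F G = ≡.refl
    minus (i ∷ is) F G = ≡.trans (solve 4 (λ a b c d → a :+ b :- (c :+ d) := a :- c :+ (b :- d)) ≡.refl (F i) (∑ℤ F is) (G i) (∑ℤ G is)) (≡.cong (λ z → F i ℤ.- G i ℤ.+ z) (minus is F G))

  ∑∑∑-swap : ∀ W → ∑∑∑ W ≡ ∑∑∑ (λ D a b → W D b a)
  ∑∑∑-swap W = ℤL.∑L-ext (upTo (suc n)) λ D → ℤL.∑L-swap (W D) AL AL

  valid : ℕ → List ℕ → List ℕ → ℤ
  valid D a b = [ isOddDurfeeSymbolOf n (D , a , b) ]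

  count : ℕ → ℤ
  count c = ∑∑∑ (λ D a b → valid D a b ℤ.* [ rank-residue (length a) (length b) ≡ᵇ c ])

  count-filtered : ∀ c → c ℕ.< 8 →
    + length (filterᵇ (λ s → ((oddRank s ℤ.- + c) %ℕ 8) ≡ᵇ 0) (oddDurfeeSymbols n)) ≡ count c
  count-filtered c c<8 = ≡.trans (length-filter test (isOddDurfeeSymbolOf n) (concatMap (λ D → concatMap (λ a → map (λ b → D , a , b) AL) AL) (upTo (suc n))))
    (≡.trans (ℤL.∑L-concatMap F (λ D → concatMap (λ a → map (λ b → D , a , b) AL) AL) (upTo (suc n))) (ℤL.∑L-ext (upTo (suc n)) λ D →
      ≡.trans (ℤL.∑L-concatMap F (λ a → map (λ b → D , a , b) AL) AL) (ℤL.∑L-ext AL λ a →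
        ≡.trans (ℤL.∑L-map F (λ b → D , a , b) AL) (ℤL.∑L-ext AL λ b →
          ≡.cong (λ t → valid D a b ℤ.* [ t ]) (rank-test (length a) (length b) c c<8)))))
    where
    test : DurfeeSymbol → Bool
    test s = ((oddRank s ℤ.- + c) %ℕ 8) ≡ᵇ 0
    F : DurfeeSymbol → ℤ
    F s = [ isOddDurfeeSymbolOf n s ] ℤ.* [ test s ]

  count-3≡5 : count 3 ≡ count 5
  count-3≡5 = ≡.trans (∑∑∑-swap (λ D a b → valid D a b ℤ.* [ rank-residue (length a) (length b) ≡ᵇ 3 ])) (∑∑∑-ext λ D a b →
    ≡.cong₂ (λ v t → [ v ] ℤ.* [ t ]) (symmetric D a b) (≡.sym (rank-swap (length a) (length b))))
    where
    symmetric : ∀ D a b → isOddDurfeeSymbolOf n (D , b , a) ≡ isOddDurfeeSymbolOf n (D , a , b)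
    symmetric D a b = ≡.trans (≡.sym (∧-assoc (validRow D b) (validRow D a) _)) (≡.trans (≡.cong₂ _∧_ (∧-comm (validRow D b) (validRow D a))
      (≡.cong (λ s → (s ℕ.+ 2 ℕ.* D ℕ.* D ℕ.+ 2 ℕ.* D ℕ.+ 1) ≡ᵇ n) (ℕₚ.+-comm (sum b) (sum a)))) (∧-assoc (validRow D a) (validRow D b) _))

N⁰≡count : ∀ n c → c ℕ.< 8 → + N⁰ (+ c) 8 n ≡ Counting.count n c
N⁰≡count zero    c c<8 = ≡.refl
N⁰≡count (suc n) c c<8 = Counting.count-filtered (suc n) c c<8

-- Assembly of the two rank identities.

module Assembly (R : CommutativeRing 0ℓ 0ℓ) (M : ℕ) (x : CommutativeRing.Carrier R) (x^M≈0 : Vanishes R M x) where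
  open CommutativeRing R
  open IntegerSolver R
  open FiniteSums R
  open ThetaProducts R M
  open LambertSums R M
  open import Algebra.Properties.Semiring.Exp semiring
  open import Relation.Binary.Reasoning.Setoid setoid

  -- `Q` is the base of the rank series. Its fourth power `p`, which is x⁸, is the base reached at w
  -- = i and also the image of q in the dilated right-hand sides.
  Q p : Carrier
  Q = x ^ 2
  p = Q ^ 4

  private
    Q-nil : Vanishes R M Q
    Q-nil = x²-nil x x^M≈0
    p-nil : Vanishes R M p
    p-nil = Families.vanishes-^ R M Q Q-nil 4 (s≤s z≤n)
    module SQ = Specialisations R M Q Q-nil
    module SP = Specialisations R M p p-nil
    p₂-unit : pinf (p ^ 2) * pinf⁻¹ (p ^ 2) (x²-nil p p-nil) ≈ 1#
    p₂-unit = pinf-inverse (p ^ 2) (x²-nil p p-nil)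

    divide : ∀ y (y-nil : Vanishes R M y) S → pinf y * (pinf⁻¹ y y-nil * S) ≈ S
    divide y y-nil S = trans (sym (*-assoc _ _ _)) (trans (*-congʳ (pinf-inverse y y-nil)) (*-identityˡ S))

  even-rank : ∀ {c F E G} → pinf Q * c ≈ x * SA Q →
    pinf p * pinf p * pinf (p ^ 4) * F ≈ pinf (p ^ 2) * pinf (p ^ 2) * pinf (p ^ 2) * pinf (p ^ 2) →
    pinf (p ^ 2) * pinf (p ^ 2) * E ≈ pinf (p ^ 4) * pinf (p ^ 4) * pinf (p ^ 4) →
    pinf (p ^ 4) * G ≈ S₂₄ p →
    c ≈ x * F + x * (Q * (E + p * G))
  even-rank {c} {F} {E} {G} hc hF hE hG = begin
    c ≈⟨ *-cancel (pinf-inverse Q Q-nil) (trans hc (trans (*-congˡ (sym ha)) (solve 3 (λ x p a → x :* (p :* a) := p :* (x :* a)) refl x (pinf Q) a))) ⟩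
    -- `rank-0` determines a + Qε as F + 2QE, while ε = E - pG by `ε-identity`. Subtracting Qε
    -- leaves a = F + Q (E + pG).
    x * a ≈⟨ *-congˡ (solve 2 (λ a e → a := a :+ e :- e) refl a (Q * ε)) ⟩
    x * (a + Q * ε - Q * ε) ≈⟨ *-congˡ (+-congʳ (SQ.Dissection.rank-0 ha hε hF hE)) ⟩
    x * (F + Q * (E + E) - Q * ε) ≈⟨ *-congˡ (+-congʳ (+-congˡ (*-congˡ (+-congˡ (sym ε+pG))))) ⟩
    x * (F + Q * (E + (ε + p * G)) - Q * ε)
      ≈⟨ solve 6 (λ x F Q E e g → x :* (F :+ Q :* (E :+ (e :+ g)) :- Q :* e) := x :* F :+ x :* (Q :* (E :+ g))) refl x F Q E ε (p * G) ⟩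
    x * F + x * (Q * (E + p * G)) ∎
    where
    a = pinf⁻¹ Q Q-nil * SA Q
    ε = pinf⁻¹ p p-nil * SE p
    ha : pinf Q * a ≈ SA Q
    ha = divide Q Q-nil (SA Q)
    hε : pinf p * ε ≈ SE p
    hε = divide p p-nil (SE p)
    ε+pG : ε + p * G ≈ E
    ε+pG = *-cancel (inverse-* p₂-unit p₂-unit) (trans (SP.ε-identity hε hG) (sym hE))

  odd-rank : ∀ {c G F} → pinf Q * c ≈ SC Q → pinf (p ^ 4) * G ≈ S₁₄ p → pinf p * F ≈ pinf (p ^ 2) * pinf (p ^ 4) →
    two * c ≈ two * (p * G + Q * F)
  odd-rank hc hG hF = SQ.Dissection.rank-1 hc (SP.Z-identity hG) hF

module RankCoefficients (R : CommutativeRing 0ℓ 0ℓ) (M : ℕ) (x : CommutativeRing.Carrier R) (x^M≈0 : Vanishes R M x) (n : ℕ) (M≡1+n : M ≡ suc n) where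
  open EighthRoot R
  private
    module K = CommutativeRing K
    module RS = RankSeries R K emb emb-isHom ζ ω ζω≈1 √2*√2 M x x^M≈0
    module KL = PartialFractions K
    module KE where
      open import Algebra.Properties.Semiring.Exp K.semiring public
    open KE using () renaming (_^_ to _^ᴷ_)
  open CommutativeRing R
  open ThetaProducts R M
  open LambertSums R M
  open PartialFractions R using (∑L)
  open ListSums R using (∑L-ext)
  open import Algebra.Properties.Semiring.Exp semiring
  open import Relation.Binary.Reasoning.Setoid setoid

  Gen₀ Gen₁ : Carrier
  Gen₀ = c₀ RS.Gen
  Gen₁ = c₁ RS.Gen

  Gen₀-series : pinf (x ^ 2) * Gen₀ ≈ x * SA (x ^ 2)
  Gen₀-series = trans (sym (c₀-emb (pinf (x ^ 2)) RS.Gen)) (trans (proj₁ (proj₁ RS.rank-series)) (c₀-split (x * SA (x ^ 2)) (SC (x ^ 2))))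

  Gen₁-series : pinf (x ^ 2) * Gen₁ ≈ SC (x ^ 2)
  Gen₁-series = trans (sym (c₁-emb (pinf (x ^ 2)) RS.Gen)) (trans (proj₁ (proj₂ RS.rank-series)) (c₁-split (x * SA (x ^ 2)) (SC (x ^ 2))))

  private
    AL : List (List ℕ)
    AL = allLists n n

  symbol-sum : (ℕ → Carrier → Carrier) → Carrier
  symbol-sum coeff = ∑L (λ D → ∑L (λ a → ∑L (λ b →
    if validRow D a ∧ validRow D b then coeff (rank-residue (length a) (length b)) (x ^ symbol-size D a b) else 0#) AL) AL) (upTo (suc n))

  private
    module Extract (c : K.Carrier → Carrier) (c-cong : ∀ {k l} → k K.≈ l → c k ≈ c l)
      (c-zero : c K.0# ≈ 0#) (c-+ : ∀ k l → c (k K.+ l) ≈ c k + c l)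
      (coeff : ℕ → Carrier → Carrier) (c-ζ^ : ∀ r a → r ℕ.< 8 → c (ζ ^ᴷ r K.* emb a) ≈ coeff r a) where

      c-∑L : ∀ {I : Set} (F : I → K.Carrier) is → c (KL.∑L F is) ≈ ∑L (λ i → c (F i)) is
      c-∑L F []       = c-zero
      c-∑L F (i ∷ is) = trans (c-+ (F i) (KL.∑L F is)) (+-congˡ (c-∑L F is))

      c-symbol : ∀ D a b → c (RS.symbol n M≡1+n D a b)
        ≈ (if validRow D a ∧ validRow D b then coeff (rank-residue (length a) (length b)) (x ^ symbol-size D a b) else 0#)
      c-symbol D a b = go (validRow D a) (validRow D b) ≡.refl ≡.refl
        where
        r = rank-residue (length a) (length b)
        v = coeff r (x ^ symbol-size D a b)
        go : ∀ va vb → validRow D a ≡ va → validRow D b ≡ vb → c (RS.symbol n M≡1+n D a b) ≈ (if validRow D a ∧ validRow D b then v else 0#)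
        go false vb ea eb = trans (c-cong (RS.symbol-invalidˡ n M≡1+n D a b ea)) (trans c-zero (reflexive (≡.cong (λ u → if u ∧ validRow D b then v else 0#) (≡.sym ea))))
        go true false ea eb = trans (c-cong (RS.symbol-invalidʳ n M≡1+n D a b eb)) (trans c-zero (reflexive (≡.cong₂ (λ u w → if u ∧ w then v else 0#) (≡.sym ea) (≡.sym eb))))
        go true true ea eb = trans (c-cong (K.trans (RS.symbol-valid n M≡1+n D a b ea eb) (K.*-congʳ {emb (x ^ symbol-size D a b)} (ζω-power (length a) (length b)))))
          (trans (c-ζ^ r (x ^ symbol-size D a b) (rank-residue<8 (length a) (length b))) (reflexive (≡.cong₂ (λ u w → if u ∧ w then v else 0#) (≡.sym ea) (≡.sym eb))))

      c-Gen : c RS.Gen ≈ symbol-sum coeff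
      c-Gen = trans (c-cong (K.sym (RS.Gen-symbols n M≡1+n))) (trans (c-∑L (λ D → KL.∑L (λ a → KL.∑L (RS.symbol n M≡1+n D a) AL) AL) (upTo (suc n))) (∑L-ext (upTo (suc n)) λ D →
        trans (c-∑L (λ a → KL.∑L (RS.symbol n M≡1+n D a) AL) AL) (∑L-ext AL λ a → trans (c-∑L (RS.symbol n M≡1+n D a) AL) (∑L-ext AL λ b → c-symbol D a b))))

    c₀-cong : ∀ {k l} → k K.≈ l → c₀ k ≈ c₀ l
    c₀-cong e = proj₁ (proj₁ e)

    c₁-cong : ∀ {k l} → k K.≈ l → c₁ k ≈ c₁ l
    c₁-cong e = proj₁ (proj₂ e)

    c₀-+ : ∀ k l → c₀ (k K.+ l) ≈ c₀ k + c₀ l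
    c₀-+ k l = refl

    c₁-+ : ∀ k l → c₁ (k K.+ l) ≈ c₁ k + c₁ l
    c₁-+ k l = refl

    module Ex₀ = Extract c₀ (λ {k} {l} → c₀-cong {k} {l}) refl c₀-+ coeff₀ c₀-ζ^
    module Ex₁ = Extract c₁ (λ {k} {l} → c₁-cong {k} {l}) refl c₁-+ coeff₁ c₁-ζ^

  Gen₀-symbols : Gen₀ ≈ symbol-sum coeff₀
  Gen₀-symbols = Ex₀.c-Gen

  Gen₁-symbols : Gen₁ ≈ symbol-sum coeff₁
  Gen₁-symbols = Ex₁.c-Gen

-- Each coefficient is read in its own ring: coefficient n modulo q^(n+1), where M is `suc n` as the
-- symbol sums require.
module Coefficients (n : ℕ) where
  open Series (suc n) hiding (R)
  open CommutativeRing (PSR (suc n)) using (semiring)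
  open import Algebra.Properties.Semiring.Exp semiring
  module RC = RankCoefficients (PSR (suc n)) (suc n) X X-nil n ≡.refl
  open EighthRoot (PSR (suc n)) using (coeff₀; coeff₁)
  open Counting n
  private
    open PartialFractions (PSR (suc n)) using (∑L)

    X^-indicator : ∀ k → (X ^ k) n ≡ [ k ≡ᵇ n ]
    X^-indicator k = ≡.trans (X-^ k n) (go k n)
      where
      go : ∀ k n → X^ k n ≡ [ k ≡ᵇ n ]
      go zero    zero    = ≡.refl
      go zero    (suc n) = ≡.refl
      go (suc k) zero    = ≡.refl
      go (suc k) (suc n) = ≡.trans (X^-suc k n) (go k n)

    evaluate : ∀ {I : Set} (F : I → PS) is → ∑L F is n ≡ ∑ℤ (λ i → F i n) is
    evaluate F []       = ≡.refl
    evaluate F (i ∷ is) = ≡.cong (λ z → F i n ℤ.+ z) (evaluate F is)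

    evaluate-symbol : ∀ (coeff : ℕ → PS → PS) (χ : ℕ → ℤ) → (∀ r (a : PS) → r ℕ.< 8 → coeff r a n ≡ a n ℤ.* χ r) → ∀ D a b →
      (if validRow D a ∧ validRow D b then coeff (rank-residue (length a) (length b)) (X ^ symbol-size D a b) else (λ _ → ℤ.0ℤ)) n
        ≡ valid D a b ℤ.* χ (rank-residue (length a) (length b))
    evaluate-symbol coeff χ h D a b with validRow D a | validRow D b
    ... | false | _     = ≡.refl
    ... | true  | false = ≡.refl
    ... | true  | true  = ≡.trans (h (rank-residue (length a) (length b)) (X ^ symbol-size D a b) (rank-residue<8 (length a) (length b)))
      (≡.cong (ℤ._* χ (rank-residue (length a) (length b))) (X^-indicator (symbol-size D a b)))

    evaluate-sum : ∀ (coeff : ℕ → PS → PS) (χ : ℕ → ℤ) → (∀ r (a : PS) → r ℕ.< 8 → coeff r a n ≡ a n ℤ.* χ r) →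
      RC.symbol-sum coeff n ≡ ∑∑∑ (λ D a b → valid D a b ℤ.* χ (rank-residue (length a) (length b)))
    evaluate-sum coeff χ h = ≡.trans (evaluate (λ D → ∑L (λ a → ∑L (S D a) AL) AL) (upTo (suc n))) (ℤL.∑L-ext (upTo (suc n)) λ D →
      ≡.trans (evaluate (λ a → ∑L (S D a) AL) AL) (ℤL.∑L-ext AL λ a → ≡.trans (evaluate (S D a) AL) (ℤL.∑L-ext AL λ b → evaluate-symbol coeff χ h D a b)))
      where
      S : ℕ → List ℕ → List ℕ → PS
      S D a b = if validRow D a ∧ validRow D b then coeff (rank-residue (length a) (length b)) (X ^ symbol-size D a b) else (λ _ → ℤ.0ℤ)

    difference : ∀ i j → ∑∑∑ (λ D a b → valid D a b ℤ.* ([ rank-residue (length a) (length b) ≡ᵇ i ] ℤ.- [ rank-residue (length a) (length b) ≡ᵇ j ])) ≡ count i ℤ.- count j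
    difference i j = ≡.sym (≡.trans (∑∑∑-- (λ D a b → valid D a b ℤ.* [ rank-residue (length a) (length b) ≡ᵇ i ]) (λ D a b → valid D a b ℤ.* [ rank-residue (length a) (length b) ≡ᵇ j ]))
      (∑∑∑-ext λ D a b → lemma (valid D a b) [ rank-residue (length a) (length b) ≡ᵇ i ] [ rank-residue (length a) (length b) ≡ᵇ j ]))
      where
      open ℤSolver.+-*-Solver
      lemma : ∀ v p q → v ℤ.* p ℤ.- v ℤ.* q ≡ v ℤ.* (p ℤ.- q)
      lemma = solve 3 (λ v p q → v :* p :- v :* q := v :* (p :- q)) ≡.refl

    times-0 : ∀ i → ℤ.0ℤ ≡ i ℤ.* ℤ.0ℤ
    times-0 i = ≡.sym (ℤₚ.*-zeroʳ i)

    times-1 : ∀ i → i ≡ i ℤ.* ℤ.1ℤ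
    times-1 i = ≡.sym (ℤₚ.*-identityʳ i)

    times--1 : ∀ i → ℤ.- i ≡ i ℤ.* ℤ.-1ℤ
    times--1 i = ≡.sym (≡.trans (ℤₚ.*-comm i ℤ.-1ℤ) (ℤₚ.-1*i≡-i i))

    coeff₀-χ : ∀ r a → r ℕ.< 8 → coeff₀ r a n ≡ a n ℤ.* ([ r ≡ᵇ 0 ] ℤ.- [ r ≡ᵇ 4 ])
    coeff₀-χ 0 a _ = times-1 (a n)
    coeff₀-χ 1 a _ = times-0 (a n)
    coeff₀-χ 2 a _ = times-0 (a n)
    coeff₀-χ 3 a _ = times-0 (a n)
    coeff₀-χ 4 a _ = times--1 (a n)
    coeff₀-χ 5 a _ = times-0 (a n)
    coeff₀-χ 6 a _ = times-0 (a n)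
    coeff₀-χ 7 a _ = times-0 (a n)
    coeff₀-χ (suc (suc (suc (suc (suc (suc (suc (suc _)))))))) a (s≤s (s≤s (s≤s (s≤s (s≤s (s≤s (s≤s (s≤s ()))))))))

    coeff₁-χ : ∀ r a → r ℕ.< 8 → coeff₁ r a n ≡ a n ℤ.* ([ r ≡ᵇ 1 ] ℤ.- [ r ≡ᵇ 5 ])
    coeff₁-χ 0 a _ = times-0 (a n)
    coeff₁-χ 1 a _ = times-1 (a n)
    coeff₁-χ 2 a _ = times-0 (a n)
    coeff₁-χ 3 a _ = times-0 (a n)
    coeff₁-χ 4 a _ = times-0 (a n)
    coeff₁-χ 5 a _ = times--1 (a n)
    coeff₁-χ 6 a _ = times-0 (a n)
    coeff₁-χ 7 a _ = times-0 (a n)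
    coeff₁-χ (suc (suc (suc (suc (suc (suc (suc (suc _)))))))) a (s≤s (s≤s (s≤s (s≤s (s≤s (s≤s (s≤s (s≤s ()))))))))

  Gen₀-count : + N⁰ (+ 0) 8 n ℤ.- + N⁰ (+ 4) 8 n ≡ RC.Gen₀ n
  Gen₀-count = ≡.trans (≡.cong₂ ℤ._-_ (N⁰≡count n 0 (s≤s z≤n)) (N⁰≡count n 4 (s≤s (s≤s (s≤s (s≤s (s≤s z≤n)))))))
    (≡.sym (≡.trans (RC.Gen₀-symbols n ℕₚ.≤-refl) (≡.trans (evaluate-sum coeff₀ (λ r → [ r ≡ᵇ 0 ] ℤ.- [ r ≡ᵇ 4 ]) coeff₀-χ) (difference 0 4))))

  Gen₁-count : + N⁰ (+ 1) 8 n ℤ.- + N⁰ (+ 3) 8 n ≡ RC.Gen₁ n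
  Gen₁-count = ≡.trans (≡.cong₂ ℤ._-_ (N⁰≡count n 1 (s≤s (s≤s z≤n))) (≡.trans (N⁰≡count n 3 (s≤s (s≤s (s≤s (s≤s z≤n))))) count-3≡5))
    (≡.sym (≡.trans (RC.Gen₁-symbols n ℕₚ.≤-refl) (≡.trans (evaluate-sum coeff₁ (λ r → [ r ≡ᵇ 1 ] ℤ.- [ r ≡ᵇ 5 ]) coeff₁-χ) (difference 1 5))))

-- The right-hand sides at q⁸ and the extraction of residue classes.

F₁ F₂ F₃ F₄ E₂ : PS
F₁ = J 2 ⊗ J 2 ⊗ J 2 ⊗ J 2 ⊗ inv (J 1 ⊗ J 1 ⊗ J 4)
E₂ = J 4 ⊗ J 4 ⊗ J 4 ⊗ inv (J 2 ⊗ J 2)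
F₂ = E₂ ⊕ X^ 1 ⊗ gq 2 4
F₃ = X^ 1 ⊗ gq 1 4
F₄ = J 2 ⊗ J 4 ⊗ inv (J 1)

module Dilation (M : ℕ) where
  open Series M hiding (R)
  open CommutativeRing (PSR M)
  open ThetaProducts (PSR M) M
  open LambertSums (PSR M) M
  open Assembly (PSR M) M X X-nil using (p)
  open IsHom (δ-isHom M)
  open Homomorphism (δ-isHom M)
  open import Algebra.Properties.Semiring.Exp semiring
  open import Relation.Binary.Reasoning.Setoid setoid

  δX≈p : δ X ≈ p
  δX≈p = trans {δ X} {X^ 8} {p} (λ n _ → δ-X n) (trans {X^ 8} {X ^ 8} {p} (X^≈ 8) (sym {p} {X ^ 8} (^-assocʳ X 2 4)))

  δ-J : ∀ m → δ (J (suc m)) ≈ pinf (p ^ suc m)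
  δ-J m = begin
    δ (J (suc m)) ≈⟨ h-cong {J (suc m)} {pinf (X ^ suc m)} (J≈pinf M m) ⟩
    δ (pinf (X ^ suc m)) ≈⟨ h-∏ M (λ j → 1# - (X ^ suc m) ^ suc j) ⟩
    B.∏ M (λ j → δ (1# - (X ^ suc m) ^ suc j)) ≈⟨ B.∏-cong M (λ j _ → factor≈ j) ⟩
    pinf (p ^ suc m) ∎
    where
    module B = FiniteSums (PSR M)
    power≈ : ∀ j → δ ((X ^ suc m) ^ suc j) ≈ (p ^ suc m) ^ suc j
    power≈ j = trans (h-^ (X ^ suc m) (suc j)) (^-congˡ (suc j) {δ (X ^ suc m)} {p ^ suc m} (trans (h-^ X (suc m)) (^-congˡ (suc m) {δ X} {p} δX≈p)))
    factor≈ : ∀ j → δ (1# - (X ^ suc m) ^ suc j) ≈ 1# - (p ^ suc m) ^ suc j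
    factor≈ j = trans (h-1- ((X ^ suc m) ^ suc j)) (+-congˡ {1#} (-‿cong {δ ((X ^ suc m) ^ suc j)} {(p ^ suc m) ^ suc j} (power≈ j)))

  δ-J₁ : δ (J 1) ≈ pinf p
  δ-J₁ = trans {δ (J 1)} {pinf (p ^ 1)} {pinf p} (δ-J 0) (pinf-cong {p ^ 1} {p} (*-identityʳ p))

  -- The identities in base p are stated with denominators cleared, so the image of a quotient is
  -- characterised by its product with the image of the denominator.
  δ-quotient : ∀ N D d e → D 0 ≡ ℤ.1ℤ → δ D ≈ d → δ N ≈ e → d * δ (N ⊗ inv D) ≈ e
  δ-quotient N D d e D0 hd he = begin
    d * δ (N * inv D) ≈⟨ *-cong {d} {δ D} {δ (N * inv D)} {δ N * δ (inv D)} (sym hd) (h-* N (inv D)) ⟩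
    δ D * (δ N * δ (inv D)) ≈⟨ solve 3 (λ a b c → a :* (b :* c) := b :* (a :* c)) refl (δ D) (δ N) (δ (inv D)) ⟩
    δ N * (δ D * δ (inv D)) ≈⟨ *-cong {δ N} {e} {δ D * δ (inv D)} {1#} he (trans (sym (h-* D (inv D))) (trans (h-cong {D * inv D} {1#} (λ n _ → inv-inverse D D0 n)) h-1)) ⟩
    e * 1# ≈⟨ *-identityʳ e ⟩
    e ∎
    where open IntegerSolver (PSR M)

  private
    δ-*₂ : ∀ f g {a b} → δ f ≈ a → δ g ≈ b → δ (f ⊗ g) ≈ a * b
    δ-*₂ f g {a} {b} p q = trans {δ (f ⊗ g)} {δ f * δ g} {a * b} (h-* f g) (*-cong {δ f} {a} {δ g} {b} p q)

    P₁ P₂ P₄ : PS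
    P₁ = pinf p
    P₂ = pinf (p ^ 2)
    P₄ = pinf (p ^ 4)

  δ-F₁ : P₁ * P₁ * P₄ * δ F₁ ≈ P₂ * P₂ * P₂ * P₂
  δ-F₁ = δ-quotient (J 2 ⊗ J 2 ⊗ J 2 ⊗ J 2) (J 1 ⊗ J 1 ⊗ J 4) (P₁ * P₁ * P₄) (P₂ * P₂ * P₂ * P₂) ≡.refl
    (δ-*₂ (J 1 ⊗ J 1) (J 4) (δ-*₂ (J 1) (J 1) δ-J₁ δ-J₁) (δ-J 3))
    (δ-*₂ (J 2 ⊗ J 2 ⊗ J 2) (J 2) (δ-*₂ (J 2 ⊗ J 2) (J 2) (δ-*₂ (J 2) (J 2) (δ-J 1) (δ-J 1)) (δ-J 1)) (δ-J 1))

  δ-E₂ : P₂ * P₂ * δ E₂ ≈ P₄ * P₄ * P₄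
  δ-E₂ = δ-quotient (J 4 ⊗ J 4 ⊗ J 4) (J 2 ⊗ J 2) (P₂ * P₂) (P₄ * P₄ * P₄) ≡.refl
    (δ-*₂ (J 2) (J 2) (δ-J 1) (δ-J 1))
    (δ-*₂ (J 4 ⊗ J 4) (J 4) (δ-*₂ (J 4) (J 4) (δ-J 3) (δ-J 3)) (δ-J 3))

  δ-F₄ : P₁ * δ F₄ ≈ P₂ * P₄
  δ-F₄ = δ-quotient (J 2 ⊗ J 4) (J 1) P₁ (P₂ * P₄) ≡.refl δ-J₁ (δ-*₂ (J 2) (J 4) (δ-J 1) (δ-J 3))

  δ-F₂ : δ F₂ ≈ δ E₂ + p * δ (gq 2 4)
  δ-F₂ = trans {δ F₂} {δ E₂ + δ (X ⊗ gq 2 4)} (h-+ E₂ (X ⊗ gq 2 4)) (+-congˡ {δ E₂} {δ (X ⊗ gq 2 4)} {p * δ (gq 2 4)} (δ-*₂ X (gq 2 4) δX≈p refl))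

  δ-F₃ : δ F₃ ≈ p * δ (gq 1 4)
  δ-F₃ = δ-*₂ X (gq 1 4) δX≈p refl

  private
    module G₂ = MockThetaSeries 2 (s≤s z≤n) (s≤s z≤n) ≡.refl
    module G₁ = MockThetaSeries 1 (s≤s z≤n) (s≤s z≤n) ≡.refl
    p-nil : Vanishes (PSR M) M p
    p-nil = G₂.Dilated.p-nil M p δX≈p

  δ-gq₂ : P₄ * δ (gq 2 4) ≈ S₂₄ p
  δ-gq₂ = trans (*-congˡ {P₄} (G₂.Dilated.δ-gq M p δX≈p)) (MockTheta.Central.lambert (PSR M) M p p-nil 0 z≤n (ℕₚ.m≤m+n M 2))

  δ-gq₁ : P₄ * δ (gq 1 4) ≈ S₁₄ p
  δ-gq₁ = trans (*-congˡ {P₄} (G₁.Dilated.δ-gq M p δX≈p)) (MockTheta.Central.lambert (PSR M) M p p-nil 1 (s≤s z≤n) (ℕₚ.m≤m+n M 1))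

private
  module Expansions (n : ℕ) where
    open Series (suc n) hiding (R)
    open CommutativeRing (PSR (suc n))
    open LambertSums (PSR (suc n)) (suc n) using (two)
    open Assembly (PSR (suc n)) (suc n) X X-nil
    open Dilation (suc n)
    open Coefficients n
    open IntegerSolver (PSR (suc n))
    open import Algebra.Properties.Semiring.Exp semiring
    open import Relation.Binary.Reasoning.Setoid setoid

    expansion₀ : RC.Gen₀ ≈ X^ 1 ⊗ δ F₁ ⊕ X^ 3 ⊗ δ F₂
    expansion₀ = begin
      RC.Gen₀ ≈⟨ even-rank {RC.Gen₀} {δ F₁} {δ E₂} {δ (gq 2 4)} RC.Gen₀-series δ-F₁ δ-E₂ δ-gq₂ ⟩
      X * δ F₁ + X * (Q * (δ E₂ + p * δ (gq 2 4)))
        ≈⟨ +-congˡ {X * δ F₁} {X * (Q * (δ E₂ + p * δ (gq 2 4)))} {X * (Q * δ F₂)} (*-congˡ {X} {Q * (δ E₂ + p * δ (gq 2 4))} {Q * δ F₂} (*-congˡ {Q} {δ E₂ + p * δ (gq 2 4)} {δ F₂} (sym δ-F₂))) ⟩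
      X * δ F₁ + X * (Q * δ F₂) ≈⟨ +-congˡ {X * δ F₁} {X * (Q * δ F₂)} {X ^ 3 * δ F₂} (sym (*-assoc X Q (δ F₂))) ⟩
      X * δ F₁ + X ^ 3 * δ F₂ ≈⟨ +-congˡ {X * δ F₁} {X ^ 3 * δ F₂} {X^ 3 * δ F₂} (*-congʳ {δ F₂} {X ^ 3} {X^ 3} (sym (X^≈ 3))) ⟩
      X^ 1 ⊗ δ F₁ ⊕ X^ 3 ⊗ δ F₂ ∎

    expansion₁ : RC.Gen₁ ≈ δ F₃ ⊕ X^ 2 ⊗ δ F₄
    -- `odd-rank` equates doubled series. The 2, not a unit among the series, is cancelled
    -- coefficient by coefficient in ℤ.
    expansion₁ m m<1+n = cancel-two _ _ (≡.trans (≡.sym (double RC.Gen₁ m m<1+n)) (≡.trans (doubled m m<1+n) (double (δ F₃ ⊕ X^ 2 ⊗ δ F₄) m m<1+n)))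
      where
      doubled : two * RC.Gen₁ ≈ two * (δ F₃ + X^ 2 * δ F₄)
      doubled = trans (odd-rank {RC.Gen₁} {δ (gq 1 4)} {δ F₄} RC.Gen₁-series δ-gq₁ δ-F₄)
        (*-congˡ {two} {p * δ (gq 1 4) + Q * δ F₄} {δ F₃ + X^ 2 * δ F₄} (+-cong {p * δ (gq 1 4)} {δ F₃} {Q * δ F₄} {X^ 2 * δ F₄} (sym δ-F₃) (*-congʳ {δ F₄} {Q} {X^ 2} (sym (X^≈ 2)))))
      double : ∀ f → two * f ≈ f + f
      double f = solve 1 (λ f → (:1 :+ :1) :* f := f :+ f) refl f
      cancel-two : ∀ i j → i ℤ.+ i ≡ j ℤ.+ j → i ≡ j
      cancel-two i j e = ℤₚ.*-cancelˡ-≡ (+ 2) i j (≡.trans (lemma i) (≡.trans e (≡.sym (lemma j))))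
        where
        lemma : ∀ i → + 2 ℤ.* i ≡ i ℤ.+ i
        lemma i = ≡.trans (ℤₚ.*-distribʳ-+ i (+ 1) (+ 1)) (≡.cong₂ ℤ._+_ (ℤₚ.*-identityˡ i) (ℤₚ.*-identityˡ i))

    rank₀ : + N⁰ (+ 0) 8 n ℤ.- + N⁰ (+ 4) 8 n ≡ (X^ 1 ⊗ δ F₁) n ℤ.+ (X^ 3 ⊗ δ F₂) n
    rank₀ = ≡.trans Gen₀-count (expansion₀ n ℕₚ.≤-refl)

    rank₁ : + N⁰ (+ 1) 8 n ℤ.- + N⁰ (+ 3) 8 n ≡ δ F₃ n ℤ.+ (X^ 2 ⊗ δ F₄) n
    rank₁ = ≡.trans Gen₁-count (expansion₁ n ℕₚ.≤-refl)

  open Expansions using (rank₀; rank₁)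

  -- q^k f(q⁸) has only exponents congruent to k modulo 8. Here `suc r` is 8 + s - k, a nonzero
  -- residue; for n = 0 the index lies below k.
  shifted-residue : ∀ k r s f n → k ℕ.+ suc r ≡ 8 ℕ.+ s → r ℕ.< 7 → s ℕ.< k → (X^ k ⊗ δ f) (8 ℕ.* n ℕ.+ s) ≡ ℤ.0ℤ
  shifted-residue k r s f zero    e r<7 s<k = X^-below k (δ f) s s<k
  shifted-residue k r s f (suc n) e r<7 s<k = ≡.trans (≡.cong (X^ k ⊗ δ f) index) (≡.trans (X^-shift k (δ f) (8 ℕ.* n ℕ.+ suc r)) (δ-residue f r n r<7))
    where
    open ≡.≡-Reasoning
    index : 8 ℕ.* suc n ℕ.+ s ≡ k ℕ.+ (8 ℕ.* n ℕ.+ suc r)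
    index = begin
      8 ℕ.* suc n ℕ.+ s ≡⟨ ≡.cong (ℕ._+ s) (≡.trans (ℕₚ.*-suc 8 n) (ℕₚ.+-comm 8 (8 ℕ.* n))) ⟩
      8 ℕ.* n ℕ.+ 8 ℕ.+ s ≡⟨ ℕₚ.+-assoc (8 ℕ.* n) 8 s ⟩
      8 ℕ.* n ℕ.+ (8 ℕ.+ s) ≡⟨ ≡.cong (8 ℕ.* n ℕ.+_) (≡.sym e) ⟩
      8 ℕ.* n ℕ.+ (k ℕ.+ suc r) ≡⟨ ≡.sym (ℕₚ.+-assoc (8 ℕ.* n) k (suc r)) ⟩
      8 ℕ.* n ℕ.+ k ℕ.+ suc r ≡⟨ ≡.cong (ℕ._+ suc r) (ℕₚ.+-comm (8 ℕ.* n) k) ⟩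
      k ℕ.+ 8 ℕ.* n ℕ.+ suc r ≡⟨ ℕₚ.+-assoc k (8 ℕ.* n) (suc r) ⟩
      k ℕ.+ (8 ℕ.* n ℕ.+ suc r) ∎

  shifted-multiple : ∀ k f n → (X^ k ⊗ δ f) (8 ℕ.* n ℕ.+ k) ≡ f n
  shifted-multiple k f n = ≡.trans (≡.cong (X^ k ⊗ δ f) (ℕₚ.+-comm (8 ℕ.* n) k)) (≡.trans (X^-shift k (δ f) (8 ℕ.* n)) (δ-multiple f n))

open import Data.Integer using (_-_)

theorem1p9 :
    ((n : ℕ) → + N⁰ (+ 0) 8 (8 Data.Nat.* n Data.Nat.+ 1) - + N⁰ (+ 4) 8 (8 Data.Nat.* n Data.Nat.+ 1)
        ≡ (J 2 ⊗ J 2 ⊗ J 2 ⊗ J 2 ⊗ inv (J 1 ⊗ J 1 ⊗ J 4)) n)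
    × ((n : ℕ) → + N⁰ (+ 0) 8 (8 Data.Nat.* n Data.Nat.+ 3) - + N⁰ (+ 4) 8 (8 Data.Nat.* n Data.Nat.+ 3)
        ≡ (J 4 ⊗ J 4 ⊗ J 4 ⊗ inv (J 2 ⊗ J 2) ⊕ X^ 1 ⊗ gq 2 4) n)
    × ((n : ℕ) → + N⁰ (+ 1) 8 (8 Data.Nat.* n) - + N⁰ (+ 3) 8 (8 Data.Nat.* n)
        ≡ (X^ 1 ⊗ gq 1 4) n)
    × ((n : ℕ) → + N⁰ (+ 1) 8 (8 Data.Nat.* n Data.Nat.+ 2) - + N⁰ (+ 3) 8 (8 Data.Nat.* n Data.Nat.+ 2)
        ≡ (J 2 ⊗ J 4 ⊗ inv (J 1)) n)
theorem1p9 = part₁ , part₂ , part₃ , part₄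
  where
  part₁ : ∀ n → + N⁰ (+ 0) 8 (8 ℕ.* n ℕ.+ 1) - + N⁰ (+ 4) 8 (8 ℕ.* n ℕ.+ 1) ≡ F₁ n
  part₁ n = ≡.trans (rank₀ (8 ℕ.* n ℕ.+ 1)) (≡.trans
    -- 1 - 3 is congruent to 6 modulo 8, hence r = 5.
    (≡.cong₂ ℤ._+_ (shifted-multiple 1 F₁ n) (shifted-residue 3 5 1 F₂ n ≡.refl (s≤s (s≤s (s≤s (s≤s (s≤s (s≤s z≤n)))))) (s≤s (s≤s z≤n))))
    (ℤₚ.+-identityʳ (F₁ n)))
  part₂ : ∀ n → + N⁰ (+ 0) 8 (8 ℕ.* n ℕ.+ 3) - + N⁰ (+ 4) 8 (8 ℕ.* n ℕ.+ 3) ≡ F₂ n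
  part₂ n = ≡.trans (rank₀ (8 ℕ.* n ℕ.+ 3)) (≡.trans
    -- The index 3 is not below the shift 1, so `shifted-residue` does not apply; removing the shift
    -- leaves the residue 2, where `δ F₁` vanishes.
    (≡.cong₂ ℤ._+_ (≡.trans (≡.cong (X^ 1 ⊗ δ F₁) index) (≡.trans (X^-shift 1 (δ F₁) (8 ℕ.* n ℕ.+ 2)) (δ-residue F₁ 1 n (s≤s (s≤s z≤n))))) (shifted-multiple 3 F₂ n))
    (ℤₚ.+-identityˡ (F₂ n)))
    where
    index : 8 ℕ.* n ℕ.+ 3 ≡ 1 ℕ.+ (8 ℕ.* n ℕ.+ 2)
    index = ℕₚ.+-suc (8 ℕ.* n) 2
  part₃ : ∀ n → + N⁰ (+ 1) 8 (8 ℕ.* n) - + N⁰ (+ 3) 8 (8 ℕ.* n) ≡ F₃ n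
  part₃ n = ≡.trans (rank₁ (8 ℕ.* n)) (≡.trans
    (≡.cong₂ ℤ._+_ (δ-multiple F₃ n) (≡.trans (≡.cong (X^ 2 ⊗ δ F₄) (≡.sym (ℕₚ.+-identityʳ (8 ℕ.* n)))) (shifted-residue 2 5 0 F₄ n ≡.refl (s≤s (s≤s (s≤s (s≤s (s≤s (s≤s z≤n)))))) (s≤s z≤n))))
    (ℤₚ.+-identityʳ (F₃ n)))
  part₄ : ∀ n → + N⁰ (+ 1) 8 (8 ℕ.* n ℕ.+ 2) - + N⁰ (+ 3) 8 (8 ℕ.* n ℕ.+ 2) ≡ F₄ n
  part₄ n = ≡.trans (rank₁ (8 ℕ.* n ℕ.+ 2)) (≡.trans
    (≡.cong₂ ℤ._+_ (δ-residue F₃ 1 n (s≤s (s≤s z≤n))) (shifted-multiple 2 F₄ n))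
    (ℤₚ.+-identityˡ (F₄ n)))
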